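{- Let $M=p_i^2p_j^2p_k^2$ with $p_i,p_j,p_k\ge3$ distinct primes, let $A,B\subset\mathbb{Z}_M$ with $A\oplus B=\mathbb{Z}_M$, $|A|=|B|=p_ip_jp_k$, and $\Phi_M\mid A$. Let $\Lambda$ be a $D(M)$-grid with $A\cap\Lambda\ne\emptyset$ such that $A\cap\Lambda$ is not $M$-fibered in any direction, and assume that one of the following holds: (a) $\{m:D(M)\mid m\mid M\}\subset\operatorname{Div}(A\cap\Lambda)$ and $A\cap\Lambda$ contains diagonal boxes; (b) $A\cap\Lambda$ has a full plane structure; (c) $A\cap\Lambda$ has an almost corner structure. Then at least one of the following is true: • the tiling $A\oplus B=\mathbb{Z}_M$ is T2-equivalent to $\Lambda\oplus B=\mathbb{Z}_M$ via fiber shifts; in this case $\Lambda$ is a translate of $A^\flat$ and both $A$ and $B$ satisfy (T2); • the tiling $A\oplus B=\mathbb{Z}_M$ is T2-equivalent to a tiling $A'\oplus B=\mathbb{Z}_M$ such that $A'\cap\Lambda$ contains a $p_\nu$ corner for some $\nu\in\{i,j,k\}$.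
   Context: $A\oplus B=\mathbb{Z}_M$: unique representation $a+b$. Masks $A(X)=\sum_{a\in A}X^a$ mod $X^M-1$; $\Phi_s$ cyclotomic. (T2): with $S_A$ the prime powers $s\mid M$, $\Phi_s\mid A$, any product of elements of $S_A$ that are powers of distinct primes gives a cyclotomic divisor of $A$. $(x,M)$ is the gcd; $\operatorname{Div}(S)=\{(s-s',M):s,s'\in S\}$. $D(M)=p_ip_jp_k$; a $D(M)$-grid is $\Lambda=x_0+D(M)\mathbb{Z}_M$, identified with $\mathbb{Z}_{p_i}\times\mathbb{Z}_{p_j}\times\mathbb{Z}_{p_k}$ via $x_0+l_iM/p_i+l_jM/p_j+l_kM/p_k\leftrightarrow(l_i,l_j,l_k)$. $F_\nu=\{0,M/p_\nu,\dots,(p_\nu-1)M/p_\nu\}$, $x*F_\nu=x+F_\nu$ ($M$-fiber in the $p_\nu$ direction); $x*F_j*F_k=x+F_j+F_k$; $S$ is $M$-fibered in the $p_\nu$ direction if $S=S'+F_\nu$, $S'\subset S$. Diagonal boxes: $A\cap\Lambda\supset(I\times J\times K)\cup(I^c\times J^c\times K^c)$ with $I,J,K$ nonempty proper subsets of $\mathbb{Z}_{p_i},\mathbb{Z}_{p_j},\mathbb{Z}_{p_k}$ and complements $I^c$ etc. Full plane structure: for some labeling $(\alpha,\beta,\gamma)$ of $(i,j,k)$ there is $x\in\Lambda\setminus A$ with $A\cap\Lambda=\{y\in\Lambda:(y-x,M)\in\{M/p_\alpha,M/p_\beta p_\gamma\}\}$. Almost corner structure: for some labeling $(\alpha,\beta,\gamma)$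 of $(i,j,k)$ there are $x_0,\dots,x_{p_\gamma-1}\in\Lambda$ with $(x_l-x_{l'},M)=M/p_\gamma$ for $l\ne l'$ and disjoint sets $\mathcal L_\alpha,\mathcal L_\beta$ with $|\mathcal L_\alpha|,|\mathcal L_\beta|>1$ and $\mathcal L_\alpha\cup\mathcal L_\beta=\{0,\dots,p_\gamma-1\}$, such that $A\cap\Lambda=\{z\in\Lambda:(z-x_l,M)=M/p_\alpha\text{ for some }l\in\mathcal L_\alpha,\text{ or }(z-x_l,M)=M/p_\beta\text{ for some }l\in\mathcal L_\beta\}$. $p_\nu$ corner in $A'\cap\Lambda$: writing $\{\nu,\beta,\gamma\}=\{i,j,k\}$, there exist $a,a_\nu\in A'\cap\Lambda$ with $(a-a_\nu,M)=M/p_\nu$, $A'\cap(a*F_\beta*F_\gamma)=a*F_\beta$ and $A'\cap(a_\nu*F_\beta*F_\gamma)=a_\nu*F_\gamma$. $A^\flat$: with $M_\nu=M/p_\nu^2$ and $\mathfrak A_\nu=\{\alpha\in\{1,2\}:\Phi_{p_\nu^\alpha}\mid A\}$, $A^\flat$ has mask $\prod_\nu\prod_{\alpha\in\mathfrak A_\nu}\sum_{t=0}^{p_\nu-1}X^{tM_\nu p_\nu^{\alpha-1}}$. T2-equivalent: $A$ satisfies (T2) iff $A'$ does (both tiling with $B$). "Via fiber shifts": obtained by finitely many steps each replacing an $M$-fiber $x*F_\nu$ of the current set by $x'*F_\nu$ with $(x-x',M)=M/p_\nu^2$, each intermediate set tiling with $B$. -}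

module Defs where

open import Data.Bool using (Bool; true; false; if_then_else_)
open import Data.Nat using (ℕ; zero; suc; _+_; _*_; _∸_; _^_; _≤_; _<_; _<ᵇ_; _≡ᵇ_)
open import Data.Nat.Divisibility using (_∣_; _∣?_)
open import Data.Nat.GCD using (gcd)
open import Data.Nat.Primality using (Prime)
open import Data.Integer as ℤ using (ℤ)
open import Data.List using (List; []; _∷_; length; map; reverse; drop; upTo; foldr; filterᵇ; concatMap)
open import Data.Nat.ListAction using (product)
open import Data.List.Relation.Unary.All using (All)
open import Data.List.Relation.Unary.Unique.Propositional using (Unique)
open import Data.Fin using (Fin; toℕ)
open import Data.Fin.Subset using (Subset; _∈_; _∉_)
open import Data.Vec using (tabulate; toList; lookup)
import Data.Vec as Vec
open import Data.Product using (Σ; ∃; _×_; _,_; proj₁; proj₂)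
open import Data.Sum using (_⊎_)
open import Relation.Nullary using (¬_; does)
open import Relation.Binary.PropositionalEquality using (_≡_; _≢_)
open import Function.Bundles using (_⇔_)

-- Integer polynomials, coefficient lists (lowest degree first)

Poly : Set
Poly = List ℤ

coeff : Poly → ℕ → ℤ
coeff []       _       = ℤ.0ℤ
coeff (a ∷ _)  zero    = a
coeff (_ ∷ as) (suc n) = coeff as n

-- equality of polynomials (trailing zeros irrelevant)
_≈ₚ_ : Poly → Poly → Set
P ≈ₚ Q = ∀ n → coeff P n ≡ coeff Q n

_+ₚ_ : Poly → Poly → Poly
[]       +ₚ q        = q
(a ∷ p)  +ₚ []       = a ∷ p
(a ∷ p)  +ₚ (b ∷ q)  = (a ℤ.+ b) ∷ (p +ₚ q)

_*ₚ_ : Poly → Poly → Poly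
[]      *ₚ q = []
(a ∷ p) *ₚ q = map (a ℤ.*_) q +ₚ (ℤ.0ℤ ∷ (p *ₚ q))

XnMinus1 : ℕ → Poly
XnMinus1 zero    = []
XnMinus1 (suc n) = ℤ.-1ℤ ∷ (Data.List.replicate n ℤ.0ℤ Data.List.++ (ℤ.1ℤ ∷ []))

-- exact division by a monic polynomial (highest-degree-first long division)
private
  subScaled : ℤ → List ℤ → List ℤ → List ℤ
  subScaled c (x ∷ xs) (y ∷ ys) = (x ℤ.- c ℤ.* y) ∷ subScaled c xs ys
  subScaled c xs       []       = xs
  subScaled c []       (_ ∷ _)  = []

  divH : ℕ → List ℤ → List ℤ → List ℤ
  divH zero    _        _  = []
  divH (suc f) []       ds = []
  divH (suc f) (c ∷ rest) ds =
    if length ds <ᵇ suc (length rest)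
    then c ∷ divH f (subScaled c rest ds) ds
    else []

divMonic : Poly → Poly → Poly
divMonic P D = reverse (divH (length P) (reverse P) (drop 1 (reverse D)))

properDivisors : ℕ → List ℕ
properDivisors n = filterᵇ (λ d → does (d ∣? n)) (map suc (upTo (n ∸ 1)))

-- table of cyclotomic polynomials Φ_1, …, Φ_n via
-- Φ_m = (X^m - 1) / ∏_{d ∣ m, d < m} Φ_d
cycloTable : ℕ → (ℕ → Poly)
cycloTable zero    = λ _ → ℤ.1ℤ ∷ []
cycloTable (suc n) m =
  if m ≡ᵇ suc n
  then divMonic (XnMinus1 (suc n))
         (foldr (λ d acc → cycloTable n d *ₚ acc) (ℤ.1ℤ ∷ []) (properDivisors (suc n)))
  else cycloTable n m

Φ : ℕ → Poly
Φ s = cycloTable s s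

_Φ∣_ : ℕ → Poly → Set
s Φ∣ P = Σ Poly λ Q → P ≈ₚ (Φ s *ₚ Q)

-- The setting: three primes p 0, p 1, p 2 (= p_i, p_j, p_k), M = p_i²p_j²p_k²

module _ (p : Fin 3 → ℕ) where

  sq : ℕ → ℕ
  sq n = n * n

  Mof : ℕ
  Mof = sq (p Fin.zero) * sq (p (Fin.suc Fin.zero)) * sq (p (Fin.suc (Fin.suc Fin.zero)))

  Dof : ℕ
  Dof = p Fin.zero * p (Fin.suc Fin.zero) * p (Fin.suc (Fin.suc Fin.zero))

  -- M_ν = M / p_ν²
  Mnu : Fin 3 → ℕ
  Mnu Fin.zero                      = sq (p (Fin.suc Fin.zero)) * sq (p (Fin.suc (Fin.suc Fin.zero)))
  Mnu (Fin.suc Fin.zero)            = sq (p Fin.zero) * sq (p (Fin.suc (Fin.suc Fin.zero)))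
  Mnu (Fin.suc (Fin.suc Fin.zero))  = sq (p Fin.zero) * sq (p (Fin.suc Fin.zero))

  Mover : Fin 3 → ℕ
  Mover ν = p ν * Mnu ν

  -- elements of ℤ_M are Fin M; congruence mod M on representatives
  dist : ℕ → ℕ → ℕ
  dist a b = (a ∸ b) + (b ∸ a)

  Cong : ℕ → ℕ → Set
  Cong a b = Mof ∣ dist a b

  gcdM : Fin Mof → Fin Mof → ℕ
  gcdM x y = gcd (dist (toℕ x) (toℕ y)) Mof

  -- mask A(X) (representative of degree < M)
  mask : Subset Mof → Poly
  mask A = toList (Vec.map (λ b → if b then ℤ.1ℤ else ℤ.0ℤ) A)

  Tiles : Subset Mof → Subset Mof → Set
  Tiles A B =
    (∀ (x : Fin Mof) → Σ (Fin Mof) λ a → Σ (Fin Mof) λ b →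
        a ∈ A × b ∈ B × Cong (toℕ a + toℕ b) (toℕ x))
    × (∀ (a a' b b' : Fin Mof) → a ∈ A → a' ∈ A → b ∈ B → b' ∈ B →
        Cong (toℕ a + toℕ b) (toℕ a' + toℕ b') → (a ≡ a') × (b ≡ b'))

  PrimePower : ℕ → Set
  PrimePower s = Σ ℕ λ q → Σ ℕ λ e → Prime q × 1 ≤ e × s ≡ q ^ e

  T2 : Subset Mof → Set
  T2 A = ∀ (qs : List (ℕ × ℕ)) → qs ≢ [] → Unique (map proj₁ qs) →
         All (λ qe → Prime (proj₁ qe) × 1 ≤ proj₂ qe
                     × (proj₁ qe ^ proj₂ qe) ∣ Mof
                     × (proj₁ qe ^ proj₂ qe) Φ∣ mask A) qs →
         product (map (λ qe → proj₁ qe ^ proj₂ qe) qs) Φ∣ mask A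

  InGrid : Fin Mof → Fin Mof → Set
  InGrid x0 y = Dof ∣ dist (toℕ y) (toℕ x0)

  gridSet : Fin Mof → Subset Mof
  gridSet x0 = tabulate (λ y → does (Dof ∣? dist (toℕ y) (toℕ x0)))

  AΛ : Subset Mof → Fin Mof → Fin Mof → Set
  AΛ A x0 y = y ∈ A × InGrid x0 y

  InDiv : (Fin Mof → Set) → ℕ → Set
  InDiv S m = Σ (Fin Mof) λ s → Σ (Fin Mof) λ s' → S s × S s' × gcdM s s' ≡ m

  InFiber : Fin Mof → Fin 3 → Fin Mof → Set
  InFiber x ν y = Σ ℕ λ t → t < p ν × Cong (toℕ y) (toℕ x + t * Mover ν)

  InPlane : Fin Mof → Fin 3 → Fin 3 → Fin Mof → Set
  InPlane x β γ y = Σ ℕ λ t → Σ ℕ λ u → t < p β × u < p γ ×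
                    Cong (toℕ y) (toℕ x + t * Mover β + u * Mover γ)

  Fibered : (Fin Mof → Set) → Fin 3 → Set₁
  Fibered S ν = Σ (Fin Mof → Set) λ S' → (∀ y → S' y → S y) ×
                (∀ y → S y ⇔ (Σ (Fin Mof) λ s → S' s × InFiber s ν y))

  NonemptyProper : {n : ℕ} → Subset n → Set
  NonemptyProper I = (Σ _ λ l → l ∈ I) × (Σ _ λ l → l ∉ I)

  DiagonalBoxes : Subset Mof → Fin Mof → Set
  DiagonalBoxes A x0 =
    Σ (Subset (p Fin.zero)) λ I → Σ (Subset (p (Fin.suc Fin.zero))) λ J →
    Σ (Subset (p (Fin.suc (Fin.suc Fin.zero)))) λ K →
    NonemptyProper I × NonemptyProper J × NonemptyProper K ×
    (∀ li lj lk → ((li ∈ I × lj ∈ J × lk ∈ K) ⊎ (li ∉ I × lj ∉ J × lk ∉ K)) →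
      ∀ (y : Fin Mof) →
      Cong (toℕ y) (toℕ x0 + toℕ li * Mover Fin.zero
                           + toℕ lj * Mover (Fin.suc Fin.zero)
                           + toℕ lk * Mover (Fin.suc (Fin.suc Fin.zero))) →
      AΛ A x0 y)

  Distinct3 : Fin 3 → Fin 3 → Fin 3 → Set
  Distinct3 α β γ = α ≢ β × β ≢ γ × α ≢ γ

  FullPlane : Subset Mof → Fin Mof → Set
  FullPlane A x0 =
    Σ (Fin 3) λ α → Σ (Fin 3) λ β → Σ (Fin 3) λ γ → Distinct3 α β γ ×
    Σ (Fin Mof) λ x → InGrid x0 x × x ∉ A ×
    (∀ y → AΛ A x0 y ⇔ (InGrid x0 y ×
        (gcdM y x * p α ≡ Mof ⊎ gcdM y x * (p β * p γ) ≡ Mof)))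

  AlmostCorner : Subset Mof → Fin Mof → Set
  AlmostCorner A x0 =
    Σ (Fin 3) λ α → Σ (Fin 3) λ β → Σ (Fin 3) λ γ → Distinct3 α β γ ×
    Σ (Fin (p γ) → Fin Mof) λ xs → (∀ l → InGrid x0 (xs l)) ×
    (∀ l l' → l ≢ l' → gcdM (xs l) (xs l') * p γ ≡ Mof) ×
    Σ (Subset (p γ)) λ Lα → Σ (Subset (p γ)) λ Lβ →
    (∀ l → ¬ (l ∈ Lα × l ∈ Lβ)) × 1 < Data.Fin.Subset.∣ Lα ∣ × 1 < Data.Fin.Subset.∣ Lβ ∣ ×
    (∀ l → l ∈ Lα ⊎ l ∈ Lβ) ×
    (∀ z → AΛ A x0 z ⇔ (InGrid x0 z ×
        ((Σ (Fin (p γ)) λ l → l ∈ Lα × gcdM z (xs l) * p α ≡ Mof)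
         ⊎ (Σ (Fin (p γ)) λ l → l ∈ Lβ × gcdM z (xs l) * p β ≡ Mof))))

  Corner : Subset Mof → Fin Mof → Fin 3 → Set
  Corner A' x0 ν =
    Σ (Fin 3) λ β → Σ (Fin 3) λ γ → Distinct3 ν β γ ×
    Σ (Fin Mof) λ a → Σ (Fin Mof) λ aν → AΛ A' x0 a × AΛ A' x0 aν ×
    gcdM a aν * p ν ≡ Mof ×
    (∀ y → (y ∈ A' × InPlane a β γ y) ⇔ InFiber a β y) ×
    (∀ y → (y ∈ A' × InPlane aν β γ y) ⇔ InFiber aν γ y)

  FiberShift : Subset Mof → Subset Mof → Set
  FiberShift A₁ A₂ =
    Σ (Fin 3) λ ν → Σ (Fin Mof) λ x → Σ (Fin Mof) λ x' →
    (∀ y → InFiber x ν y → y ∈ A₁) × gcdM x x' ≡ Mnu ν ×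
    (∀ y → y ∈ A₂ ⇔ ((y ∈ A₁ × ¬ InFiber x ν y) ⊎ InFiber x' ν y))

  data ShiftChain (B : Subset Mof) : Subset Mof → Subset Mof → Set where
    done : ∀ A → ShiftChain B A A
    step : ∀ A₁ A₂ A₃ → FiberShift A₁ A₂ → Tiles A₂ B → ShiftChain B A₂ A₃ →
           ShiftChain B A₁ A₃

  -- A^♭ as the multiset of exponents of its mask, given the flags
  -- flag ν a = true  iff  a+1 ∈ 𝔄_ν
  AflatExps : (Fin 3 → Fin 2 → Bool) → List ℕ
  AflatExps flag = foldr sumset (0 ∷ []) factors
    where
      sumset : List ℕ → List ℕ → List ℕ
      sumset xs ys = concatMap (λ x → map (x +_) ys) xs
      factor : Fin 3 → Fin 2 → List (List ℕ)
      factor ν a = if flag ν a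
                   then map (λ t → t * Mnu ν * p ν ^ toℕ a) (upTo (p ν)) ∷ []
                   else []
      factors : List (List ℕ)
      factors = concatMap (λ ν → concatMap (factor ν) (Data.List.allFin 2)) (Data.List.allFin 3)

  FlagsSpec : Subset Mof → (Fin 3 → Fin 2 → Bool) → Set
  FlagsSpec A flag = ∀ ν a → (flag ν a ≡ true) ⇔ ((p ν ^ suc (toℕ a)) Φ∣ mask A)

  -- Λ (mask) is a translate of A^♭ (mask), mod X^M - 1
  TranslateOf : Subset Mof → List ℕ → Set
  TranslateOf Λ es = Σ ℕ λ t → ∀ (y : Fin Mof) →
    length (filterᵇ (λ e → does (Mof ∣? dist (t + e) (toℕ y))) es)
      ≡ (if lookup Λ y then 1 else 0)

{-# OPTIONS --safe #-}
module Submission where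

open import Data.Nat as ℕ using (ℕ; zero; suc; _≤_; _<_; z≤n; s≤s; _∸_; NonZero)
open import Relation.Binary.PropositionalEquality
open import Data.Fin using (Fin)
open import Data.Nat.Primality using (Prime)
open import Data.Product using (Σ; ∃; _×_; _,_; proj₁; proj₂)
open import Data.Empty using (⊥; ⊥-elim)
open import Data.Sum using (_⊎_; inj₁; inj₂; [_,_]′)
open import Relation.Nullary using (¬_; Dec; yes; no; does)

module Polynomials where
  open import Defs
  open import Data.Integer as ℤ using (ℤ; 0ℤ; 1ℤ)
  import Data.Integer.Properties as ℤP
  open import Data.List using ([]; _∷_; map)
  open import Data.Maybe as Maybe using (Maybe; just; nothing)
  open import Level using (0ℓ)
  open import Relation.Binary.Bundles using (Setoid)
  open import Algebra.Bundles using (CommutativeRing)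
  open import Tactic.RingSolver.Core.AlmostCommutativeRing using (AlmostCommutativeRing; fromCommutativeRing)

  infix 4 _≋_
  infixl 7 _⊛_
  infixl 6 _⊞_ _⊟_

  record _≋_ (P Q : Poly) : Set where
    constructor eqₚ
    field at : P ≈ₚ Q
  open _≋_ public

  _⊞_ _⊛_ _⊟_ : Poly → Poly → Poly
  _⊞_ = _+ₚ_
  _⊛_ = _*ₚ_

  negₚ : Poly → Poly
  negₚ = map (λ a → ℤ.- a)

  P ⊟ Q = P ⊞ negₚ Q

  scale : ℤ → Poly → Poly
  scale a = map (a ℤ.*_)

  const : ℤ → Poly
  const a = a ∷ []

  ≋-refl : ∀ {P} → P ≋ P
  ≋-refl = eqₚ λ n → refl

  ≋-sym : ∀ {P Q} → P ≋ Q → Q ≋ P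
  ≋-sym e = eqₚ λ n → sym (at e n)

  ≋-trans : ∀ {P Q R} → P ≋ Q → Q ≋ R → P ≋ R
  ≋-trans e f = eqₚ λ n → trans (at e n) (at f n)

  ≡⇒≋ : ∀ {P Q} → P ≡ Q → P ≋ Q
  ≡⇒≋ refl = ≋-refl

  coeff-+ : ∀ P Q n → coeff (P ⊞ Q) n ≡ coeff P n ℤ.+ coeff Q n
  coeff-+ [] Q n = sym (ℤP.+-identityˡ _)
  coeff-+ (a ∷ P) [] n = sym (ℤP.+-identityʳ _)
  coeff-+ (a ∷ P) (b ∷ Q) zero = refl
  coeff-+ (a ∷ P) (b ∷ Q) (suc n) = coeff-+ P Q n

  coeff-scale : ∀ a P n → coeff (scale a P) n ≡ a ℤ.* coeff P n
  coeff-scale a [] n = sym (ℤP.*-zeroʳ a)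
  coeff-scale a (b ∷ P) zero = refl
  coeff-scale a (b ∷ P) (suc n) = coeff-scale a P n

  coeff-neg : ∀ P n → coeff (negₚ P) n ≡ ℤ.- coeff P n
  coeff-neg [] n = refl
  coeff-neg (b ∷ P) zero = refl
  coeff-neg (b ∷ P) (suc n) = coeff-neg P n

  +-cong : ∀ {P P' Q Q'} → P ≋ P' → Q ≋ Q' → P ⊞ Q ≋ P' ⊞ Q'
  +-cong {P} {P'} {Q} {Q'} e f = eqₚ λ n → begin
      coeff (P ⊞ Q) n            ≡⟨ coeff-+ P Q n ⟩
      coeff P n ℤ.+ coeff Q n    ≡⟨ cong₂ ℤ._+_ (at e n) (at f n) ⟩
      coeff P' n ℤ.+ coeff Q' n  ≡⟨ coeff-+ P' Q' n ⟨
      coeff (P' ⊞ Q') n          ∎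
    where open ≡-Reasoning

  +-congʳ : ∀ P {Q Q'} → Q ≋ Q' → P ⊞ Q ≋ P ⊞ Q'
  +-congʳ P = +-cong (≋-refl {P})

  +-congˡ : ∀ {P P'} Q → P ≋ P' → P ⊞ Q ≋ P' ⊞ Q
  +-congˡ Q e = +-cong e (≋-refl {Q})

  +-comm : ∀ P Q → P ⊞ Q ≋ Q ⊞ P
  +-comm P Q = eqₚ λ n → trans (coeff-+ P Q n) (trans (ℤP.+-comm (coeff P n) _) (sym (coeff-+ Q P n)))

  +-assoc : ∀ P Q R → (P ⊞ Q) ⊞ R ≋ P ⊞ (Q ⊞ R)
  +-assoc P Q R = eqₚ λ n → begin
      coeff ((P ⊞ Q) ⊞ R) n                      ≡⟨ coeff-+ (P ⊞ Q) R n ⟩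
      coeff (P ⊞ Q) n ℤ.+ coeff R n              ≡⟨ cong (ℤ._+ coeff R n) (coeff-+ P Q n) ⟩
      (coeff P n ℤ.+ coeff Q n) ℤ.+ coeff R n    ≡⟨ ℤP.+-assoc (coeff P n) _ _ ⟩
      coeff P n ℤ.+ (coeff Q n ℤ.+ coeff R n)    ≡⟨ cong (ℤ._+_ (coeff P n)) (coeff-+ Q R n) ⟨
      coeff P n ℤ.+ coeff (Q ⊞ R) n              ≡⟨ coeff-+ P (Q ⊞ R) n ⟨
      coeff (P ⊞ (Q ⊞ R)) n                      ∎
    where open ≡-Reasoning

  +-idʳ : ∀ P → P ⊞ [] ≋ P
  +-idʳ P = +-comm P []

  neg-cong : ∀ {P Q} → P ≋ Q → negₚ P ≋ negₚ Q
  neg-cong {P} {Q} e = eqₚ λ n → trans (coeff-neg P n) (trans (cong (λ a → ℤ.- a) (at e n)) (sym (coeff-neg Q n)))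

  +-invʳ : ∀ P → P ⊞ negₚ P ≋ []
  +-invʳ P = eqₚ λ n → trans (coeff-+ P (negₚ P) n)
    (trans (cong (ℤ._+_ (coeff P n)) (coeff-neg P n)) (ℤP.+-inverseʳ (coeff P n)))

  scale-cong : ∀ {a b P Q} → a ≡ b → P ≋ Q → scale a P ≋ scale b Q
  scale-cong {a} {b} {P} {Q} refl e =
    eqₚ λ n → trans (coeff-scale a P n) (trans (cong (a ℤ.*_) (at e n)) (sym (coeff-scale a Q n)))

  ∷-cong : ∀ {a b P Q} → a ≡ b → P ≋ Q → a ∷ P ≋ b ∷ Q
  ∷-cong e f = eqₚ λ { zero → e ; (suc n) → at f n }

  ≋-tail : ∀ {a b P Q} → a ∷ P ≋ b ∷ Q → P ≋ Q
  ≋-tail e = eqₚ λ n → at e (suc n)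

  0∷[]≋ : ∀ {P} → P ≋ [] → 0ℤ ∷ P ≋ []
  0∷[]≋ e = eqₚ λ { zero → refl ; (suc n) → at e n }

  scale-0 : ∀ P → scale 0ℤ P ≋ []
  scale-0 P = eqₚ λ n → trans (coeff-scale 0ℤ P n) (ℤP.*-zeroˡ (coeff P n))

  scale-1 : ∀ P → scale 1ℤ P ≋ P
  scale-1 P = eqₚ λ n → trans (coeff-scale 1ℤ P n) (ℤP.*-identityˡ (coeff P n))

  scale-+ : ∀ a P Q → scale a (P ⊞ Q) ≋ scale a P ⊞ scale a Q
  scale-+ a P Q = eqₚ λ n → begin
      coeff (scale a (P ⊞ Q)) n                    ≡⟨ coeff-scale a (P ⊞ Q) n ⟩
      a ℤ.* coeff (P ⊞ Q) n                        ≡⟨ cong (a ℤ.*_) (coeff-+ P Q n) ⟩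
      a ℤ.* (coeff P n ℤ.+ coeff Q n)              ≡⟨ ℤP.*-distribˡ-+ a (coeff P n) _ ⟩
      a ℤ.* coeff P n ℤ.+ a ℤ.* coeff Q n          ≡⟨ cong₂ ℤ._+_ (coeff-scale a P n) (coeff-scale a Q n) ⟨
      coeff (scale a P) n ℤ.+ coeff (scale a Q) n  ≡⟨ coeff-+ (scale a P) (scale a Q) n ⟨
      coeff (scale a P ⊞ scale a Q) n              ∎
    where open ≡-Reasoning

  scale-+ˡ : ∀ a b P → scale (a ℤ.+ b) P ≋ scale a P ⊞ scale b P
  scale-+ˡ a b P = eqₚ λ n → begin
      coeff (scale (a ℤ.+ b) P) n                  ≡⟨ coeff-scale (a ℤ.+ b) P n ⟩
      (a ℤ.+ b) ℤ.* coeff P n                      ≡⟨ ℤP.*-distribʳ-+ (coeff P n) a b ⟩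
      a ℤ.* coeff P n ℤ.+ b ℤ.* coeff P n          ≡⟨ cong₂ ℤ._+_ (coeff-scale a P n) (coeff-scale b P n) ⟨
      coeff (scale a P) n ℤ.+ coeff (scale b P) n  ≡⟨ coeff-+ (scale a P) (scale b P) n ⟨
      coeff (scale a P ⊞ scale b P) n              ∎
    where open ≡-Reasoning

  scale-* : ∀ a b P → scale (a ℤ.* b) P ≋ scale a (scale b P)
  scale-* a b P = eqₚ λ n → begin
      coeff (scale (a ℤ.* b) P) n    ≡⟨ coeff-scale (a ℤ.* b) P n ⟩
      a ℤ.* b ℤ.* coeff P n          ≡⟨ ℤP.*-assoc a b _ ⟩
      a ℤ.* (b ℤ.* coeff P n)        ≡⟨ cong (a ℤ.*_) (coeff-scale b P n) ⟨
      a ℤ.* coeff (scale b P) n      ≡⟨ coeff-scale a (scale b P) n ⟨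
      coeff (scale a (scale b P)) n  ∎
    where open ≡-Reasoning

  ≋-setoid : Setoid 0ℓ 0ℓ
  ≋-setoid = record { Carrier = Poly ; _≈_ = _≋_
    ; isEquivalence = record { refl = ≋-refl ; sym = ≋-sym ; trans = ≋-trans } }

  module ≋-R where
    open import Relation.Binary.Reasoning.Setoid ≋-setoid public

  +-interchange : ∀ P Q R S → (P ⊞ Q) ⊞ (R ⊞ S) ≋ (P ⊞ R) ⊞ (Q ⊞ S)
  +-interchange P Q R S = begin
      (P ⊞ Q) ⊞ (R ⊞ S)  ≈⟨ +-assoc P Q (R ⊞ S) ⟩
      P ⊞ (Q ⊞ (R ⊞ S))  ≈⟨ +-congʳ P (≋-sym (+-assoc Q R S)) ⟩
      P ⊞ ((Q ⊞ R) ⊞ S)  ≈⟨ +-congʳ P (+-congˡ S (+-comm Q R)) ⟩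
      P ⊞ ((R ⊞ Q) ⊞ S)  ≈⟨ +-congʳ P (+-assoc R Q S) ⟩
      P ⊞ (R ⊞ (Q ⊞ S))  ≈⟨ +-assoc P R (Q ⊞ S) ⟨
      (P ⊞ R) ⊞ (Q ⊞ S)  ∎
    where open ≋-R

  *-congʳ : ∀ P {Q Q'} → Q ≋ Q' → P ⊛ Q ≋ P ⊛ Q'
  *-congʳ [] e = ≋-refl
  *-congʳ (a ∷ P) e = +-cong (scale-cong {a} refl e) (∷-cong refl (*-congʳ P e))

  *-zeroʳ : ∀ P → P ⊛ [] ≋ []
  *-zeroʳ [] = ≋-refl
  *-zeroʳ (a ∷ P) = 0∷[]≋ (*-zeroʳ P)

  *-distribˡ : ∀ P Q R → P ⊛ (Q ⊞ R) ≋ P ⊛ Q ⊞ P ⊛ R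
  *-distribˡ [] Q R = ≋-refl
  *-distribˡ (a ∷ P) Q R = ≋-trans
    (+-cong (scale-+ a Q R) (∷-cong refl (*-distribˡ P Q R)))
    (+-interchange (scale a Q) (scale a R) (0ℤ ∷ P ⊛ Q) (0ℤ ∷ P ⊛ R))

  *-distribʳ : ∀ R P Q → (P ⊞ Q) ⊛ R ≋ P ⊛ R ⊞ Q ⊛ R
  *-distribʳ R [] Q = ≋-refl
  *-distribʳ R (a ∷ P) [] = ≋-sym (+-idʳ _)
  *-distribʳ R (a ∷ P) (b ∷ Q) = ≋-trans
    (+-cong (scale-+ˡ a b R) (∷-cong refl (*-distribʳ R P Q)))
    (+-interchange (scale a R) (scale b R) (0ℤ ∷ P ⊛ R) (0ℤ ∷ Q ⊛ R))

  scale-⊛ : ∀ a P Q → scale a P ⊛ Q ≋ scale a (P ⊛ Q)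
  scale-⊛ a [] Q = ≋-refl
  scale-⊛ a (b ∷ P) Q = begin
      scale (a ℤ.* b) Q ⊞ (0ℤ ∷ scale a P ⊛ Q)
        ≈⟨ +-cong (scale-* a b Q) (∷-cong (sym (ℤP.*-zeroʳ a)) (scale-⊛ a P Q)) ⟩
      scale a (scale b Q) ⊞ scale a (0ℤ ∷ P ⊛ Q)
        ≈⟨ scale-+ a (scale b Q) (0ℤ ∷ P ⊛ Q) ⟨
      scale a (scale b Q ⊞ (0ℤ ∷ P ⊛ Q)) ∎
    where open ≋-R

  shift-⊛ : ∀ P Q → (0ℤ ∷ P) ⊛ Q ≋ 0ℤ ∷ P ⊛ Q
  shift-⊛ P Q = +-congˡ (0ℤ ∷ P ⊛ Q) (scale-0 Q)

  ⊛-∷ : ∀ P b Q → P ⊛ (b ∷ Q) ≋ scale b P ⊞ (0ℤ ∷ P ⊛ Q)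
  ⊛-∷ [] b Q = ≋-sym (0∷[]≋ ≋-refl)
  ⊛-∷ (a ∷ P) b Q = ∷-cong (cong (ℤ._+ 0ℤ) (ℤP.*-comm a b)) (begin
      scale a Q ⊞ P ⊛ (b ∷ Q)                  ≈⟨ +-congʳ (scale a Q) (⊛-∷ P b Q) ⟩
      scale a Q ⊞ (scale b P ⊞ (0ℤ ∷ P ⊛ Q))   ≈⟨ +-assoc (scale a Q) _ _ ⟨
      (scale a Q ⊞ scale b P) ⊞ (0ℤ ∷ P ⊛ Q)   ≈⟨ +-congˡ (0ℤ ∷ P ⊛ Q) (+-comm (scale a Q) (scale b P)) ⟩
      (scale b P ⊞ scale a Q) ⊞ (0ℤ ∷ P ⊛ Q)   ≈⟨ +-assoc (scale b P) _ _ ⟩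
      scale b P ⊞ (scale a Q ⊞ (0ℤ ∷ P ⊛ Q))   ∎)
    where open ≋-R

  *-comm : ∀ P Q → P ⊛ Q ≋ Q ⊛ P
  *-comm [] Q = ≋-sym (*-zeroʳ Q)
  *-comm (a ∷ P) Q = ≋-trans (+-congʳ (scale a Q) (∷-cong refl (*-comm P Q))) (≋-sym (⊛-∷ Q a P))

  *-congˡ : ∀ {P P'} Q → P ≋ P' → P ⊛ Q ≋ P' ⊛ Q
  *-congˡ {P} {P'} Q e = ≋-trans (*-comm P Q) (≋-trans (*-congʳ Q e) (*-comm Q P'))

  *-cong : ∀ {P P' Q Q'} → P ≋ P' → Q ≋ Q' → P ⊛ Q ≋ P' ⊛ Q'
  *-cong {P} {P'} {Q} {Q'} e f = ≋-trans (*-congˡ Q e) (*-congʳ P' f)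

  *-assoc : ∀ P Q R → (P ⊛ Q) ⊛ R ≋ P ⊛ (Q ⊛ R)
  *-assoc [] Q R = ≋-refl
  *-assoc (a ∷ P) Q R = begin
      (scale a Q ⊞ (0ℤ ∷ P ⊛ Q)) ⊛ R          ≈⟨ *-distribʳ R (scale a Q) _ ⟩
      scale a Q ⊛ R ⊞ (0ℤ ∷ P ⊛ Q) ⊛ R        ≈⟨ +-cong (scale-⊛ a Q R) (shift-⊛ (P ⊛ Q) R) ⟩
      scale a (Q ⊛ R) ⊞ (0ℤ ∷ (P ⊛ Q) ⊛ R)    ≈⟨ +-congʳ (scale a (Q ⊛ R)) (∷-cong refl (*-assoc P Q R)) ⟩
      scale a (Q ⊛ R) ⊞ (0ℤ ∷ P ⊛ (Q ⊛ R))    ∎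
    where open ≋-R

  𝟙 : Poly
  𝟙 = 1ℤ ∷ []

  const-⊛ : ∀ a P → const a ⊛ P ≋ scale a P
  const-⊛ a P = ≋-trans (+-congʳ (scale a P) (0∷[]≋ ≋-refl)) (+-idʳ (scale a P))

  *-idˡ : ∀ P → 𝟙 ⊛ P ≋ P
  *-idˡ P = ≋-trans (const-⊛ 1ℤ P) (scale-1 P)

  polyRing : CommutativeRing 0ℓ 0ℓ
  polyRing = record
    { Carrier = Poly ; _≈_ = _≋_ ; _+_ = _⊞_ ; _*_ = _⊛_ ; -_ = negₚ ; 0# = [] ; 1# = 𝟙
    ; isCommutativeRing = record
      { isRing = record
        { +-isAbelianGroup = record
          { isGroup = record
            { isMonoid = record
              { isSemigroup = record
                { isMagma = record { isEquivalence = Setoid.isEquivalence ≋-setoid ; ∙-cong = +-cong }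
                ; assoc = +-assoc }
              ; identity = (λ P → ≋-refl) , +-idʳ }
            ; inverse = (λ P → ≋-trans (+-comm (negₚ P) P) (+-invʳ P)) , +-invʳ
            ; ⁻¹-cong = neg-cong }
          ; comm = +-comm }
        ; *-cong = *-cong
        ; *-assoc = *-assoc
        ; *-identity = *-idˡ , (λ P → ≋-trans (*-comm P 𝟙) (*-idˡ P))
        ; distrib = *-distribˡ , *-distribʳ }
      ; *-comm = *-comm } }

  polyACR : AlmostCommutativeRing 0ℓ 0ℓ
  polyACR = fromCommutativeRing polyRing isZero
    where
    isZero : ∀ P → Maybe ([] ≋ P)
    isZero [] = just ≋-refl
    isZero (ℤ.+ zero ∷ P) = Maybe.map (λ e → ≋-sym (0∷[]≋ (≋-sym e))) (isZero P)
    isZero (_ ∷ _) = nothing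

module Division where
  open import Defs
  open Polynomials
  open import Data.Bool using (true; false; if_then_else_)
  open import Data.Nat as ℕ using (_<ᵇ_)
  import Data.Nat.Properties as ℕP
  open import Data.Integer as ℤ using (ℤ; 0ℤ; 1ℤ)
  import Data.Integer.Properties as ℤP
  open import Data.List using (List; []; _∷_; _++_; length; map; foldl; reverse; drop)
  import Data.List.Properties as LP
  open import Function using (_∋_; case_of_)
  open import Tactic.RingSolver using (solve-∀)

  sub′ : ℤ → List ℤ → List ℤ → List ℤ
  sub′ c (x ∷ xs) (y ∷ ys) = (x ℤ.- c ℤ.* y) ∷ sub′ c xs ys
  sub′ c xs       []       = xs
  sub′ c []       (_ ∷ _)  = []

  div′ : ℕ → List ℤ → List ℤ → List ℤ
  div′ zero    _          _  = []
  div′ (suc f) []         ds = []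
  div′ (suc f) (c ∷ rest) ds =
    if length ds <ᵇ suc (length rest) then c ∷ div′ f (sub′ c rest ds) ds else []

  -- The division loop behind divMonic is private to Defs.  The underscores in the two
  -- signatures below are solved by unification with its hidden name.
  mutual
    divMonic≡ : ∀ P D → divMonic P D ≡ reverse (div′ (length P) (reverse P) (drop 1 (reverse D)))
    divMonic≡ P D with length P | reverse P | drop 1 (reverse D)
    ... | n | xs | ds with (List ℤ ∋ [])
    ... | acc = loop≡ n xs ds acc

    loop≡ : ∀ (n : ℕ) (xs ds acc : List ℤ) → _ ≡ foldl (λ y x → x ∷ y) acc (div′ n xs ds)
    loop≡ zero    xs         ds acc = refl
    loop≡ (suc n) []         ds acc = refl
    loop≡ (suc n) (c ∷ rest) ds acc with length ds <ᵇ suc (length rest)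
    ... | false = refl
    ... | true  = trans (loop≡ n _ ds (c ∷ acc))
                    (cong (λ s → foldl (λ y x → x ∷ y) (c ∷ acc) (div′ n s ds)) (sub≡ c rest ds))

    sub≡ : ∀ (c : ℤ) (xs ds : List ℤ) → _ ≡ sub′ c xs ds
    sub≡ c (x ∷ xs) (y ∷ ys) = cong (_ ∷_) (sub≡ c xs ys)
    sub≡ c []       []       = refl
    sub≡ c (x ∷ xs) []       = refl
    sub≡ c []       (_ ∷ _)  = refl

  shift : ℕ → Poly → Poly
  shift zero    P = P
  shift (suc k) P = 0ℤ ∷ shift k P

  shift-cong : ∀ k {P Q} → P ≋ Q → shift k P ≋ shift k Q
  shift-cong zero    e = e
  shift-cong (suc k) e = ∷-cong refl (shift-cong k e)

  shift-[] : ∀ k → shift k [] ≋ []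
  shift-[] zero    = ≋-refl
  shift-[] (suc k) = 0∷[]≋ (shift-[] k)

  shift-+ : ∀ k P Q → shift k (P ⊞ Q) ≋ shift k P ⊞ shift k Q
  shift-+ zero    P Q = ≋-refl
  shift-+ (suc k) P Q = ∷-cong refl (shift-+ k P Q)

  shift-scale : ∀ k a P → shift k (scale a P) ≋ scale a (shift k P)
  shift-scale zero    a P = ≋-refl
  shift-scale (suc k) a P = ∷-cong (sym (ℤP.*-zeroʳ a)) (shift-scale k a P)

  shift-shift : ∀ j k P → shift j (shift k P) ≡ shift (j ℕ.+ k) P
  shift-shift zero    k P = refl
  shift-shift (suc j) k P = cong (0ℤ ∷_) (shift-shift j k P)

  shift-⊛ˡ : ∀ k P Q → shift k P ⊛ Q ≋ shift k (P ⊛ Q)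
  shift-⊛ˡ zero    P Q = ≋-refl
  shift-⊛ˡ (suc k) P Q = ≋-trans (shift-⊛ (shift k P) Q) (∷-cong refl (shift-⊛ˡ k P Q))

  x^ : ℕ → Poly
  x^ n = shift n 𝟙

  x^-⊛ : ∀ n P → x^ n ⊛ P ≋ shift n P
  x^-⊛ n P = ≋-trans (shift-⊛ˡ n 𝟙 P) (shift-cong n (*-idˡ P))

  x^-+ : ∀ m n → x^ (m ℕ.+ n) ≋ x^ m ⊛ x^ n
  x^-+ m n = ≋-sym (≋-trans (x^-⊛ m (x^ n)) (≡⇒≋ (shift-shift m n 𝟙)))

  highFirst : List ℤ → Poly
  highFirst []       = []
  highFirst (c ∷ xs) = shift (length xs) (const c) ⊞ highFirst xs

  ++-shift : ∀ P c → P ++ (c ∷ []) ≋ shift (length P) (const c) ⊞ P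
  ++-shift []      c = ≋-refl
  ++-shift (a ∷ P) c = ∷-cong (sym (ℤP.+-identityˡ a)) (++-shift P c)

  reverse≋ : ∀ xs → reverse xs ≋ highFirst xs
  reverse≋ []       = ≋-refl
  reverse≋ (c ∷ xs) = begin
      reverse (c ∷ xs)
        ≡⟨ LP.unfold-reverse c xs ⟩
      reverse xs ++ (c ∷ [])
        ≈⟨ ++-shift (reverse xs) c ⟩
      shift (length (reverse xs)) (const c) ⊞ reverse xs
        ≡⟨ cong (λ k → shift k (const c) ⊞ reverse xs) (LP.length-reverse xs) ⟩
      shift (length xs) (const c) ⊞ reverse xs
        ≈⟨ +-congʳ (shift (length xs) (const c)) (reverse≋ xs) ⟩
      shift (length xs) (const c) ⊞ highFirst xs ∎
    where open ≋-R

  sub′-length : ∀ c xs ys → length (sub′ c xs ys) ≡ length xs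
  sub′-length c (x ∷ xs) (y ∷ ys) = cong suc (sub′-length c xs ys)
  sub′-length c []       []       = refl
  sub′-length c (x ∷ xs) []       = refl
  sub′-length c []       (_ ∷ _)  = refl

  private
    regroup : ∀ A B C D E → (A ⊞ negₚ (C ⊛ B)) ⊞ (D ⊞ negₚ (C ⊛ E)) ≋ (A ⊞ D) ⊞ negₚ (C ⊛ (B ⊞ E))
    regroup = solve-∀ polyACR

    solve₁ : ∀ X Y H → X ⊞ H ≋ (X ⊞ Y) ⊞ (H ⊞ negₚ Y)
    solve₁ = solve-∀ polyACR

    solve₂ : ∀ C B D Q R → C ⊛ (B ⊛ D) ⊞ (D ⊛ Q ⊞ R) ≋ D ⊛ (C ⊛ B ⊞ Q) ⊞ R
    solve₂ = solve-∀ polyACR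

  shift-const : ∀ k c → shift k (const c) ≋ const c ⊛ x^ k
  shift-const k c = ≋-trans (≋-trans (shift-cong k (≋-trans (∷-cong (sym (ℤP.*-identityʳ c)) ≋-refl) (≋-sym (const-⊛ c 𝟙))))
    (≋-trans (shift-cong k (const-⊛ c 𝟙)) (shift-scale k c 𝟙))) (≋-sym (const-⊛ c (x^ k)))

  const-sub : ∀ a c b → const (a ℤ.- c ℤ.* b) ≋ const a ⊞ negₚ (const c ⊛ const b)
  const-sub a c b = ∷-cong (cong (λ t → a ℤ.+ ℤ.- t) (sym (ℤP.+-identityʳ (c ℤ.* b)))) ≋-refl

  sub′-highFirst : ∀ c xs ys → length ys ≤ length xs →
    highFirst (sub′ c xs ys) ≋ highFirst xs ⊞ negₚ (const c ⊛ shift (length xs ∸ length ys) (highFirst ys))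
  sub′-highFirst c xs [] le = ≋-sym (≋-trans (+-congʳ (highFirst xs)
    (neg-cong (≋-trans (*-congʳ (const c) (shift-[] (length xs))) (*-zeroʳ (const c)))))
    (≋-trans (+-idʳ (highFirst xs)) (≡⇒≋ (cong highFirst (sub′-[] xs)))))
    where
    sub′-[] : ∀ xs → xs ≡ sub′ c xs []
    sub′-[] []      = refl
    sub′-[] (_ ∷ _) = refl
  sub′-highFirst c (x ∷ xs) (y ∷ ys) (s≤s le) = begin
      shift (length (sub′ c xs ys)) (const (x ℤ.- c ℤ.* y)) ⊞ highFirst (sub′ c xs ys)
        ≡⟨ cong (λ k → shift k (const (x ℤ.- c ℤ.* y)) ⊞ highFirst (sub′ c xs ys)) (sub′-length c xs ys) ⟩
      shift l (const (x ℤ.- c ℤ.* y)) ⊞ highFirst (sub′ c xs ys)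
        ≈⟨ +-cong top (sub′-highFirst c xs ys le) ⟩
      (shift l (const x) ⊞ negₚ (const c ⊛ shift k (shift m (const y))))
        ⊞ (highFirst xs ⊞ negₚ (const c ⊛ shift k (highFirst ys)))
        ≈⟨ regroup (shift l (const x)) (shift k (shift m (const y))) (const c) (highFirst xs) (shift k (highFirst ys)) ⟩
      (shift l (const x) ⊞ highFirst xs) ⊞ negₚ (const c ⊛ (shift k (shift m (const y)) ⊞ shift k (highFirst ys)))
        ≈⟨ +-congʳ (shift l (const x) ⊞ highFirst xs)
             (neg-cong (*-congʳ (const c) (≋-sym (shift-+ k (shift m (const y)) (highFirst ys))))) ⟩
      (shift l (const x) ⊞ highFirst xs) ⊞ negₚ (const c ⊛ shift k (shift m (const y) ⊞ highFirst ys)) ∎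
    where
    open ≋-R
    l = length xs
    m = length ys
    k = l ∸ m
    top : shift l (const (x ℤ.- c ℤ.* y)) ≋ shift l (const x) ⊞ negₚ (const c ⊛ shift k (shift m (const y)))
    top = begin
      shift l (const (x ℤ.- c ℤ.* y))
        ≈⟨ shift-cong l (const-sub x c y) ⟩
      shift l (const x ⊞ negₚ (const c ⊛ const y))
        ≈⟨ shift-+ l (const x) (negₚ (const c ⊛ const y)) ⟩
      shift l (const x) ⊞ shift l (negₚ (const c ⊛ const y))
        ≈⟨ +-congʳ (shift l (const x)) (shift-neg l (const c ⊛ const y)) ⟩
      shift l (const x) ⊞ negₚ (shift l (const c ⊛ const y))
        ≈⟨ +-congʳ (shift l (const x)) (neg-cong (shift-const⊛ l (const y))) ⟩
      shift l (const x) ⊞ negₚ (const c ⊛ shift l (const y))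
        ≡⟨ cong (λ j → shift l (const x) ⊞ negₚ (const c ⊛ shift j (const y))) (ℕP.m∸n+n≡m le) ⟨
      shift l (const x) ⊞ negₚ (const c ⊛ shift (k ℕ.+ m) (const y))
        ≡⟨ cong (λ j → shift l (const x) ⊞ negₚ (const c ⊛ j)) (shift-shift k m (const y)) ⟨
      shift l (const x) ⊞ negₚ (const c ⊛ shift k (shift m (const y))) ∎
      where
      shift-neg : ∀ j P → shift j (negₚ P) ≋ negₚ (shift j P)
      shift-neg zero    P = ≋-refl
      shift-neg (suc j) P = ∷-cong refl (shift-neg j P)
      shift-const⊛ : ∀ j P → shift j (const c ⊛ P) ≋ const c ⊛ shift j P
      shift-const⊛ j P = ≋-trans (shift-cong j (*-comm (const c) P))
        (≋-trans (≋-sym (shift-⊛ˡ j P (const c))) (*-comm (shift j P) (const c)))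

  div′-length : ∀ f xs ds → length xs ≤ f → length (div′ f xs ds) ≡ length xs ∸ length ds
  div′-length zero    []       ds le = sym (ℕP.0∸n≡0 (length ds))
  div′-length (suc f) []       ds le = sym (ℕP.0∸n≡0 (length ds))
  div′-length (suc f) (c ∷ rest) ds (s≤s le) with length ds <ᵇ suc (length rest) in eq
  ... | true  = trans (cong suc (trans (div′-length f (sub′ c rest ds) ds (subst (_≤ f) (sym (sub′-length c rest ds)) le))
                  (cong (_∸ length ds) (sub′-length c rest ds))))
                  (sym (ℕP.+-∸-assoc 1 (ℕP.≤-pred (ℕP.<ᵇ⇒< (length ds) (suc (length rest)) (subst Data.Bool.T (sym eq) _)))))
    where import Data.Bool
  ... | false = sym (ℕP.m≤n⇒m∸n≡0 (ℕP.≮⇒≥ {length ds} {suc (length rest)} λ lt → subst Data.Bool.T eq (ℕP.<⇒<ᵇ lt)))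
    where import Data.Bool

  div′-correct : ∀ f xs ds → length xs ≤ f → Σ (List ℤ) λ r → length r ≤ length ds ×
    (highFirst xs ≋ highFirst (1ℤ ∷ ds) ⊛ highFirst (div′ f xs ds) ⊞ highFirst r)
  div′-correct zero    [] ds le = [] , z≤n , ≋-sym (≋-trans (+-idʳ _) (*-zeroʳ (highFirst (1ℤ ∷ ds))))
  div′-correct (suc f) [] ds le = [] , z≤n , ≋-sym (≋-trans (+-idʳ _) (*-zeroʳ (highFirst (1ℤ ∷ ds))))
  div′-correct (suc f) (c ∷ rest) ds (s≤s le) with length ds <ᵇ suc (length rest) in eq
  ... | false = c ∷ rest , ℕP.≮⇒≥ (λ lt → subst Data.Bool.T eq (ℕP.<⇒<ᵇ lt)) ,
        ≋-sym (+-congˡ (highFirst (c ∷ rest)) (*-zeroʳ (highFirst (1ℤ ∷ ds))))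
    where import Data.Bool
  ... | true with div′-correct f (sub′ c rest ds) ds (subst (_≤ f) (sym (sub′-length c rest ds)) le)
  ... | r , rle , e = r , rle , (begin
      shift l (const c) ⊞ highFirst rest
        ≈⟨ solve₁ (shift l (const c)) Y (highFirst rest) ⟩
      (shift l (const c) ⊞ Y) ⊞ (highFirst rest ⊞ negₚ Y)
        ≈⟨ +-cong lead (≋-sym (sub′-highFirst c rest ds dle)) ⟩
      const c ⊛ (x^ k ⊛ D) ⊞ highFirst (sub′ c rest ds)
        ≈⟨ +-congʳ (const c ⊛ (x^ k ⊛ D)) e ⟩
      const c ⊛ (x^ k ⊛ D) ⊞ (D ⊛ highFirst q ⊞ highFirst r)
        ≈⟨ solve₂ (const c) (x^ k) D (highFirst q) (highFirst r) ⟩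
      D ⊛ (const c ⊛ x^ k ⊞ highFirst q) ⊞ highFirst r
        ≈⟨ +-congˡ (highFirst r) (*-congʳ D (+-congˡ (highFirst q) (≋-sym (shift-const k c)))) ⟩
      D ⊛ (shift k (const c) ⊞ highFirst q) ⊞ highFirst r
        ≡⟨ cong (λ j → D ⊛ (shift j (const c) ⊞ highFirst q) ⊞ highFirst r) qlen ⟨
      D ⊛ (shift (length q) (const c) ⊞ highFirst q) ⊞ highFirst r ∎)
    where
    import Data.Bool
    open ≋-R
    dle : length ds ≤ length rest
    dle = ℕP.≤-pred (ℕP.<ᵇ⇒< (length ds) (suc (length rest)) (subst Data.Bool.T (sym eq) _))
    l = length rest
    k = l ∸ length ds
    D = highFirst (1ℤ ∷ ds)
    q = div′ f (sub′ c rest ds) ds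
    Y = const c ⊛ shift k (highFirst ds)
    qlen : length q ≡ k
    qlen = trans (div′-length f (sub′ c rest ds) ds (subst (_≤ f) (sym (sub′-length c rest ds)) le))
             (cong (_∸ length ds) (sub′-length c rest ds))
    lead : shift l (const c) ⊞ Y ≋ const c ⊛ (x^ k ⊛ D)
    lead = begin
      shift l (const c) ⊞ Y
        ≈⟨ +-congˡ Y (shift-const l c) ⟩
      const c ⊛ x^ l ⊞ const c ⊛ shift k (highFirst ds)
        ≡⟨ cong (λ j → const c ⊛ x^ j ⊞ Y) (ℕP.m∸n+n≡m dle) ⟨
      const c ⊛ x^ (k ℕ.+ length ds) ⊞ const c ⊛ shift k (highFirst ds)
        ≡⟨ cong (λ j → const c ⊛ j ⊞ Y) (shift-shift k (length ds) 𝟙) ⟨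
      const c ⊛ shift k (x^ (length ds)) ⊞ const c ⊛ shift k (highFirst ds)
        ≈⟨ *-distribˡ (const c) (shift k (x^ (length ds))) (shift k (highFirst ds)) ⟨
      const c ⊛ (shift k (x^ (length ds)) ⊞ shift k (highFirst ds))
        ≈⟨ *-congʳ (const c) (shift-+ k (x^ (length ds)) (highFirst ds)) ⟨
      const c ⊛ shift k D
        ≈⟨ *-congʳ (const c) (x^-⊛ k D) ⟨
      const c ⊛ (x^ k ⊛ D) ∎

  -- Monic of degree d: as a list it has exactly d + 1 entries, since divMonic reads off the last one.
  record Monic (P : Poly) (d : ℕ) : Set where
    field
      len  : length P ≡ suc d
      lead : coeff P d ≡ 1ℤ
  open Monic public

  coeff-≥len : ∀ P n → length P ≤ n → coeff P n ≡ 0ℤ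
  coeff-≥len []      n       le       = refl
  coeff-≥len (a ∷ P) (suc n) (s≤s le) = coeff-≥len P n le

  monic-above : ∀ {D d} → Monic D d → ∀ n → d < n → coeff D n ≡ 0ℤ
  monic-above {D} m n lt = coeff-≥len D n (subst (_≤ n) (sym (len m)) lt)

  coeff-⊛-∷ : ∀ D s S n → coeff (D ⊛ (s ∷ S)) n ≡ s ℤ.* coeff D n ℤ.+ coeff (0ℤ ∷ D ⊛ S) n
  coeff-⊛-∷ D s S n = trans (at (⊛-∷ D s S) n)
    (trans (coeff-+ (scale s D) (0ℤ ∷ D ⊛ S) n) (cong (ℤ._+ coeff (0ℤ ∷ D ⊛ S) n) (coeff-scale s D n)))

  monic-top-zero : ∀ {D d} → Monic D d → ∀ S → (∀ n → d ≤ n → coeff (D ⊛ S) n ≡ 0ℤ) → S ≋ []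
  monic-top-zero m [] h = ≋-refl
  monic-top-zero {D} {d} m (s ∷ S) h = ≋-trans (∷-cong s≡0 S≋0) (0∷[]≋ ≋-refl)
    where
    open ≡-Reasoning
    S≋0 : S ≋ []
    S≋0 = monic-top-zero m S λ n le → begin
      coeff (D ⊛ S) n                                      ≡⟨ ℤP.+-identityˡ _ ⟨
      0ℤ ℤ.+ coeff (D ⊛ S) n                               ≡⟨ cong (ℤ._+ coeff (D ⊛ S) n) (ℤP.*-zeroʳ s) ⟨
      s ℤ.* 0ℤ ℤ.+ coeff (D ⊛ S) n
        ≡⟨ cong (λ t → s ℤ.* t ℤ.+ coeff (D ⊛ S) n) (monic-above m (suc n) (s≤s le)) ⟨
      s ℤ.* coeff D (suc n) ℤ.+ coeff (D ⊛ S) n            ≡⟨ coeff-⊛-∷ D s S (suc n) ⟨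
      coeff (D ⊛ (s ∷ S)) (suc n)                          ≡⟨ h (suc n) (ℕP.m≤n⇒m≤1+n le) ⟩
      0ℤ ∎
    s≡0 : s ≡ 0ℤ
    s≡0 = begin
      s                                                    ≡⟨ ℤP.*-identityʳ s ⟨
      s ℤ.* 1ℤ                                             ≡⟨ ℤP.+-identityʳ _ ⟨
      s ℤ.* 1ℤ ℤ.+ 0ℤ
        ≡⟨ cong₂ ℤ._+_ (cong (s ℤ.*_) (lead m)) (at (0∷[]≋ (≋-trans (*-congʳ D S≋0) (*-zeroʳ D))) d) ⟨
      s ℤ.* coeff D d ℤ.+ coeff (0ℤ ∷ D ⊛ S) d             ≡⟨ coeff-⊛-∷ D s S d ⟨
      coeff (D ⊛ (s ∷ S)) d                                ≡⟨ h d ℕP.≤-refl ⟩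
      0ℤ ∎

  monic-coeff-top : ∀ {D d} → Monic D d → ∀ Q m → (∀ j → m < j → coeff Q j ≡ 0ℤ) →
    coeff (D ⊛ Q) (d ℕ.+ m) ≡ coeff Q m
  monic-coeff-top {D} {d} mo [] m h = at (*-zeroʳ D) (d ℕ.+ m)
  monic-coeff-top {D} {d} mo (s ∷ S) zero h = begin
      coeff (D ⊛ (s ∷ S)) (d ℕ.+ 0)                        ≡⟨ cong (coeff (D ⊛ (s ∷ S))) (ℕP.+-identityʳ d) ⟩
      coeff (D ⊛ (s ∷ S)) d                                ≡⟨ coeff-⊛-∷ D s S d ⟩
      s ℤ.* coeff D d ℤ.+ coeff (0ℤ ∷ D ⊛ S) d
        ≡⟨ cong₂ ℤ._+_ (cong (s ℤ.*_) (lead mo))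
             (at (0∷[]≋ (≋-trans (*-congʳ D (eqₚ λ j → h (suc j) (s≤s z≤n))) (*-zeroʳ D))) d) ⟩
      s ℤ.* 1ℤ ℤ.+ 0ℤ                                      ≡⟨ ℤP.+-identityʳ _ ⟩
      s ℤ.* 1ℤ                                             ≡⟨ ℤP.*-identityʳ s ⟩
      s ∎
    where open ≡-Reasoning
  monic-coeff-top {D} {d} mo (s ∷ S) (suc m) h = begin
      coeff (D ⊛ (s ∷ S)) (d ℕ.+ suc m)                    ≡⟨ cong (coeff (D ⊛ (s ∷ S))) (ℕP.+-suc d m) ⟩
      coeff (D ⊛ (s ∷ S)) (suc (d ℕ.+ m))                  ≡⟨ coeff-⊛-∷ D s S (suc (d ℕ.+ m)) ⟩
      s ℤ.* coeff D (suc (d ℕ.+ m)) ℤ.+ coeff (D ⊛ S) (d ℕ.+ m)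
        ≡⟨ cong (λ t → s ℤ.* t ℤ.+ coeff (D ⊛ S) (d ℕ.+ m)) (monic-above mo _ (s≤s (ℕP.m≤m+n d m))) ⟩
      s ℤ.* 0ℤ ℤ.+ coeff (D ⊛ S) (d ℕ.+ m)                 ≡⟨ cong (ℤ._+ coeff (D ⊛ S) (d ℕ.+ m)) (ℤP.*-zeroʳ s) ⟩
      0ℤ ℤ.+ coeff (D ⊛ S) (d ℕ.+ m)                       ≡⟨ ℤP.+-identityˡ _ ⟩
      coeff (D ⊛ S) (d ℕ.+ m)
        ≡⟨ monic-coeff-top mo S m (λ j lt → h (suc j) (s≤s lt)) ⟩
      coeff S m ∎
    where open ≡-Reasoning

  private
    cancel-eq : ∀ D S T → D ⊛ (S ⊟ T) ≋ D ⊛ S ⊟ D ⊛ T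
    cancel-eq = solve-∀ polyACR

    sub-add : ∀ S T → S ≋ (S ⊟ T) ⊞ T
    sub-add = solve-∀ polyACR

    sub-add′ : ∀ P Q R → P ≋ Q ⊞ R → P ⊟ Q ≋ R
    sub-add′ P Q R e = ≋-trans (+-congˡ (negₚ Q) e) (aux Q R)
      where
      aux : ∀ Q R → (Q ⊞ R) ⊟ Q ≋ R
      aux = solve-∀ polyACR

  ⊟≋0⇒≋ : ∀ {S T} → S ⊟ T ≋ [] → S ≋ T
  ⊟≋0⇒≋ {S} {T} e = ≋-trans (sub-add S T) (+-congˡ T e)

  monic-cancel : ∀ {D d} → Monic D d → ∀ {S T} → D ⊛ S ≋ D ⊛ T → S ≋ T
  monic-cancel {D} m {S} {T} e = ⊟≋0⇒≋ (monic-top-zero m (S ⊟ T) λ n _ →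
    at (≋-trans (cancel-eq D S T) (≋-trans (+-congˡ (negₚ (D ⊛ T)) e) (+-invʳ (D ⊛ T)))) n)

  infix 4 _∣ₚ_
  infixr 3 _,ₚ_
  record _∣ₚ_ (D P : Poly) : Set where
    constructor _,ₚ_
    field
      quotₚ : Poly
      eqdiv : P ≋ D ⊛ quotₚ
  open _∣ₚ_ public

  length-+ₚ : ∀ P Q → length P ≤ length Q → length (P ⊞ Q) ≡ length Q
  length-+ₚ [] Q le = refl
  length-+ₚ (a ∷ P) (b ∷ Q) (s≤s le) = cong suc (length-+ₚ P Q le)

  length-⊛ : ∀ P Q m n → length P ≡ suc m → length Q ≡ suc n → length (P ⊛ Q) ≡ suc (m ℕ.+ n)
  length-⊛ (a ∷ []) (b ∷ Q) zero n refl lq = trans (cong suc (trans (lem (map (a ℤ.*_) Q)) (LP.length-map (a ℤ.*_) Q))) lq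
    where
    lem : ∀ R → length (R ⊞ []) ≡ length R
    lem [] = refl
    lem (_ ∷ R) = refl
  length-⊛ (a ∷ a' ∷ P) Q (suc m) n lp lq = trans (length-+ₚ (map (a ℤ.*_) Q) (0ℤ ∷ (a' ∷ P) ⊛ Q) le) (cong suc ih)
    where
    ih : length ((a' ∷ P) ⊛ Q) ≡ suc (m ℕ.+ n)
    ih = length-⊛ (a' ∷ P) Q m n (ℕP.suc-injective lp) lq
    le : length (map (a ℤ.*_) Q) ≤ suc (length ((a' ∷ P) ⊛ Q))
    le = subst₂ _≤_ (sym (trans (LP.length-map (a ℤ.*_) Q) lq)) (cong suc (sym ih))
      (s≤s (ℕP.m≤n⇒m≤1+n (ℕP.m≤n+m n m)))

  monic-⊛ : ∀ {P Q m n} → Monic P m → Monic Q n → Monic (P ⊛ Q) (m ℕ.+ n)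
  monic-⊛ {P} {Q} {m} {n} mp mq = record
    { len  = length-⊛ P Q m n (len mp) (len mq)
    ; lead = trans (monic-coeff-top mp Q n (monic-above mq)) (lead mq) }

  monic-reverse : ∀ {D d} → Monic D d → Σ (List ℤ) λ ds → reverse D ≡ 1ℤ ∷ ds × length ds ≡ d
  monic-reverse {D} {d} m with reverse D in eq
  ... | [] = case trans (sym (len m)) (trans (sym (LP.length-reverse D)) (cong length eq)) of λ ()
  ... | c ∷ ds = ds , cong (_∷ ds) c≡1 , lds
    where
    lds : length ds ≡ d
    lds = ℕP.suc-injective (trans (cong length (sym eq)) (trans (LP.length-reverse D) (len m)))
    D≡ : D ≡ reverse ds ++ (c ∷ [])
    D≡ = trans (sym (LP.reverse-involutive D)) (trans (cong reverse eq) (LP.unfold-reverse c ds))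
    last : ∀ P → coeff (P ++ (c ∷ [])) (length P) ≡ c
    last [] = refl
    last (_ ∷ P) = last P
    c≡1 : c ≡ 1ℤ
    c≡1 = trans (sym (last (reverse ds))) (trans (cong₂ coeff (sym D≡) (trans (LP.length-reverse ds) lds)) (lead m))

  divide : ∀ {D d} → Monic D d → ∀ P → Σ Poly λ R → length R ≤ d × (P ≋ D ⊛ divMonic P D ⊞ R)
  divide {D} {d} m P with monic-reverse m
  ... | ds , rD , lds with div′-correct (length P) (reverse P) ds (ℕP.≤-reflexive (LP.length-reverse P))
  ... | r , rle , e = reverse r , subst₂ _≤_ (sym (LP.length-reverse r)) lds rle , (begin
      P                                        ≡⟨ LP.reverse-involutive P ⟨
      reverse (reverse P)                      ≈⟨ reverse≋ (reverse P) ⟩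
      highFirst (reverse P)                    ≈⟨ e ⟩
      highFirst (1ℤ ∷ ds) ⊛ highFirst q ⊞ highFirst r
        ≈⟨ +-cong (*-cong (≋-trans (≋-sym (reverse≋ (1ℤ ∷ ds))) (≡⇒≋ (trans (cong reverse (sym rD)) (LP.reverse-involutive D))))
             (≋-sym (reverse≋ q))) (≋-sym (reverse≋ r)) ⟩
      D ⊛ reverse q ⊞ reverse r
        ≡⟨ cong (λ z → D ⊛ z ⊞ reverse r) (trans (cong (λ z → reverse (div′ (length P) (reverse P) (drop 1 z))) (sym rD)) (sym (divMonic≡ P D))) ⟩
      D ⊛ divMonic P D ⊞ reverse r ∎)
    where
    open ≋-R
    q = div′ (length P) (reverse P) ds

  divMonic-exact : ∀ {D d} → Monic D d → ∀ {P} → D ∣ₚ P → P ≋ D ⊛ divMonic P D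
  divMonic-exact {D} {d} m {P} (Q ,ₚ e) with divide m P
  ... | R , Rle , f = ≋-trans e (*-congʳ D (⊟≋0⇒≋ (monic-top-zero m (Q ⊟ divMonic P D) λ n le →
    trans (at (≋-trans (cancel-eq D Q (divMonic P D)) (≋-trans (+-congˡ (negₚ (D ⊛ divMonic P D)) (≋-sym e))
      (sub-add′ P (D ⊛ divMonic P D) R f))) n) (coeff-≥len R n (ℕP.≤-trans Rle le)))))

  divMonic-monic : ∀ {D d P n} → Monic D d → Monic P n → d ≤ n → D ∣ₚ P → Monic (divMonic P D) (n ∸ d)
  divMonic-monic {D} {d} {P} {n} m mp le dv with monic-reverse m
  ... | ds , rD , lds = record { len = lq ; lead = ld }
    where
    lq : length (divMonic P D) ≡ suc (n ∸ d)
    lq = trans (cong length (divMonic≡ P D)) (trans (LP.length-reverse (div′ (length P) (reverse P) (drop 1 (reverse D))))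
      (trans (cong (λ z → length (div′ (length P) (reverse P) (drop 1 z))) rD)
      (trans (div′-length (length P) (reverse P) ds (ℕP.≤-reflexive (LP.length-reverse P)))
      (trans (cong₂ _∸_ (trans (LP.length-reverse P) (len mp)) lds) (ℕP.+-∸-assoc 1 le)))))
    ld : coeff (divMonic P D) (n ∸ d) ≡ 1ℤ
    ld = trans (sym (monic-coeff-top m (divMonic P D) (n ∸ d) (λ j lt → coeff-≥len (divMonic P D) j (subst (_≤ j) (sym lq) lt))))
      (trans (cong (coeff (D ⊛ divMonic P D)) (ℕP.m+[n∸m]≡n le)) (trans (sym (at (divMonic-exact m dv) n)) (lead mp)))

module CyclotomicPolynomials where
  open import Defs hiding (step)
  open Polynomials
  open Division
  open import Data.Bool using (true; false; T)
  open import Data.Nat as ℕ using (_≡ᵇ_)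
  import Data.Nat.Properties as ℕP
  open import Data.Nat.Divisibility using (_∣_; divides; _∣?_; ∣⇒≤; ∣-trans; ∣-antisym)
  open import Data.Nat.GCD using (gcd; gcd[m,n]∣m; gcd[m,n]∣n; module Bézout; gcd-GCD)
  open import Data.Nat.Induction using (<-rec)
  open import Data.Integer as ℤ using (ℤ; 0ℤ; 1ℤ)
  import Data.Integer.Properties as ℤP
  open import Data.List using (List; []; _∷_; _++_; length; map; foldr; upTo; replicate)
  import Data.List.Properties as LP
  open import Data.List.Membership.Propositional using (_∈_)
  open import Data.List.Membership.Propositional.Properties using (∈-map⁻; ∈-map⁺; ∈-upTo⁻; ∈-upTo⁺; ∈-filter⁻; ∈-filter⁺)
  open import Data.List.Relation.Unary.Any using (here; there)
  open import Data.List.Relation.Unary.All as All using (All; []; _∷_)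
  open import Data.List.Relation.Unary.Unique.Propositional using (Unique)
  open import Data.List.Relation.Unary.AllPairs using ([]; _∷_)
  import Data.List.Relation.Unary.Unique.Propositional.Properties as UP
  open import Data.Nat.Primality using (prime⇒nonTrivial; prime⇒irreducible)
  open import Relation.Nullary using (contradiction)
  open import Relation.Nullary.Decidable.Core using (T?)
  open import Tactic.RingSolver using (solve-∀)

  ∣ₚ-trans : ∀ {P Q R} → P ∣ₚ Q → Q ∣ₚ R → P ∣ₚ R
  ∣ₚ-trans {P} {Q} {R} (U ,ₚ e) (V ,ₚ f) = U ⊛ V ,ₚ ≋-trans f (≋-trans (*-congˡ V e) (*-assoc P U V))

  ∣ₚ-resp : ∀ {P Q R} → P ∣ₚ Q → Q ≋ R → P ∣ₚ R
  ∣ₚ-resp (U ,ₚ e) f = U ,ₚ ≋-trans (≋-sym f) e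

  ∣ₚ-+ : ∀ {P Q R} → P ∣ₚ Q → P ∣ₚ R → P ∣ₚ Q ⊞ R
  ∣ₚ-+ {P} (U ,ₚ e) (V ,ₚ f) = U ⊞ V ,ₚ ≋-trans (+-cong e f) (≋-sym (*-distribˡ P U V))

  ∣ₚ-*ʳ : ∀ {P Q} R → P ∣ₚ Q → P ∣ₚ Q ⊛ R
  ∣ₚ-*ʳ {P} {Q} R (U ,ₚ e) = U ⊛ R ,ₚ ≋-trans (*-congˡ R e) (*-assoc P U R)

  ∣ₚ-*ˡ : ∀ {P Q} R → P ∣ₚ Q → P ∣ₚ R ⊛ Q
  ∣ₚ-*ˡ {P} {Q} R d = ∣ₚ-resp {P} {Q ⊛ R} {R ⊛ Q} (∣ₚ-*ʳ {P} {Q} R d) (*-comm Q R)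

  ∣ₚ-neg : ∀ {P Q} → P ∣ₚ Q → P ∣ₚ negₚ Q
  ∣ₚ-neg {P} {Q} (U ,ₚ e) = negₚ U ,ₚ ≋-trans (neg-cong e) (lem P U)
    where
    lem : ∀ P U → negₚ (P ⊛ U) ≋ P ⊛ negₚ U
    lem = solve-∀ polyACR

  record Coprimeₚ (P Q : Poly) : Set where
    constructor cop
    field
      {u v} : Poly
      {c}   : ℤ
      c≢0   : c ≢ 0ℤ
      eq    : u ⊛ P ⊞ v ⊛ Q ≋ const c

  cop-sym : ∀ {P Q} → Coprimeₚ P Q → Coprimeₚ Q P
  cop-sym {P} {Q} (cop {u} {v} z e) = cop {u = v} {v = u} z (≋-trans (+-comm (v ⊛ Q) (u ⊛ P)) e)

  cop-factor : ∀ {P Q R} → Coprimeₚ P Q → R ∣ₚ Q → Coprimeₚ P R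
  cop-factor {P} {Q} {R} (cop {u} {v} z e) (W ,ₚ f) = cop {u = u} {v = v ⊛ W} z
    (≋-trans (+-congʳ (u ⊛ P) (≋-trans (lem v W R) (*-congʳ v (≋-sym f)))) e)
    where
    lem : ∀ v W R → (v ⊛ W) ⊛ R ≋ v ⊛ (R ⊛ W)
    lem = solve-∀ polyACR

  const-⊛-const : ∀ a b → const a ⊛ const b ≋ const (a ℤ.* b)
  const-⊛-const a b = const-⊛ a (const b)

  cop-⊛ : ∀ {P Q R} → Coprimeₚ P Q → Coprimeₚ P R → Coprimeₚ P (Q ⊛ R)
  cop-⊛ {P} {Q} {R} (cop {u} {v} {c} z e) (cop {u'} {v'} {c'} z' e') = cop
    {u = u ⊛ (u' ⊛ P ⊞ v' ⊛ R) ⊞ v ⊛ (Q ⊛ u')} {v = v ⊛ v'}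
    (λ h → nz (ℤP.i*j≡0⇒i≡0∨j≡0 c h))
    (≋-trans (lem u v u' v' P Q R) (≋-trans (*-cong e e') (const-⊛-const c c')))
    where
    open import Data.Sum using (_⊎_; inj₁; inj₂)
    nz : (c ≡ 0ℤ) ⊎ (c' ≡ 0ℤ) → _
    nz (inj₁ h) = z h
    nz (inj₂ h) = z' h
    lem : ∀ u v u' v' P Q R → (u ⊛ (u' ⊛ P ⊞ v' ⊛ R) ⊞ v ⊛ (Q ⊛ u')) ⊛ P ⊞ (v ⊛ v') ⊛ (Q ⊛ R)
      ≋ (u ⊛ P ⊞ v ⊛ Q) ⊛ (u' ⊛ P ⊞ v' ⊛ R)
    lem = solve-∀ polyACR

  cop-∣ : ∀ {P Q R m n} → Coprimeₚ P Q → Monic P m → Monic Q n → P ∣ₚ R → Q ∣ₚ R → (P ⊛ Q) ∣ₚ R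
  cop-∣ {P} {Q} {R} {m} {n} (cop {u} {v} {c} z e) mP mQ (U ,ₚ f) (V ,ₚ g) = divMonic R D ,ₚ R≋
    where
    D = P ⊛ Q
    mD = monic-⊛ mP mQ
    W = u ⊛ V ⊞ v ⊛ U
    cR : const c ⊛ R ≋ D ⊛ W
    cR = begin
      const c ⊛ R                          ≈⟨ *-congˡ R e ⟨
      (u ⊛ P ⊞ v ⊛ Q) ⊛ R                  ≈⟨ l₁ u P v Q R ⟩
      (u ⊛ P) ⊛ R ⊞ (v ⊛ Q) ⊛ R            ≈⟨ +-cong (*-congʳ (u ⊛ P) g) (*-congʳ (v ⊛ Q) f) ⟩
      (u ⊛ P) ⊛ (Q ⊛ V) ⊞ (v ⊛ Q) ⊛ (P ⊛ U) ≈⟨ l₂ u P v Q U V ⟩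
      D ⊛ W                                ∎
      where
      open ≋-R
      l₁ : ∀ u P v Q R → (u ⊛ P ⊞ v ⊛ Q) ⊛ R ≋ (u ⊛ P) ⊛ R ⊞ (v ⊛ Q) ⊛ R
      l₁ = solve-∀ polyACR
      l₂ : ∀ u P v Q U V → (u ⊛ P) ⊛ (Q ⊛ V) ⊞ (v ⊛ Q) ⊛ (P ⊛ U) ≋ (P ⊛ Q) ⊛ (u ⊛ V ⊞ v ⊛ U)
      l₂ = solve-∀ polyACR
    dv = divide mD R
    r = proj₁ dv
    rle : length r ≤ m ℕ.+ n
    rle = proj₁ (proj₂ dv)
    S = W ⊟ const c ⊛ divMonic R D
    DS≋cr : D ⊛ S ≋ const c ⊛ r
    DS≋cr = begin
      D ⊛ S                                        ≈⟨ l₁ D W (const c) (divMonic R D) ⟩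
      D ⊛ W ⊟ const c ⊛ (D ⊛ divMonic R D)         ≈⟨ +-congˡ (negₚ (const c ⊛ (D ⊛ divMonic R D))) (≋-sym cR) ⟩
      const c ⊛ R ⊟ const c ⊛ (D ⊛ divMonic R D)
        ≈⟨ +-congˡ (negₚ (const c ⊛ (D ⊛ divMonic R D))) (*-congʳ (const c) (proj₂ (proj₂ dv))) ⟩
      const c ⊛ (D ⊛ divMonic R D ⊞ r) ⊟ const c ⊛ (D ⊛ divMonic R D) ≈⟨ l₂ (const c) (D ⊛ divMonic R D) r ⟩
      const c ⊛ r                                  ∎
      where
      open ≋-R
      l₁ : ∀ D W c q → D ⊛ (W ⊟ c ⊛ q) ≋ D ⊛ W ⊟ c ⊛ (D ⊛ q)
      l₁ = solve-∀ polyACR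
      l₂ : ∀ c q r → c ⊛ (q ⊞ r) ⊟ c ⊛ q ≋ c ⊛ r
      l₂ = solve-∀ polyACR
    S≋0 : S ≋ []
    S≋0 = monic-top-zero mD S λ k le → trans (at DS≋cr k) (trans (at (const-⊛ c r) k)
      (trans (coeff-scale c r k) (trans (cong (c ℤ.*_) (coeff-≥len r k (ℕP.≤-trans rle le))) (ℤP.*-zeroʳ c))))
    r≋0 : r ≋ []
    r≋0 = eqₚ λ k → ℤP.*-cancelˡ-≡ c (coeff r k) 0ℤ ⦃ ℤ.≢-nonZero z ⦄ (trans (sym (trans (at (const-⊛ c r) k) (coeff-scale c r k)))
      (trans (sym (at DS≋cr k)) (trans (at (≋-trans (*-congʳ D S≋0) (*-zeroʳ D)) k) (sym (ℤP.*-zeroʳ c)))))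
    R≋ : R ≋ D ⊛ divMonic R D
    R≋ = ≋-trans (proj₂ (proj₂ dv)) (≋-trans (+-congʳ (D ⊛ divMonic R D) r≋0) (+-idʳ (D ⊛ divMonic R D)))

  E₋ : ℕ → Poly
  E₋ n = x^ n ⊟ 𝟙

  E₋-0 : E₋ 0 ≋ []
  E₋-0 = +-invʳ 𝟙

  xnMinus1≋ : ∀ n → XnMinus1 n ≋ E₋ n
  xnMinus1≋ zero = ≋-sym E₋-0
  xnMinus1≋ (suc n) = ∷-cong refl (≋-trans (lem n) (≋-sym (+-idʳ (x^ n))))
    where
    lem : ∀ k → replicate k 0ℤ ++ (1ℤ ∷ []) ≋ x^ k
    lem zero = ≋-refl
    lem (suc k) = ∷-cong refl (lem k)

  xnMinus1-monic : ∀ n → 1 ≤ n → Monic (XnMinus1 n) n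
  xnMinus1-monic (suc n) _ = record
    { len = cong suc (trans (LP.length-++ (replicate n 0ℤ)) (trans (cong (ℕ._+ 1) (LP.length-replicate n)) (ℕP.+-comm n 1)))
    ; lead = lem n }
    where
    lem : ∀ k → coeff (replicate k 0ℤ ++ (1ℤ ∷ [])) k ≡ 1ℤ
    lem zero = refl
    lem (suc k) = lem k

  E₋-+ : ∀ m n → E₋ (m ℕ.+ n) ≋ x^ m ⊛ E₋ n ⊞ E₋ m
  E₋-+ m n = ≋-trans (+-congˡ (negₚ 𝟙) (x^-+ m n)) (lem (x^ m) (x^ n) 𝟙 (*-id (x^ m)))
    where
    *-id : ∀ P → P ⊛ 𝟙 ≋ P
    *-id P = ≋-trans (*-comm P 𝟙) (*-idˡ P)
    lem : ∀ a b i → a ⊛ i ≋ a → a ⊛ b ⊟ i ≋ a ⊛ (b ⊟ i) ⊞ (a ⊟ i)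
    lem a b i h = ≋-trans (l₁ a b i) (+-congʳ (a ⊛ b ⊟ a ⊛ i) (+-congˡ (negₚ i) h) ⟫ l₂ a b i)
      where
      infixr 2 _⟫_
      _⟫_ : ∀ {P Q R} → P ≋ Q → Q ≋ R → P ≋ R
      _⟫_ = ≋-trans
      l₁ : ∀ a b i → a ⊛ b ⊟ i ≋ (a ⊛ b ⊟ a ⊛ i) ⊞ (a ⊛ i ⊟ i)
      l₁ = solve-∀ polyACR
      l₂ : ∀ a b i → (a ⊛ b ⊟ a ⊛ i) ⊞ (a ⊟ i) ≋ a ⊛ (b ⊟ i) ⊞ (a ⊟ i)
      l₂ = solve-∀ polyACR

  E₋-∣ : ∀ {m n} → m ∣ n → E₋ m ∣ₚ E₋ n
  E₋-∣ {m} {n} (divides k refl) = go k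
    where
    go : ∀ k → E₋ m ∣ₚ E₋ (k ℕ.* m)
    go zero = [] ,ₚ ≋-trans E₋-0 (≋-sym (*-zeroʳ (E₋ m)))
    go (suc k) = ∣ₚ-resp (∣ₚ-+ (∣ₚ-*ˡ (x^ m) (go k)) (𝟙 ,ₚ ≋-trans (≋-sym (*-idˡ (E₋ m))) (*-comm 𝟙 (E₋ m))))
      (≋-sym (E₋-+ m (k ℕ.* m)))

  private
    E₋-bézout : ∀ m n g {i j} → m ∣ i → n ∣ j → g ℕ.+ j ≡ i → Σ Poly λ u → Σ Poly λ v → u ⊛ E₋ m ⊞ v ⊛ E₋ n ≋ E₋ g
    E₋-bézout m n g {i} {j} mi nj e with E₋-∣ mi | E₋-∣ nj
    ... | U ,ₚ f | V ,ₚ h = U , negₚ (x^ g ⊛ V) , (begin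
        U ⊛ E₋ m ⊞ negₚ (x^ g ⊛ V) ⊛ E₋ n
          ≈⟨ +-cong (≋-trans (*-comm U (E₋ m)) (≋-sym f)) (l₁ (x^ g) V (E₋ n)) ⟩
        E₋ i ⊞ negₚ (x^ g ⊛ (E₋ n ⊛ V))
          ≈⟨ +-congʳ (E₋ i) (neg-cong (*-congʳ (x^ g) (≋-sym h))) ⟩
        E₋ i ⊞ negₚ (x^ g ⊛ E₋ j)
          ≈⟨ +-congˡ (negₚ (x^ g ⊛ E₋ j)) (≋-trans (≡⇒≋ (cong E₋ (sym e))) (E₋-+ g j)) ⟩
        (x^ g ⊛ E₋ j ⊞ E₋ g) ⊞ negₚ (x^ g ⊛ E₋ j)
          ≈⟨ l₂ (x^ g ⊛ E₋ j) (E₋ g) ⟩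
        E₋ g ∎)
      where
      open ≋-R
      l₁ : ∀ a V e → negₚ (a ⊛ V) ⊛ e ≋ negₚ (a ⊛ (e ⊛ V))
      l₁ = solve-∀ polyACR
      l₂ : ∀ X Y → (X ⊞ Y) ⊞ negₚ X ≋ Y
      l₂ = solve-∀ polyACR

  E₋-gcd : ∀ m n → Σ Poly λ u → Σ Poly λ v → u ⊛ E₋ m ⊞ v ⊛ E₋ n ≋ E₋ (gcd m n)
  E₋-gcd m n = from (Bézout.identity (gcd-GCD m n))
    where
    from : ∀ {d} → Bézout.Identity d m n → Σ Poly λ u → Σ Poly λ v → u ⊛ E₋ m ⊞ v ⊛ E₋ n ≋ E₋ d
    from {d} (Bézout.+- x y eq) = E₋-bézout m n d (divides x refl) (divides y refl) eq
    from {d} (Bézout.-+ x y eq) = let U , V , e = E₋-bézout n m d (divides y refl) (divides x refl) eq in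
      V , U , ≋-trans (+-comm (V ⊛ E₋ m) (U ⊛ E₋ n)) e

  cop-E₋-gcd : ∀ {P m} n → P ∣ₚ E₋ m → Coprimeₚ P (E₋ (gcd m n)) → Coprimeₚ P (E₋ n)
  cop-E₋-gcd {P} {m} n (W ,ₚ e) (cop {u} {v} {c} z f) with E₋-gcd m n
  ... | U , V , g = cop {u = u ⊞ v ⊛ (U ⊛ W)} {v = v ⊛ V} z (begin
      (u ⊞ v ⊛ (U ⊛ W)) ⊛ P ⊞ (v ⊛ V) ⊛ E₋ n      ≈⟨ l₁ u v U W P V (E₋ n) ⟩
      u ⊛ P ⊞ v ⊛ (U ⊛ (P ⊛ W) ⊞ V ⊛ E₋ n)
        ≈⟨ +-congʳ (u ⊛ P) (*-congʳ v (+-congˡ (V ⊛ E₋ n) (*-congʳ U (≋-sym e)))) ⟩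
      u ⊛ P ⊞ v ⊛ (U ⊛ E₋ m ⊞ V ⊛ E₋ n)           ≈⟨ +-congʳ (u ⊛ P) (*-congʳ v g) ⟩
      u ⊛ P ⊞ v ⊛ E₋ (gcd m n)                    ≈⟨ f ⟩
      const c ∎)
    where
    open ≋-R
    l₁ : ∀ u v U W P V e → (u ⊞ v ⊛ (U ⊛ W)) ⊛ P ⊞ (v ⊛ V) ⊛ e ≋ u ⊛ P ⊞ v ⊛ (U ⊛ (P ⊛ W) ⊞ V ⊛ e)
    l₁ = solve-∀ polyACR

  -- x d/dx, which unlike d/dx keeps the degree of a monomial.
  euler : ℤ → Poly → Poly
  euler k []      = []
  euler k (a ∷ P) = k ℤ.* a ∷ euler (1ℤ ℤ.+ k) P

  coeff-euler : ∀ k P n → coeff (euler k P) n ≡ (ℤ.+ n ℤ.+ k) ℤ.* coeff P n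
  coeff-euler k [] n = sym (ℤP.*-zeroʳ (ℤ.+ n ℤ.+ k))
  coeff-euler k (a ∷ P) zero = cong (ℤ._* a) (sym (ℤP.+-identityˡ k))
  coeff-euler k (a ∷ P) (suc n) = trans (coeff-euler (1ℤ ℤ.+ k) P n)
    (cong (ℤ._* coeff P n) (trans (sym (ℤP.+-assoc (ℤ.+ n) 1ℤ k)) (cong (ℤ._+ k) (ℤP.+-comm (ℤ.+ n) 1ℤ))))

  euler-cong : ∀ k {P Q} → P ≋ Q → euler k P ≋ euler k Q
  euler-cong k {P} {Q} e = eqₚ λ n → trans (coeff-euler k P n) (trans (cong ((ℤ.+ n ℤ.+ k) ℤ.*_) (at e n)) (sym (coeff-euler k Q n)))

  euler-suc : ∀ k P → euler (1ℤ ℤ.+ k) P ≋ euler k P ⊞ P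
  euler-suc k P = eqₚ λ n → trans (coeff-euler (1ℤ ℤ.+ k) P n) (trans (lem (ℤ.+ n) k (coeff P n))
    (sym (trans (coeff-+ (euler k P) P n) (cong (ℤ._+ coeff P n) (coeff-euler k P n)))))
    where
    open import Data.Integer.Tactic.RingSolver as ZS using ()
    lem : ∀ n k c → (n ℤ.+ (1ℤ ℤ.+ k)) ℤ.* c ≡ (n ℤ.+ k) ℤ.* c ℤ.+ c
    lem = ZS.solve-∀

  euler-scale : ∀ k a P → euler k (scale a P) ≋ scale a (euler k P)
  euler-scale k a P = eqₚ λ n → trans (coeff-euler k (scale a P) n) (trans (cong ((ℤ.+ n ℤ.+ k) ℤ.*_) (coeff-scale a P n))
    (trans (lem (ℤ.+ n ℤ.+ k) a (coeff P n)) (sym (trans (coeff-scale a (euler k P) n) (cong (a ℤ.*_) (coeff-euler k P n))))))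
    where
    open import Data.Integer.Tactic.RingSolver as ZS using ()
    lem : ∀ n k c → n ℤ.* (k ℤ.* c) ≡ k ℤ.* (n ℤ.* c)
    lem = ZS.solve-∀

  euler-+ : ∀ k P Q → euler k (P ⊞ Q) ≋ euler k P ⊞ euler k Q
  euler-+ k P Q = eqₚ λ n → trans (coeff-euler k (P ⊞ Q) n) (trans (cong ((ℤ.+ n ℤ.+ k) ℤ.*_) (coeff-+ P Q n))
    (trans (ℤP.*-distribˡ-+ (ℤ.+ n ℤ.+ k) (coeff P n) (coeff Q n))
    (sym (trans (coeff-+ (euler k P) (euler k Q) n) (cong₂ ℤ._+_ (coeff-euler k P n) (coeff-euler k Q n))))))

  euler-0∷ : ∀ P → euler 0ℤ (0ℤ ∷ P) ≋ 0ℤ ∷ (euler 0ℤ P ⊞ P)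
  euler-0∷ P = ∷-cong refl (euler-suc 0ℤ P)

  euler-leibniz : ∀ P Q → euler 0ℤ (P ⊛ Q) ≋ euler 0ℤ P ⊛ Q ⊞ P ⊛ euler 0ℤ Q
  euler-leibniz [] Q = ≋-refl
  euler-leibniz (a ∷ P) Q = begin
      euler 0ℤ (scale a Q ⊞ (0ℤ ∷ P ⊛ Q))
        ≈⟨ euler-+ 0ℤ (scale a Q) (0ℤ ∷ P ⊛ Q) ⟩
      euler 0ℤ (scale a Q) ⊞ euler 0ℤ (0ℤ ∷ P ⊛ Q)
        ≈⟨ +-cong (euler-scale 0ℤ a Q) (euler-0∷ (P ⊛ Q)) ⟩
      scale a Q' ⊞ (0ℤ ∷ (euler 0ℤ (P ⊛ Q) ⊞ P ⊛ Q))
        ≈⟨ +-congʳ (scale a Q') (∷-cong refl (+-congˡ (P ⊛ Q) (euler-leibniz P Q))) ⟩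
      scale a Q' ⊞ (0ℤ ∷ (((P' ⊛ Q) ⊞ (P ⊛ Q')) ⊞ P ⊛ Q))
        ≈⟨ +-congʳ (scale a Q') (∷-cong refl (l₁ (P' ⊛ Q) (P ⊛ Q') (P ⊛ Q))) ⟩
      scale a Q' ⊞ ((0ℤ ∷ (P' ⊛ Q ⊞ P ⊛ Q)) ⊞ (0ℤ ∷ P ⊛ Q'))
        ≈⟨ l₂ (scale a Q') (0ℤ ∷ (P' ⊛ Q ⊞ P ⊛ Q)) (0ℤ ∷ P ⊛ Q') ⟩
      (0ℤ ∷ (P' ⊛ Q ⊞ P ⊛ Q)) ⊞ (scale a Q' ⊞ (0ℤ ∷ P ⊛ Q'))
        ≈⟨ +-congˡ (scale a Q' ⊞ (0ℤ ∷ P ⊛ Q')) (∷-cong refl (≋-sym (*-distribʳ Q P' P))) ⟩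
      (0ℤ ∷ (P' ⊞ P) ⊛ Q) ⊞ (a ∷ P) ⊛ Q'
        ≈⟨ +-congˡ ((a ∷ P) ⊛ Q') (shift-⊛ (P' ⊞ P) Q) ⟨
      (0ℤ ∷ (P' ⊞ P)) ⊛ Q ⊞ (a ∷ P) ⊛ Q'
        ≈⟨ +-congˡ ((a ∷ P) ⊛ Q') (*-congˡ Q (∷-cong {0ℤ} {0ℤ ℤ.* a} refl (≋-sym (euler-suc 0ℤ P)))) ⟩
      euler 0ℤ (a ∷ P) ⊛ Q ⊞ (a ∷ P) ⊛ Q' ∎
    where
    open ≋-R
    P' = euler 0ℤ P
    Q' = euler 0ℤ Q
    l₁ : ∀ X Y Z → (X ⊞ Y) ⊞ Z ≋ (X ⊞ Z) ⊞ Y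
    l₁ = solve-∀ polyACR
    l₂ : ∀ X Y Z → X ⊞ (Y ⊞ Z) ≋ Y ⊞ (X ⊞ Z)
    l₂ = solve-∀ polyACR

  -- From xⁿ − 1 = F G the Euler operator gives n xⁿ = F'G + FG', so (F, G) contains n xⁿ − n (xⁿ − 1) = n.
  squarefree : ∀ n {F G} → 1 ≤ n → E₋ n ≋ F ⊛ G → Coprimeₚ F G
  squarefree n@(suc m) {F} {G} _ e = cop {u = G' ⊟ N ⊛ G} {v = F'} {c = ℤ.+ n} (λ ()) (begin
      (G' ⊟ N ⊛ G) ⊛ F ⊞ F' ⊛ G             ≈⟨ l₁ G' N G F F' ⟩
      (F' ⊛ G ⊞ F ⊛ G') ⊟ N ⊛ (F ⊛ G)       ≈⟨ +-congʳ _ (neg-cong (*-congʳ N (≋-sym e))) ⟩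
      (F' ⊛ G ⊞ F ⊛ G') ⊟ N ⊛ E₋ n          ≈⟨ +-congˡ (negₚ (N ⊛ E₋ n)) (≋-sym (euler-leibniz F G)) ⟩
      euler 0ℤ (F ⊛ G) ⊟ N ⊛ E₋ n           ≈⟨ +-congˡ (negₚ (N ⊛ E₋ n)) (euler-cong 0ℤ (≋-sym e)) ⟩
      euler 0ℤ (E₋ n) ⊟ N ⊛ E₋ n            ≈⟨ +-congˡ (negₚ (N ⊛ E₋ n)) eulerE ⟩
      scale (ℤ.+ n) (x^ n) ⊟ N ⊛ E₋ n       ≈⟨ +-congˡ (negₚ (N ⊛ E₋ n)) (const-⊛ (ℤ.+ n) (x^ n)) ⟨
      N ⊛ x^ n ⊟ N ⊛ E₋ n                   ≈⟨ l₂ N (x^ n) 𝟙 ⟩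
      N ⊛ 𝟙                                 ≈⟨ *-comm N 𝟙 ⟩
      𝟙 ⊛ N                                 ≈⟨ *-idˡ N ⟩
      N ∎)
    where
    open ≋-R
    N = const (ℤ.+ n)
    F' = euler 0ℤ F
    G' = euler 0ℤ G
    l₁ : ∀ G' N G F F' → (G' ⊟ N ⊛ G) ⊛ F ⊞ F' ⊛ G ≋ (F' ⊛ G ⊞ F ⊛ G') ⊟ N ⊛ (F ⊛ G)
    l₁ = solve-∀ polyACR
    l₂ : ∀ N x i → N ⊛ x ⊟ N ⊛ (x ⊟ i) ≋ N ⊛ i
    l₂ = solve-∀ polyACR
    eulerX : ∀ m k → euler k (x^ m) ≋ scale (ℤ.+ m ℤ.+ k) (x^ m)
    eulerX zero k = ∷-cong (cong (ℤ._* 1ℤ) (sym (ℤP.+-identityˡ k))) ≋-refl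
    eulerX (suc m) k = ∷-cong (trans (ℤP.*-zeroʳ k) (sym (ℤP.*-zeroʳ (ℤ.+ (suc m) ℤ.+ k))))
      (≋-trans (eulerX m (1ℤ ℤ.+ k)) (scale-cong {ℤ.+ m ℤ.+ (1ℤ ℤ.+ k)} (trans (sym (ℤP.+-assoc (ℤ.+ m) 1ℤ k)) (cong (ℤ._+ k) (ℤP.+-comm (ℤ.+ m) 1ℤ))) (≋-refl {x^ m})))
    eulerE : euler 0ℤ (E₋ n) ≋ scale (ℤ.+ n) (x^ n)
    eulerE = ∷-cong {euler0} {ℤ.+ n ℤ.* 0ℤ} (sym (ℤP.*-zeroʳ (ℤ.+ n))) (≋-trans (euler-cong 1ℤ (+-idʳ (x^ m)))
      (≋-trans (eulerX m 1ℤ) (scale-cong {ℤ.+ m ℤ.+ 1ℤ} (cong ℤ.+_ (ℕP.+-comm m 1)) (≋-refl {x^ m}))))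
      where
      euler0 = 0ℤ ℤ.* (0ℤ ℤ.+ ℤ.- 1ℤ)

  T-does⁻ : ∀ {A : Set} (d : Dec A) → T (does d) → A
  T-does⁻ (yes a) _ = a

  T-does⁺ : ∀ {A : Set} (d : Dec A) → A → T (does d)
  T-does⁺ (yes _) _ = _
  T-does⁺ (no ¬a) a = ⊥-elim (¬a a)

  ∈-properDivisors⁻ : ∀ {d n} → d ∈ properDivisors n → 1 ≤ d × d ∣ n × d < n
  ∈-properDivisors⁻ {d} {n} i with ∈-filter⁻ (λ d → T? (does (d ∣? n))) {xs = map suc (upTo (n ∸ 1))} i
  ... | i' , dn with ∈-map⁻ suc i'
  ... | k , k∈ , refl = s≤s z≤n , T-does⁻ (suc k ∣? n) dn , bound n (∈-upTo⁻ k∈)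
    where
    bound : ∀ n → k < n ∸ 1 → suc k < n
    bound (suc n) lt = s≤s lt

  ∈-properDivisors⁺ : ∀ {d n} → 1 ≤ d → d ∣ n → d < n → d ∈ properDivisors n
  ∈-properDivisors⁺ {suc d} {suc n} _ dn (s≤s lt) =
    ∈-filter⁺ (λ d → T? (does (d ∣? suc n))) (∈-map⁺ suc (∈-upTo⁺ lt)) (T-does⁺ (suc d ∣? suc n) dn)

  properDivisors-unique : ∀ n → Unique (properDivisors n)
  properDivisors-unique n = UP.filter⁺ (λ d → T? (does (d ∣? n))) (UP.map⁺ ℕP.suc-injective (UP.upTo⁺ (n ∸ 1)))

  ∏Φ : List ℕ → Poly
  ∏Φ = foldr (λ d acc → Φ d ⊛ acc) 𝟙

  cycloTable≡Φ : ∀ {m n} → m ≤ n → cycloTable n m ≡ Φ m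
  cycloTable≡Φ {zero} {zero} z≤n = refl
  cycloTable≡Φ {m} {suc n} le with m ℕ.≟ suc n
  ... | yes refl = refl
  ... | no m≢ with m ≡ᵇ suc n in eq
  ... | true = ⊥-elim (m≢ (ℕP.≡ᵇ⇒≡ m (suc n) (subst T (sym eq) _)))
  ... | false = cycloTable≡Φ (ℕP.≤-pred (ℕP.≤∧≢⇒< le m≢))

  Φ-suc : ∀ n → Φ (suc n) ≡ divMonic (XnMinus1 (suc n)) (∏Φ (properDivisors (suc n)))
  Φ-suc n with suc n ≡ᵇ suc n in eq
  ... | false = ⊥-elim (subst T eq (ℕP.≡⇒≡ᵇ (suc n) (suc n) refl))
  ... | true = cong (divMonic (XnMinus1 (suc n))) (go (properDivisors (suc n)) λ i → ℕP.≤-pred (proj₂ (proj₂ (∈-properDivisors⁻ {n = suc n} i))))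
    where
    go : ∀ xs → (∀ {d} → d ∈ xs → d ≤ n) → foldr (λ d acc → cycloTable n d *ₚ acc) 𝟙 xs ≡ ∏Φ xs
    go [] h = refl
    go (x ∷ xs) h = cong₂ _*ₚ_ (cycloTable≡Φ (h (here refl))) (go xs (λ i → h (there i)))

  record Cyclotomic (n : ℕ) : Set where
    field
      {deg}  : ℕ
      monic  : Monic (Φ n) deg
      factor : E₋ n ≋ Φ n ⊛ ∏Φ (properDivisors n)
  open Cyclotomic

  Φ∣E₋ : ∀ {n} → Cyclotomic n → Φ n ∣ₚ E₋ n
  Φ∣E₋ {n} c = ∏Φ (properDivisors n) ,ₚ factor c

  ∏Φ-∈ : ∀ {d xs} → d ∈ xs → Φ d ∣ₚ ∏Φ xs
  ∏Φ-∈ {d} {x ∷ xs} (here refl) = ∏Φ xs ,ₚ ≋-refl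
  ∏Φ-∈ {d} {x ∷ xs} (there i) = ∣ₚ-*ˡ (Φ x) (∏Φ-∈ i)

  cop-𝟙 : ∀ P → Coprimeₚ P 𝟙
  cop-𝟙 P = cop {u = []} {v = 𝟙} {c = 1ℤ} (λ ()) (*-idˡ 𝟙)

  cop-∏Φ : ∀ {P} xs → (∀ {d} → d ∈ xs → Coprimeₚ P (Φ d)) → Coprimeₚ P (∏Φ xs)
  cop-∏Φ {P} [] h = cop-𝟙 P
  cop-∏Φ (x ∷ xs) h = cop-⊛ (h (here refl)) (cop-∏Φ xs (λ i → h (there i)))

  cop-proper : ∀ {d g} → 1 ≤ d → Cyclotomic d → (∀ {c} → 1 ≤ c → c < d → Cyclotomic c) →
    1 ≤ g → g ∣ d → g < d → Coprimeₚ (Φ d) (E₋ g)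
  cop-proper {d} {g} 1≤d cd cs 1≤g g∣d g<d = cop-resp (cop-⊛ (c 1≤g g∣d g<d) (cop-∏Φ (properDivisors g) λ i →
      let 1≤e , e∣g , e<g = ∈-properDivisors⁻ {n = g} i in c 1≤e (∣-trans e∣g g∣d) (ℕP.<-trans e<g g<d)))
      (≋-sym (factor (cs 1≤g g<d)))
    where
    c : ∀ {e} → 1 ≤ e → e ∣ d → e < d → Coprimeₚ (Φ d) (Φ e)
    c 1≤e e∣d e<d = cop-factor (squarefree d 1≤d (factor cd)) (∏Φ-∈ (∈-properDivisors⁺ 1≤e e∣d e<d))
    cop-resp : ∀ {P Q R} → Coprimeₚ P Q → Q ≋ R → Coprimeₚ P R
    cop-resp {P} {Q} {R} h e = cop-factor h (𝟙 ,ₚ ≋-trans e (≋-trans (≋-sym (*-idˡ R)) (*-comm 𝟙 R)))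

  gcd>0 : ∀ m n → 1 ≤ m → 1 ≤ gcd m n
  gcd>0 m n 1≤m with gcd m n | gcd[m,n]∣m m n
  ... | zero | divides k e = contradiction (trans e (ℕP.*-zeroʳ k)) (λ e → contradiction (subst (1 ≤_) e 1≤m) λ ())
  ... | suc _ | _ = s≤s z≤n

  cop-Φ-E₋ : ∀ {d n} → 1 ≤ d → Cyclotomic d → (∀ {c} → 1 ≤ c → c < d → Cyclotomic c) → ¬ d ∣ n → Coprimeₚ (Φ d) (E₋ n)
  cop-Φ-E₋ {d} {n} 1≤d cd cs d∤n = cop-E₋-gcd {m = d} n (Φ∣E₋ cd)
    (cop-proper 1≤d cd cs (gcd>0 d n 1≤d) (gcd[m,n]∣m d n)
      (ℕP.≤∧≢⇒< (∣⇒≤ ⦃ ℕ.>-nonZero 1≤d ⦄ (gcd[m,n]∣m d n)) λ e → d∤n (subst (_∣ n) e (gcd[m,n]∣n d n))))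

  cop-ΦΦ : ∀ {d e} → 1 ≤ d → 1 ≤ e → d ≢ e → (∀ {c} → 1 ≤ c → c ≤ d → Cyclotomic c) → (∀ {c} → 1 ≤ c → c ≤ e → Cyclotomic c) →
    Coprimeₚ (Φ d) (Φ e)
  cop-ΦΦ {d} {e} 1≤d 1≤e d≢e cd ce with d ∣? e
  ... | no d∤e = cop-factor (cop-Φ-E₋ 1≤d (cd 1≤d ℕP.≤-refl) (λ a b → cd a (ℕP.<⇒≤ b)) d∤e) (Φ∣E₋ (ce 1≤e ℕP.≤-refl))
  ... | yes d∣e = cop-sym (cop-factor (cop-Φ-E₋ 1≤e (ce 1≤e ℕP.≤-refl) (λ a b → ce a (ℕP.<⇒≤ b))
      (λ e∣d → d≢e (∣-antisym d∣e e∣d))) (Φ∣E₋ (cd 1≤d ℕP.≤-refl)))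

  cyclotomic : ∀ n → 1 ≤ n → Cyclotomic n
  cyclotomic = <-rec (λ n → 1 ≤ n → Cyclotomic n) step
    where
    step : ∀ n → (∀ {m} → m < n → 1 ≤ m → Cyclotomic m) → 1 ≤ n → Cyclotomic n
    step (suc n) ih 1≤n = record
        { monic  = subst (λ P → Monic P (N ∸ proj₁ mD)) (sym (Φ-suc n)) (divMonic-monic (proj₂ mD) (xnMinus1-monic N 1≤n) deg≤ dvd)
        ; factor = ≋-trans (≋-sym (xnMinus1≋ N)) (≋-trans (divMonic-exact (proj₂ mD) dvd)
            (≋-trans (*-comm D (divMonic (XnMinus1 N) D)) (*-congˡ D (≡⇒≋ (sym (Φ-suc n)))))) }
      where
      N = suc n
      cs : ∀ {c} → 1 ≤ c → c < N → Cyclotomic c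
      cs a b = ih b a
      D = ∏Φ (properDivisors N)
      go : ∀ xs → Unique xs → (∀ {d} → d ∈ xs → 1 ≤ d × d ∣ N × d < N) → (Σ ℕ λ k → Monic (∏Φ xs) k) × ∏Φ xs ∣ₚ XnMinus1 N
      go [] _ _ = (0 , record { len = refl ; lead = refl }) , (XnMinus1 N ,ₚ ≋-sym (*-idˡ (XnMinus1 N)))
      go (x ∷ xs) (x∉ ∷ us) h with go xs us (λ i → h (there i)) | h (here refl)
      ... | (k , mk) , dv | 1≤x , x∣N , x<N = (_ , monic-⊛ (monic (cs 1≤x x<N)) mk) ,
          cop-∣ (cop-∏Φ xs λ {d} i → let 1≤d , d∣N , d<N = h (there i) in
              cop-ΦΦ 1≤x 1≤d (λ e → All.lookup x∉ i e) (λ a b → cs a (ℕP.≤-<-trans b x<N)) (λ a b → cs a (ℕP.≤-<-trans b d<N)))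
            (monic (cs 1≤x x<N)) mk
            (∣ₚ-resp (∣ₚ-trans (Φ∣E₋ (cs 1≤x x<N)) (E₋-∣ x∣N)) (≋-sym (xnMinus1≋ N))) dv
      both = go (properDivisors N) (properDivisors-unique N) (∈-properDivisors⁻ {n = N})
      mD = proj₁ both
      dvd = proj₂ both
      deg≤ : proj₁ mD ≤ N
      deg≤ with proj₁ mD ℕ.≤? N
      ... | yes le = le
      ... | no ¬le = contradiction (trans (at (eqdiv dvd) N) (at (≋-trans (*-congʳ D Q≋0) (*-zeroʳ D)) N))
            (λ e → contradiction (trans (sym (lead (xnMinus1-monic N 1≤n))) e) λ ())
        where
        Q≋0 : quotₚ dvd ≋ []
        Q≋0 = monic-top-zero (proj₂ mD) (quotₚ dvd) λ k le → trans (sym (at (eqdiv dvd) k))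
          (monic-above (xnMinus1-monic N 1≤n) k (ℕP.<-≤-trans (ℕP.≰⇒> ¬le) le))

  Φ∣E₋-∣ : ∀ {s n} → 1 ≤ s → s ∣ n → Φ s ∣ₚ E₋ n
  Φ∣E₋-∣ 1≤s s∣n = ∣ₚ-trans (Φ∣E₋ (cyclotomic _ 1≤s)) (E₋-∣ s∣n)

  E₋-monic : ∀ n → 1 ≤ n → Monic (E₋ n) n
  E₋-monic (suc n) _ = record { len = cong suc (trans (lem (x^ n)) (lx n)) ; lead = trans (at (+-idʳ (x^ n)) n) (cx n) }
    where
    lem : ∀ R → length (R ⊞ []) ≡ length R
    lem [] = refl
    lem (_ ∷ R) = refl
    lx : ∀ n → length (x^ n) ≡ suc n
    lx zero = refl
    lx (suc n) = cong suc (lx n)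
    cx : ∀ n → coeff (x^ n) n ≡ 1ℤ
    cx zero = refl
    cx (suc n) = cx n

  Φ⊛E₋-∣ : ∀ {s m n} → 1 ≤ s → 1 ≤ m → s ∣ n → m ∣ n → ¬ s ∣ m → (Φ s ⊛ E₋ m) ∣ₚ E₋ n
  Φ⊛E₋-∣ {s} {m} {n} 1≤s 1≤m s∣n m∣n s∤m = cop-∣ (cop-Φ-E₋ 1≤s (cyclotomic s 1≤s) (λ a _ → cyclotomic _ a) s∤m)
    (monic (cyclotomic s 1≤s)) (E₋-monic m 1≤m) (Φ∣E₋-∣ 1≤s s∣n) (E₋-∣ m∣n)

  E₋-prime : ∀ {q} → Prime q → E₋ q ≋ Φ q ⊛ E₋ 1
  E₋-prime {q} pq = ≋-trans (factor (cyclotomic q 1≤q)) (*-congʳ (Φ q) (≋-trans (∏-cong) (≋-sym (factor (cyclotomic 1 ℕP.≤-refl)))))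
    where
    1<q : 1 < q
    1<q = ℕ.nonTrivial⇒n>1 q ⦃ prime⇒nonTrivial pq ⦄
    1≤q : 1 ≤ q
    1≤q = ℕP.<⇒≤ 1<q
    singleton : ∀ {xs} → Unique xs → 1 ∈ xs → (∀ {d} → d ∈ xs → d ≡ 1) → xs ≡ 1 ∷ []
    singleton {x ∷ []} u i g = cong (_∷ []) (g (here refl))
    singleton {x ∷ y ∷ xs} ((x≢y ∷ _) ∷ _) i g = ⊥-elim (x≢y (trans (g (here refl)) (sym (g (there (here refl))))))
    divisors : properDivisors q ≡ 1 ∷ []
    divisors = singleton (properDivisors-unique q) (∈-properDivisors⁺ ℕP.≤-refl (divides q (sym (ℕP.*-identityʳ q))) 1<q) only
      where
      only : ∀ {d} → d ∈ properDivisors q → d ≡ 1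
      only i with ∈-properDivisors⁻ i
      ... | _ , d∣q , d<q with prime⇒irreducible pq d∣q
      ... | inj₁ d≡1 = d≡1
      ... | inj₂ d≡q = ⊥-elim (ℕP.<⇒≢ d<q d≡q)
    ∏-cong : ∏Φ (properDivisors q) ≋ Φ 1 ⊛ 𝟙
    ∏-cong = subst (λ xs → ∏Φ xs ≋ Φ 1 ⊛ 𝟙) (sym divisors) ≋-refl

module Folding where
  open import Defs hiding (step)
  open Polynomials
  open Division
  open CyclotomicPolynomials using (E₋; E₋-monic)
  open import Data.Bool using (if_then_else_)
  import Data.Nat as ℕ
  import Data.Nat.Properties as ℕP
  import Data.Nat.Divisibility as ℕD
  open import Data.Integer as ℤ using (ℤ; 0ℤ; 1ℤ; ∣_∣)
  import Data.Integer.Properties as ℤP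
  import Data.Integer.Divisibility.Signed as ℤS
  open import Data.Integer.Tactic.RingSolver using (solve-∀)
  open import Data.List using ([]; _∷_; length)

  infix 4 _∣ᵢ_
  _∣ᵢ_ : ℕ → ℤ → Set
  n ∣ᵢ z = (ℤ.+ n) ℤS.∣ z

  abstract
    _∣ᵢ?_ : ∀ n z → Dec (n ∣ᵢ z)
    n ∣ᵢ? z = (ℤ.+ n) ℤS.∣? z

  δ : ℕ → ℤ → ℤ
  δ n c = if does (n ∣ᵢ? c) then 1ℤ else 0ℤ

  δ-yes : ∀ {n c} → n ∣ᵢ c → δ n c ≡ 1ℤ
  δ-yes {n} {c} h with n ∣ᵢ? c
  ... | yes _ = refl
  ... | no ¬h = ⊥-elim (¬h h)

  δ-no : ∀ {n c} → ¬ n ∣ᵢ c → δ n c ≡ 0ℤ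
  δ-no {n} {c} ¬h with n ∣ᵢ? c
  ... | yes h = ⊥-elim (¬h h)
  ... | no _ = refl

  δ-mod : ∀ {n c c'} → n ∣ᵢ c ℤ.- c' → δ n c ≡ δ n c'
  δ-mod {n} {c} {c'} h with n ∣ᵢ? c'
  ... | yes g = δ-yes (subst (n ∣ᵢ_) (lem c c') (ℤS.∣m∣n⇒∣m+n h g))
    where
    lem : ∀ c c' → c ℤ.- c' ℤ.+ c' ≡ c
    lem = solve-∀
  ... | no ¬g = δ-no λ g → ¬g (subst (n ∣ᵢ_) (lem c c') (ℤS.∣m∣n⇒∣m-n g h))
    where
    lem : ∀ c c' → c ℤ.- (c ℤ.- c') ≡ c'
    lem = solve-∀

  -- The sum of the coefficients at the exponents congruent to c modulo n.
  fold : ℕ → ℤ → Poly → ℤ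
  fold n c []      = 0ℤ
  fold n c (a ∷ P) = δ n c ℤ.* a ℤ.+ fold n (c ℤ.- 1ℤ) P

  fold-[] : ∀ n c {P} → P ≋ [] → fold n c P ≡ 0ℤ
  fold-[] n c {[]} e = refl
  fold-[] n c {a ∷ P} e = trans (cong₂ (λ x y → δ n c ℤ.* x ℤ.+ y) (at e 0) (fold-[] n (c ℤ.- 1ℤ) {P} (eqₚ λ k → at e (suc k))))
    (trans (ℤP.+-identityʳ _) (ℤP.*-zeroʳ (δ n c)))

  fold-cong : ∀ n c {P Q} → P ≋ Q → fold n c P ≡ fold n c Q
  fold-cong n c {[]} {Q} e = sym (fold-[] n c (≋-sym e))
  fold-cong n c {a ∷ P} {[]} e = fold-[] n c e
  fold-cong n c {a ∷ P} {b ∷ Q} e = cong₂ (λ x y → δ n c ℤ.* x ℤ.+ y) (at e 0) (fold-cong n (c ℤ.- 1ℤ) (≋-tail e))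

  fold-+ : ∀ n c P Q → fold n c (P ⊞ Q) ≡ fold n c P ℤ.+ fold n c Q
  fold-+ n c [] Q = sym (ℤP.+-identityˡ _)
  fold-+ n c (a ∷ P) [] = sym (ℤP.+-identityʳ _)
  fold-+ n c (a ∷ P) (b ∷ Q) = trans (cong (ℤ._+_ (δ n c ℤ.* (a ℤ.+ b))) (fold-+ n (c ℤ.- 1ℤ) P Q))
    (lem (δ n c) a b (fold n (c ℤ.- 1ℤ) P) (fold n (c ℤ.- 1ℤ) Q))
    where
    lem : ∀ d a b x y → d ℤ.* (a ℤ.+ b) ℤ.+ (x ℤ.+ y) ≡ (d ℤ.* a ℤ.+ x) ℤ.+ (d ℤ.* b ℤ.+ y)
    lem = solve-∀

  fold-scale : ∀ n c a P → fold n c (scale a P) ≡ a ℤ.* fold n c P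
  fold-scale n c a [] = sym (ℤP.*-zeroʳ a)
  fold-scale n c a (b ∷ P) = trans (cong (ℤ._+_ (δ n c ℤ.* (a ℤ.* b))) (fold-scale n (c ℤ.- 1ℤ) a P))
    (lem (δ n c) a b (fold n (c ℤ.- 1ℤ) P))
    where
    lem : ∀ d a b x → d ℤ.* (a ℤ.* b) ℤ.+ a ℤ.* x ≡ a ℤ.* (d ℤ.* b ℤ.+ x)
    lem = solve-∀

  fold-neg : ∀ n c P → fold n c (negₚ P) ≡ ℤ.- fold n c P
  fold-neg n c [] = refl
  fold-neg n c (b ∷ P) = trans (cong (ℤ._+_ (δ n c ℤ.* (ℤ.- b))) (fold-neg n (c ℤ.- 1ℤ) P)) (lem (δ n c) b (fold n (c ℤ.- 1ℤ) P))
    where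
    lem : ∀ d b x → d ℤ.* (ℤ.- b) ℤ.+ ℤ.- x ≡ ℤ.- (d ℤ.* b ℤ.+ x)
    lem = solve-∀

  fold-0∷ : ∀ n c P → fold n c (0ℤ ∷ P) ≡ fold n (c ℤ.- 1ℤ) P
  fold-0∷ n c P = trans (cong (ℤ._+ fold n (c ℤ.- 1ℤ) P) (ℤP.*-zeroʳ (δ n c))) (ℤP.+-identityˡ _)

  fold-shift : ∀ n c k P → fold n c (shift k P) ≡ fold n (c ℤ.- ℤ.+ k) P
  fold-shift n c zero P = cong (λ z → fold n z P) (sym (ℤP.+-identityʳ c))
  fold-shift n c (suc k) P = trans (fold-0∷ n c (shift k P)) (trans (fold-shift n (c ℤ.- 1ℤ) k P)
    (cong (λ z → fold n z P) (lem c (ℤ.+ k))))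
    where
    lem : ∀ c k → c ℤ.- 1ℤ ℤ.- k ≡ c ℤ.- (1ℤ ℤ.+ k)
    lem = solve-∀

  fold-x^ : ∀ n c k P → fold n c (x^ k ⊛ P) ≡ fold n (c ℤ.- ℤ.+ k) P
  fold-x^ n c k P = trans (fold-cong n c (x^-⊛ k P)) (fold-shift n c k P)

  fold-mod : ∀ n {c c'} P → n ∣ᵢ c ℤ.- c' → fold n c P ≡ fold n c' P
  fold-mod n [] h = refl
  fold-mod n {c} {c'} (a ∷ P) h = cong₂ (λ x y → x ℤ.* a ℤ.+ y) (δ-mod h) (fold-mod n P (subst (n ∣ᵢ_) (lem c c') h))
    where
    lem : ∀ c c' → c ℤ.- c' ≡ c ℤ.- 1ℤ ℤ.- (c' ℤ.- 1ℤ)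
    lem = solve-∀

  fold-E₋⊛ : ∀ n c k Q → fold n c (E₋ k ⊛ Q) ≡ fold n (c ℤ.- ℤ.+ k) Q ℤ.- fold n c Q
  fold-E₋⊛ n c k Q = begin
      fold n c ((x^ k ⊟ 𝟙) ⊛ Q)
        ≡⟨ fold-cong n c (*-distribʳ Q (x^ k) (negₚ 𝟙)) ⟩
      fold n c (x^ k ⊛ Q ⊞ negₚ 𝟙 ⊛ Q)
        ≡⟨ fold-+ n c (x^ k ⊛ Q) (negₚ 𝟙 ⊛ Q) ⟩
      fold n c (x^ k ⊛ Q) ℤ.+ fold n c (negₚ 𝟙 ⊛ Q)
        ≡⟨ cong₂ ℤ._+_ (fold-x^ n c k Q) (trans (fold-cong n c (const-⊛ ℤ.-1ℤ Q)) (trans (fold-scale n c ℤ.-1ℤ Q) (ℤP.-1*i≡-i (fold n c Q)))) ⟩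
      fold n (c ℤ.- ℤ.+ k) Q ℤ.- fold n c Q ∎
    where open ≡-Reasoning

  fold-E₋ : ∀ n c Q → fold n c (E₋ n ⊛ Q) ≡ 0ℤ
  fold-E₋ n c Q = trans (fold-E₋⊛ n c n Q) (trans (cong (ℤ._- fold n c Q) (fold-mod n Q (subst (n ∣ᵢ_) (lem c (ℤ.+ n)) (ℤS.∣m⇒∣-m (ℤS.∣-refl {ℤ.+ n})))))
    (ℤP.+-inverseʳ (fold n c Q)))
    where
    lem : ∀ c n → ℤ.- n ≡ c ℤ.- n ℤ.- c
    lem = solve-∀

  pos-∤ : ∀ {n j} → 1 ≤ j → j < n → ¬ n ∣ᵢ (ℤ.+ j)
  pos-∤ {n} {suc j} _ lt h = ℕP.<⇒≱ lt (ℕD.∣⇒≤ (ℤS.∣⇒∣ᵤ h))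

  neg-∤ : ∀ {n j} → 1 ≤ j → j < n → ¬ n ∣ᵢ (ℤ.- (ℤ.+ j))
  neg-∤ {n} {j} 1≤j lt h = pos-∤ 1≤j lt (subst (n ∣ᵢ_) (ℤP.neg-involutive (ℤ.+ j)) (ℤS.∣m⇒∣-m h))

  fold-short⁻ : ∀ {n} j R → 1 ≤ j → j ℕ.+ length R ≤ n → fold n (ℤ.- (ℤ.+ j)) R ≡ 0ℤ
  fold-short⁻ j [] 1≤j le = refl
  fold-short⁻ {n} j (a ∷ R) 1≤j le = trans (cong₂ (λ x y → x ℤ.* a ℤ.+ y)
      (δ-no (neg-∤ 1≤j (ℕP.<-≤-trans (ℕP.m<m+n j (s≤s z≤n)) le)))
      (trans (cong (λ z → fold n z R) (lem (ℤ.+ j))) (fold-short⁻ (suc j) R (s≤s z≤n) (subst (_≤ n) (ℕP.+-suc j (length R)) le))))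
    (trans (ℤP.+-identityʳ _) (ℤP.*-zeroˡ a))
    where
    lem : ∀ j → ℤ.- j ℤ.- 1ℤ ≡ ℤ.- (1ℤ ℤ.+ j)
    lem = solve-∀

  0∣ᵢ : ∀ n → n ∣ᵢ 0ℤ
  0∣ᵢ n = ℤS.divides 0ℤ refl

  fold-short : ∀ {n} k R → length R ≤ n → k < n → fold n (ℤ.+ k) R ≡ coeff R k
  fold-short k [] le lt = refl
  fold-short {n} zero (a ∷ R) le lt = trans (cong₂ (λ x y → x ℤ.* a ℤ.+ y) (δ-yes (0∣ᵢ n)) (fold-short⁻ 1 R (s≤s z≤n) le))
    (trans (ℤP.+-identityʳ _) (ℤP.*-identityˡ a))
  fold-short {n} (suc k) (a ∷ R) le lt = trans (cong₂ (λ x y → x ℤ.* a ℤ.+ y) (δ-no (pos-∤ (s≤s z≤n) lt))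
      (fold-short k R (ℕP.≤-trans (ℕP.n≤1+n _) le) (ℕP.<-trans (ℕP.n<1+n k) lt)))
    (trans (cong (ℤ._+ coeff R k) (ℤP.*-zeroˡ a)) (ℤP.+-identityˡ _))

  fold-zero⇒∣ : ∀ n {P} → 1 ≤ n → (∀ c → fold n c P ≡ 0ℤ) → E₋ n ∣ₚ P
  fold-zero⇒∣ n {P} 1≤n h with divide (E₋-monic n 1≤n) P
  ... | R , Rle , e = divMonic P (E₋ n) ,ₚ ≋-trans e (≋-trans (+-congʳ (E₋ n ⊛ divMonic P (E₋ n)) R≋0) (+-idʳ _))
    where
    fR : ∀ c → fold n c R ≡ 0ℤ
    fR c = trans (sym (ℤP.+-identityˡ _)) (trans (cong (ℤ._+ fold n c R) (sym (fold-E₋ n c (divMonic P (E₋ n)))))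
      (trans (sym (fold-+ n c (E₋ n ⊛ divMonic P (E₋ n)) R)) (trans (sym (fold-cong n c e)) (h c))))
    R≋0 : R ≋ []
    R≋0 = eqₚ go
      where
      go : ∀ k → coeff R k ≡ 0ℤ
      go k with k ℕ.<? n
      ... | yes lt = trans (sym (fold-short k R Rle lt)) (fR (ℤ.+ k))
      ... | no ¬lt = coeff-≥len R k (ℕP.≤-trans Rle (ℕP.≮⇒≥ ¬lt))

  sum< : ℕ → (ℤ → ℤ) → ℤ
  sum< zero    f = 0ℤ
  sum< (suc n) f = f (ℤ.+ n) ℤ.+ sum< n f

  total : Poly → ℤ
  total []      = 0ℤ
  total (a ∷ P) = a ℤ.+ total P

  sum<-cong : ∀ n {f g : ℤ → ℤ} → (∀ c → f c ≡ g c) → sum< n f ≡ sum< n g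
  sum<-cong zero h = refl
  sum<-cong (suc n) h = cong₂ ℤ._+_ (h (ℤ.+ n)) (sum<-cong n h)

  sum<-+ : ∀ n f g → sum< n (λ c → f c ℤ.+ g c) ≡ sum< n f ℤ.+ sum< n g
  sum<-+ zero f g = refl
  sum<-+ (suc n) f g = trans (cong (ℤ._+_ (f (ℤ.+ n) ℤ.+ g (ℤ.+ n))) (sum<-+ n f g)) (lem (f (ℤ.+ n)) (g (ℤ.+ n)) (sum< n f) (sum< n g))
    where
    lem : ∀ a b x y → (a ℤ.+ b) ℤ.+ (x ℤ.+ y) ≡ (a ℤ.+ x) ℤ.+ (b ℤ.+ y)
    lem = solve-∀

  sum<-*ʳ : ∀ n f a → sum< n (λ c → f c ℤ.* a) ≡ sum< n f ℤ.* a
  sum<-*ʳ zero f a = refl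
  sum<-*ʳ (suc n) f a = trans (cong (ℤ._+_ (f (ℤ.+ n) ℤ.* a)) (sum<-*ʳ n f a)) (sym (ℤP.*-distribʳ-+ a (f (ℤ.+ n)) (sum< n f)))

  sum<-pred : ∀ n f → sum< (suc n) (λ c → f (c ℤ.- 1ℤ)) ≡ sum< n f ℤ.+ f ℤ.-1ℤ
  sum<-pred zero f = ℤP.+-comm (f ℤ.-1ℤ) 0ℤ
  sum<-pred (suc n) f = trans (cong (ℤ._+_ (f (ℤ.+ suc n ℤ.- 1ℤ))) (sum<-pred n f)) (trans (cong (λ z → f z ℤ.+ (sum< n f ℤ.+ f ℤ.-1ℤ)) refl) (sym (ℤP.+-assoc (f (ℤ.+ n)) (sum< n f) (f ℤ.-1ℤ))))

  sum<-rotate : ∀ n f → (∀ c → f (c ℤ.- ℤ.+ n) ≡ f c) → sum< n (λ c → f (c ℤ.- 1ℤ)) ≡ sum< n f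
  sum<-rotate zero f h = refl
  sum<-rotate (suc n) f h = trans (sum<-pred n f) (trans (ℤP.+-comm (sum< n f) (f ℤ.-1ℤ)) (cong (ℤ._+ sum< n f)
    (trans (cong f (lem (ℤ.+ n))) (h (ℤ.+ n)))))
    where
    lem : ∀ n → ℤ.-1ℤ ≡ n ℤ.- (1ℤ ℤ.+ n)
    lem = solve-∀

  sum<-δ : ∀ n → 1 ≤ n → sum< n (δ n) ≡ 1ℤ
  sum<-δ n 1≤n = go n 1≤n ℕP.≤-refl
    where
    go : ∀ k → 1 ≤ k → k ≤ n → sum< k (δ n) ≡ 1ℤ
    go (suc zero) _ le = trans (ℤP.+-identityʳ _) (δ-yes (0∣ᵢ n))
    go (suc (suc k)) _ le = trans (cong₂ ℤ._+_ (δ-no (pos-∤ (s≤s z≤n) le)) (go (suc k) (s≤s z≤n) (ℕP.≤-trans (ℕP.n≤1+n _) le))) refl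

  fold-period : ∀ n c P → fold n (c ℤ.- ℤ.+ n) P ≡ fold n c P
  fold-period n c P = fold-mod n P (subst (n ∣ᵢ_) (lem c (ℤ.+ n)) (ℤS.∣m⇒∣-m (ℤS.∣-refl {ℤ.+ n})))
    where
    lem : ∀ c n → ℤ.- n ≡ c ℤ.- n ℤ.- c
    lem = solve-∀

  sum<-fold : ∀ n P → 1 ≤ n → sum< n (λ c → fold n c P) ≡ total P
  sum<-fold n [] 1≤n = sum0 n
    where
    sum0 : ∀ n → sum< n (λ _ → 0ℤ) ≡ 0ℤ
    sum0 zero = refl
    sum0 (suc n) = trans (ℤP.+-identityˡ _) (sum0 n)
  sum<-fold n (a ∷ P) 1≤n = begin
      sum< n (λ c → δ n c ℤ.* a ℤ.+ fold n (c ℤ.- 1ℤ) P)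
        ≡⟨ sum<-+ n (λ c → δ n c ℤ.* a) (λ c → fold n (c ℤ.- 1ℤ) P) ⟩
      sum< n (λ c → δ n c ℤ.* a) ℤ.+ sum< n (λ c → fold n (c ℤ.- 1ℤ) P)
        ≡⟨ cong₂ ℤ._+_ (trans (sum<-*ʳ n (δ n) a) (trans (cong (ℤ._* a) (sum<-δ n 1≤n)) (ℤP.*-identityˡ a)))
             (trans (sum<-rotate n (λ c → fold n c P) (λ c → fold-period n c P)) (sum<-fold n P 1≤n)) ⟩
      a ℤ.+ total P ∎
    where open ≡-Reasoning

  sum<-split : ∀ m k f → sum< (m ℕ.+ k) f ≡ sum< m (λ c → f (ℤ.+ k ℤ.+ c)) ℤ.+ sum< k f
  sum<-split zero k f = sym (ℤP.+-identityˡ _)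
  sum<-split (suc m) k f = trans (cong₂ (λ x y → f x ℤ.+ y) (cong ℤ.+_ (ℕP.+-comm m k)) (sum<-split m k f))
    (sym (ℤP.+-assoc (f (ℤ.+ k ℤ.+ ℤ.+ m)) _ _))

  sum<-periodic : ∀ p k f → (∀ c → f (ℤ.+ k ℤ.+ c) ≡ f c) → sum< (p ℕ.* k) f ≡ ℤ.+ p ℤ.* sum< k f
  sum<-periodic zero k f h = sym (ℤP.*-zeroˡ (sum< k f))
  sum<-periodic (suc p) k f h = begin
      sum< (k ℕ.+ p ℕ.* k) f            ≡⟨ cong (λ z → sum< z f) (ℕP.+-comm k (p ℕ.* k)) ⟩
      sum< (p ℕ.* k ℕ.+ k) f            ≡⟨ sum<-split (p ℕ.* k) k f ⟩
      sum< (p ℕ.* k) (λ c → f (ℤ.+ k ℤ.+ c)) ℤ.+ sum< k f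
        ≡⟨ cong (ℤ._+ sum< k f) (trans (sum<-cong (p ℕ.* k) h) (sum<-periodic p k f h)) ⟩
      ℤ.+ p ℤ.* sum< k f ℤ.+ sum< k f   ≡⟨ lem (ℤ.+ p) (sum< k f) ⟩
      (1ℤ ℤ.+ ℤ.+ p) ℤ.* sum< k f       ∎
    where
    open ≡-Reasoning
    lem : ∀ p s → p ℤ.* s ℤ.+ s ≡ (1ℤ ℤ.+ p) ℤ.* s
    lem = solve-∀

  periodic⇒∣total : ∀ p k P → 1 ≤ p ℕ.* k → (∀ c → fold (p ℕ.* k) (ℤ.+ k ℤ.+ c) P ≡ fold (p ℕ.* k) c P) → p ∣ᵢ total P
  periodic⇒∣total p k P 1≤ h = ℤS.divides (sum< k (λ c → fold (p ℕ.* k) c P)) (trans (sym (sum<-fold (p ℕ.* k) P 1≤))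
    (trans (sum<-periodic p k (λ c → fold (p ℕ.* k) c P) h) (ℤP.*-comm (ℤ.+ p) _)))

  total-+ : ∀ P Q → total (P ⊞ Q) ≡ total P ℤ.+ total Q
  total-+ [] Q = sym (ℤP.+-identityˡ _)
  total-+ (a ∷ P) [] = sym (ℤP.+-identityʳ _)
  total-+ (a ∷ P) (b ∷ Q) = trans (cong (ℤ._+_ (a ℤ.+ b)) (total-+ P Q)) (lem a b (total P) (total Q))
    where
    lem : ∀ a b x y → (a ℤ.+ b) ℤ.+ (x ℤ.+ y) ≡ (a ℤ.+ x) ℤ.+ (b ℤ.+ y)
    lem = solve-∀

  fold-const : ∀ n {P k} → (∀ c → fold n c P ≡ k) → ∀ Q c → fold n c (Q ⊛ P) ≡ total Q ℤ.* k
  fold-const n {P} {k} h [] c = sym (ℤP.*-zeroˡ k)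
  fold-const n {P} {k} h (a ∷ Q) c = begin
      fold n c (scale a P ⊞ (0ℤ ∷ Q ⊛ P))
        ≡⟨ fold-+ n c (scale a P) (0ℤ ∷ Q ⊛ P) ⟩
      fold n c (scale a P) ℤ.+ fold n c (0ℤ ∷ Q ⊛ P)
        ≡⟨ cong₂ ℤ._+_ (trans (fold-scale n c a P) (cong (a ℤ.*_) (h c))) (trans (fold-0∷ n c (Q ⊛ P)) (fold-const n h Q (c ℤ.- 1ℤ))) ⟩
      a ℤ.* k ℤ.+ total Q ℤ.* k   ≡⟨ ℤP.*-distribʳ-+ k a (total Q) ⟨
      (a ℤ.+ total Q) ℤ.* k       ∎
    where open ≡-Reasoning

  total-⊛ : ∀ P Q → total (P ⊛ Q) ≡ total P ℤ.* total Q
  total-⊛ [] Q = sym (ℤP.*-zeroˡ (total Q))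
  total-⊛ (a ∷ P) Q = trans (total-+ (scale a Q) (0ℤ ∷ P ⊛ Q)) (trans (cong₂ ℤ._+_ (lem a Q) (trans (ℤP.+-identityˡ _) (total-⊛ P Q)))
    (sym (ℤP.*-distribʳ-+ (total Q) a (total P))))
    where
    lem : ∀ a Q → total (scale a Q) ≡ a ℤ.* total Q
    lem a [] = sym (ℤP.*-zeroʳ a)
    lem a (b ∷ Q) = trans (cong (ℤ._+_ (a ℤ.* b)) (lem a Q)) (sym (ℤP.*-distribˡ-+ a b (total Q)))

module Tijdeman where
  open import Defs using (Poly)
  open Polynomials
  open Division
  open CyclotomicPolynomials using (∣ₚ-+)
  open Folding
  import Data.Nat as ℕ
  import Data.Nat.Properties as ℕP
  import Data.Nat.Divisibility as ℕD
  open import Data.Nat.Primality using (euclidsLemma; prime)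
  open import Data.Nat.Primality.Factorisation using (factorise; PrimeFactorisation)
  open import Data.Nat.Combinatorics using (_C_; nCn≡1; nC1≡n; nCk+nC[k+1]≡[n+1]C[k+1]; k>n⇒nCk≡0)
  open import Data.Nat.ListAction using (product)
  open import Data.Integer as ℤ using (ℤ; 0ℤ; 1ℤ; ∣_∣)
  import Data.Integer.Properties as ℤP
  import Data.Integer.Divisibility.Signed as ℤS
  open import Data.Integer.Tactic.RingSolver using (solve-∀)
  import Data.Nat.Tactic.RingSolver as ℕS
  open import Data.List using (List; []; _∷_; length; map)
  import Data.List.Properties as LP
  open import Data.List.Membership.Propositional using (_∈_)
  open import Data.List.Relation.Unary.Any using (here; there)
  open import Data.List.Relation.Unary.All using (All; []; _∷_)
  open import Data.Fin using (zero; suc; toℕ; fromℕ; inject₁)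
  import Data.Fin.Properties as FP
  open import Relation.Nullary using (contradiction)
  open import Algebra.Bundles using (CommutativeRing)

  open CommutativeRing polyRing using (semiring; commutativeSemiring)
  open import Algebra.Properties.Semiring.Exp semiring using (_^_; ^-congˡ)
  open import Algebra.Properties.Semiring.Mult semiring using (×-congʳ) renaming (_×_ to _×ₚ_)
  open import Algebra.Properties.CommutativeSemiring.Binomial commutativeSemiring using (theorem; binomialTerm)
  open import Algebra.Properties.Semiring.Sum semiring using (sum)

  [1+k]*[1+n]C[1+k] : ∀ n k → suc k ℕ.* (suc n C suc k) ≡ suc n ℕ.* (n C k)
  [1+k]*[1+n]C[1+k] zero zero = refl
  [1+k]*[1+n]C[1+k] zero (suc k) = trans (cong (suc (suc k) ℕ.*_) (k>n⇒nCk≡0 {1} {suc (suc k)} (s≤s (s≤s z≤n)))) (ℕP.*-zeroʳ (suc (suc k)))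
  [1+k]*[1+n]C[1+k] (suc n) zero = trans (cong (1 ℕ.*_) (nC1≡n (suc (suc n)))) (ℕP.*-comm 1 (suc (suc n)))
  [1+k]*[1+n]C[1+k] (suc n) (suc k) = begin
      suc (suc k) ℕ.* (suc (suc n) C suc (suc k))
        ≡⟨ cong (suc (suc k) ℕ.*_) (nCk+nC[k+1]≡[n+1]C[k+1] (suc n) (suc k)) ⟨
      suc (suc k) ℕ.* ((suc n C suc k) ℕ.+ (suc n C suc (suc k)))
        ≡⟨ l₁ k (suc n C suc k) (suc n C suc (suc k)) ⟩
      (suc n C suc k) ℕ.+ (suc k ℕ.* (suc n C suc k) ℕ.+ suc (suc k) ℕ.* (suc n C suc (suc k)))
        ≡⟨ cong (λ z → (suc n C suc k) ℕ.+ z) (cong₂ ℕ._+_ ([1+k]*[1+n]C[1+k] n k) ([1+k]*[1+n]C[1+k] n (suc k))) ⟩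
      (suc n C suc k) ℕ.+ (suc n ℕ.* (n C k) ℕ.+ suc n ℕ.* (n C suc k))
        ≡⟨ cong ((suc n C suc k) ℕ.+_) (trans (sym (ℕP.*-distribˡ-+ (suc n) (n C k) (n C suc k))) (cong (suc n ℕ.*_) (nCk+nC[k+1]≡[n+1]C[k+1] n k))) ⟩
      suc (suc n) ℕ.* (suc n C suc k) ∎
    where
    open ≡-Reasoning
    l₁ : ∀ k a b → suc (suc k) ℕ.* (a ℕ.+ b) ≡ a ℕ.+ (suc k ℕ.* a ℕ.+ suc (suc k) ℕ.* b)
    l₁ = ℕS.solve-∀

  prime∣C : ∀ {q} → Prime q → ∀ k → suc k < q → q ℕD.∣ (q C suc k)
  prime∣C {suc n} pq k lt with euclidsLemma (suc k) (suc n C suc k) pq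
      (subst (suc n ℕD.∣_) (sym ([1+k]*[1+n]C[1+k] n k)) (ℕD.m∣m*n (n C k)))
  ... | inj₁ h = contradiction (ℕD.∣⇒≤ h) (ℕP.<⇒≱ lt)
  ... | inj₂ h = h

  ×ₚ≋ : ∀ n P → n ×ₚ P ≋ const (ℤ.+ n) ⊛ P
  ×ₚ≋ zero P = ≋-sym (≋-trans (const-⊛ 0ℤ P) (scale-0 P))
  ×ₚ≋ (suc n) P = ≋-trans (+-congʳ P (×ₚ≋ n P)) (≋-trans (+-cong (≋-sym (scale-1 P)) (const-⊛ (ℤ.+ n) P))
    (≋-trans (≋-sym (scale-+ˡ 1ℤ (ℤ.+ n) P)) (≋-sym (const-⊛ (ℤ.+ suc n) P))))

  const-∣-× : ∀ {q n} P → q ℕD.∣ n → const (ℤ.+ q) ∣ₚ n ×ₚ P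
  const-∣-× {q} {n} P (ℕD.divides k refl) = const (ℤ.+ k) ⊛ P ,ₚ ≋-trans (×ₚ≋ n P)
    (≋-trans (*-congˡ P (≋-trans (≡⇒≋ (cong const (trans (ℤP.pos-* k q) (ℤP.*-comm (ℤ.+ k) (ℤ.+ q))))) (≋-sym (const-⊛ (ℤ.+ q) (const (ℤ.+ k))))))
    (*-assoc (const (ℤ.+ q)) (const (ℤ.+ k)) P))

  -- P ≡ Q modulo q.
  infix 4 _≡ₚ_mod_
  _≡ₚ_mod_ : Poly → Poly → ℕ → Set
  P ≡ₚ Q mod q = Σ Poly λ V → P ≋ Q ⊞ const (ℤ.+ q) ⊛ V

  frobenius : ∀ {q} → Prime q → ∀ P Q → (P ⊞ Q) ^ q ≡ₚ P ^ q ⊞ Q ^ q mod q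
  frobenius {q} pq P Q with q | pq
  ... | zero | prime {{()}} _
  ... | suc n | pq' = quotₚ mid , (begin
      (P ⊞ Q) ^ suc n                      ≈⟨ theorem (suc n) P Q ⟩
      1 ×ₚ (𝟙 ⊛ Q ^ suc n) ⊞ sum (λ i → t (suc i))
        ≈⟨ +-cong (≋-trans (+-idʳ (𝟙 ⊛ Q ^ suc n)) (*-idˡ (Q ^ suc n))) (sum-last (λ i → t (suc i))) ⟩
      Q ^ suc n ⊞ (sum (λ i → t (suc (inject₁ i))) ⊞ t (suc (fromℕ n)))
        ≈⟨ +-congʳ (Q ^ suc n) (+-cong (eqdiv mid) last) ⟩
      Q ^ suc n ⊞ (const (ℤ.+ suc n) ⊛ quotₚ mid ⊞ P ^ suc n)
        ≈⟨ l₁ (Q ^ suc n) (const (ℤ.+ suc n) ⊛ quotₚ mid) (P ^ suc n) ⟩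
      (P ^ suc n ⊞ Q ^ suc n) ⊞ const (ℤ.+ suc n) ⊛ quotₚ mid ∎)
    where
    open ≋-R
    open import Tactic.RingSolver as PS using ()
    l₁ : ∀ A B C → A ⊞ (B ⊞ C) ≋ (C ⊞ A) ⊞ B
    l₁ = PS.solve-∀ polyACR
    t = binomialTerm P Q (suc n)
    sum-last : ∀ {m} (f : Fin (suc m) → Poly) → sum f ≋ sum (λ i → f (inject₁ i)) ⊞ f (fromℕ m)
    sum-last {zero} f = +-idʳ (f zero)
    sum-last {suc m} f = ≋-trans (+-congʳ (f zero) (sum-last (λ i → f (suc i))))
      (≋-sym (+-assoc (f zero) (sum (λ i → f (suc (inject₁ i)))) (f (suc (fromℕ m)))))
    sum-∣ : ∀ {m} {f : Fin m → Poly} → (∀ i → const (ℤ.+ suc n) ∣ₚ f i) → const (ℤ.+ suc n) ∣ₚ sum f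
    sum-∣ {zero} h = [] ,ₚ ≋-sym (*-zeroʳ (const (ℤ.+ suc n)))
    sum-∣ {suc m} h = ∣ₚ-+ (h zero) (sum-∣ (λ i → h (suc i)))
    mid : const (ℤ.+ suc n) ∣ₚ sum (λ i → t (suc (inject₁ i)))
    mid = sum-∣ λ i → const-∣-× {suc n} {suc n C toℕ (suc (inject₁ i))} _ (prime∣C pq' (toℕ (inject₁ i))
      (s≤s (subst (_< n) (sym (FP.toℕ-inject₁ i)) (FP.toℕ<n i))))
    last : t (suc (fromℕ n)) ≋ P ^ suc n
    last rewrite FP.toℕ-fromℕ n | nCn≡1 (suc n) | ℕP.n∸n≡0 n =
      ≋-trans (+-idʳ (P ^ suc n ⊛ 𝟙)) (≋-trans (*-comm (P ^ suc n) 𝟙) (*-idˡ (P ^ suc n)))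

  polyOf : List ℕ → Poly
  polyOf []       = []
  polyOf (e ∷ es) = x^ e ⊞ polyOf es

  x^-^ : ∀ e q → x^ e ^ q ≋ x^ (q ℕ.* e)
  x^-^ e zero = ≋-refl
  x^-^ e (suc q) = ≋-trans (*-congʳ (x^ e) (x^-^ e q)) (≋-sym (x^-+ e (q ℕ.* e)))

  frobenius-list : ∀ {q} → Prime q → ∀ es → polyOf es ^ q ≡ₚ polyOf (map (q ℕ.*_) es) mod q
  frobenius-list {q} pq [] = [] , zero^ q pq
    where
    zero^ : ∀ q → Prime q → [] ^ q ≋ [] ⊞ const (ℤ.+ q) ⊛ []
    zero^ zero (prime {{()}} _)
    zero^ (suc n) _ = ≋-sym (*-zeroʳ (const (ℤ.+ suc n)))
  frobenius-list {q} pq (e ∷ es) with frobenius pq (x^ e) (polyOf es) | frobenius-list pq es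
  ... | V , f | W , g = V ⊞ W , (begin
      (x^ e ⊞ polyOf es) ^ q                                ≈⟨ f ⟩
      (x^ e ^ q ⊞ polyOf es ^ q) ⊞ c ⊛ V                    ≈⟨ +-congˡ (c ⊛ V) (+-cong (x^-^ e q) g) ⟩
      (x^ (q ℕ.* e) ⊞ (polyOf (map (q ℕ.*_) es) ⊞ c ⊛ W)) ⊞ c ⊛ V
        ≈⟨ l₁ (x^ (q ℕ.* e)) (polyOf (map (q ℕ.*_) es)) c V W ⟩
      (x^ (q ℕ.* e) ⊞ polyOf (map (q ℕ.*_) es)) ⊞ c ⊛ (V ⊞ W) ∎)
    where
    open ≋-R
    open import Tactic.RingSolver as PS using ()
    c = const (ℤ.+ q)
    l₁ : ∀ A B c V W → (A ⊞ (B ⊞ c ⊛ W)) ⊞ c ⊛ V ≋ (A ⊞ B) ⊞ c ⊛ (V ⊞ W)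
    l₁ = PS.solve-∀ polyACR

  ind : ∀ {A : Set} → Dec A → ℕ
  ind (yes _) = 1
  ind (no _)  = 0

  -- The number of list entries congruent to c modulo n.
  count : ℕ → ℤ → List ℕ → ℕ
  count n c []       = 0
  count n c (e ∷ es) = ind (n ∣ᵢ? (c ℤ.- ℤ.+ e)) ℕ.+ count n c es

  -- The number of pairs (a, b) with a + b ≡ c modulo n.
  count₂ : ℕ → ℤ → List ℕ → List ℕ → ℕ
  count₂ n c []       bs = 0
  count₂ n c (a ∷ as) bs = count n (c ℤ.- ℤ.+ a) bs ℕ.+ count₂ n c as bs

  δ-ind : ∀ n c → δ n c ≡ ℤ.+ ind (n ∣ᵢ? c)
  δ-ind n c with n ∣ᵢ? c
  ... | yes h = refl
  ... | no ¬h = refl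

  fold-x^1 : ∀ n c e → fold n c (x^ e) ≡ δ n (c ℤ.- ℤ.+ e)
  fold-x^1 n c e = trans (fold-shift n c e 𝟙) (trans (ℤP.+-identityʳ _) (ℤP.*-identityʳ _))

  fold-polyOf : ∀ n c es → fold n c (polyOf es) ≡ ℤ.+ count n c es
  fold-polyOf n c [] = refl
  fold-polyOf n c (e ∷ es) = trans (fold-+ n c (x^ e) (polyOf es))
    (cong₂ ℤ._+_ (trans (fold-x^1 n c e) (δ-ind n (c ℤ.- ℤ.+ e))) (fold-polyOf n c es))

  fold-polyOf₂ : ∀ n c as bs → fold n c (polyOf as ⊛ polyOf bs) ≡ ℤ.+ count₂ n c as bs
  fold-polyOf₂ n c [] bs = refl
  fold-polyOf₂ n c (a ∷ as) bs = trans (fold-cong n c (*-distribʳ (polyOf bs) (x^ a) (polyOf as)))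
    (trans (fold-+ n c (x^ a ⊛ polyOf bs) (polyOf as ⊛ polyOf bs))
    (cong₂ ℤ._+_ (trans (fold-x^ n c a (polyOf bs)) (fold-polyOf n (c ℤ.- ℤ.+ a) bs)) (fold-polyOf₂ n c as bs)))

  total-polyOf : ∀ es → total (polyOf es) ≡ ℤ.+ length es
  total-polyOf [] = refl
  total-polyOf (e ∷ es) = trans (total-+ (x^ e) (polyOf es)) (cong₂ ℤ._+_ (tx e) (total-polyOf es))
    where
    tx : ∀ e → total (x^ e) ≡ 1ℤ
    tx zero = refl
    tx (suc e) = trans (ℤP.+-identityˡ _) (tx e)

  TileL : ℕ → List ℕ → List ℕ → Set
  TileL M as bs = ∀ c → count₂ M c as bs ≡ 1

  total-^ : ∀ P n → total (P ^ n) ≡ total P ℤ.^ n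
  total-^ P zero = refl
  total-^ P (suc n) = trans (total-⊛ P (P ^ n)) (cong (total P ℤ.*_) (total-^ P n))

  all-one : ∀ n (f : ℤ → ℕ) → (∀ c → 1 ≤ f c) → sum< n (λ c → ℤ.+ f c) ≡ ℤ.+ n → ∀ c → c < n → f (ℤ.+ c) ≡ 1
  all-one n f h e = λ c lt → ℕP.≤-antisym (go n c lt (ℤP.drop‿+≤+ (subst (ℤ._≤ ℤ.+ n) (sumℤ n) (ℤP.≤-reflexive e)))) (h (ℤ.+ c))
    where
    sumℕ : ℕ → ℕ
    sumℕ zero = 0
    sumℕ (suc n) = f (ℤ.+ n) ℕ.+ sumℕ n
    sumℤ : ∀ n → sum< n (λ c → ℤ.+ f c) ≡ ℤ.+ sumℕ n
    sumℤ zero = refl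
    sumℤ (suc n) = cong (ℤ._+_ (ℤ.+ f (ℤ.+ n))) (sumℤ n)
    low : ∀ n → n ≤ sumℕ n
    low zero = z≤n
    low (suc n) = ℕP.+-mono-≤ (h (ℤ.+ n)) (low n)
    go : ∀ n c → c < n → sumℕ n ≤ n → f (ℤ.+ c) ≤ 1
    go (suc n) c lt le with c ℕ.≟ n
    ... | yes refl = ℕP.+-cancelʳ-≤ n (f (ℤ.+ c)) 1 (ℕP.≤-trans (ℕP.+-monoʳ-≤ (f (ℤ.+ c)) (low n)) le)
    ... | no c≢n = go n c (ℕP.≤∧≢⇒< (ℕP.≤-pred lt) c≢n) (ℕP.≤-pred (ℕP.≤-trans (ℕP.+-monoˡ-≤ (sumℕ n) (h (ℤ.+ n))) le))

  reduce : ∀ n → 1 ≤ n → ∀ c → Σ ℕ λ k → k < n × n ∣ᵢ (ℤ.+ k ℤ.- c)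
  reduce n 1≤n c = c %ℕ n , n%ℕd<d c n , ℤS.divides (ℤ.- (c /ℕ n)) (trans (cong (ℤ._-_ (ℤ.+ (c %ℕ n))) (a≡a%ℕn+[a/ℕn]*n c n)) (lem (ℤ.+ (c %ℕ n)) (c /ℕ n) (ℤ.+ n)))
    where
    open import Data.Integer.DivMod
    instance _ = ℕ.>-nonZero 1≤n
    lem : ∀ r q n → r ℤ.- (r ℤ.+ q ℤ.* n) ≡ ℤ.- q ℤ.* n
    lem = solve-∀

  length-TileL : ∀ {M as bs} → 1 ≤ M → TileL M as bs → length as ℕ.* length bs ≡ M
  length-TileL {M} {as} {bs} 1≤M t = ℤP.+-injective (begin
      ℤ.+ (length as ℕ.* length bs)              ≡⟨ ℤP.pos-* (length as) (length bs) ⟩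
      ℤ.+ length as ℤ.* ℤ.+ length bs            ≡⟨ cong₂ ℤ._*_ (total-polyOf as) (total-polyOf bs) ⟨
      total (polyOf as) ℤ.* total (polyOf bs)    ≡⟨ total-⊛ (polyOf as) (polyOf bs) ⟨
      total (polyOf as ⊛ polyOf bs)              ≡⟨ sum<-fold M (polyOf as ⊛ polyOf bs) 1≤M ⟨
      sum< M (λ c → fold M c (polyOf as ⊛ polyOf bs)) ≡⟨ sum<-cong M (λ c → trans (fold-polyOf₂ M c as bs) (cong ℤ.+_ (t c))) ⟩
      sum< M (λ _ → 1ℤ)                          ≡⟨ ones M ⟩
      ℤ.+ M ∎)
    where
    open ≡-Reasoning
    ones : ∀ n → sum< n (λ _ → 1ℤ) ≡ ℤ.+ n
    ones zero = refl
    ones (suc n) = cong (ℤ._+_ 1ℤ) (ones n)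

  count₂-mod : ∀ n {c c'} as bs → n ∣ᵢ c ℤ.- c' → count₂ n c as bs ≡ count₂ n c' as bs
  count₂-mod n {c} {c'} as bs h = ℤP.+-injective (trans (sym (fold-polyOf₂ n c as bs)) (trans (fold-mod n (polyOf as ⊛ polyOf bs) h) (fold-polyOf₂ n c' as bs)))

  prime∣^ : ∀ {q} → Prime q → ∀ m n → q ℕD.∣ m ℕ.^ n → q ℕD.∣ m
  prime∣^ pq m zero h = ⊥-elim (lem (ℕD.∣1⇒≡1 h) pq)
    where
    lem : ∀ {q} → q ≡ 1 → Prime q → ⊥
    lem refl (prime {{()}} _)
  prime∣^ pq m (suc n) h with euclidsLemma m (m ℕ.^ n) pq h
  ... | inj₁ g = g
  ... | inj₂ g = prime∣^ pq m n g

  -- Modulo a prime q not dividing M, A(X^q) B(X) ≡ A(X)^(q-1) · A(X) B(X), whose coefficients are all |A|^(q-1) ≢ 0.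
  -- So qA + B covers every residue, hence exactly once.
  tijdeman-prime : ∀ {M as bs q} → 1 ≤ M → TileL M as bs → Prime q → ¬ q ℕD.∣ M → TileL M (map (q ℕ.*_) as) bs
  tijdeman-prime {M} {as} {bs} {q} 1≤M t pq q∤M c with reduce M 1≤M c
  ... | k , k<M , h = trans (count₂-mod M qas bs (subst (M ∣ᵢ_) (l₀ (ℤ.+ k) c) (ℤS.∣m⇒∣-m h))) (all-one M f pos sumM k k<M)
    where
    l₀ : ∀ k c → ℤ.- (k ℤ.- c) ≡ c ℤ.- k
    l₀ = solve-∀
    qas = map (q ℕ.*_) as
    f : ℤ → ℕ
    f c = count₂ M c qas bs
    A = polyOf as
    B = polyOf bs
    q∤len : ¬ q ℕD.∣ length as
    q∤len h = q∤M (subst (q ℕD.∣_) (length-TileL {as = as} {bs} 1≤M t) (ℕD.∣m⇒∣m*n (length bs) h))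
    V = proj₁ (frobenius-list pq as)
    val : ∀ c → ℤ.+ f c ℤ.+ ℤ.+ q ℤ.* fold M c (V ⊛ B) ≡ ℤ.+ (length as ℕ.^ ℕ.pred q)
    val c = begin
      ℤ.+ f c ℤ.+ ℤ.+ q ℤ.* fold M c (V ⊛ B)
        ≡⟨ cong₂ ℤ._+_ (fold-polyOf₂ M c qas bs) (trans (fold-cong M c (const-⊛ (ℤ.+ q) (V ⊛ B))) (fold-scale M c (ℤ.+ q) (V ⊛ B))) ⟨
      fold M c (polyOf qas ⊛ B) ℤ.+ fold M c (const (ℤ.+ q) ⊛ (V ⊛ B))
        ≡⟨ fold-+ M c (polyOf qas ⊛ B) (const (ℤ.+ q) ⊛ (V ⊛ B)) ⟨
      fold M c (polyOf qas ⊛ B ⊞ const (ℤ.+ q) ⊛ (V ⊛ B))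
        ≡⟨ fold-cong M c (l₁ (polyOf qas) (const (ℤ.+ q)) V B) ⟨
      fold M c ((polyOf qas ⊞ const (ℤ.+ q) ⊛ V) ⊛ B)
        ≡⟨ fold-cong M c (*-congˡ B (proj₂ (frobenius-list pq as))) ⟨
      fold M c (A ^ q ⊛ B)
        ≡⟨ fold-cong M c (*-congˡ B (pow q pq)) ⟩
      fold M c ((A ^ ℕ.pred q ⊛ A) ⊛ B)
        ≡⟨ fold-cong M c (*-assoc (A ^ ℕ.pred q) A B) ⟩
      fold M c (A ^ ℕ.pred q ⊛ (A ⊛ B))
        ≡⟨ fold-const M (λ c → trans (fold-polyOf₂ M c as bs) (cong ℤ.+_ (t c))) (A ^ ℕ.pred q) c ⟩
      total (A ^ ℕ.pred q) ℤ.* 1ℤ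
        ≡⟨ ℤP.*-identityʳ _ ⟩
      total (A ^ ℕ.pred q)
        ≡⟨ trans (total-^ A (ℕ.pred q)) (cong (ℤ._^ ℕ.pred q) (total-polyOf as)) ⟩
      (ℤ.+ length as) ℤ.^ ℕ.pred q
        ≡⟨ pos-^ (length as) (ℕ.pred q) ⟨
      ℤ.+ (length as ℕ.^ ℕ.pred q) ∎
      where
      open ≡-Reasoning
      open import Tactic.RingSolver as PS using ()
      l₁ : ∀ A c V B → (A ⊞ c ⊛ V) ⊛ B ≋ A ⊛ B ⊞ c ⊛ (V ⊛ B)
      l₁ = PS.solve-∀ polyACR
      pow : ∀ q → Prime q → A ^ q ≋ A ^ ℕ.pred q ⊛ A
      pow zero (prime {{()}} _)
      pow (suc n) _ = *-comm A (A ^ n)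
      pos-^ : ∀ m n → ℤ.+ (m ℕ.^ n) ≡ (ℤ.+ m) ℤ.^ n
      pos-^ m zero = refl
      pos-^ m (suc n) = trans (ℤP.pos-* m (m ℕ.^ n)) (cong (ℤ.+ m ℤ.*_) (pos-^ m n))
    pos : ∀ c → 1 ≤ f c
    pos c with f c in eq
    ... | suc _ = s≤s z≤n
    ... | zero = ⊥-elim (q∤len (prime∣^ pq (length as) (ℕ.pred q) (ℤS.∣⇒∣ᵤ (ℤS.divides {ℤ.+ q} (fold M c (V ⊛ B))
        (trans (sym (val c)) (trans (cong (λ z → ℤ.+ z ℤ.+ ℤ.+ q ℤ.* fold M c (V ⊛ B)) eq) (trans (ℤP.+-identityˡ _) (ℤP.*-comm (ℤ.+ q) _))))))))
    sumM : sum< M (λ c → ℤ.+ f c) ≡ ℤ.+ M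
    sumM = begin
      sum< M (λ c → ℤ.+ f c)                          ≡⟨ sum<-cong M (λ c → fold-polyOf₂ M c qas bs) ⟨
      sum< M (λ c → fold M c (polyOf qas ⊛ B))        ≡⟨ sum<-fold M (polyOf qas ⊛ B) 1≤M ⟩
      total (polyOf qas ⊛ B)                          ≡⟨ total-⊛ (polyOf qas) B ⟩
      total (polyOf qas) ℤ.* total B                  ≡⟨ cong₂ ℤ._*_ (total-polyOf qas) (total-polyOf bs) ⟩
      ℤ.+ length qas ℤ.* ℤ.+ length bs                ≡⟨ cong (λ z → ℤ.+ z ℤ.* ℤ.+ length bs) (LP.length-map (q ℕ.*_) as) ⟩
      ℤ.+ length as ℤ.* ℤ.+ length bs                 ≡⟨ ℤP.pos-* (length as) (length bs) ⟨
      ℤ.+ (length as ℕ.* length bs)                   ≡⟨ cong ℤ.+_ (length-TileL {as = as} {bs} 1≤M t) ⟩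
      ℤ.+ M ∎
      where open ≡-Reasoning

  tijdeman : ∀ {M as bs} r → 1 ≤ M → .{{NonZero r}} → (∀ {q} → Prime q → q ℕD.∣ r → ¬ q ℕD.∣ M) →
    TileL M as bs → TileL M (map (r ℕ.*_) as) bs
  tijdeman {M} {as} {bs} r 1≤M h t = subst (λ z → TileL M (map (z ℕ.*_) as) bs) (sym (PrimeFactorisation.isFactorisation F))
    (go (PrimeFactorisation.factors F) (PrimeFactorisation.factorsPrime F)
      λ i → subst (_ ℕD.∣_) (sym (PrimeFactorisation.isFactorisation F)) (∈⇒∣ i))
    where
    F = factorise r
    ∈⇒∣ : ∀ {q qs} → q ∈ qs → q ℕD.∣ product qs
    ∈⇒∣ {q} {x ∷ qs} (here refl) = ℕD.m∣m*n (product qs)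
    ∈⇒∣ {q} {x ∷ qs} (there i) = ℕD.∣n⇒∣m*n x (∈⇒∣ i)
    go : ∀ qs → All Prime qs → (∀ {q} → q ∈ qs → q ℕD.∣ r) → TileL M (map (product qs ℕ.*_) as) bs
    go [] _ _ = subst (λ z → TileL M z bs) (sym (trans (LP.map-cong (ℕP.*-identityˡ) as) (LP.map-id as))) t
    go (q ∷ qs) (pq ∷ ps) g = subst (λ z → TileL M z bs)
      (trans (sym (LP.map-∘ as)) (LP.map-cong (λ a → sym (ℕP.*-assoc q (product qs) a)) as))
      (tijdeman-prime {as = map (product qs ℕ.*_) as} 1≤M (go qs ps (λ i → g (there i))) pq (h pq (g (here refl))))

module Counting where
  open import Defs using (Poly)
  open Folding
  open Tijdeman
  import Data.Nat as ℕ
  import Data.Nat.Properties as ℕP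
  open import Data.Integer as ℤ using (ℤ; +_; _-_; 0ℤ; 1ℤ)
  import Data.Integer.Properties as ℤP
  open import Data.Integer.Tactic.RingSolver using (solve-∀)
  open import Data.Bool using (true; false; if_then_else_)
  open import Data.Fin as Fin using (zero; suc; toℕ; punchOut)
  import Data.Fin.Properties as FP
  open import Data.Fin.Subset as Sub using (Subset; ∣_∣)
  open import Data.Vec as Vec using ([]; _∷_; here; there)
  open import Data.List as List using (List; []; _∷_; map; length; lookup)
  import Data.List.Properties as LP
  open import Data.List.Membership.Propositional using (_∈_)
  open import Data.List.Membership.Propositional.Properties using (∈-map⁺; ∈-map⁻; ∈-lookup)
  open import Data.List.Relation.Unary.Any as Any using (here; there)
  import Data.List.Relation.Unary.Any.Properties as AnyP
  open import Data.List.Relation.Unary.All as All using ([]; _∷_)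
  open import Data.List.Relation.Unary.AllPairs using ([]; _∷_)
  open import Data.List.Relation.Unary.Unique.Propositional using (Unique)
  open import Data.List.Relation.Unary.Unique.Propositional.Properties using (map⁺)

  ind-yes : ∀ {A : Set} (d : Dec A) → A → ind d ≡ 1
  ind-yes (yes _) a = refl
  ind-yes (no ¬a) a = ⊥-elim (¬a a)

  ind-no : ∀ {A : Set} (d : Dec A) → ¬ A → ind d ≡ 0
  ind-no (yes a) ¬a = ⊥-elim (¬a a)
  ind-no (no _)  ¬a = refl

  surjective : ∀ {k} (f : Fin k → Fin k) → (∀ {i j} → f i ≡ f j → i ≡ j) → ∀ c → Σ (Fin k) λ i → f i ≡ c
  surjective {suc k} f inj c with FP.any? (λ i → f i Fin.≟ c)
  ... | yes q = q
  ... | no ¬q = ⊥-elim (ℕP.<⇒≱ (ℕP.n<1+n k) (FP.injective⇒≤ {f = λ i → punchOut (miss i)} λ {i} {j} e →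
      inj (FP.punchOut-injective (miss i) (miss j) e)))
    where
    miss : ∀ i → c ≢ f i
    miss i q = ¬q (i , sym q)

  choose : ∀ {N} {P Q : Fin N → Set} → (∀ j → P j ⊎ Q j) → (∀ j → P j) ⊎ Σ (Fin N) Q
  choose {zero} k = inj₁ λ ()
  choose {suc N} {P} {Q} k = join (k zero) (choose (λ j → k (suc j)))
    where
    join : P zero ⊎ Q zero → (∀ j → P (suc j)) ⊎ Σ (Fin N) (λ j → Q (suc j)) → (∀ j → P j) ⊎ Σ (Fin (suc N)) Q
    join (inj₂ q) _ = inj₂ (zero , q)
    join _ (inj₂ (j , q)) = inj₂ (suc j , q)
    join (inj₁ a) (inj₁ b) = inj₁ λ { zero → a ; (suc j) → b j }

  elems : ∀ {k} → Subset k → List (Fin k)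
  elems []          = []
  elems (true ∷ v)  = zero ∷ map suc (elems v)
  elems (false ∷ v) = map suc (elems v)

  length-elems : ∀ {k} (v : Subset k) → length (elems v) ≡ ∣ v ∣
  length-elems []          = refl
  length-elems (true ∷ v)  = cong suc (trans (LP.length-map suc (elems v)) (length-elems v))
  length-elems (false ∷ v) = trans (LP.length-map suc (elems v)) (length-elems v)

  elems⁺ : ∀ {k} {v : Subset k} {x} → x Sub.∈ v → x ∈ elems v
  elems⁺ {v = true ∷ v}  here      = here refl
  elems⁺ {v = true ∷ v}  (there i) = there (∈-map⁺ suc (elems⁺ i))
  elems⁺ {v = false ∷ v} (there i) = ∈-map⁺ suc (elems⁺ i)

  elems⁻ : ∀ {k} (v : Subset k) {x} → x ∈ elems v → x Sub.∈ v
  elems⁻ (true ∷ v)  (here refl) = here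
  elems⁻ (true ∷ v)  (there i) with ∈-map⁻ suc i
  ... | y , j , refl = there (elems⁻ v j)
  elems⁻ (false ∷ v) i with ∈-map⁻ suc i
  ... | y , j , refl = there (elems⁻ v j)

  unique-elems : ∀ {k} (v : Subset k) → Unique (elems v)
  unique-elems []          = []
  unique-elems (true ∷ v)  = All.tabulate (λ i q → absurd (subst (_∈ map suc (elems v)) (sym q) i)) ∷ map⁺ FP.suc-injective (unique-elems v)
    where
    absurd : ¬ zero ∈ map suc (elems v)
    absurd i with ∈-map⁻ suc i
    ... | _ , _ , ()
  unique-elems (false ∷ v) = map⁺ FP.suc-injective (unique-elems v)

  unique-lookup : ∀ {A : Set} {xs : List A} → Unique xs → ∀ i j → lookup xs i ≡ lookup xs j → i ≡ j
  unique-lookup (_ ∷ _) zero zero q = refl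
  unique-lookup (h ∷ _) zero (suc j) q = ⊥-elim (All.lookup h (∈-lookup j) q)
  unique-lookup (h ∷ _) (suc i) zero q = ⊥-elim (All.lookup h (∈-lookup i) (sym q))
  unique-lookup (_ ∷ u) (suc i) (suc j) q = cong suc (unique-lookup u i j q)

  -- An injective relation from a list without repetitions into another list.
  length-≤ : ∀ {A : Set} {xs ys : List A} {R : A → A → Set} → Unique xs → (∀ {x} → x ∈ xs → Σ A λ y → y ∈ ys × R x y) →
    (∀ {x x' y} → x ∈ xs → x' ∈ xs → R x y → R x' y → x ≡ x') → length xs ≤ length ys
  length-≤ {A} {xs} {ys} {R} u f inj = FP.injective⇒≤ {f = λ i → Any.index (mem i)} λ {i} {j} q →
      unique-lookup u i j (inj (∈-lookup i) (∈-lookup j) (rel i) (subst (R (lookup xs j)) (same i j q) (rel j)))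
    where
    mem : ∀ i → proj₁ (f (∈-lookup {xs = xs} i)) ∈ ys
    mem i = proj₁ (proj₂ (f (∈-lookup i)))
    rel : ∀ i → R (lookup xs i) (proj₁ (f (∈-lookup {xs = xs} i)))
    rel i = proj₂ (proj₂ (f (∈-lookup i)))
    same : ∀ i j → Any.index (mem i) ≡ Any.index (mem j) → proj₁ (f (∈-lookup {xs = xs} j)) ≡ proj₁ (f (∈-lookup {xs = xs} i))
    same i j q = trans (AnyP.lookup-index (mem j)) (trans (cong (lookup ys) (sym q)) (sym (AnyP.lookup-index (mem i))))

  two-elements : ∀ {k} (v : Subset k) → 1 < ∣ v ∣ → Σ (Fin k) λ a → Σ (Fin k) λ b → a Sub.∈ v × b Sub.∈ v × a ≢ b
  two-elements v lt = go (elems v) refl (subst (1 <_) (sym (length-elems v)) lt) (unique-elems v)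
    where
    go : ∀ xs → xs ≡ elems v → 1 < length xs → Unique xs → Σ _ λ a → Σ _ λ b → a Sub.∈ v × b Sub.∈ v × a ≢ b
    go (x ∷ []) q (s≤s ()) u
    go (x ∷ y ∷ xs) q lt ((x≢y ∷ _) ∷ _) = x , y , elems⁻ v (subst (x ∈_) q (here refl)) , elems⁻ v (subst (y ∈_) q (there (here refl))) , x≢y

  module _ {n : ℕ} {c : ℤ} where
    Hit : ℕ → Set
    Hit e = n ∣ᵢ c - + e

    count-0 : ∀ {es} → (∀ {e} → e ∈ es → ¬ Hit e) → count n c es ≡ 0
    count-0 {[]} g = refl
    count-0 {e ∷ es} g = cong₂ ℕ._+_ (ind-no (n ∣ᵢ? (c - + e)) (g (here refl))) (count-0 λ i → g (there i))

    count-1 : ∀ {es} → Unique es → ∀ {e} → e ∈ es → Hit e → (∀ {e'} → e' ∈ es → Hit e' → e' ≡ e) → count n c es ≡ 1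
    count-1 {e ∷ es} (e∉ ∷ u) (here refl) q g = cong₂ ℕ._+_ (ind-yes (n ∣ᵢ? (c - + e)) q)
      (count-0 λ i q' → All.lookup e∉ i (sym (g (there i) q')))
    count-1 {e' ∷ es} (e'∉ ∷ u) {e} (there i) q g = cong₂ ℕ._+_ (ind-no (n ∣ᵢ? (c - + e')) (λ q' → All.lookup e'∉ i (g (here refl) q')))
      (count-1 u i q (λ j → g (there j)))

    count-hit : ∀ {es} → 1 ≤ count n c es → Σ ℕ λ e → e ∈ es × Hit e
    count-hit {e ∷ es} le with n ∣ᵢ? (c - + e)
    ... | yes q = e , here refl , q
    ... | no _ = let e' , i , q = count-hit {es} le in e' , there i , q

    count-pos : ∀ {es e} → e ∈ es → Hit e → 1 ≤ count n c es
    count-pos {e ∷ es} (here refl) q = subst (λ k → 1 ≤ k ℕ.+ count n c es) (sym (ind-yes (n ∣ᵢ? (c - + e)) q)) (s≤s z≤n)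
    count-pos {e' ∷ es} (there i) q = ℕP.≤-trans (count-pos i q) (ℕP.m≤n+m _ (ind (n ∣ᵢ? (c - + e'))))

    count-single : ∀ {es} → count n c es ≤ 1 → ∀ {e e'} → e ∈ es → e' ∈ es → Hit e → Hit e' → e ≡ e'
    count-single le (here refl) (here refl) q q' = refl
    count-single {e ∷ es} le (here refl) (there j) q q' = ⊥-elim (ℕP.<⇒≱ (ℕP.+-mono-≤ (ℕP.≤-reflexive (sym (ind-yes (n ∣ᵢ? (c - + e)) q))) (count-pos j q')) le)
    count-single {e ∷ es} le (there i) (here refl) q q' = ⊥-elim (ℕP.<⇒≱ (ℕP.+-mono-≤ (ℕP.≤-reflexive (sym (ind-yes (n ∣ᵢ? (c - + e)) q'))) (count-pos i q)) le)
    count-single {e ∷ es} le (there i) (there j) q q' = count-single (ℕP.≤-trans (ℕP.m≤n+m _ (ind (n ∣ᵢ? (c - + e)))) le) i j q q'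

  module _ {n : ℕ} where
    Hit₂ : ℤ → ℕ → ℕ → Set
    Hit₂ c a b = n ∣ᵢ c - + a - + b

    count₂-0 : ∀ {c as bs} → (∀ {a b} → a ∈ as → b ∈ bs → ¬ Hit₂ c a b) → count₂ n c as bs ≡ 0
    count₂-0 {c} {[]} g = refl
    count₂-0 {c} {a ∷ as} {bs} g = cong₂ ℕ._+_ (count-0 {es = bs} (g (here refl))) (count₂-0 {as = as} {bs} λ i → g (there i))

    count₂-1 : ∀ {c as bs} → Unique as → Unique bs → ∀ {a b} → a ∈ as → b ∈ bs → Hit₂ c a b →
      (∀ {a' b'} → a' ∈ as → b' ∈ bs → Hit₂ c a' b' → a' ≡ a × b' ≡ b) → count₂ n c as bs ≡ 1
    count₂-1 {c} {a ∷ as} {bs} (a∉ ∷ u) v (here refl) j q g = cong₂ ℕ._+_ (count-1 v j q λ k q' → proj₂ (g (here refl) k q'))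
      (count₂-0 {as = as} {bs} λ i k q' → All.lookup a∉ i (sym (proj₁ (g (there i) k q'))))
    count₂-1 {c} {a' ∷ as} {bs} (a'∉ ∷ u) v (there i) j q g = cong₂ ℕ._+_ (count-0 {es = bs} λ k q' → All.lookup a'∉ i (proj₁ (g (here refl) k q')))
      (count₂-1 u v i j q λ k l → g (there k) l)

    count₂-hit : ∀ {c as bs} → 1 ≤ count₂ n c as bs → Σ ℕ λ a → Σ ℕ λ b → a ∈ as × b ∈ bs × Hit₂ c a b
    count₂-hit {c} {a ∷ as} {bs} le with count n (c - + a) bs in eq
    ... | zero = let a' , b , i , j , q = count₂-hit {c} {as} {bs} le in a' , b , there i , j , q
    ... | suc k = let b , j , q = count-hit {n} {c - + a} {bs} (subst (1 ≤_) (sym eq) (s≤s z≤n)) in a , b , here refl , j , q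

    count₂-pos : ∀ {c as bs a b} → a ∈ as → b ∈ bs → Hit₂ c a b → 1 ≤ count₂ n c as bs
    count₂-pos {c} {a ∷ as} {bs} (here refl) j q = ℕP.≤-trans (count-pos j q) (ℕP.m≤m+n _ (count₂ n c as bs))
    count₂-pos {c} {a' ∷ as} {bs} (there i) j q = ℕP.≤-trans (count₂-pos {c} i j q) (ℕP.m≤n+m _ (count n (c - + a') bs))

    count₂-single : ∀ {c as bs} → count₂ n c as bs ≤ 1 → ∀ {a a' b b'} → a ∈ as → a' ∈ as → b ∈ bs → b' ∈ bs →
      Hit₂ c a b → Hit₂ c a' b' → a ≡ a' × b ≡ b'
    count₂-single {c} {a ∷ as} {bs} le (here refl) (here refl) j j' q q' = refl , count-single (ℕP.≤-trans (ℕP.m≤m+n _ _) le) j j' q q'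
    count₂-single {c} {a ∷ as} {bs} le (here refl) (there i) j j' q q' = ⊥-elim (ℕP.<⇒≱ (ℕP.+-mono-≤ (count-pos j q) (count₂-pos {c} i j' q')) le)
    count₂-single {c} {a ∷ as} {bs} le (there i) (here refl) j j' q q' = ⊥-elim (ℕP.<⇒≱ (ℕP.+-mono-≤ (count-pos j' q') (count₂-pos {c} i j q)) le)
    count₂-single {c} {a ∷ as} {bs} le (there i) (there i') j j' q q' = count₂-single {c} {as} {bs} (ℕP.≤-trans (ℕP.m≤n+m _ (count n (c - + a) bs)) le) i i' j j' q q'

  maskOf : ∀ {k} → Subset k → Poly
  maskOf v = Vec.toList (Vec.map (λ b → if b then 1ℤ else 0ℤ) v)

  residues : ∀ {k} → Subset k → List ℕ
  residues v = map toℕ (elems v)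

  residues-suc : ∀ {k} (xs : List (Fin k)) n c → count n c (map toℕ (map suc xs)) ≡ count n (c - 1ℤ) (map toℕ xs)
  residues-suc [] n c = refl
  residues-suc (x ∷ xs) n c = cong₂ ℕ._+_ (cong (λ z → ind (n ∣ᵢ? z)) (lem c (+ toℕ x))) (residues-suc xs n c)
    where
    lem : ∀ c x → c - (1ℤ ℤ.+ x) ≡ c - 1ℤ - x
    lem = solve-∀

  fold-mask : ∀ {k} (v : Subset k) n c → fold n c (maskOf v) ≡ + count n c (residues v)
  fold-mask [] n c = refl
  fold-mask (true ∷ v) n c = cong₂ ℤ._+_ (trans (ℤP.*-identityʳ (δ n c)) (trans (δ-ind n c) (cong (λ z → + ind (n ∣ᵢ? z)) (sym (ℤP.+-identityʳ c)))))
    (trans (fold-mask v n (c - 1ℤ)) (cong +_ (sym (residues-suc (elems v) n c))))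
  fold-mask (false ∷ v) n c = trans (cong (ℤ._+ fold n (c - 1ℤ) (maskOf v)) (ℤP.*-zeroʳ (δ n c))) (trans (ℤP.+-identityˡ _)
    (trans (fold-mask v n (c - 1ℤ)) (cong +_ (sym (residues-suc (elems v) n c)))))

module Setting (p : Fin 3 → ℕ) (pr : ∀ ν → Prime (p ν)) (p≥3 : ∀ ν → 3 ≤ p ν) (p≢ : ∀ {ν μ : Fin 3} → ν ≢ μ → p ν ≢ p μ) where
  import Data.Nat as ℕ
  open import Data.Nat.Primality using (euclidsLemma; prime)
  open import Defs using (Mof; Dof; Mnu; Mover; Distinct3; dist; Cong; gcdM; Tiles; InGrid; AΛ; InFiber; InPlane; Fibered; Corner; T2; InDiv; DiagonalBoxes; FullPlane; AlmostCorner)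
  open Folding
  open Tijdeman using (reduce; polyOf; count; fold-polyOf; total-polyOf; TileL; tijdeman; count₂)
  open import Data.Fin as Fin using (zero; suc)
  open import Data.Fin.Properties as FP using (any?)
  open import Relation.Binary.Definitions using (tri<; tri≈; tri>)
  import Data.Nat.Properties as ℕP
  import Data.Nat.Divisibility as ℕD
  open import Data.Nat.Coprimality as Cop using (Coprime; coprime-divisor; coprime-Bézout)
  open import Data.Nat.GCD using (module Bézout; gcd[m,n]∣m; gcd[m,n]∣n; gcd-greatest)
  open import Data.Integer as ℤ using (ℤ; 0ℤ; 1ℤ; ∣_∣; +_; _+_; _*_; _-_; -_)
  import Data.Integer.Properties as ℤP
  open import Data.Integer.Divisibility.Signed using (divides; ∣⇒∣ᵤ; ∣ᵤ⇒∣; ∣m∣n⇒∣m+n; ∣m∣n⇒∣m-n; ∣m⇒∣-m; ∣m⇒∣m*n; ∣n⇒∣m*n; ∣-refl; ∣-trans; *-cancelˡ-∣)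
  open import Data.Integer.Tactic.RingSolver using (solve-∀)
  import Data.Nat.Tactic.RingSolver as ℕS
  open import Relation.Nullary using (¬?; _×-dec_; _→-dec_)
  open import Data.List using (List; []; _∷_; map; allFin; lookup)
  import Data.List.Properties as LP
  open import Data.List.Membership.Propositional using () renaming (_∈_ to _∈ˡ_)
  open import Data.List.Membership.Propositional.Properties using (∈-allFin; ∈-map⁺; ∈-map⁻; ∈-lookup)
  open import Data.List.Relation.Unary.Any using (here; there)
  import Data.List.Relation.Unary.All as All
  open import Data.List.Relation.Unary.AllPairs using ([]; _∷_)
  open import Data.List.Relation.Unary.Unique.Propositional using (Unique)
  open import Data.List.Relation.Unary.Unique.Propositional.Properties using (allFin⁺; map⁺)
  open Counting
  open import Data.Fin.Subset using (Subset; _∈_; _∉_) renaming (∣_∣ to ∣_∣ˢ)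
  open import Data.Fin.Subset.Properties using (_∈?_)
  open import Function.Bundles using (mk⇔; Equivalence)

  pattern 0F = zero
  pattern 1F = suc zero
  pattern 2F = suc (suc zero)

  M : ℕ
  M = Mof p

  pp : Fin 3 → ℕ
  pp ν = p ν ℕ.* p ν

  p>0 : ∀ ν → 1 ≤ p ν
  p>0 ν = ℕP.≤-trans (s≤s z≤n) (p≥3 ν)

  pp>0 : ∀ ν → 1 ≤ pp ν
  pp>0 ν = ℕP.*-mono-≤ (p>0 ν) (p>0 ν)

  M>0 : 1 ≤ M
  M>0 = ℕP.*-mono-≤ (ℕP.*-mono-≤ (pp>0 0F) (pp>0 1F)) (pp>0 2F)

  p∣pp : ∀ ν → p ν ℕD.∣ pp ν
  p∣pp ν = ℕD.m∣m*n (p ν)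

  M≡pp*Mnu : ∀ ν → M ≡ pp ν ℕ.* Mnu p ν
  M≡pp*Mnu 0F = ℕP.*-assoc (pp 0F) (pp 1F) (pp 2F)
  M≡pp*Mnu 1F = trans (cong (ℕ._* pp 2F) (ℕP.*-comm (pp 0F) (pp 1F))) (ℕP.*-assoc (pp 1F) (pp 0F) (pp 2F))
  M≡pp*Mnu 2F = ℕP.*-comm (pp 0F ℕ.* pp 1F) (pp 2F)

  pp∣Mnu : ∀ {ν μ} → μ ≢ ν → pp μ ℕD.∣ Mnu p ν
  pp∣Mnu {0F} {0F} h = ⊥-elim (h refl)
  pp∣Mnu {0F} {1F} h = ℕD.m∣m*n (pp 2F)
  pp∣Mnu {0F} {2F} h = ℕD.n∣m*n (pp 1F)
  pp∣Mnu {1F} {0F} h = ℕD.m∣m*n (pp 2F)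
  pp∣Mnu {1F} {1F} h = ⊥-elim (h refl)
  pp∣Mnu {1F} {2F} h = ℕD.n∣m*n (pp 0F)
  pp∣Mnu {2F} {0F} h = ℕD.m∣m*n (pp 1F)
  pp∣Mnu {2F} {1F} h = ℕD.n∣m*n (pp 0F)
  pp∣Mnu {2F} {2F} h = ⊥-elim (h refl)

  pp∣M : ∀ ν → pp ν ℕD.∣ M
  pp∣M ν = subst (pp ν ℕD.∣_) (sym (M≡pp*Mnu ν)) (ℕD.m∣m*n (Mnu p ν))

  prime≡ : ∀ {q r} → Prime q → Prime r → q ℕD.∣ r → q ≡ r
  prime≡ {q} {r} pq@(prime {{_}} _) pr' d with Data.Nat.Primality.prime⇒irreducible pr' d
    where import Data.Nat.Primality
  ... | inj₁ refl = ⊥-elim (lem pq)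
    where
    lem : ¬ Prime 1
    lem (prime {{()}} _)
  ... | inj₂ e = e

  p∤pp : ∀ {ν μ} → ν ≢ μ → ¬ p ν ℕD.∣ pp μ
  p∤pp {ν} {μ} h d with euclidsLemma (p μ) (p μ) (pr ν) d
  ... | inj₁ g = p≢ h (prime≡ (pr ν) (pr μ) g)
  ... | inj₂ g = p≢ h (prime≡ (pr ν) (pr μ) g)

  p∤* : ∀ {q m n} → Prime q → ¬ q ℕD.∣ m → ¬ q ℕD.∣ n → ¬ q ℕD.∣ m ℕ.* n
  p∤* {q} {m} {n} pq a b d with euclidsLemma m n pq d
  ... | inj₁ g = a g
  ... | inj₂ g = b g

  p∤Mnu : ∀ ν → ¬ p ν ℕD.∣ Mnu p ν
  p∤Mnu 0F = p∤* (pr 0F) (p∤pp λ ()) (p∤pp λ ())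
  p∤Mnu 1F = p∤* (pr 1F) (p∤pp λ ()) (p∤pp λ ())
  p∤Mnu 2F = p∤* (pr 2F) (p∤pp λ ()) (p∤pp λ ())

  prime∣M : ∀ {q} → Prime q → q ℕD.∣ M → Σ (Fin 3) λ ν → q ≡ p ν
  prime∣M {q} pq d with euclidsLemma (pp 0F ℕ.* pp 1F) (pp 2F) pq d
  ... | inj₂ g = 2F , one 2F g
    where
    one : ∀ ν → q ℕD.∣ pp ν → q ≡ p ν
    one ν g with euclidsLemma (p ν) (p ν) pq g
    ... | inj₁ h = prime≡ pq (pr ν) h
    ... | inj₂ h = prime≡ pq (pr ν) h
  ... | inj₁ g with euclidsLemma (pp 0F) (pp 1F) pq g
  ...   | inj₁ h = 0F , one 0F h
    where
    one : ∀ ν → q ℕD.∣ pp ν → q ≡ p ν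
    one ν g with euclidsLemma (p ν) (p ν) pq g
    ... | inj₁ h = prime≡ pq (pr ν) h
    ... | inj₂ h = prime≡ pq (pr ν) h
  ...   | inj₂ h = 1F , one 1F h
    where
    one : ∀ ν → q ℕD.∣ pp ν → q ≡ p ν
    one ν g with euclidsLemma (p ν) (p ν) pq g
    ... | inj₁ h = prime≡ pq (pr ν) h
    ... | inj₂ h = prime≡ pq (pr ν) h

  opaque
    coprime-p : ∀ {q n} → Prime q → ¬ q ℕD.∣ n → Coprime q n
    coprime-p {q} {n} pq h {d} (dq , dn) with Data.Nat.Primality.prime⇒irreducible pq dq
      where import Data.Nat.Primality
    ... | inj₁ e = e
    ... | inj₂ refl = ⊥-elim (h dn)

    coprime-* : ∀ {k m n} → Coprime k m → Coprime k n → Coprime k (m ℕ.* n)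
    coprime-* {k} {m} {n} a b {d} (dk , dmn) = b (dk , coprime-divisor (λ { (x , y) → a (ℕD.∣-trans x dk , y) }) dmn)

    coprime-pp : ∀ {ν n} → ¬ p ν ℕD.∣ n → Coprime (pp ν) n
    coprime-pp {ν} {n} h = Cop.sym (coprime-* (Cop.sym (coprime-p (pr ν) h)) (Cop.sym (coprime-p (pr ν) h)))

    coprime-∣ : ∀ {m n x} → Coprime m n → m ℕD.∣ x → n ℕD.∣ x → m ℕ.* n ℕD.∣ x
    coprime-∣ {m} {n} c (ℕD.divides k refl) nx with coprime-divisor (Cop.sym c) (subst (n ℕD.∣_) (ℕP.*-comm k m) nx)
    ... | ℕD.divides j refl = ℕD.divides j (trans (ℕP.*-assoc j n m) (cong (j ℕ.*_) (ℕP.*-comm n m)))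

    all∣⇒M∣ : ∀ {x} → (∀ ν → pp ν ℕD.∣ x) → M ℕD.∣ x
    all∣⇒M∣ q = coprime-∣ (Cop.sym (coprime-* (Cop.sym (coprime-pp {0F} (p∤pp {0F} {2F} λ ()))) (Cop.sym (coprime-pp {1F} (p∤pp {1F} {2F} λ ())))))
        (coprime-∣ (coprime-pp {0F} (p∤pp {0F} {1F} λ ())) (q 0F) (q 1F)) (q 2F)

    -- Integers modulo M

    ∣ᵢ-trans : ∀ {m n x} → m ℕD.∣ n → n ∣ᵢ x → m ∣ᵢ x
    ∣ᵢ-trans {m} {n} {x} d h = ∣-trans (∣ᵤ⇒∣ {+ m} {+ n} d) h

    ∣ᵢ-intro : ∀ {m n} → m ℕD.∣ n → m ∣ᵢ (+ n)
    ∣ᵢ-intro {m} {n} d = ∣ᵤ⇒∣ {+ m} {+ n} d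

    M∣ : ∀ {x} → (∀ ν → pp ν ∣ᵢ x) → M ∣ᵢ x
    M∣ h = ∣ᵤ⇒∣ (all∣⇒M∣ λ ν → ∣⇒∣ᵤ (h ν))

    euclidℤ : ∀ ν {x y} → p ν ∣ᵢ x * y → p ν ∣ᵢ x ⊎ p ν ∣ᵢ y
    euclidℤ ν {x} {y} h with euclidsLemma ∣ x ∣ ∣ y ∣ (pr ν) (subst (p ν ℕD.∣_) (ℤP.abs-* x y) (∣⇒∣ᵤ h))
    ... | inj₁ g = inj₁ (∣ᵤ⇒∣ g)
    ... | inj₂ g = inj₂ (∣ᵤ⇒∣ g)

    +pp : ∀ ν → + pp ν ≡ + p ν * + p ν
    +pp ν = ℤP.pos-* (p ν) (p ν)

    p∣ᵢ* : ∀ ν {x y} → p ν ∣ᵢ x → p ν ∣ᵢ y → pp ν ∣ᵢ x * y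
    p∣ᵢ* ν {x} {y} (divides a refl) (divides b refl) = divides (a * b) (trans (lem a b (+ p ν)) (cong ((a * b) *_) (sym (+pp ν))))
      where
      lem : ∀ a b p → a * p * (b * p) ≡ a * b * (p * p)
      lem = solve-∀

    pp⇒p : ∀ ν {x} → pp ν ∣ᵢ x → p ν ∣ᵢ x
    pp⇒p ν = ∣ᵢ-trans (p∣pp ν)

  opaque
    inverse-p : ∀ ν u → ¬ p ν ∣ᵢ u → Σ ℤ λ v → p ν ∣ᵢ u * v - 1ℤ
    inverse-p ν u h = signed u refl
      where
      nat : ∀ n → ¬ p ν ℕD.∣ n → Σ ℤ λ v → p ν ∣ᵢ + n * v - 1ℤ
      nat n h with coprime-Bézout (coprime-p (pr ν) h)
      ... | Bézout.+- x y e = - (+ y) , divides (- (+ x)) (trans (lem (+ n) (+ y)) (trans (cong (λ z → - z) (trans (cong (λ z → 1ℤ + z) (sym (ℤP.pos-* y n)))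
              (trans (cong (λ z → + z) e) (ℤP.pos-* x (p ν))))) (ℤP.neg-distribˡ-* (+ x) (+ p ν))))
        where
        lem : ∀ n y → n * - y - 1ℤ ≡ - (1ℤ + y * n)
        lem = solve-∀
      ... | Bézout.-+ x y e = + y , divides (+ x) (trans (cong (λ z → z - 1ℤ) (trans (ℤP.*-comm (+ n) (+ y)) (trans (sym (ℤP.pos-* y n)) (cong (λ z → + z) (sym e)))))
              (trans (lem (+ (x ℕ.* p ν))) (ℤP.pos-* x (p ν))))
        where
        lem : ∀ a → 1ℤ + a - 1ℤ ≡ a
        lem = solve-∀
      signed : ∀ w → w ≡ u → Σ ℤ λ v → p ν ∣ᵢ w * v - 1ℤ
      signed (+ n) refl = nat n λ d → h (∣ᵢ-intro d)
      signed ℤ.-[1+ n ] refl with nat (suc n) (λ d → h (∣ᵤ⇒∣ d))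
      ... | v , g = - v , subst (λ z → p ν ∣ᵢ z - 1ℤ) (lem (+ suc n) v) g
        where
        lem : ∀ n v → n * v ≡ - n * - v
        lem = solve-∀

    inverse : ∀ ν u → ¬ p ν ∣ᵢ u → Σ ℤ λ v → pp ν ∣ᵢ u * v - 1ℤ
    inverse ν u h with inverse-p ν u h
    ... | v , g = v * (+ 2 - u * v) , subst (pp ν ∣ᵢ_) (lem u v) (∣m⇒∣-m (p∣ᵢ* ν g g))
      where
      lem : ∀ u v → - ((u * v - 1ℤ) * (u * v - 1ℤ)) ≡ u * (v * (+ 2 - u * v)) - 1ℤ
      lem = solve-∀

  -- The idempotent of ℤ_M that is 1 modulo p_ν² and 0 modulo the other squares.
  opaque
    idem : Fin 3 → ℤ
    idem ν = + Mnu p ν * proj₁ (inverse ν (+ Mnu p ν) λ h → p∤Mnu ν (∣⇒∣ᵤ h))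

    idem-1 : ∀ ν → pp ν ∣ᵢ idem ν - 1ℤ
    idem-1 ν = proj₂ (inverse ν (+ Mnu p ν) λ h → p∤Mnu ν (∣⇒∣ᵤ h))

    idem-0 : ∀ {ν μ} → μ ≢ ν → pp μ ∣ᵢ idem ν
    idem-0 {ν} {μ} h = ∣m⇒∣m*n _ (∣ᵢ-intro (pp∣Mnu h))

  -- Valuation types at p_ν of a difference x − y: divisible by p_ν², exactly by p_ν, or not.
  data V : Set where
    e h n : V

  val : Fin 3 → ℤ → V
  val ν z with pp ν ∣ᵢ? z | p ν ∣ᵢ? z
  ... | yes _ | _     = e
  ... | no _  | yes _ = h
  ... | no _  | no _  = n

  opaque
    val-e⁺ : ∀ {ν z} → pp ν ∣ᵢ z → val ν z ≡ e
    val-e⁺ {ν} {z} d with pp ν ∣ᵢ? z | p ν ∣ᵢ? z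
    ... | yes _ | _ = refl
    ... | no ¬d | _ = ⊥-elim (¬d d)

    val-e⁻ : ∀ {ν z} → val ν z ≡ e → pp ν ∣ᵢ z
    val-e⁻ {ν} {z} q with pp ν ∣ᵢ? z | p ν ∣ᵢ? z
    ... | yes d | _ = d
    val-e⁻ {ν} {z} () | no _ | yes _
    val-e⁻ {ν} {z} () | no _ | no _

    val-n⁺ : ∀ {ν z} → ¬ p ν ∣ᵢ z → val ν z ≡ n
    val-n⁺ {ν} {z} ¬d with pp ν ∣ᵢ? z | p ν ∣ᵢ? z
    ... | yes d | _     = ⊥-elim (¬d (pp⇒p ν d))
    ... | no _  | yes d = ⊥-elim (¬d d)
    ... | no _  | no _  = refl

    val-n⁻ : ∀ {ν z} → val ν z ≡ n → ¬ p ν ∣ᵢ z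
    val-n⁻ {ν} {z} q d with pp ν ∣ᵢ? z | p ν ∣ᵢ? z
    val-n⁻ {ν} {z} () d | yes _ | _
    val-n⁻ {ν} {z} () d | no _ | yes _
    val-n⁻ {ν} {z} q d | no _ | no ¬d = ¬d d

    val-h⁺ : ∀ {ν z} → p ν ∣ᵢ z → ¬ pp ν ∣ᵢ z → val ν z ≡ h
    val-h⁺ {ν} {z} d ¬d with pp ν ∣ᵢ? z | p ν ∣ᵢ? z
    ... | yes g | _     = ⊥-elim (¬d g)
    ... | no _  | yes _ = refl
    ... | no _  | no ¬g = ⊥-elim (¬g d)

    _≟V_ : (a b : V) → Dec (a ≡ b)
    e ≟V e = yes refl
    e ≟V h = no λ ()
    e ≟V n = no λ ()
    h ≟V e = no λ ()
    h ≟V h = yes refl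
    h ≟V n = no λ ()
    n ≟V e = no λ ()
    n ≟V h = no λ ()
    n ≟V n = yes refl

    val-≢n⁻ : ∀ {ν z} → val ν z ≢ n → p ν ∣ᵢ z
    val-≢n⁻ {ν} {z} q = decide (p ν ∣ᵢ? z)
      where
      decide : Dec (p ν ∣ᵢ z) → p ν ∣ᵢ z
      decide (yes d) = d
      decide (no ¬d) = ⊥-elim (q (val-n⁺ ¬d))

    val-cong : ∀ {ν x y} → (pp ν ∣ᵢ x → pp ν ∣ᵢ y) → (pp ν ∣ᵢ y → pp ν ∣ᵢ x) →
      (p ν ∣ᵢ x → p ν ∣ᵢ y) → (p ν ∣ᵢ y → p ν ∣ᵢ x) → val ν x ≡ val ν y
    val-cong {ν} {x} {y} a b c d with val ν x in q
    ... | e = sym (val-e⁺ (a (val-e⁻ q)))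
    ... | n = sym (val-n⁺ λ g → val-n⁻ {ν} {x} q (d g))
    ... | h = sym (val-h⁺ (c (val-≢n⁻ λ g → lem (trans (sym q) g))) λ g → lem′ (trans (sym q) (val-e⁺ (b g))))
      where
      lem : h ≢ n
      lem ()
      lem′ : h ≢ e
      lem′ ()

  opaque
    T : Fin 3 → ℤ → ℤ → V
    T ν x y = val ν (x - y)

    T-val : ∀ ν x y → T ν x y ≡ val ν (x - y)
    T-val ν x y = refl

  E : Fin 3 → ℤ → ℤ → Set
  E ν x y = T ν x y ≡ e

  E? : ∀ ν x y → Dec (E ν x y)
  E? ν x y = T ν x y ≟V e

  N? : ∀ ν x y → Dec (T ν x y ≡ n)
  N? ν x y = T ν x y ≟V n

  infix 4 _≈_
  record _≈_ (x y : ℤ) : Set where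
    constructor ≈⁺
    field ≈⁻ : M ∣ᵢ x - y
  open _≈_ public

  opaque
    ∣-swap : ∀ m x y → m ∣ᵢ x - y → m ∣ᵢ y - x
    ∣-swap m x y d = subst (m ∣ᵢ_) (lem x y) (∣m⇒∣-m d)
      where
      lem : ∀ x y → - (x - y) ≡ y - x
      lem = solve-∀

    ∣-tele : ∀ m x y z → m ∣ᵢ x - y → m ∣ᵢ y - z → m ∣ᵢ x - z
    ∣-tele m x y z a b = subst (m ∣ᵢ_) (lem x y z) (∣m∣n⇒∣m+n a b)
      where
      lem : ∀ x y z → (x - y) + (y - z) ≡ x - z
      lem = solve-∀

  module _ {ν : Fin 3} where
    opaque

      E⁺ : ∀ {x y} → pp ν ∣ᵢ x - y → E ν x y
      E⁺ {x} {y} d = trans (T-val ν x y) (val-e⁺ d)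

      E⁻ : ∀ {x y} → E ν x y → pp ν ∣ᵢ x - y
      E⁻ {x} {y} q = val-e⁻ (trans (sym (T-val ν x y)) q)

      n⁺ : ∀ {x y} → ¬ p ν ∣ᵢ x - y → T ν x y ≡ n
      n⁺ {x} {y} d = trans (T-val ν x y) (val-n⁺ d)

      n⁻ : ∀ {x y} → T ν x y ≡ n → ¬ p ν ∣ᵢ x - y
      n⁻ {x} {y} q = val-n⁻ (trans (sym (T-val ν x y)) q)

      ≢n⁺ : ∀ {x y} → p ν ∣ᵢ x - y → T ν x y ≢ n
      ≢n⁺ d q = n⁻ q d

      ≢n⁻ : ∀ {x y} → T ν x y ≢ n → p ν ∣ᵢ x - y
      ≢n⁻ {x} {y} q = val-≢n⁻ λ g → q (trans (T-val ν x y) g)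

      T-cong : ∀ {x y x' y'} → (pp ν ∣ᵢ x - y → pp ν ∣ᵢ x' - y') → (pp ν ∣ᵢ x' - y' → pp ν ∣ᵢ x - y) →
        (p ν ∣ᵢ x - y → p ν ∣ᵢ x' - y') → (p ν ∣ᵢ x' - y' → p ν ∣ᵢ x - y) → T ν x y ≡ T ν x' y'
      T-cong {x} {y} {x'} {y'} a b c d = trans (T-val ν x y) (trans (val-cong a b c d) (sym (T-val ν x' y')))

      T-sym : ∀ x y → T ν x y ≡ T ν y x
      T-sym x y = T-cong (∣-swap (pp ν) x y) (∣-swap (pp ν) y x) (∣-swap (p ν) x y) (∣-swap (p ν) y x)

      E-refl : ∀ {x} → E ν x x
      E-refl {x} = E⁺ (subst (pp ν ∣ᵢ_) (sym (ℤP.+-inverseʳ x)) (0∣ᵢ (pp ν)))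

      E-sym : ∀ {x y} → E ν x y → E ν y x
      E-sym {x} {y} q = trans (T-sym y x) q

      E-trans : ∀ {x y z} → E ν x y → E ν y z → E ν x z
      E-trans {x} {y} {z} a b = E⁺ (∣-tele (pp ν) x y z (E⁻ a) (E⁻ b))

      T-Eˡ : ∀ {x x'} y → E ν x x' → T ν x y ≡ T ν x' y
      T-Eˡ {x} {x'} y q = T-cong (∣-tele (pp ν) x' x y d') (∣-tele (pp ν) x x' y d)
          (∣-tele (p ν) x' x y (pp⇒p ν d')) (∣-tele (p ν) x x' y (pp⇒p ν d))
        where
        d : pp ν ∣ᵢ x - x'
        d = E⁻ q
        d' : pp ν ∣ᵢ x' - x
        d' = ∣-swap (pp ν) x x' d

      T-Eʳ : ∀ x {y y'} → E ν y y' → T ν x y ≡ T ν x y'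
      T-Eʳ x {y} {y'} q = trans (T-sym x y) (trans (T-Eˡ x q) (T-sym y' x))

      ≢n-sym : ∀ {x y} → T ν x y ≢ n → T ν y x ≢ n
      ≢n-sym {x} {y} q g = q (trans (T-sym x y) g)

      ≢n-trans : ∀ {x y z} → T ν x y ≢ n → T ν y z ≢ n → T ν x z ≢ n
      ≢n-trans {x} {y} {z} a b = ≢n⁺ (∣-tele (p ν) x y z (≢n⁻ a) (≢n⁻ b))

      n-≢n : ∀ {x y z} → T ν x y ≡ n → T ν y z ≢ n → T ν x z ≡ n
      n-≢n {x} {y} {z} a b with N? ν x z
      ... | yes q = q
      ... | no q = ⊥-elim (≢n-trans q (≢n-sym b) a)

      ≢n-n : ∀ {x y z} → T ν x y ≢ n → T ν y z ≡ n → T ν x z ≡ n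
      ≢n-n {x} {y} {z} a b = trans (T-sym x z) (n-≢n (trans (T-sym z y) b) (≢n-sym a))

      E⇒≢n : ∀ {x y} → E ν x y → T ν x y ≢ n
      E⇒≢n q g with trans (sym q) g
      ... | ()

      h⇒≢n : ∀ {x y} → T ν x y ≡ h → T ν x y ≢ n
      h⇒≢n q g with trans (sym q) g
      ... | ()

      h⇒¬E : ∀ {x y} → T ν x y ≡ h → ¬ E ν x y
      h⇒¬E q g with trans (sym q) g
      ... | ()

      n⇒¬E : ∀ {x y} → T ν x y ≡ n → ¬ E ν x y
      n⇒¬E q g with trans (sym q) g
      ... | ()

      ≢⇒h : ∀ {x y} → T ν x y ≢ n → ¬ E ν x y → T ν x y ≡ h
      ≢⇒h {x} {y} a b with T ν x y
      ... | e = ⊥-elim (b refl)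
      ... | h = refl
      ... | n = ⊥-elim (a refl)

  opaque
    T-diff : ∀ {ν x y u v} → pp ν ∣ᵢ (x - y) - (u - v) → T ν x y ≡ T ν u v
    T-diff {ν} {x} {y} {u} {v} d = T-cong (down d) (up d) (down (pp⇒p ν d)) (up (pp⇒p ν d))
      where
      l₁ : ∀ a b → a - (a - b) ≡ b
      l₁ = solve-∀
      l₂ : ∀ a b → (a - b) + b ≡ a
      l₂ = solve-∀
      down : ∀ {m} → m ∣ᵢ (x - y) - (u - v) → m ∣ᵢ x - y → m ∣ᵢ u - v
      down {m} k g = subst (m ∣ᵢ_) (l₁ (x - y) (u - v)) (∣m∣n⇒∣m-n g k)
      up : ∀ {m} → m ∣ᵢ (x - y) - (u - v) → m ∣ᵢ u - v → m ∣ᵢ x - y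
      up {m} k g = subst (m ∣ᵢ_) (l₂ (x - y) (u - v)) (∣m∣n⇒∣m+n k g)

  opaque
    ≈⇒E : ∀ {x y} → x ≈ y → ∀ ν → E ν x y
    ≈⇒E (≈⁺ q) ν = E⁺ (∣ᵢ-trans (pp∣M ν) q)

    E⇒≈ : ∀ {x y} → (∀ ν → E ν x y) → x ≈ y
    E⇒≈ q = ≈⁺ (M∣ λ ν → E⁻ (q ν))

  data VView (v : V) : Set where
    is-e : v ≡ e → VView v
    is-h : v ≡ h → VView v
    is-n : v ≡ n → VView v

  caseV : ∀ {P : Set} v → (v ≡ e → P) → (v ≡ h → P) → (v ≡ n → P) → P
  caseV e a b c = a refl
  caseV h a b c = b refl
  caseV n a b c = c refl

  vview : ∀ v → VView v
  vview e = is-e refl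
  vview h = is-h refl
  vview n = is-n refl

  opaque
    -- Changing one coordinate: set ν u x agrees with u at p_ν and with x at the other primes.
    set : Fin 3 → ℤ → ℤ → ℤ
    set ν u x = x + (u - x) * idem ν

    set-E : ∀ ν u x → E ν (set ν u x) u
    set-E ν u x = E⁺ (subst (pp ν ∣ᵢ_) (lem u x (idem ν)) (∣n⇒∣m*n (u - x) (idem-1 ν)))
      where
      lem : ∀ u x i → (u - x) * (i - 1ℤ) ≡ x + (u - x) * i - u
      lem = solve-∀

    set-E′ : ∀ {ν μ} u x → μ ≢ ν → E μ (set ν u x) x
    set-E′ {ν} {μ} u x q = E⁺ (subst (pp μ ∣ᵢ_) (lem u x (idem ν)) (∣n⇒∣m*n (u - x) (idem-0 q)))
      where
      lem : ∀ u x i → (u - x) * i ≡ x + (u - x) * i - x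
      lem = solve-∀

    -- Needs p ≥ 3: x + p and x + 2p cannot both agree with z.
    avoid : ∀ ν x z → Σ ℤ λ u → T ν u x ≡ h × ¬ E ν u z
    avoid ν x z with E? ν (x + + p ν) z
    ... | no ¬q = x + + p ν , trans (T-val ν _ _) (val-h⁺ (subst (p ν ∣ᵢ_) (l x (+ p ν)) ∣-refl) (λ d → lem (subst (pp ν ∣ᵢ_) (sym (l x (+ p ν))) d))) , ¬q
      where
      l : ∀ x p → p ≡ x + p - x
      l = solve-∀
      lem : ¬ pp ν ∣ᵢ + p ν
      lem d = ℕP.<⇒≱ (ℕP.m<m*n (p ν) (p ν) ⦃ ℕ.>-nonZero (p>0 ν) ⦄ (ℕP.≤-trans (s≤s (s≤s z≤n)) (p≥3 ν))) (ℕD.∣⇒≤ ⦃ ℕ.>-nonZero (p>0 ν) ⦄ (∣⇒∣ᵤ d))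
    ... | yes q = x + + 2 * + p ν , trans (T-val ν _ _) (val-h⁺ (subst (p ν ∣ᵢ_) (l x (+ p ν)) (∣n⇒∣m*n (+ 2) ∣-refl)) (λ d → lem 2 (s≤s z≤n) (p≥3 ν) (subst (pp ν ∣ᵢ_) (sym (l x (+ p ν))) d))) ,
        λ g → lem 1 ℕP.≤-refl (ℕP.≤-trans (s≤s (s≤s z≤n)) (p≥3 ν)) (subst (pp ν ∣ᵢ_) (l₂ x (+ p ν)) (E⁻ (E-trans g (E-sym q))))
      where
      l : ∀ x p → + 2 * p ≡ x + + 2 * p - x
      l = solve-∀
      l₂ : ∀ x p → x + + 2 * p - (x + p) ≡ + 1 * p
      l₂ = solve-∀
      lem : ∀ k → 1 ≤ k → k < p ν → ¬ pp ν ∣ᵢ + k * + p ν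
      lem k 1≤k lt d = ℕP.<⇒≱ lt (ℕD.∣⇒≤ ⦃ ℕ.>-nonZero 1≤k ⦄ (ℕD.*-cancelʳ-∣ (p ν) ⦃ ℕ.>-nonZero (p>0 ν) ⦄ (∣⇒∣ᵤ (subst (pp ν ∣ᵢ_) (sym (ℤP.pos-* k (p ν))) d))))

  Unit : ℤ → Set
  Unit r = ∀ ν → ¬ p ν ∣ᵢ r

  opaque
    val-* : ∀ {ν} r z → ¬ p ν ∣ᵢ r → val ν (r * z) ≡ val ν z
    val-* {ν} r z ¬d = val-cong back (∣n⇒∣m*n r) back₁ (∣n⇒∣m*n r)
      where
      back₁ : p ν ∣ᵢ r * z → p ν ∣ᵢ z
      back₁ d with euclidℤ ν {r} {z} d
      ... | inj₁ g = ⊥-elim (¬d g)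
      ... | inj₂ g = g
      back : pp ν ∣ᵢ r * z → pp ν ∣ᵢ z
      back d with inverse ν r ¬d
      ... | v , g = subst (pp ν ∣ᵢ_) (lem r v z) (∣m∣n⇒∣m-n (∣n⇒∣m*n v d) (∣n⇒∣m*n z g))
        where
        lem : ∀ r v z → v * (r * z) - z * (r * v - 1ℤ) ≡ z
        lem = solve-∀

    transfer : ∀ {ν} u w → val ν u ≡ val ν w → Σ ℤ λ ρ → (¬ p ν ∣ᵢ ρ) × pp ν ∣ᵢ ρ * u - w
    transfer {ν} u w q with vview (val ν u)
    ... | is-e a = 1ℤ , (λ d → lem (ℕD.∣1⇒≡1 (∣⇒∣ᵤ d))) , ∣m∣n⇒∣m-n (∣n⇒∣m*n 1ℤ (val-e⁻ a)) (val-e⁻ (trans (sym q) a))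
      where
      lem : p ν ≢ 1
      lem g with subst (3 ≤_) g (p≥3 ν)
      ... | s≤s ()
    ... | is-n a with inverse ν u (val-n⁻ a)
    ...   | v , g = w * v , ndiv , subst (pp ν ∣ᵢ_) (l u v w) (∣n⇒∣m*n w g)
      where
      l : ∀ u v w → w * (u * v - 1ℤ) ≡ w * v * u - w
      l = solve-∀
      l₂ : ∀ u v w → w * v * u - w * (u * v - 1ℤ) ≡ w
      l₂ = solve-∀
      ndiv : ¬ p ν ∣ᵢ w * v
      ndiv d = val-n⁻ {ν} {w} (trans (sym q) a) (subst (p ν ∣ᵢ_) (l₂ u v w) (∣m∣n⇒∣m-n (∣m⇒∣m*n u d) (∣n⇒∣m*n w (pp⇒p ν g))))
    transfer {ν} u w q | is-h a with val-≢n⁻ {ν} {u} (λ g → absurd (trans (sym a) g)) | val-≢n⁻ {ν} {w} (λ g → absurd (trans (sym (trans (sym q) a)) g))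
      where
      absurd : h ≢ n
      absurd ()
    ... | divides u' refl | divides w' refl with inverse-p ν u' (λ d → absurd (trans (sym a) (val-e⁺ (p∣ᵢ* ν d ∣-refl))))
      where
      absurd : h ≢ e
      absurd ()
    ... | v , g = w' * v , ndiv , subst (pp ν ∣ᵢ_) (l u' v w' (+ p ν)) (p∣ᵢ* ν (∣n⇒∣m*n w' g) ∣-refl)
      where
      absurd : h ≢ e
      absurd ()
      l : ∀ u v w p → w * (u * v - 1ℤ) * p ≡ w * v * (u * p) - w * p
      l = solve-∀
      l₂ : ∀ u v w → w * v * u - w * (u * v - 1ℤ) ≡ w
      l₂ = solve-∀
      ndiv : ¬ p ν ∣ᵢ w' * v
      ndiv d = absurd (trans (sym (trans (sym q) a)) (val-e⁺ (p∣ᵢ* ν (subst (p ν ∣ᵢ_) (l₂ u' v w') (∣m∣n⇒∣m-n (∣m⇒∣m*n u' d) (∣n⇒∣m*n w' g))) ∣-refl)))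

    mix : (Fin 3 → ℤ) → ℤ
    mix c = set 0F (c 0F) (set 1F (c 1F) (c 2F))

    mix-E : ∀ c ν → E ν (mix c) (c ν)
    mix-E c 0F = set-E 0F (c 0F) (set 1F (c 1F) (c 2F))
    mix-E c 1F = E-trans (set-E′ (c 0F) (set 1F (c 1F) (c 2F)) λ ()) (set-E 1F (c 1F) (c 2F))
    mix-E c 2F = E-trans (set-E′ (c 0F) (set 1F (c 1F) (c 2F)) λ ()) (set-E′ (c 1F) (c 2F) λ ())

    ∣-resp-E : ∀ {ν x y} → E ν x y → p ν ∣ᵢ x → p ν ∣ᵢ y
    ∣-resp-E {ν} {x} {y} q d = subst (p ν ∣ᵢ_) (lem x y) (∣m∣n⇒∣m-n d (pp⇒p ν (E⁻ q)))
      where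
      lem : ∀ x y → x - (x - y) ≡ y
      lem = solve-∀

    mix-unit : ∀ c → (∀ ν → ¬ p ν ∣ᵢ c ν) → Unit (mix c)
    mix-unit c g ν d = g ν (∣-resp-E (mix-E c ν) d)

    transfer-all : ∀ u w → (∀ ν → val ν u ≡ val ν w) → Σ ℤ λ r → Unit r × M ∣ᵢ r * u - w
    transfer-all u w q = mix c , mix-unit c (λ ν → proj₁ (proj₂ (t ν))) , M∣ λ ν →
        subst (pp ν ∣ᵢ_) (lem (mix c) (c ν) u w) (∣m∣n⇒∣m+n (∣m⇒∣m*n u (E⁻ (mix-E c ν))) (proj₂ (proj₂ (t ν))))
      where
      t : ∀ ν → Σ ℤ λ ρ → (¬ p ν ∣ᵢ ρ) × pp ν ∣ᵢ ρ * u - w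
      t ν = transfer {ν} u w (q ν)
      c : Fin 3 → ℤ
      c ν = proj₁ (t ν)
      lem : ∀ m c u w → (m - c) * u + (c * u - w) ≡ m * u - w
      lem = solve-∀

  -- Coordinates of a point of the grid of x along p_ν: x + j p_ν modulo p_ν².
  at : Fin 3 → ℤ → ℕ → ℤ
  at ν x k = x + + k * + p ν

  opaque
    small-∤ : ∀ {ν} k → 1 ≤ k → k < p ν → ¬ pp ν ∣ᵢ + k * + p ν
    small-∤ {ν} k 1≤k lt d = ℕP.<⇒≱ lt (ℕD.∣⇒≤ ⦃ ℕ.>-nonZero 1≤k ⦄ (ℕD.*-cancelʳ-∣ (p ν) ⦃ ℕ.>-nonZero (p>0 ν) ⦄
      (∣⇒∣ᵤ (subst (pp ν ∣ᵢ_) (sym (ℤP.pos-* k (p ν))) d))))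

    at-near : ∀ {ν} x k → T ν (at ν x k) x ≢ n
    at-near {ν} x k = ≢n⁺ (subst (p ν ∣ᵢ_) (lem x (+ k * + p ν)) (∣n⇒∣m*n (+ k) ∣-refl))
      where
      lem : ∀ x y → y ≡ x + y - x
      lem = solve-∀

    at-h : ∀ {ν} x k → 1 ≤ k → k < p ν → T ν (at ν x k) x ≡ h
    at-h {ν} x k 1≤k lt = ≢⇒h (at-near x k) λ q → small-∤ k 1≤k lt (subst (pp ν ∣ᵢ_) (lem x (+ k * + p ν)) (E⁻ q))
      where
      lem : ∀ x y → x + y - x ≡ y
      lem = solve-∀

    at-E : ∀ {ν y x} → T ν y x ≢ n → Σ (Fin (p ν)) λ j → E ν y (at ν x (Fin.toℕ j))
    at-E {ν} {y} {x} q = go (≢n⁻ q)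
      where
      l₁ : ∀ j k p → - ((j - k) * p) ≡ k * p - j * p
      l₁ = solve-∀
      l₂ : ∀ y x z → y - x - z ≡ y - (x + z)
      l₂ = solve-∀
      go : p ν ∣ᵢ y - x → Σ (Fin (p ν)) λ j → E ν y (at ν x (Fin.toℕ j))
      go (divides k k≡) = Fin.fromℕ< lt , subst (λ i → E ν y (at ν x i)) (sym (FP.toℕ-fromℕ< lt))
          (E⁺ (subst (pp ν ∣ᵢ_) (trans (l₁ (+ j) k (+ p ν)) (trans (cong (λ z → z - + j * + p ν) (sym k≡)) (l₂ y x (+ j * + p ν))))
            (∣m⇒∣-m (p∣ᵢ* ν {+ j - k} {+ p ν} (proj₂ (proj₂ r)) ∣-refl))))
        where
        r : Σ ℕ λ j → j < p ν × p ν ∣ᵢ (+ j - k)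
        r = reduce (p ν) (p>0 ν) k
        j : ℕ
        j = proj₁ r
        lt : j < p ν
        lt = proj₁ (proj₂ r)

    at-inj : ∀ {ν x} (j j' : Fin (p ν)) → E ν (at ν x (Fin.toℕ j)) (at ν x (Fin.toℕ j')) → j ≡ j'
    at-inj {ν} {x} j j' q = FP.toℕ-injective (ordered (Fin.toℕ j) (Fin.toℕ j') (FP.toℕ<n j) (FP.toℕ<n j') q)
      where
      lem : ∀ x i k p → x + (i + k) * p - (x + i * p) ≡ k * p
      lem = solve-∀
      le : ∀ i k → i < k → k < p ν → ¬ E ν (at ν x k) (at ν x i)
      le i k lt lt' g = small-∤ (k ∸ i) (ℕP.m<n⇒0<n∸m lt) (ℕP.≤-<-trans (ℕP.m∸n≤m k i) lt')
        (subst (pp ν ∣ᵢ_) (trans (cong (λ z → x + z * + p ν - (x + + i * + p ν)) (cong +_ (sym (ℕP.m+[n∸m]≡n (ℕP.<⇒≤ lt)))))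
          (lem x (+ i) (+ (k ∸ i)) (+ p ν))) (E⁻ g))
      ordered : ∀ i k → i < p ν → k < p ν → E ν (at ν x i) (at ν x k) → i ≡ k
      ordered i k lt lt' g with ℕP.<-cmp i k
      ... | tri< a _ _ = ⊥-elim (le i k a lt' (E-sym g))
      ... | tri≈ _ b _ = b
      ... | tri> _ _ c = ⊥-elim (le k i c lt g)

  opaque
    ≈-refl : ∀ {x} → x ≈ x
    ≈-refl {x} = ≈⁺ (subst (M ∣ᵢ_) (sym (ℤP.+-inverseʳ x)) (0∣ᵢ M))

    ≈-sym : ∀ {x y} → x ≈ y → y ≈ x
    ≈-sym {x} {y} (≈⁺ q) = ≈⁺ (∣-swap M x y q)

    ≈-trans : ∀ {x y z} → x ≈ y → y ≈ z → x ≈ z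
    ≈-trans {x} {y} {z} (≈⁺ q) (≈⁺ r) = ≈⁺ (∣-tele M x y z q r)

  record Tiling (A B : ℤ → Set) : Set₁ where
    field
      A?     : ∀ z → Dec (A z)
      A-resp : ∀ {x y} → x ≈ y → A x → A y
      solve  : ∀ {r} → Unit r → ∀ t → Σ ℤ λ a → Σ ℤ λ b → A a × B b × (r * a + b) ≈ t
      uniq   : ∀ {r a a' b b'} → Unit r → A a → A a' → B b → B b' → (r * a + b) ≈ (r * a' + b') → a ≈ a' × b ≈ b'
      b₀     : ℤ
      Bb₀    : B b₀
      search : ∀ {Q R : ℤ → Set} → (∀ b → B b → Q b ⊎ R b) → (∀ b → B b → Q b) ⊎ (Σ ℤ λ b → B b × R b)

  opaque
    unit-1 : Unit 1ℤ
    unit-1 ν d = lem (ℕD.∣1⇒≡1 (∣⇒∣ᵤ d))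
      where
      lem : p ν ≢ 1
      lem q with subst (3 ≤_) q (p≥3 ν)
      ... | s≤s ()

    set-unit : ∀ ν ρ → ¬ p ν ∣ᵢ ρ → Unit (set ν ρ 1ℤ)
    set-unit ν ρ g μ d with μ Fin.≟ ν
    ... | yes refl = g (∣-resp-E (set-E ν ρ 1ℤ) d)
    ... | no q = unit-1 μ (∣-resp-E (set-E′ ρ 1ℤ q) d)

  module Base {A B : ℤ → Set} (t : Tiling A B) where
    open Tiling t public

    opaque
      -- The types of the differences of A and of B are disjoint.
      clash : ∀ {a a' b b'} → A a → A a' → B b → B b' → (∀ ν → T ν a a' ≡ T ν b b') → b ≈ b'
      clash {a} {a'} {b} {b'} Aa Aa' Bb Bb' q with transfer-all (a - a') (b - b') (λ ν → trans (sym (T-val ν a a')) (trans (q ν) (T-val ν b b')))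
      ... | r , ur , d = ≈-sym (proj₂ (uniq ur Aa Aa' Bb' Bb (≈⁺ (subst (M ∣ᵢ_) (lem r a a' b b') d))))
        where
        lem : ∀ r a a' b b' → r * (a - a') - (b - b') ≡ r * a + b' - (r * a' + b)
        lem = solve-∀

    record Sol (x b : ℤ) (r : ℤ) : Set where
      constructor sol
      field
        {z b'} : ℤ
        Az  : A z
        Bb' : B b'
        eq  : (r * (z - x)) ≈ (b - b')

    opaque
      solution : ∀ {r} → Unit r → ∀ x b → Sol x b r
      solution {r} ur x b with solve ur (r * x + b)
      ... | z , b' , Az , Bb' , ≈⁺ d = sol Az Bb' (≈⁺ (subst (M ∣ᵢ_) (lem r z x b b') d))
        where
        lem : ∀ r z x b b' → r * z + b' - (r * x + b) ≡ r * (z - x) - (b - b')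
        lem = solve-∀

      sol-T : ∀ {x b r} → Unit r → (s : Sol x b r) → ∀ ν → T ν (Sol.z s) x ≡ T ν b (Sol.b' s)
      sol-T {x} {b} {r} ur (sol {z} {b'} Az Bb' (≈⁺ d)) ν = trans (T-val ν z x) (trans (sym (val-* r (z - x) (ur ν)))
        (trans (val-cong {ν} {r * (z - x)} {b - b'} (fwd (pp∣M ν)) (bwd (pp∣M ν)) (fwd p∣M) (bwd p∣M)) (sym (T-val ν b b'))))
        where
        l₁ : ∀ x y → x - (x - y) ≡ y
        l₁ = solve-∀
        l₂ : ∀ x y → (x - y) + y ≡ x
        l₂ = solve-∀
        fwd : ∀ {m} → m ℕD.∣ M → m ∣ᵢ r * (z - x) → m ∣ᵢ b - b'
        fwd {m} mM g = subst (m ∣ᵢ_) (l₁ (r * (z - x)) (b - b')) (∣m∣n⇒∣m-n g (∣ᵢ-trans mM d))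
        bwd : ∀ {m} → m ℕD.∣ M → m ∣ᵢ b - b' → m ∣ᵢ r * (z - x)
        bwd {m} mM g = subst (m ∣ᵢ_) (l₂ (r * (z - x)) (b - b')) (∣m∣n⇒∣m+n (∣ᵢ-trans mM d) g)
        p∣M : p ν ℕD.∣ M
        p∣M = ℕD.∣-trans (p∣pp ν) (pp∣M ν)

    record Sol₁ (x b : ℤ) : Set where
      field
        {z b'} : ℤ
        Az  : A z
        Bb' : B b'
        shift : (z - x) ≈ (b - b')
        eqT : ∀ ν → T ν z x ≡ T ν b b'

    opaque
      solution₁ : ∀ x b → Sol₁ x b
      solution₁ x b = record { Az = Sol.Az s ; Bb' = Sol.Bb' s ; shift = subst (_≈ (b - Sol.b' s)) (ℤP.*-identityˡ (Sol.z s - x)) (Sol.eq s)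
                             ; eqT = sol-T unit-1 s }
        where
        s : Sol x b 1ℤ
        s = solution unit-1 x b

      uniq₁ : ∀ {x b z z' c c'} → A z → A z' → B c → B c' → (z - x) ≈ (b - c) → (z' - x) ≈ (b - c') → z ≈ z' × c ≈ c'
      uniq₁ {x} {b} {z} {z'} {c} {c'} Az Az' Bc Bc' (≈⁺ d) (≈⁺ d') = uniq unit-1 Az Az' Bc Bc'
        (≈⁺ (subst (M ∣ᵢ_) (lem x b z z' c c') (∣m∣n⇒∣m-n d d')))
        where
        lem : ∀ x b z z' c c' → (z - x) - (b - c) - ((z' - x) - (b - c')) ≡ 1ℤ * z + c - (1ℤ * z' + c')
        lem = solve-∀

      bispan : ∀ {x a z b b'} → ¬ A x → A a → (∀ μ → T μ x a ≢ n) → A z → B b → B b' → (∀ μ → T μ z x ≡ T μ b b') →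
        ¬ (∀ μ → E μ x a ⊎ (¬ E μ z x × ¬ E μ z a))
      bispan {x} {a} {z} {b} {b'} ¬Ax Aa g Az Bb Bb' q k = ¬Ax (A-resp (E⇒≈ λ μ → trans (q μ) (≈⇒E b≈b' μ)) Az)
        where
        same : ∀ μ → T μ z a ≡ T μ z x
        same μ with k μ
        ... | inj₁ xa = sym (T-Eʳ z xa)
        ... | inj₂ (u , v) with N? μ z x
        ...   | yes w = trans (n-≢n w (g μ)) (sym w)
        ...   | no w = trans (≢⇒h (≢n-trans w (g μ)) v) (sym (≢⇒h w u))
        b≈b' : b ≈ b'
        b≈b' = clash Az Aa Bb Bb' (λ μ → trans (same μ) (q μ))

    Line : Fin 3 → ℤ → ℤ → Set
    Line ν x y = ∀ μ → μ ≢ ν → E μ y x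

    Fiber : Fin 3 → ℤ → Set
    Fiber ν x = ∀ y → T ν y x ≢ n → Line ν x y → A y

    FullLine : Fin 3 → ℤ → Set
    FullLine ν b = ∀ c → Σ ℤ λ b' → B b' × T ν b' c ≢ n × Line ν b b'

    Regular : Fin 3 → Set
    Regular ν = ∀ b → B b → FullLine ν b

    Sparse : Fin 3 → Set
    Sparse ν = ∀ {b b'} → B b → B b' → T ν b b' ≢ n → Line ν b' b → b ≈ b'

    record TypeAt (ν : Fin 3) (x b : ℤ) : Set where
      field
        {z b'} : ℤ
        Az    : A z
        Bb'   : B b'
        shift : (z - x) ≈ (b - b')
        far   : T ν z x ≡ n
        line  : Line ν x z
        far'  : T ν b b' ≡ n
        line' : Line ν b' b

    mkType : ∀ {ν x b} (s : Sol₁ x b) → T ν (Sol₁.z s) x ≡ n → Line ν x (Sol₁.z s) → TypeAt ν x b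
    mkType s f l = record { Az = Sol₁.Az s ; Bb' = Sol₁.Bb' s ; shift = Sol₁.shift s ; far = f ; line = l
      ; far' = trans (sym (Sol₁.eqT s _)) f ; line' = λ μ q → trans (sym (Sol₁.eqT s μ)) (l μ q) }

    record Shiftable (ν : Fin 3) (x : ℤ) : Set where
      field
        {z}   : ℤ
        far   : T ν z x ≡ n
        line  : Line ν x z
        fiber : Fiber ν z

    Localised : Fin 3 → ℤ → ℤ → Set
    Localised ν x b = ∀ {z b'} → A z → B b' → (∀ μ → T μ z x ≡ T μ b b') → E ν z x ⊎ (T ν z x ≡ n × Line ν x z)

    -- Multiplying A by units that are 1 outside p_ν moves a solution along its ν-line, which sweeps out
    -- a whole fiber of A on one side and a whole line of B on the other.
    module _ {ν : Fin 3} {x b : ℤ} (Bb : B b) (ty : TypeAt ν x b) (loc : Localised ν x b) (sp : Sparse ν) where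
      open TypeAt ty

      private
        Moved : ℤ → Set
        Moved ρ = Σ ℤ λ z' → Σ ℤ λ c → A z' × B c × (T ν z' x ≡ n) × Line ν x z' × Line ν b c ×
          T ν z' z ≢ n × pp ν ∣ᵢ ρ * (z' - x) - (b - c)

        at-ν : ∀ r ρ z x b c → (r * (z - x) - (b - c)) - (r - ρ) * (z - x) ≡ ρ * (z - x) - (b - c)
        at-ν = solve-∀

        at-μ : ∀ r z x b c → (r * (z - x) - (b - c)) - (r - 1ℤ) * (z - x) ≡ z - x - (b - c)
        at-μ = solve-∀

        trivial : ∀ ρ (ndiv : ¬ p ν ∣ᵢ ρ) (s : Sol x b (set ν ρ 1ℤ)) → ¬ E ν (Sol.z s) x
        trivial ρ ndiv s ez = n⇒¬E far (E-trans (≈⇒E (proj₁ (uniq₁ {x} {b} Az (Sol.Az s) Bb' (Sol.Bb' s) shift (≈⁺ (M∣ close)))) ν) ez)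
          where
          d = ≈⁻ (Sol.eq s)
          close : ∀ μ → pp μ ∣ᵢ Sol.z s - x - (b - Sol.b' s)
          close μ with μ Fin.≟ ν
          ... | yes refl = subst (pp ν ∣ᵢ_) (at-μ (set ν ρ 1ℤ) (Sol.z s) x b (Sol.b' s))
                (∣m∣n⇒∣m-n (∣ᵢ-trans (pp∣M ν) d) (∣n⇒∣m*n (set ν ρ 1ℤ - 1ℤ) (E⁻ ez)))
          ... | no q = subst (pp μ ∣ᵢ_) (at-μ (set ν ρ 1ℤ) (Sol.z s) x b (Sol.b' s))
                (∣m∣n⇒∣m-n (∣ᵢ-trans (pp∣M μ) d) (∣m⇒∣m*n (Sol.z s - x) (E⁻ (set-E′ ρ 1ℤ q))))

        moved : ∀ ρ (ndiv : ¬ p ν ∣ᵢ ρ) (s : Sol x b (set ν ρ 1ℤ)) → T ν (Sol.z s) x ≡ n → Line ν x (Sol.z s) → Moved ρ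
        moved ρ ndiv s f ln = Sol.z s , Sol.b' s , Sol.Az s , Sol.Bb' s , f , ln , ln' , near ,
            subst (pp ν ∣ᵢ_) (at-ν (set ν ρ 1ℤ) ρ (Sol.z s) x b (Sol.b' s))
              (∣m∣n⇒∣m-n (∣ᵢ-trans (pp∣M ν) (≈⁻ (Sol.eq s))) (∣m⇒∣m*n (Sol.z s - x) (E⁻ (set-E ν ρ 1ℤ))))
          where
          ln' : Line ν b (Sol.b' s)
          ln' μ q = E-sym (trans (sym (sol-T (set-unit ν ρ ndiv) s μ)) (ln μ q))
          vec : T ν (Sol.z s) z ≡ n → ∀ μ → T μ (Sol.z s) z ≡ T μ b b'
          vec g μ with μ Fin.≟ ν
          ... | yes refl = trans g (sym far')
          ... | no q = trans (E-trans (ln μ q) (E-sym (line μ q))) (sym (line' μ q))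
          near : T ν (Sol.z s) z ≢ n
          near g = n⇒¬E far' (≈⇒E (clash (Sol.Az s) Az Bb Bb' (vec g)) ν)

        move : ∀ ρ → ¬ p ν ∣ᵢ ρ → Moved ρ
        move ρ ndiv = split (loc (Sol.Az s) (Sol.Bb' s) (sol-T (set-unit ν ρ ndiv) s))
          where
          s = solution (set-unit ν ρ ndiv) x b
          split : E ν (Sol.z s) x ⊎ (T ν (Sol.z s) x ≡ n × Line ν x (Sol.z s)) → Moved ρ
          split (inj₁ ez) = ⊥-elim (trivial ρ ndiv s ez)
          split (inj₂ (f , ln)) = moved ρ ndiv s f ln

        l₁ : ∀ ρ z' y x z b c b' → (ρ * (z' - x) - (b - c)) - ρ * (z' - z) + ρ * (y - z) - (ρ * (y - x) - (z - x)) - ((z - x) - (b - b'))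
          ≡ c - b'
        l₁ = solve-∀
        l₂ : ∀ ρ z' y x z b c b' → (ρ * (z' - x) - (b - c)) - (c - b') - (ρ * (y - x) - (z - x)) - ((z - x) - (b - b')) ≡ ρ * (z' - y)
        l₂ = solve-∀
        l₃ : ∀ ρ z' x z b c c₀ → (ρ * (z' - x) - (b - c)) - ρ * (z' - z) - (ρ * (z - x) - (b - c₀)) ≡ c - c₀
        l₃ = solve-∀

        reach : ∀ y → T ν y z ≢ n → Line ν x y → ∀ ρ → ¬ p ν ∣ᵢ ρ → pp ν ∣ᵢ ρ * (y - x) - (z - x) → Moved ρ → A y
        reach y near ly ρ ndiv dρ (z' , c , Az' , Bc , f , ln , ln' , nr , d) = A-resp (E⇒≈ fin) Az'
          where
          c≈b' : c ≈ b'
          c≈b' = sp Bc Bb' (≢n⁺ (subst (p ν ∣ᵢ_) (l₁ ρ z' y x z b c b') (∣m∣n⇒∣m-n (∣m∣n⇒∣m-n (∣m∣n⇒∣m+n (∣m∣n⇒∣m-n (pp⇒p ν d)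
              (∣n⇒∣m*n ρ (≢n⁻ nr))) (∣n⇒∣m*n ρ (≢n⁻ near))) (pp⇒p ν dρ)) (∣ᵢ-trans (ℕD.∣-trans (p∣pp ν) (pp∣M ν)) (≈⁻ shift)))))
            (λ μ q → E-trans (ln' μ q) (line' μ q))
          fin : ∀ μ → E μ z' y
          fin μ with μ Fin.≟ ν
          ... | no q = E-trans (ln μ q) (E-sym (ly μ q))
          ... | yes refl = E⁺ (val-e⁻ (trans (sym (val-* ρ (z' - y) ndiv)) (val-e⁺ (subst (pp ν ∣ᵢ_) (l₂ ρ z' y x z b c b')
                 (∣m∣n⇒∣m-n (∣m∣n⇒∣m-n (∣m∣n⇒∣m-n d (E⁻ (≈⇒E c≈b' ν))) dρ) (∣ᵢ-trans (pp∣M ν) (≈⁻ shift)))))))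

        hit : ∀ c₀ ρ → pp ν ∣ᵢ ρ * (z - x) - (b - c₀) → Moved ρ → Σ ℤ λ c → B c × T ν c c₀ ≢ n × Line ν b c
        hit c₀ ρ dρ (z' , c , Az' , Bc , f , ln , ln' , nr , d) = c , Bc ,
          ≢n⁺ (subst (p ν ∣ᵢ_) (l₃ ρ z' x z b c c₀) (∣m∣n⇒∣m-n (∣m∣n⇒∣m-n (pp⇒p ν d) (∣n⇒∣m*n ρ (≢n⁻ nr))) (pp⇒p ν dρ))) , ln'

        transferT : ∀ u v u' v' → T ν u v ≡ T ν u' v' → Σ ℤ λ ρ → (¬ p ν ∣ᵢ ρ) × pp ν ∣ᵢ ρ * (u - v) - (u' - v')
        transferT u v u' v' q = transfer {ν} (u - v) (u' - v') (trans (sym (T-val ν u v)) (trans q (T-val ν u' v')))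

      sweep-fiber : Fiber ν z
      sweep-fiber y near ly = reach y near (λ μ q → E-trans (ly μ q) (line μ q)) (proj₁ tr) (proj₁ (proj₂ tr)) (proj₂ (proj₂ tr)) (move (proj₁ tr) (proj₁ (proj₂ tr)))
        where
        tr = transferT y x z x (trans (≢n-n near far) (sym far))

      sweep-line : FullLine ν b
      sweep-line c₀ with N? ν b c₀
      ... | no g = b , Bb , g , λ μ q → E-refl
      ... | yes g = hit c₀ (proj₁ tr) (proj₂ (proj₂ tr)) (move (proj₁ tr) (proj₁ (proj₂ tr)))
        where
        tr = transferT z x b c₀ (trans far (sym g))

      sweep : Shiftable ν x
      sweep = record { far = far ; line = line ; fiber = sweep-fiber }

  -- A labelling (α, β, γ) of the three primes.
  module Labels (α β γ : Fin 3) (d : Distinct3 p α β γ) where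
    α≢β : α ≢ β
    α≢β = proj₁ d
    β≢γ : β ≢ γ
    β≢γ = proj₁ (proj₂ d)
    α≢γ : α ≢ γ
    α≢γ = proj₂ (proj₂ d)

    cover : ∀ μ → μ ≡ α ⊎ μ ≡ β ⊎ μ ≡ γ
    cover μ with μ Fin.≟ α | μ Fin.≟ β | μ Fin.≟ γ
    ... | yes q | _ | _ = inj₁ q
    ... | no _ | yes q | _ = inj₂ (inj₁ q)
    ... | no _ | no _ | yes q = inj₂ (inj₂ q)
    ... | no a | no b | no c = ⊥-elim (four α β γ μ α≢β β≢γ α≢γ a b c)
      where
      four : ∀ (α β γ μ : Fin 3) → α ≢ β → β ≢ γ → α ≢ γ → μ ≢ α → μ ≢ β → μ ≢ γ → ⊥
      four 0F 0F _ _ a _ _ _ _ _ = a refl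
      four 1F 1F _ _ a _ _ _ _ _ = a refl
      four 2F 2F _ _ a _ _ _ _ _ = a refl
      four _ 0F 0F _ _ a _ _ _ _ = a refl
      four _ 1F 1F _ _ a _ _ _ _ = a refl
      four _ 2F 2F _ _ a _ _ _ _ = a refl
      four 0F _ 0F _ _ _ a _ _ _ = a refl
      four 1F _ 1F _ _ _ a _ _ _ = a refl
      four 2F _ 2F _ _ _ a _ _ _ = a refl
      four 0F _ _ 0F _ _ _ a _ _ = a refl
      four 1F _ _ 1F _ _ _ a _ _ = a refl
      four 2F _ _ 2F _ _ _ a _ _ = a refl
      four _ 0F _ 0F _ _ _ _ a _ = a refl
      four _ 1F _ 1F _ _ _ _ a _ = a refl
      four _ 2F _ 2F _ _ _ _ a _ = a refl
      four _ _ 0F 0F _ _ _ _ _ a = a refl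
      four _ _ 1F 1F _ _ _ _ _ a = a refl
      four _ _ 2F 2F _ _ _ _ _ a = a refl

    all3 : {P : Fin 3 → Set} → P α → P β → P γ → ∀ μ → P μ
    all3 {P} a b c μ with cover μ
    ... | inj₁ refl = a
    ... | inj₂ (inj₁ refl) = b
    ... | inj₂ (inj₂ refl) = c

    lineα : {P : Fin 3 → Set} → P β → P γ → ∀ μ → μ ≢ α → P μ
    lineα {P} b c μ q with cover μ
    ... | inj₁ r = ⊥-elim (q r)
    ... | inj₂ (inj₁ refl) = b
    ... | inj₂ (inj₂ refl) = c

    lineβ : {P : Fin 3 → Set} → P α → P γ → ∀ μ → μ ≢ β → P μ
    lineβ {P} a c μ q with cover μ
    ... | inj₁ refl = a
    ... | inj₂ (inj₁ r) = ⊥-elim (q r)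
    ... | inj₂ (inj₂ refl) = c

    lineγ : {P : Fin 3 → Set} → P α → P β → ∀ μ → μ ≢ γ → P μ
    lineγ {P} a b μ q with cover μ
    ... | inj₁ refl = a
    ... | inj₂ (inj₁ refl) = b
    ... | inj₂ (inj₂ r) = ⊥-elim (q r)

    pt : ℤ → ℤ → ℤ → ℤ
    pt u v w = set α u (set β v w)

    ptα : ∀ u v w → E α (pt u v w) u
    ptα u v w = set-E α u (set β v w)

    ptβ : ∀ u v w → E β (pt u v w) v
    ptβ u v w = E-trans (set-E′ u (set β v w) λ q → α≢β (sym q)) (set-E β v w)

    ptγ : ∀ u v w → E γ (pt u v w) w
    ptγ u v w = E-trans (set-E′ u (set β v w) λ q → α≢γ (sym q)) (set-E′ v w λ q → β≢γ (sym q))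

  -- A finite set of residues modulo p² that is invariant under translation by p has cardinality divisible by p.
  module _ {ν : Fin 3} {N : ℕ} (f : Fin N → ℤ) (inj : ∀ {j j'} → pp ν ∣ᵢ f j - f j' → j ≡ j')
      (up : ∀ j → Σ (Fin N) λ j' → pp ν ∣ᵢ f j' - (f j + + p ν)) (down : ∀ j → Σ (Fin N) λ j' → pp ν ∣ᵢ f j' - (f j - + p ν)) where
    private
      r : Fin N → ℕ
      r j = proj₁ (reduce (pp ν) (pp>0 ν) (f j))
      r≡ : ∀ j → pp ν ∣ᵢ (+ r j - f j)
      r≡ j = proj₂ (proj₂ (reduce (pp ν) (pp>0 ν) (f j)))

      to-f : ∀ j c → pp ν ∣ᵢ c - + r j → pp ν ∣ᵢ f j - c
      to-f j c q = subst (pp ν ∣ᵢ_) (lem (f j) c (+ r j)) (∣m⇒∣-m (∣m∣n⇒∣m+n q (r≡ j)))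
        where
        lem : ∀ f c r → - ((c - r) + (r - f)) ≡ f - c
        lem = solve-∀

      to-r : ∀ j c → pp ν ∣ᵢ f j - c → pp ν ∣ᵢ c - + r j
      to-r j c q = subst (pp ν ∣ᵢ_) (lem (f j) c (+ r j)) (∣m⇒∣-m (∣m∣n⇒∣m+n q (r≡ j)))
        where
        lem : ∀ f c r → - ((f - c) + (r - f)) ≡ c - r
        lem = solve-∀

      ∣-trans′ : ∀ a b c → pp ν ∣ᵢ a - b → pp ν ∣ᵢ c - b → pp ν ∣ᵢ a - c
      ∣-trans′ a b c q q' = subst (pp ν ∣ᵢ_) (lem a b c) (∣m∣n⇒∣m-n q q')
        where
        lem : ∀ a b c → (a - b) - (c - b) ≡ a - c
        lem = solve-∀

      absent : ∀ c js → (∀ {j} → j ∈ˡ js → ¬ pp ν ∣ᵢ f j - c) → count (pp ν) c (map r js) ≡ 0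
      absent c [] g = refl
      absent c (j ∷ js) g = cong₂ ℕ._+_ (ind-no (pp ν ∣ᵢ? (c - + r j)) (λ q → g (here refl) (to-f j c q))) (absent c js (λ i → g (there i)))

      single : ∀ c js → Unique js → ∀ {j} → j ∈ˡ js → pp ν ∣ᵢ f j - c → count (pp ν) c (map r js) ≡ 1
      single c (j ∷ js) (j∉ ∷ us) (here refl) q = cong₂ ℕ._+_ (ind-yes (pp ν ∣ᵢ? (c - + r j)) (to-r j c q))
        (absent c js λ {j'} i q' → All.lookup j∉ i (inj (∣-trans′ (f j) c (f j') q q')))
      single c (j' ∷ js) (j∉ ∷ us) {j} (there i) q = cong₂ ℕ._+_ (ind-no (pp ν ∣ᵢ? (c - + r j')) (λ q' →
          All.lookup j∉ i (inj (∣-trans′ (f j') c (f j) (to-f j' c q') q)))) (single c js us i q)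

      es : List ℕ
      es = map r (allFin N)

      periodic : ∀ c → count (pp ν) (+ p ν + c) es ≡ count (pp ν) c es
      periodic c = go (any? λ j → pp ν ∣ᵢ? (f j - c))
        where
        lu : ∀ f f' c p → (f' - (f + p)) + (f - c) ≡ f' - (p + c)
        lu = solve-∀
        ld : ∀ f f' c p → (f' - (f - p)) + (f - (p + c)) ≡ f' - c
        ld = solve-∀
        go : Dec (∃ λ j → pp ν ∣ᵢ f j - c) → count (pp ν) (+ p ν + c) es ≡ count (pp ν) c es
        go (yes (j , q)) = trans (single (+ p ν + c) (allFin N) (allFin⁺ N) (∈-allFin (proj₁ (up j)))
            (subst (pp ν ∣ᵢ_) (lu (f j) (f (proj₁ (up j))) c (+ p ν)) (∣m∣n⇒∣m+n (proj₂ (up j)) q)))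
          (sym (single c (allFin N) (allFin⁺ N) (∈-allFin j) q))
        go (no ¬q) = trans (absent (+ p ν + c) (allFin N) λ {j} _ q → ¬q (proj₁ (down j) ,
            subst (pp ν ∣ᵢ_) (ld (f j) (f (proj₁ (down j))) c (+ p ν)) (∣m∣n⇒∣m+n (proj₂ (down j)) q)))
          (sym (absent c (allFin N) λ {j} _ q → ¬q (j , q)))

    orbit-divides : p ν ℕD.∣ N
    orbit-divides = ∣⇒∣ᵤ (subst (p ν ∣ᵢ_) (trans (total-polyOf es) (cong +_ (trans (LP.length-map r (allFin N)) (LP.length-tabulate {n = N} (λ j → j)))))
      (periodic⇒∣total (p ν) (p ν) (polyOf es) (pp>0 ν) λ c →
        trans (fold-polyOf (pp ν) (+ p ν + c) es) (trans (cong +_ (periodic c)) (sym (fold-polyOf (pp ν) c es)))))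

  opaque
    conv : ∀ {ν a a₀ b b₀ t} → E ν a a₀ → E ν b b₀ → T ν a₀ b₀ ≡ t → T ν a b ≡ t
    conv q r s = trans (T-Eˡ _ q) (trans (T-Eʳ _ r) s)

  pick : ∀ {P : Set} → Dec P → ¬ ¬ P → P
  pick (yes q) _ = q
  pick (no ¬q) r = ⊥-elim (r ¬q)

  module Clashes {A B : ℤ → Set} (t : Tiling A B) (α β γ : Fin 3) (d : Distinct3 p α β γ) where
    open Base t public
    open Labels α β γ d public

    -- A witness for the difference type (u, v, w) in A.
    record DivA (u v w : V) : Set where
      constructor divA
      field
        {a a'} : ℤ
        Aa  : A a
        Aa' : A a'
        qα  : T α a a' ≡ u
        qβ  : T β a a' ≡ v
        qγ  : T γ a a' ≡ w

    opaque
      excl : ∀ {u v w b b'} → DivA u v w → B b → B b' → T α b b' ≡ u → T β b b' ≡ v → T γ b b' ≡ w →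
        ¬ (u ≡ e → v ≡ e → w ≡ e → ⊥)
      excl {u} {v} {w} {b} {b'} (divA Aa Aa' qα qβ qγ) Bb Bb' rα rβ rγ k =
        k (trans (sym rα) (q α)) (trans (sym rβ) (q β)) (trans (sym rγ) (q γ))
        where
        q : ∀ ν → E ν b b'
        q = ≈⇒E (clash Aa Aa' Bb Bb' (all3 (trans qα (sym rα)) (trans qβ (sym rβ)) (trans qγ (sym rγ))))

    opaque
      offset : ∀ ν x → Σ ℤ λ u → T ν u x ≡ h
      offset ν x = let u , q , _ = avoid ν x x in u , q

    opaque
      second : ∀ {ν x u} → T ν u x ≡ h → Σ ℤ λ u' → T ν u' x ≡ h × T ν u u' ≡ h
      second {ν} {x} {u} q = let u' , r , s = avoid ν x u in
        u' , r , ≢⇒h (≢n-trans (h⇒≢n q) (≢n-sym (h⇒≢n r))) (λ g → s (E-sym g))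

    opaque
      hn : ∀ {ν x y z} → T ν x y ≡ h → T ν y z ≡ n → T ν x z ≡ n
      hn q r = ≢n-n (h⇒≢n q) r

    opaque
      symT : ∀ {ν x y t} → T ν x y ≡ t → T ν y x ≡ t
      symT {ν} {x} {y} q = trans (T-sym y x) q

  module Center {A B : ℤ → Set} (t : Tiling A B) (α β γ : Fin 3) (d : Distinct3 p α β γ) (x : ℤ)
      (inα : ∀ {y} → T α y x ≡ h → E β y x → E γ y x → A y)
      (inβγ : ∀ {y} → E α y x → T β y x ≡ h → T γ y x ≡ h → A y)
      (only : ∀ {y} → A y → (∀ ν → T ν y x ≢ n) → (T α y x ≡ h × E β y x × E γ y x) ⊎ (E α y x × T β y x ≡ h × T γ y x ≡ h)) where
    open Clashes t α β γ d

    opaque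
      ¬Ax : ¬ A x
      ¬Ax Ax with only Ax (λ ν q → n⇒¬E q E-refl)
      ... | inj₁ (q , _) = h⇒¬E q E-refl
      ... | inj₂ (_ , q , _) = h⇒¬E q E-refl

    private
      u₁ = proj₁ (offset α x)
      hu₁ = proj₂ (offset α x)
      u₂ = proj₁ (second hu₁)
      hu₂ = proj₁ (proj₂ (second hu₁))
      v₁ = proj₁ (offset β x)
      hv₁ = proj₂ (offset β x)
      v₂ = proj₁ (second hv₁)
      hv₂ = proj₁ (proj₂ (second hv₁))
      w₁ = proj₁ (offset γ x)
      hw₁ = proj₂ (offset γ x)
      w₂ = proj₁ (second hw₁)
      hw₂ = proj₁ (proj₂ (second hw₁))

    opaque
      axis : ∀ {u} → T α u x ≡ h → A (pt u x x)
      axis {u} q = inα (conv (ptα u x x) E-refl q) (ptβ u x x) (ptγ u x x)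

    opaque
      plane : ∀ {v w} → T β v x ≡ h → T γ w x ≡ h → A (pt x v w)
      plane {v} {w} q r = inβγ (ptα x v w) (conv (ptβ x v w) E-refl q) (conv (ptγ x v w) E-refl r)

    opaque
      hee : DivA h e e
      hee = divA (axis hu₁) (axis hu₂) (conv (ptα u₁ x x) (ptα u₂ x x) (proj₂ (proj₂ (second hu₁))))
        (conv (ptβ u₁ x x) (ptβ u₂ x x) E-refl) (conv (ptγ u₁ x x) (ptγ u₂ x x) E-refl)

    opaque
      ehe : DivA e h e
      ehe = divA (plane hv₁ hw₁) (plane hv₂ hw₁) (conv (ptα x v₁ w₁) (ptα x v₂ w₁) E-refl)
        (conv (ptβ x v₁ w₁) (ptβ x v₂ w₁) (proj₂ (proj₂ (second hv₁)))) (conv (ptγ x v₁ w₁) (ptγ x v₂ w₁) E-refl)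

    opaque
      eeh : DivA e e h
      eeh = divA (plane hv₁ hw₁) (plane hv₁ hw₂) (conv (ptα x v₁ w₁) (ptα x v₁ w₂) E-refl)
        (conv (ptβ x v₁ w₁) (ptβ x v₁ w₂) E-refl) (conv (ptγ x v₁ w₁) (ptγ x v₁ w₂) (proj₂ (proj₂ (second hw₁))))

    opaque
      ehh : DivA e h h
      ehh = divA (plane hv₁ hw₁) (plane hv₂ hw₂) (conv (ptα x v₁ w₁) (ptα x v₂ w₂) E-refl)
        (conv (ptβ x v₁ w₁) (ptβ x v₂ w₂) (proj₂ (proj₂ (second hv₁)))) (conv (ptγ x v₁ w₁) (ptγ x v₂ w₂) (proj₂ (proj₂ (second hw₁))))

    opaque
      hhh : DivA h h h
      hhh = divA (axis hu₁) (plane hv₁ hw₁) (conv (ptα u₁ x x) (ptα x v₁ w₁) hu₁)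
        (conv (ptβ u₁ x x) (ptβ x v₁ w₁) (symT hv₁)) (conv (ptγ u₁ x x) (ptγ x v₁ w₁) (symT hw₁))

    opaque
      cross : ∀ {z b b'} → A z → B b → B b' → (∀ μ → T μ z x ≡ T μ b b') → E α z x × (E β z x ⊎ E γ z x)
      cross {z} {b} {b'} Az Bb Bb' q = pick (E? α z x) onα , onβγ (E? β z x) (E? γ z x)
        where
        onα : ¬ ¬ E α z x
        onα ¬q = let u , hu , ¬zu = avoid α x z in
          bispan ¬Ax (axis hu) (all3 (h⇒≢n (conv E-refl (ptα u x x) (symT hu))) (E⇒≢n (E-sym (ptβ u x x))) (E⇒≢n (E-sym (ptγ u x x))))
            Az Bb Bb' q (all3 (inj₂ (¬q , λ g → ¬zu (E-sym (E-trans g (ptα u x x))))) (inj₁ (E-sym (ptβ u x x))) (inj₁ (E-sym (ptγ u x x))))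
        onβγ : Dec (E β z x) → Dec (E γ z x) → E β z x ⊎ E γ z x
        onβγ (yes r) _ = inj₁ r
        onβγ _ (yes r) = inj₂ r
        onβγ (no ¬r) (no ¬s) = let v , hv , ¬zv = avoid β x z ; w , hw , ¬zw = avoid γ x z in
          ⊥-elim (bispan ¬Ax (plane hv hw)
            (all3 (E⇒≢n (E-sym (ptα x v w))) (h⇒≢n (conv E-refl (ptβ x v w) (symT hv))) (h⇒≢n (conv E-refl (ptγ x v w) (symT hw))))
            Az Bb Bb' q (all3 (inj₁ (E-sym (ptα x v w))) (inj₂ (¬r , λ g → ¬zv (E-sym (E-trans g (ptβ x v w)))))
              (inj₂ (¬s , λ g → ¬zw (E-sym (E-trans g (ptγ x v w)))))))

    opaque
      sparseβ : Sparse β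
      sparseβ {b} {b'} Bb Bb' q l with E? β b b'
      ... | yes r = E⇒≈ (all3 (l α α≢β) r (l γ λ g → β≢γ (sym g)))
      ... | no r = ⊥-elim (excl ehe Bb Bb' (l α α≢β) (≢⇒h q r) (l γ λ g → β≢γ (sym g)) λ _ ())

    opaque
      sparseγ : Sparse γ
      sparseγ {b} {b'} Bb Bb' q l with E? γ b b'
      ... | yes r = E⇒≈ (all3 (l α α≢γ) (l β β≢γ) r)
      ... | no r = ⊥-elim (excl eeh Bb Bb' (l α α≢γ) (l β β≢γ) (≢⇒h q r) λ _ _ ())

    opaque
      onβ : ∀ {z b b'} → B b → B b' → (∀ μ → T μ z x ≡ T μ b b') → ¬ E β z x → E α z x → E γ z x → T β z x ≡ n
      onβ {z} {b} {b'} Bb Bb' q ¬r a c with vview (T β z x)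
      ... | is-e r = ⊥-elim (¬r r)
      ... | is-h r = ⊥-elim (excl ehe Bb Bb' (trans (sym (q α)) a) (trans (sym (q β)) r) (trans (sym (q γ)) c) λ _ ())
      ... | is-n r = r

    opaque
      onγ : ∀ {z b b'} → B b → B b' → (∀ μ → T μ z x ≡ T μ b b') → ¬ E γ z x → E α z x → E β z x → T γ z x ≡ n
      onγ {z} {b} {b'} Bb Bb' q ¬r a c with vview (T γ z x)
      ... | is-e r = ⊥-elim (¬r r)
      ... | is-h r = ⊥-elim (excl eeh Bb Bb' (trans (sym (q α)) a) (trans (sym (q β)) c) (trans (sym (q γ)) r) λ _ _ ())
      ... | is-n r = r

    opaque
      localβ : ∀ b → B b → Localised β x b
      localβ b Bb {z} {b'} Az Bb' q with cross Az Bb Bb' q | E? β z x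
      ... | a , _ | yes r = inj₁ r
      ... | a , inj₁ r | no _ = inj₁ r
      ... | a , inj₂ c | no ¬r = inj₂ (onβ Bb Bb' q ¬r a c , lineβ a c)

    opaque
      localγ : ∀ b → B b → Localised γ x b
      localγ b Bb {z} {b'} Az Bb' q with cross Az Bb Bb' q | E? γ z x
      ... | a , _ | yes r = inj₁ r
      ... | a , inj₂ r | no _ = inj₁ r
      ... | a , inj₁ c | no ¬r = inj₂ (onγ Bb Bb' q ¬r a c , lineγ a c)

    opaque
      kind : ∀ b → B b → TypeAt β x b ⊎ TypeAt γ x b
      kind b Bb = go (solution₁ x b)
        where
        go : Sol₁ x b → TypeAt β x b ⊎ TypeAt γ x b
        go s with cross (Sol₁.Az s) Bb (Sol₁.Bb' s) (Sol₁.eqT s) | E? β (Sol₁.z s) x | E? γ (Sol₁.z s) x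
        ... | a , _ | yes r | yes r' = ⊥-elim (¬Ax (A-resp (E⇒≈ (all3 a r r')) (Sol₁.Az s)))
        ... | a , _ | yes r | no ¬c = inj₂ (mkType s (onγ Bb (Sol₁.Bb' s) (Sol₁.eqT s) ¬c a r) (lineγ a r))
        ... | a , _ | no ¬r | yes c = inj₁ (mkType s (onβ Bb (Sol₁.Bb' s) (Sol₁.eqT s) ¬r a c) (lineβ a c))
        ... | a , inj₁ r | no ¬r | no _ = ⊥-elim (¬r r)
        ... | a , inj₂ c | no _ | no ¬c = ⊥-elim (¬c c)

    -- Both kinds of line at x occur: b is of type β, while z* lies on the γ-line of x.
    module Mixed {b z* : ℤ} (Bb : B b) (tb : TypeAt β x b)
        (Az* : A z*) (z*α : E α z* x) (z*β : E β z* x) (z*γ : T γ z* x ≡ n) where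
      open TypeAt tb using () renaming (z to zβ; Az to Azβ; far to farβ; line to lineZ; b' to b₁; Bb' to Bb₁; far' to far₁; line' to line₁)

      zβα : E α zβ x
      zβα = lineZ α α≢β
      zβγ : E γ zβ x
      zβγ = lineZ γ λ g → β≢γ (sym g)

      opaque
        hne : DivA h n e
        hne = divA (axis hu₁) Azβ (conv (ptα u₁ x x) zβα hu₁) (conv (ptβ u₁ x x) E-refl (symT farβ)) (conv (ptγ u₁ x x) zβγ E-refl)

      opaque
        hen : DivA h e n
        hen = divA (axis hu₁) Az* (conv (ptα u₁ x x) z*α hu₁) (conv (ptβ u₁ x x) z*β E-refl) (conv (ptγ u₁ x x) E-refl (symT z*γ))

      opaque
        ehn : DivA e h n
        ehn = divA (plane hv₁ hw₁) Az* (conv (ptα x v₁ w₁) z*α E-refl) (conv (ptβ x v₁ w₁) z*β hv₁) (conv (ptγ x v₁ w₁) E-refl (hn hw₁ (symT z*γ)))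

      opaque
        enn : DivA e n n
        enn = divA Azβ Az* (conv zβα z*α E-refl) (conv E-refl z*β farβ) (conv zβγ E-refl (symT z*γ))

      opaque
        exclN : ∀ {s t b'} → DivA s n t → B b' → T α b b' ≡ s → T β b b' ≢ n → T γ b b' ≡ t → ⊥
        exclN w Bb' qα qβ qγ = excl w Bb₁ Bb' (trans (T-Eˡ _ (E-sym (line₁ α α≢β))) qα) (n-≢n (symT far₁) qβ)
          (trans (T-Eˡ _ (E-sym (line₁ γ λ g → β≢γ (sym g)))) qγ) λ _ ()

      -- b' differs from b by x − u at p_α, and by a nonzero multiple of p_γ at p_γ.
      Step : ℤ → Set
      Step u = Σ ℤ λ b' → B b' × pp α ∣ᵢ (b - b') - (x - u) × E β b b' × T γ b b' ≡ h

      Stray : ℤ → ℤ → Set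
      Stray u v = Σ ℤ λ b' → B b' × pp α ∣ᵢ (b - b') - (x - u) × pp β ∣ᵢ (b - b') - (x - v) × T γ b b' ≡ n

      opaque
        diff : ∀ {ν z y b' a c} → (z - y) ≈ (b - b') → E ν z a → E ν y c → pp ν ∣ᵢ (b - b') - (a - c)
        diff {ν} {z} {y} {b'} {a} {c} (≈⁺ m) q r = subst (pp ν ∣ᵢ_) (lem (b - b') z y a c)
          (∣m∣n⇒∣m-n (∣m∣n⇒∣m-n (E⁻ q) (E⁻ r)) (∣ᵢ-trans (pp∣M ν) m))
          where
          lem : ∀ k z y a c → (z - a) - (y - c) - ((z - y) - k) ≡ k - (a - c)
          lem = solve-∀

      rowAt : ∀ {u v} → T α u x ≡ h → T β v x ≡ h → Sol₁ (pt u v x) b → Step u ⊎ Stray u v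
      rowAt {u} {v} hu hv s = split (pick2 (E? β z y) (E? β z x) fβ) (pick3 (E? α z y) (E? α z x) (E? γ z x) fαγ)
        where
        y = pt u v x
        z = Sol₁.z s
        b' = Sol₁.b' s
        Az = Sol₁.Az s
        Bb' = Sol₁.Bb' s
        q = Sol₁.eqT s
        yα : T α y x ≡ h
        yα = conv (ptα u v x) E-refl hu
        yβ : T β y x ≡ h
        yβ = conv (ptβ u v x) E-refl hv
        yγ : E γ y x
        yγ = ptγ u v x
        ¬Ay : ¬ A y
        ¬Ay Ay with only Ay (all3 (h⇒≢n yα) (h⇒≢n yβ) (E⇒≢n yγ))
        ... | inj₁ (_ , g , _) = h⇒¬E yβ g
        ... | inj₂ (g , _) = h⇒¬E yα g
        not-e : T α b b' ≡ e → T β b b' ≡ e → T γ b b' ≡ e → ⊥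
        not-e a c g = ¬Ay (A-resp (E⇒≈ (all3 (trans (q α) a) (trans (q β) c) (trans (q γ) g))) Az)
        pick2 : ∀ {P Q : Set} → Dec P → Dec Q → ¬ (¬ P × ¬ Q) → P ⊎ Q
        pick2 (yes a) _ _ = inj₁ a
        pick2 _ (yes c) _ = inj₂ c
        pick2 (no a) (no c) g = ⊥-elim (g (a , c))
        pick3 : ∀ {P Q R : Set} → Dec P → Dec Q → Dec R → ¬ (¬ P × ¬ Q × ¬ R) → P ⊎ Q ⊎ R
        pick3 (yes a) _ _ _ = inj₁ a
        pick3 _ (yes c) _ _ = inj₂ (inj₁ c)
        pick3 _ _ (yes c) _ = inj₂ (inj₂ c)
        pick3 (no a) (no c) (no f) g = ⊥-elim (g (a , c , f))
        fβ : ¬ (¬ E β z y × ¬ E β z x)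
        fβ (¬r , ¬r') = bispan ¬Ay (axis hu)
          (all3 (E⇒≢n (E-trans (ptα u v x) (E-sym (ptα u x x)))) (h⇒≢n (conv E-refl (ptβ u x x) yβ)) (E⇒≢n (E-trans yγ (E-sym (ptγ u x x)))))
          Az Bb Bb' q (all3 (inj₁ (E-trans (ptα u v x) (E-sym (ptα u x x)))) (inj₂ (¬r , λ g → ¬r' (E-trans g (ptβ u x x))))
            (inj₁ (E-trans yγ (E-sym (ptγ u x x)))))
        fαγ : ¬ (¬ E α z y × ¬ E α z x × ¬ E γ z x)
        fαγ (¬r , ¬r' , ¬c) = let w , hw , ¬zw = avoid γ x z in bispan ¬Ay (plane hv hw)
          (all3 (h⇒≢n (conv E-refl (ptα x v w) yα)) (E⇒≢n (E-trans (ptβ u v x) (E-sym (ptβ x v w)))) (h⇒≢n (conv yγ (ptγ x v w) (symT hw))))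
          Az Bb Bb' q (all3 (inj₂ (¬r , λ g → ¬r' (E-trans g (ptα x v w)))) (inj₁ (E-trans (ptβ u v x) (E-sym (ptβ x v w))))
            (inj₂ ((λ g → ¬c (E-trans g yγ)) , λ g → ¬zw (E-sym (E-trans g (ptγ x v w))))))
        bα : ∀ {k} → T α z y ≡ k → T α b b' ≡ k
        bα g = trans (sym (q α)) g
        bβ : ∀ {k} → T β z y ≡ k → T β b b' ≡ k
        bβ g = trans (sym (q β)) g
        bγ : ∀ {k} → T γ z y ≡ k → T γ b b' ≡ k
        bγ g = trans (sym (q γ)) g
        eh : ∀ {ν} → E ν z x → T ν y x ≡ h → T ν z y ≡ h
        eh g k = conv g E-refl (symT k)
        nne : T α z y ≡ n → T β z zβ ≡ n → E γ z x → DivA n n e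
        nne g k f = divA Az Azβ (conv E-refl zβα (n-≢n g (h⇒≢n yα))) k (conv f zβγ E-refl)
        split : E β z y ⊎ E β z x → E α z y ⊎ E α z x ⊎ E γ z x → Step u ⊎ Stray u v
        split (inj₁ r) (inj₁ a) = caseV (T γ z y)
          (λ g → ⊥-elim (not-e (bα a) (bβ r) (bγ g)))
          (λ g → ⊥-elim (excl eeh Bb Bb' (bα a) (bβ r) (bγ g) λ _ _ ()))
          (λ g → ⊥-elim (exclN enn Bb' (bα a) (E⇒≢n (bβ r)) (bγ g)))
        split (inj₂ r) (inj₁ a) = caseV (T γ z y)
          (λ g → ⊥-elim (excl ehe Bb Bb' (bα a) (bβ (eh r yβ)) (bγ g) λ _ ()))
          (λ g → ⊥-elim (excl ehh Bb Bb' (bα a) (bβ (eh r yβ)) (bγ g) λ _ ()))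
          (λ g → ⊥-elim (excl ehn Bb Bb' (bα a) (bβ (eh r yβ)) (bγ g) λ _ ()))
        split (inj₁ r) (inj₂ (inj₁ a)) = caseV (T γ z y)
          (λ g → ⊥-elim (excl hee Bb Bb' (bα (eh a yα)) (bβ r) (bγ g) λ ()))
          (λ g → inj₁ (b' , Bb' , diff (Sol₁.shift s) a (ptα u v x) , bβ r , bγ g))
          (λ g → ⊥-elim (excl hen Bb Bb' (bα (eh a yα)) (bβ r) (bγ g) λ ()))
        split (inj₂ r) (inj₂ (inj₁ a)) = caseV (T γ z y)
          (λ g → ⊥-elim (¬Ax (A-resp (E⇒≈ (all3 a r (E-trans g yγ))) Az)))
          (λ g → ⊥-elim (excl hhh Bb Bb' (bα (eh a yα)) (bβ (eh r yβ)) (bγ g) λ ()))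
          (λ g → inj₂ (b' , Bb' , diff (Sol₁.shift s) a (ptα u v x) , diff (Sol₁.shift s) r (ptβ u v x) , bγ g))
        split (inj₁ r) (inj₂ (inj₂ c)) = caseV (T α z y)
          (λ g → ⊥-elim (not-e (bα g) (bβ r) (bγ (E-trans c (E-sym yγ)))))
          (λ g → ⊥-elim (excl hee Bb Bb' (bα g) (bβ r) (bγ (E-trans c (E-sym yγ))) λ ()))
          (λ g → ⊥-elim (exclN (nne g (conv r E-refl (hn yβ (symT farβ))) c) Bb' (bα g) (E⇒≢n (bβ r)) (bγ (E-trans c (E-sym yγ)))))
        split (inj₂ r) (inj₂ (inj₂ c)) = caseV (T α z y)
          (λ g → ⊥-elim (excl ehe Bb Bb' (bα g) (bβ (eh r yβ)) (bγ (E-trans c (E-sym yγ))) λ _ ()))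
          (λ g → ⊥-elim (exclN hne Bb' (bα g) (h⇒≢n (bβ (eh r yβ))) (bγ (E-trans c (E-sym yγ)))))
          (λ g → ⊥-elim (exclN (nne g (conv r E-refl (symT farβ)) c) Bb' (bα g) (h⇒≢n (bβ (eh r yβ))) (bγ (E-trans c (E-sym yγ)))))

      row : ∀ {u v} → T α u x ≡ h → T β v x ≡ h → Step u ⊎ Stray u v
      row hu hv = rowAt hu hv (solution₁ _ b)

      strays : ∀ {u} → Stray u v₁ → Stray u v₂ → ⊥
      strays {u} (b' , Bb' , aα , aβ , _) (b'' , Bb'' , cα , cβ , _) = conflict (vview (T γ b' b''))
        where
        lα : ∀ b b' b'' x u → ((b - b'') - (x - u)) - ((b - b') - (x - u)) ≡ b' - b''
        lα = solve-∀
        lβ : ∀ b b' b'' x v v' → ((b - b'') - (x - v')) - ((b - b') - (x - v)) ≡ (b' - b'') - (v - v')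
        lβ = solve-∀
        eα : E α b' b''
        eα = E⁺ (subst (pp α ∣ᵢ_) (lα b b' b'' x u) (∣m∣n⇒∣m-n cα aα))
        hβ : T β b' b'' ≡ h
        hβ = trans (T-diff (subst (pp β ∣ᵢ_) (lβ b b' b'' x v₁ v₂) (∣m∣n⇒∣m-n cβ aβ))) (proj₂ (proj₂ (second hv₁)))
        conflict : VView (T γ b' b'') → ⊥
        conflict (is-e g) = excl ehe Bb' Bb'' eα hβ g λ _ ()
        conflict (is-h g) = excl ehh Bb' Bb'' eα hβ g λ _ ()
        conflict (is-n g) = excl ehn Bb' Bb'' eα hβ g λ _ ()

      step : ∀ {u} → T α u x ≡ h → Step u
      step {u} hu = either (row hu hv₁) (row hu hv₂)
        where
        either : Step u ⊎ Stray u v₁ → Step u ⊎ Stray u v₂ → Step u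
        either (inj₁ r) _ = r
        either _ (inj₁ r) = r
        either (inj₂ r) (inj₂ r') = ⊥-elim (strays r r')

      -- One element of B in every γ-class of the (α, γ)-plane through b.
      record Fill (w : ℤ) : Set where
        field
          {b'}  : ℤ
          Bb'   : B b'
          sameβ : E β b b'
          offγ  : pp γ ∣ᵢ (b - b') - (x - w)
          alt   : T α b b' ≡ h ⊎ (T α b b' ≡ n × DivA n e e × DivA n e n)

      fillAt : ∀ {w} → T γ w x ≡ h → Sol₁ (pt x x w) b → Fill w
      fillAt {w} hw s = split (E? γ z y)
        where
        y = pt x x w
        z = Sol₁.z s
        b' = Sol₁.b' s
        Az = Sol₁.Az s
        Bb' = Sol₁.Bb' s
        q = Sol₁.eqT s
        yγ : T γ y x ≡ h
        yγ = conv (ptγ x x w) E-refl hw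
        ¬Ay : ¬ A y
        ¬Ay Ay = [ (λ r → h⇒¬E yγ (proj₂ (proj₂ r))) , (λ r → h⇒¬E (proj₁ (proj₂ r)) (ptβ x x w)) ]′
          (only Ay (all3 (E⇒≢n (ptα x x w)) (E⇒≢n (ptβ x x w)) (h⇒≢n yγ)))
        zβy : E β z y
        zβy = pick (E? β z y) λ ¬r → let v , hv , ¬zv = avoid β x z in bispan ¬Ay (plane hv hw)
          (all3 (E⇒≢n (E-trans (ptα x x w) (E-sym (ptα x v w)))) (h⇒≢n (conv (ptβ x x w) (ptβ x v w) (symT hv)))
            (E⇒≢n (E-trans (ptγ x x w) (E-sym (ptγ x v w)))))
          Az Bb Bb' q (all3 (inj₁ (E-trans (ptα x x w) (E-sym (ptα x v w)))) (inj₂ (¬r , λ g → ¬zv (E-sym (E-trans g (ptβ x v w)))))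
            (inj₁ (E-trans (ptγ x x w) (E-sym (ptγ x v w)))))
        side : ¬ (¬ E α z y × ¬ E γ z y × ¬ E γ z x)
        side (¬a , ¬c , ¬c') = let u , hu , ¬zu = avoid α x z in bispan ¬Ay (axis hu)
          (all3 (h⇒≢n (conv (ptα x x w) (ptα u x x) (symT hu))) (E⇒≢n (E-trans (ptβ x x w) (E-sym (ptβ u x x))))
            (h⇒≢n (conv E-refl (ptγ u x x) yγ)))
          Az Bb Bb' q (all3 (inj₂ (¬a , λ g → ¬zu (E-sym (E-trans g (ptα u x x))))) (inj₁ (E-trans (ptβ x x w) (E-sym (ptβ u x x))))
            (inj₂ (¬c , λ g → ¬c' (E-trans g (ptγ u x x)))))
        zβx : E β z x
        zβx = E-trans zβy (ptβ x x w)
        bα : ∀ {k} → T α z y ≡ k → T α b b' ≡ k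
        bα g = trans (sym (q α)) g
        bβ : E β b b'
        bβ = trans (sym (q β)) zβy
        bγ : ∀ {k} → T γ z y ≡ k → T γ b b' ≡ k
        bγ g = trans (sym (q γ)) g
        not-e : T α z y ≡ e → T γ z y ≡ e → ⊥
        not-e a c = ¬Ay (A-resp (E⇒≈ (all3 a zβy c)) Az)
        zx : ∀ {k} → T α z y ≡ k → T α z x ≡ k
        zx g = trans (T-Eʳ z (E-sym (ptα x x w))) g
        bᵤ = step hu₁
        hᵤ : T α b (proj₁ bᵤ) ≡ h
        hᵤ = trans (T-diff (proj₁ (proj₂ (proj₂ bᵤ)))) (symT hu₁)
        notγy : E γ z y → ⊥
        notγy c = caseV (T α z y) (λ g → not-e g c) (λ g → excl hee Bb Bb' (bα g) bβ (bγ c) λ ())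
          (λ g → excl (divA Az (axis hu₁) (conv E-refl (ptα u₁ x x) (n-≢n (zx g) (≢n-sym (h⇒≢n hu₁)))) (E-trans zβx (E-sym (ptβ u₁ x x)))
               (conv c (ptγ u₁ x x) yγ))
             (proj₁ (proj₂ bᵤ)) Bb' (≢n-n (≢n-sym (h⇒≢n hᵤ)) (bα g)) (E-trans (E-sym (proj₁ (proj₂ (proj₂ (proj₂ bᵤ))))) bβ)
             (trans (T-Eʳ _ (E-sym (bγ c))) (symT (proj₂ (proj₂ (proj₂ (proj₂ bᵤ)))))) λ ())
        γx : E γ z x → Fill w
        γx c = record { Bb' = Bb' ; sameβ = bβ ; offγ = diff (Sol₁.shift s) c (ptγ x x w)
          ; alt = caseV (T α z y) (λ g → ⊥-elim (¬Ax (A-resp (E⇒≈ (all3 (zx g) zβx c)) Az))) (λ g → inj₁ (bα g))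
              (λ g → inj₂ (bα g ,
                divA Az (axis hu₁) (conv E-refl (ptα u₁ x x) (n-≢n (zx g) (≢n-sym (h⇒≢n hu₁)))) (E-trans zβx (E-sym (ptβ u₁ x x))) (E-trans c (E-sym (ptγ u₁ x x))) ,
                divA Az Az* (conv E-refl z*α (zx g)) (E-trans zβx (E-sym z*β)) (conv c E-refl (symT z*γ)))) }
        split : Dec (E γ z y) → Fill w
        split (yes c) = ⊥-elim (notγy c)
        split (no ¬c) = split₂ (E? γ z x) (E? α z y)
          where
          split₂ : Dec (E γ z x) → Dec (E α z y) → Fill w
          split₂ (yes c) _ = γx c
          split₂ (no ¬c') (no ¬a) = ⊥-elim (side (¬a , ¬c , ¬c'))
          split₂ (no ¬c') (yes a) = ⊥-elim (caseV (T γ z y) ¬c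
            (λ g → excl eeh Bb Bb' (bα a) bβ (bγ g) λ _ _ ()) (λ g → exclN enn Bb' (bα a) (E⇒≢n bβ) (bγ g)))

      fill : ∀ {w} → T γ w x ≡ h → Fill w
      fill hw = fillAt hw (solution₁ _ b)

    mixed-⊥ : ∀ {b₀ c} → B b₀ → TypeAt β x b₀ → TypeAt γ x c → ⊥
    mixed-⊥ {b₀} {c} Bb₀ tb tc = p≢ α≢γ (prime≡ (pr α) (pr γ) (orbit-divides g inj up down))
      where
      open TypeAt tc using () renaming (z to z*; Az to Az*; far to far*; line to line*)
      module Mx {b} (Bb : B b) (ty : TypeAt β x b) = Mixed {z* = z*} Bb ty Az* (line* α α≢γ) (line* β β≢γ) far*
      open Mx Bb₀ tb using (Fill; fill; hen; enn; exclN)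

      Extra : Set
      Extra = DivA n e e × DivA n e n

      record Member (j : Fin (p γ)) : Set where
        field
          {b'}  : ℤ
          Bb'   : B b'
          sameβ : E β b₀ b'
          coord : E γ b' (at γ b₀ (Fin.toℕ j))

      from-fill : ∀ j → Fill (at γ x (Fin.toℕ j)) → Member j
      from-fill j f = record { Bb' = Fill.Bb' f ; sameβ = Fill.sameβ f
        ; coord = E⁺ (subst (pp γ ∣ᵢ_) (lem b₀ (Fill.b' f) x (+ Fin.toℕ j * + p γ)) (∣m⇒∣-m (Fill.offγ f))) }
        where
        lem : ∀ b b' x y → - ((b - b') - (x - (x + y))) ≡ b' - (b + y)
        lem = solve-∀

      member : ∀ j → Σ (Member j) λ m → T α b₀ (Member.b' m) ≢ n ⊎ Extra
      member j = go (Fin.toℕ j) refl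
        where
        go : ∀ k → k ≡ Fin.toℕ j → Σ (Member j) λ m → T α b₀ (Member.b' m) ≢ n ⊎ Extra
        go zero q = record { Bb' = Bb₀ ; sameβ = E-refl ; coord = subst (λ k → E γ b₀ (at γ b₀ k)) q
            (E⁺ (subst (pp γ ∣ᵢ_) (lem b₀ (+ p γ)) (0∣ᵢ (pp γ)))) } , inj₁ (E⇒≢n E-refl)
          where
          lem : ∀ b y → 0ℤ ≡ b - (b + 0ℤ * y)
          lem = solve-∀
        go (suc k) q = from-fill j f , [ (λ r → inj₁ (h⇒≢n r)) , (λ r → inj₂ (proj₂ r)) ]′ (Fill.alt f)
          where
          f : Fill (at γ x (Fin.toℕ j))
          f = fill (at-h x (Fin.toℕ j) (subst (1 ≤_) q (s≤s z≤n)) (FP.toℕ<n j))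

      g : Fin (p γ) → ℤ
      g j = Member.b' (proj₁ (member j))
      Bg : ∀ j → B (g j)
      Bg j = Member.Bb' (proj₁ (member j))
      gβ : ∀ j → E β b₀ (g j)
      gβ j = Member.sameβ (proj₁ (member j))
      gγ : ∀ j → E γ (g j) (at γ b₀ (Fin.toℕ j))
      gγ j = Member.coord (proj₁ (member j))
      gγ₀ : ∀ j → T γ b₀ (g j) ≢ n
      gγ₀ j = ≢n-sym (≢n-trans (E⇒≢n (gγ j)) (at-near b₀ (Fin.toℕ j)))

      choice : ∀ {N} {P : Fin N → Set} {Q : Set} → (∀ j → P j ⊎ Q) → (∀ j → P j) ⊎ Q
      choice {zero} k = inj₁ λ ()
      choice {suc N} {P} {Q} k = join (k zero) (choice (λ j → k (suc j)))
        where
        join : P zero ⊎ Q → (∀ j → P (suc j)) ⊎ Q → (∀ j → P j) ⊎ Q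
        join (inj₂ q) _ = inj₂ q
        join _ (inj₂ q) = inj₂ q
        join (inj₁ a) (inj₁ b) = inj₁ λ { zero → a ; (suc j) → b j }

      uniform : (∀ j → T α b₀ (g j) ≢ n) ⊎ Extra
      uniform = choice λ j → proj₂ (member j)

      typeβ : ∀ j → TypeAt β x (g j)
      typeβ j = [ (λ r → r) , (λ r → ⊥-elim (bad r)) ]′ (kind (g j) (Bg j))
        where
        bad : TypeAt γ x (g j) → ⊥
        bad ty = caseV (T α b₀ b'') (λ q → exclN enn Bb'' q (E⇒≢n qβ) qγ) (λ q → excl hen Bb₀ Bb'' q qβ qγ λ ())
            (λ q → [ (λ r → r j (trans (T-Eʳ b₀ qα) q)) , (λ r → excl (proj₂ r) Bb₀ Bb'' q qβ qγ λ ()) ]′ uniform)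
          where
          open TypeAt ty using () renaming (b' to b''; Bb' to Bb''; far' to far''; line' to line'')
          qα : E α (g j) b''
          qα = line'' α α≢γ
          qβ : E β b₀ b''
          qβ = E-trans (gβ j) (line'' β β≢γ)
          qγ : T γ b₀ b'' ≡ n
          qγ = ≢n-n (gγ₀ j) far''

      inj : ∀ {j j'} → pp α ∣ᵢ g j - g j' → j ≡ j'
      inj {j} {j'} q = at-inj {x = b₀} j j' (E-trans (E-sym (gγ j)) (E-trans (≈⇒E same γ) (gγ j')))
        where
        same : g j ≈ g j'
        same = sparseγ (Bg j) (Bg j') (≢n-trans (≢n-sym (gγ₀ j)) (gγ₀ j')) (lineγ (E⁺ q) (E-trans (E-sym (gβ j)) (gβ j')))

      neighbour : ∀ j {u} → T α u x ≡ h → Σ (Fin (p γ)) λ j' → pp α ∣ᵢ g j' - (g j + (u - x))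
      neighbour j {u} hu = find (Mx.step (Bg j) (typeβ j) hu)
        where
        lem : ∀ g g' b' x u → ((g - b') - (x - u)) + (b' - g') ≡ - (g' - (g + (u - x)))
        lem = solve-∀
        find : Mx.Step (Bg j) (typeβ j) u → Σ (Fin (p γ)) λ j' → pp α ∣ᵢ g j' - (g j + (u - x))
        find (b' , Bb' , offα , qβ , qγ) = j' , subst (pp α ∣ᵢ_) (ℤP.neg-involutive _) (∣m⇒∣-m (subst (pp α ∣ᵢ_)
            (lem (g j) (g j') b' x u) (∣m∣n⇒∣m+n offα (E⁻ eα))))
          where
          b₀γ : T γ b' b₀ ≢ n
          b₀γ = ≢n-trans (≢n-sym (h⇒≢n qγ)) (≢n-sym (gγ₀ j))
          j' = proj₁ (at-E b₀γ)
          eγ : E γ b' (g j')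
          eγ = E-trans (proj₂ (at-E b₀γ)) (E-sym (gγ j'))
          eβ : E β b' (g j')
          eβ = E-trans (E-sym qβ) (E-trans (E-sym (gβ j)) (gβ j'))
          nα : T α (g j) b' ≢ n
          nα = h⇒≢n (trans (T-diff offα) (symT hu))
          eα : E α b' (g j')
          eα = caseV (T α b' (g j')) (λ q → q) (λ q → ⊥-elim (excl hee Bb' (Bg j') q eβ eγ λ ()))
            (λ q → ⊥-elim ([ (λ r → ≢n-trans (≢n-sym nα) (≢n-trans (≢n-sym (r j)) (r j')) q) , (λ r → excl (proj₁ r) Bb' (Bg j') q eβ eγ λ ()) ]′ uniform))

      up : ∀ j → Σ (Fin (p γ)) λ j' → pp α ∣ᵢ g j' - (g j + + p α)
      up j = let j' , q = neighbour j {at α x 1} (at-h x 1 ℕP.≤-refl (ℕP.≤-trans (s≤s (s≤s z≤n)) (p≥3 α))) in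
        j' , subst (λ z → pp α ∣ᵢ g j' - (g j + z)) (lem x (+ p α)) q
        where
        lem : ∀ x y → x + 1ℤ * y - x ≡ y
        lem = solve-∀

      down : ∀ j → Σ (Fin (p γ)) λ j' → pp α ∣ᵢ g j' - (g j - + p α)
      down j = let j' , q = neighbour j {x - + p α} hd in j' , subst (λ z → pp α ∣ᵢ g j' - (g j + z)) (lem x (+ p α)) q
        where
        lem : ∀ x y → x - y - x ≡ - y
        lem = solve-∀
        l₂ : ∀ x y → (x - y - x) - (x - (x + 1ℤ * y)) ≡ 0ℤ
        l₂ = solve-∀
        hd : T α (x - + p α) x ≡ h
        hd = trans (T-diff (subst (pp α ∣ᵢ_) (sym (l₂ x (+ p α))) (0∣ᵢ (pp α)))) (symT (at-h x 1 ℕP.≤-refl (ℕP.≤-trans (s≤s (s≤s z≤n)) (p≥3 α))))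

    result : (Shiftable β x × Regular β) ⊎ (Shiftable γ x × Regular γ)
    result = first (search kind)
      where
      second′ : ∀ {c} → TypeAt γ x c → (∀ b → B b → TypeAt γ x b) ⊎ (Σ ℤ λ b → B b × TypeAt β x b) →
        (Shiftable β x × Regular β) ⊎ (Shiftable γ x × Regular γ)
      second′ tc (inj₁ all) = inj₂ (sweep Bb₀ (all b₀ Bb₀) (localγ b₀ Bb₀) sparseγ , λ b Bb → sweep-line Bb (all b Bb) (localγ b Bb) sparseγ)
      second′ tc (inj₂ (b , Bb , tb)) = ⊥-elim (mixed-⊥ Bb tb tc)
      first : (∀ b → B b → TypeAt β x b) ⊎ (Σ ℤ λ b → B b × TypeAt γ x b) → (Shiftable β x × Regular β) ⊎ (Shiftable γ x × Regular γ)
      first (inj₁ all) = inj₁ (sweep Bb₀ (all b₀ Bb₀) (localβ b₀ Bb₀) sparseβ , λ b Bb → sweep-line Bb (all b Bb) (localβ b Bb) sparseβ)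
      first (inj₂ (c , Bc , tc)) = second′ tc (search λ b Bb → [ inj₂ , inj₁ ]′ (kind b Bb))

  -- S marks the γ-levels of the grid of x on which A is an α-fiber without its point over x;
  -- on the other levels A is a β-fiber without its point over x.
  record Crossed {A B : ℤ → Set} (t : Tiling A B) (α β γ : Fin 3) (x : ℤ) (S : ℤ → Set) : Set where
    field
      S?     : ∀ w → Dec (S w)
      S-resp : ∀ {w w'} → E γ w w' → S w → S w'
      inα    : ∀ {y} → T α y x ≡ h → E β y x → T γ y x ≢ n → S y → A y
      inβ    : ∀ {y} → E α y x → T β y x ≡ h → T γ y x ≢ n → ¬ S y → A y
      only   : ∀ {y} → A y → (∀ ν → T ν y x ≢ n) → (S y × T α y x ≡ h × E β y x) ⊎ (¬ S y × E α y x × T β y x ≡ h)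
      l₁ l₂ m₁ m₂ : ℤ
      l₁~ : T γ l₁ x ≢ n
      l₂~ : T γ l₂ x ≢ n
      m₁~ : T γ m₁ x ≢ n
      m₂~ : T γ m₂ x ≢ n
      Sl₁ : S l₁
      Sl₂ : S l₂
      Sm₁ : ¬ S m₁
      Sm₂ : ¬ S m₂
      l₁≢l₂ : ¬ E γ l₁ l₂
      m₁≢m₂ : ¬ E γ m₁ m₂

  mirror : ∀ {A B t α β γ x S} → Crossed {A} {B} t α β γ x S → Crossed t β α γ x (λ w → ¬ S w)
  mirror {S = S} c = record
    { S? = λ w → neg (S? w)
    ; S-resp = λ q ¬s s → ¬s (S-resp (E-sym q) s)
    ; inα = λ q r g s → inβ r q g s
    ; inβ = λ q r g ¬s → inα r q g (pick (S? _) ¬s)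
    ; only = λ a g → [ (λ { (s , q , r) → inj₂ ((λ ¬s → ¬s s) , r , q) }) , (λ { (s , q , r) → inj₁ (s , r , q) }) ]′ (only a g)
    ; l₁ = m₁ ; l₂ = m₂ ; m₁ = l₁ ; m₂ = l₂ ; l₁~ = m₁~ ; l₂~ = m₂~ ; m₁~ = l₁~ ; m₂~ = l₂~
    ; Sl₁ = Sm₁ ; Sl₂ = Sm₂ ; Sm₁ = λ g → g Sl₁ ; Sm₂ = λ g → g Sl₂ ; l₁≢l₂ = m₁≢m₂ ; m₁≢m₂ = l₁≢l₂ }
    where
    open Crossed c
    neg : ∀ {P : Set} → Dec P → Dec (¬ P)
    neg (yes q) = no λ g → g q
    neg (no q) = yes q

  module Side {A B : ℤ → Set} (t : Tiling A B) (α β γ : Fin 3) (d : Distinct3 p α β γ) (x : ℤ) (S : ℤ → Set) (c : Crossed t α β γ x S) where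
    open Clashes t α β γ d public
    open Crossed c public

    x[_] : ℤ → ℤ
    x[ w ] = pt x x w

    u₁ = proj₁ (offset α x)
    hu₁ = proj₂ (offset α x)
    u₂ = proj₁ (second hu₁)
    hu₂ = proj₁ (proj₂ (second hu₁))
    v₁ = proj₁ (offset β x)
    hv₁ = proj₂ (offset β x)
    v₂ = proj₁ (second hv₁)
    hv₂ = proj₁ (proj₂ (second hv₁))

    hl : T γ l₁ l₂ ≡ h
    hl = ≢⇒h (≢n-trans l₁~ (≢n-sym l₂~)) l₁≢l₂
    hm : T γ m₁ m₂ ≡ h
    hm = ≢⇒h (≢n-trans m₁~ (≢n-sym m₂~)) m₁≢m₂
    ¬E-lm : ∀ {w w'} → S w → ¬ S w' → ¬ E γ w w'
    ¬E-lm s ¬s q = ¬s (S-resp q s)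
    hlm : ∀ {w w'} → T γ w x ≢ n → T γ w' x ≢ n → S w → ¬ S w' → T γ w w' ≡ h
    hlm q r s ¬s = ≢⇒h (≢n-trans q (≢n-sym r)) (¬E-lm s ¬s)

    armα : ∀ {u w} → T α u x ≡ h → T γ w x ≢ n → S w → A (pt u x w)
    armα {u} {w} q r s = inα (conv (ptα u x w) E-refl q) (ptβ u x w) (λ k → r (trans (T-Eˡ x (E-sym (ptγ u x w))) k)) (S-resp (E-sym (ptγ u x w)) s)

    armβ : ∀ {v w} → T β v x ≡ h → T γ w x ≢ n → ¬ S w → A (pt x v w)
    armβ {v} {w} q r s = inβ (ptα x v w) (conv (ptβ x v w) E-refl q) (λ k → r (trans (T-Eˡ x (E-sym (ptγ x v w))) k)) (λ g → s (S-resp (ptγ x v w) g))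

    private
      tα : ∀ {u v w u' v' w' k} → T α u u' ≡ k → T α (pt u v w) (pt u' v' w') ≡ k
      tα {u} {v} {w} {u'} {v'} {w'} = conv (ptα u v w) (ptα u' v' w')
      tβ : ∀ {u v w u' v' w' k} → T β v v' ≡ k → T β (pt u v w) (pt u' v' w') ≡ k
      tβ {u} {v} {w} {u'} {v'} {w'} = conv (ptβ u v w) (ptβ u' v' w')
      tγ : ∀ {u v w u' v' w' k} → T γ w w' ≡ k → T γ (pt u v w) (pt u' v' w') ≡ k
      tγ {u} {v} {w} {u'} {v'} {w'} = conv (ptγ u v w) (ptγ u' v' w')

    hu₁₂ = proj₂ (proj₂ (second hu₁))
    hv₁₂ = proj₂ (proj₂ (second hv₁))

    hee : DivA h e e
    hee = divA (armα hu₁ l₁~ Sl₁) (armα hu₂ l₁~ Sl₁) (tα hu₁₂) (tβ E-refl) (tγ E-refl)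
    ehe : DivA e h e
    ehe = divA (armβ hv₁ m₁~ Sm₁) (armβ hv₂ m₁~ Sm₁) (tα E-refl) (tβ hv₁₂) (tγ E-refl)
    eeh : DivA e e h
    eeh = divA (armα hu₁ l₁~ Sl₁) (armα hu₁ l₂~ Sl₂) (tα E-refl) (tβ E-refl) (tγ hl)
    heh : DivA h e h
    heh = divA (armα hu₁ l₁~ Sl₁) (armα hu₂ l₂~ Sl₂) (tα hu₁₂) (tβ E-refl) (tγ hl)
    ehh : DivA e h h
    ehh = divA (armβ hv₁ m₁~ Sm₁) (armβ hv₂ m₂~ Sm₂) (tα E-refl) (tβ hv₁₂) (tγ hm)
    hhh : DivA h h h
    hhh = divA (armα hu₁ l₁~ Sl₁) (armβ hv₁ m₁~ Sm₁) (tα hu₁) (tβ (symT hv₁)) (tγ (hlm l₁~ m₁~ Sl₁ Sm₁))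

    ¬Ax[] : ∀ w → T γ w x ≢ n → ¬ A x[ w ]
    ¬Ax[] w q Ax = [ (λ r → h⇒¬E (proj₁ (proj₂ r)) (ptα x x w)) , (λ r → h⇒¬E (proj₂ (proj₂ r)) (ptβ x x w)) ]′
      (only Ax (all3 (E⇒≢n (ptα x x w)) (E⇒≢n (ptβ x x w)) (λ k → q (trans (T-Eˡ x (E-sym (ptγ x x w))) k))))

    avoid-m : ∀ z → Σ ℤ λ m → T γ m x ≢ n × ¬ S m × ¬ E γ z m
    avoid-m z = go (E? γ z m₁)
      where
      go : Dec (E γ z m₁) → Σ ℤ λ m → T γ m x ≢ n × ¬ S m × ¬ E γ z m
      go (no q) = m₁ , m₁~ , Sm₁ , q
      go (yes q) = m₂ , m₂~ , Sm₂ , λ r → m₁≢m₂ (E-trans (E-sym q) r)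

    module AtLevel (w : ℤ) (w~ : T γ w x ≢ n) (Sw : S w) where

      cross : ∀ {z b b'} → A z → B b → B b' → (∀ μ → T μ z x[ w ] ≡ T μ b b') →
        E α z x[ w ] × (E β z x[ w ] ⊎ E γ z x[ w ])
      cross {z} {b} {b'} Az Bb Bb' q = pick (E? α z x[ w ]) onα , onβγ (E? β z x[ w ]) (E? γ z x[ w ])
        where
        onα : ¬ ¬ E α z x[ w ]
        onα ¬q = let u , hu , ¬zu = avoid α x z in
          bispan (¬Ax[] w w~) (armα hu w~ Sw) (all3 (h⇒≢n (tα (symT hu))) (E⇒≢n (tβ E-refl)) (E⇒≢n (tγ E-refl)))
            Az Bb Bb' q (all3 (inj₂ (¬q , λ g → ¬zu (E-sym (E-trans g (ptα u x w))))) (inj₁ (tβ E-refl)) (inj₁ (tγ E-refl)))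
        onβγ : Dec (E β z x[ w ]) → Dec (E γ z x[ w ]) → E β z x[ w ] ⊎ E γ z x[ w ]
        onβγ (yes r) _ = inj₁ r
        onβγ _ (yes r) = inj₂ r
        onβγ (no ¬r) (no ¬s) = let v , hv , ¬zv = avoid β x z ; m , m~ , Sm , ¬zm = avoid-m z in
          ⊥-elim (bispan (¬Ax[] w w~) (armβ hv m~ Sm) (all3 (E⇒≢n (tα E-refl)) (h⇒≢n (tβ (symT hv))) (h⇒≢n (tγ (hlm w~ m~ Sw Sm))))
            Az Bb Bb' q (all3 (inj₁ (tα E-refl)) (inj₂ (¬r , λ g → ¬zv (E-sym (E-trans g (ptβ x v m)))))
              (inj₂ (¬s , λ g → ¬zm (E-trans g (ptγ x v m))))))

      onβ : ∀ {z b b'} → B b → B b' → (∀ μ → T μ z x[ w ] ≡ T μ b b') → ¬ E β z x[ w ] → E α z x[ w ] → E γ z x[ w ] → T β z x[ w ] ≡ n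
      onβ {z} {b} {b'} Bb Bb' q ¬r a c = caseV (T β z x[ w ]) (λ r → ⊥-elim (¬r r))
        (λ r → ⊥-elim (excl ehe Bb Bb' (trans (sym (q α)) a) (trans (sym (q β)) r) (trans (sym (q γ)) c) λ _ ())) (λ r → r)

      onγ : ∀ {z b b'} → B b → B b' → (∀ μ → T μ z x[ w ] ≡ T μ b b') → ¬ E γ z x[ w ] → E α z x[ w ] → E β z x[ w ] → T γ z x[ w ] ≡ n
      onγ {z} {b} {b'} Bb Bb' q ¬r a c = caseV (T γ z x[ w ]) (λ r → ⊥-elim (¬r r))
        (λ r → ⊥-elim (excl eeh Bb Bb' (trans (sym (q α)) a) (trans (sym (q β)) c) (trans (sym (q γ)) r) λ _ _ ())) (λ r → r)

      localβ : ∀ b → B b → Localised β x[ w ] b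
      localβ b Bb {z} {b'} Az Bb' q = go (cross Az Bb Bb' q) (E? β z x[ w ])
        where
        go : E α z x[ w ] × (E β z x[ w ] ⊎ E γ z x[ w ]) → Dec (E β z x[ w ]) → E β z x[ w ] ⊎ (T β z x[ w ] ≡ n × Line β x[ w ] z)
        go _ (yes r) = inj₁ r
        go (a , inj₁ r) (no _) = inj₁ r
        go (a , inj₂ k) (no ¬r) = inj₂ (onβ Bb Bb' q ¬r a k , lineβ a k)

      localγ : ∀ b → B b → Localised γ x[ w ] b
      localγ b Bb {z} {b'} Az Bb' q = go (cross Az Bb Bb' q) (E? γ z x[ w ])
        where
        go : E α z x[ w ] × (E β z x[ w ] ⊎ E γ z x[ w ]) → Dec (E γ z x[ w ]) → E γ z x[ w ] ⊎ (T γ z x[ w ] ≡ n × Line γ x[ w ] z)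
        go _ (yes r) = inj₁ r
        go (a , inj₂ r) (no _) = inj₁ r
        go (a , inj₁ k) (no ¬r) = inj₂ (onγ Bb Bb' q ¬r a k , lineγ a k)

      kind : ∀ b → B b → TypeAt β x[ w ] b ⊎ TypeAt γ x[ w ] b
      kind b Bb = go (solution₁ x[ w ] b)
        where
        go : Sol₁ x[ w ] b → TypeAt β x[ w ] b ⊎ TypeAt γ x[ w ] b
        go s = split (cross Az Bb Bb' eqT) (E? β z x[ w ]) (E? γ z x[ w ])
          where
          open Sol₁ s
          split : E α z x[ w ] × (E β z x[ w ] ⊎ E γ z x[ w ]) → Dec (E β z x[ w ]) → Dec (E γ z x[ w ]) → TypeAt β x[ w ] b ⊎ TypeAt γ x[ w ] b
          split (a , _) (yes r) (yes k) = ⊥-elim (¬Ax[] w w~ (A-resp (E⇒≈ (all3 a r k)) Az))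
          split (a , _) (yes r) (no ¬k) = inj₂ (mkType s (onγ Bb Bb' eqT ¬k a r) (lineγ a r))
          split (a , _) (no ¬r) (yes k) = inj₁ (mkType s (onβ Bb Bb' eqT ¬r a k) (lineβ a k))
          split (a , inj₁ r) (no ¬r) (no _) = ⊥-elim (¬r r)
          split (a , inj₂ k) (no _) (no ¬k) = ⊥-elim (¬k k)

    sparseβ : Sparse β
    sparseβ {b} {b'} Bb Bb' q l = go (E? β b b')
      where
      go : Dec (E β b b') → b ≈ b'
      go (yes r) = E⇒≈ (all3 (l α α≢β) r (l γ λ g → β≢γ (sym g)))
      go (no r) = ⊥-elim (excl ehe Bb Bb' (l α α≢β) (≢⇒h q r) (l γ λ g → β≢γ (sym g)) λ _ ())

    sparseγ : Sparse γ
    sparseγ {b} {b'} Bb Bb' q l = go (E? γ b b')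
      where
      go : Dec (E γ b b') → b ≈ b'
      go (yes r) = E⇒≈ (all3 (l α α≢γ) (l β β≢γ) r)
      go (no r) = ⊥-elim (excl eeh Bb Bb' (l α α≢γ) (l β β≢γ) (≢⇒h q r) λ _ _ ())

    sweepβ : ∀ w (w~ : T γ w x ≢ n) → S w → ∀ b → B b → TypeAt β x[ w ] b → Shiftable β x[ w ]
    sweepβ w w~ Sw b Bb ty = sweep Bb ty (AtLevel.localβ w w~ Sw b Bb) sparseβ

    lineβ-full : ∀ w (w~ : T γ w x ≢ n) → S w → ∀ b → B b → TypeAt β x[ w ] b → FullLine β b
    lineβ-full w w~ Sw b Bb ty = sweep-line Bb ty (AtLevel.localβ w w~ Sw b Bb) sparseβ

    sweepγ : ∀ w (w~ : T γ w x ≢ n) → S w → ∀ b → B b → TypeAt γ x[ w ] b → Shiftable γ x[ w ]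
    sweepγ w w~ Sw b Bb ty = sweep Bb ty (AtLevel.localγ w w~ Sw b Bb) sparseγ

    lineγ-full : ∀ w (w~ : T γ w x ≢ n) → S w → ∀ b → B b → TypeAt γ x[ w ] b → FullLine γ b
    lineγ-full w w~ Sw b Bb ty = sweep-line Bb ty (AtLevel.localγ w w~ Sw b Bb) sparseγ

    -- A γ-fiber over one level serves every level.
    transport : ∀ w w' (w~ : T γ w x ≢ n) → S w → T γ w' x ≢ n → ∀ {b y} → B b → E α y x → E β y x → E γ y w' → TypeAt γ x[ w ] b → TypeAt γ y b
    transport w w' w~ Sw w'~ {b} {y} Bb yα yβ yγ ty = record
        { Az = sweep-fiber Bb ty (AtLevel.localγ w w~ Sw b Bb) sparseγ z' near (lineγ z'α z'β)
        ; Bb' = Bb' ; shift = ≈-trans same shift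
        ; far = trans (T-diff (E⁻₀ γ)) far ; line = lineγ (trans (T-diff (E⁻₀ α)) (line α α≢γ)) (trans (T-diff (E⁻₀ β)) (line β β≢γ))
        ; far' = far' ; line' = line' }
      where
      open TypeAt ty
      z' = z + (y - x[ w ])
      lem : ∀ z y a → (z + (y - a) - y) - (z - a) ≡ 0ℤ
      lem = solve-∀
      lem₂ : ∀ z y a → (z + (y - a) - z) - (y - a) ≡ 0ℤ
      lem₂ = solve-∀
      same : (z' - y) ≈ (z - x[ w ])
      same = ≈⁺ (subst (M ∣ᵢ_) (sym (lem z y x[ w ])) (Folding.0∣ᵢ M))
      E⁻₀ : ∀ ν → pp ν ∣ᵢ (z' - y) - (z - x[ w ])
      E⁻₀ ν = subst (pp ν ∣ᵢ_) (sym (lem z y x[ w ])) (Folding.0∣ᵢ (pp ν))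
      move : ∀ ν → T ν z' z ≡ T ν y x[ w ]
      move ν = T-diff (subst (pp ν ∣ᵢ_) (sym (lem₂ z y x[ w ])) (Folding.0∣ᵢ (pp ν)))
      z'α : E α z' z
      z'α = trans (move α) (conv yα (ptα x x w) E-refl)
      z'β : E β z' z
      z'β = trans (move β) (conv yβ (ptβ x x w) E-refl)
      near : T γ z' z ≢ n
      near q = ≢n-trans w'~ (≢n-sym w~) (trans (sym (conv yγ (ptγ x x w) refl)) (trans (sym (move γ)) q))

  type-unique : ∀ {A B} (t : Tiling A B) → let open Base t in ∀ {ν μ x b} → ν ≢ μ → TypeAt ν x b → TypeAt μ x b → ⊥
  type-unique t {ν} {μ} {x} {b} q ty ty' = n⇒¬E (TypeAt.far ty) (E-trans (≈⇒E (proj₁ (uniq₁ {x} {b} (TypeAt.Az ty) (TypeAt.Az ty') (TypeAt.Bb' ty) (TypeAt.Bb' ty') (TypeAt.shift ty) (TypeAt.shift ty'))) ν) (TypeAt.line ty' ν q))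
    where open Base t

  module Both {A B : ℤ → Set} (t : Tiling A B) (α β γ : Fin 3) (d : Distinct3 p α β γ) (x : ℤ) (S : ℤ → Set) (c : Crossed t α β γ x S) where
    d′ : Distinct3 p β α γ
    d′ = (λ q → proj₁ d (sym q)) , proj₂ (proj₂ d) , proj₁ (proj₂ d)
    open Side t α β γ d x S c
    module Op = Side t β α γ d′ x (λ w → ¬ S w) (mirror c)

    -- b is of type β at level l₁ and of type α at level m₁, while z* lies on the γ-line of x.
    module Mixed {b z* : ℤ} (Bb : B b) (tb : TypeAt β x[ l₁ ] b) (ta : TypeAt α (Op.x[ m₁ ]) b)
        (Az* : A z*) (z*α : E α z* x) (z*β : E β z* x) (z*γ : T γ z* x ≡ n) where
      open TypeAt tb using () renaming (z to zβ; Az to Azβ; far to farβ; line to lineZ; b' to b₁; Bb' to Bb₁; far' to far₁; line' to line₁)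
      open TypeAt ta using () renaming (b' to b₂; Bb' to Bb₂; far' to far₂; line' to line₂)

      zβα : E α zβ x
      zβα = E-trans (lineZ α α≢β) (ptα x x l₁)
      zββ : T β zβ x ≡ n
      zββ = conv E-refl (E-sym (ptβ x x l₁)) farβ
      zβγ : E γ zβ l₁
      zβγ = E-trans (lineZ γ λ g → β≢γ (sym g)) (ptγ x x l₁)

      level* : ∀ {w} → T γ w x ≢ n → T γ w z* ≡ n
      level* q = ≢n-n q (symT z*γ)

      hne : DivA h n e
      hne = divA (armα hu₁ l₁~ Sl₁) Azβ (conv (ptα u₁ x l₁) zβα hu₁) (conv (ptβ u₁ x l₁) E-refl (symT zββ)) (conv (ptγ u₁ x l₁) zβγ E-refl)
      hen : DivA h e n
      hen = divA (armα hu₁ l₁~ Sl₁) Az* (conv (ptα u₁ x l₁) z*α hu₁) (conv (ptβ u₁ x l₁) z*β E-refl) (conv (ptγ u₁ x l₁) E-refl (level* l₁~))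
      ehn : DivA e h n
      ehn = divA (armβ hv₁ m₁~ Sm₁) Az* (conv (ptα x v₁ m₁) z*α E-refl) (conv (ptβ x v₁ m₁) z*β hv₁) (conv (ptγ x v₁ m₁) E-refl (level* m₁~))
      enn : DivA e n n
      enn = divA Azβ Az* (conv zβα z*α E-refl) (conv E-refl z*β zββ) (conv zβγ E-refl (level* l₁~))

      exclN : ∀ {s t b'} → DivA s n t → B b' → T α b b' ≡ s → T β b b' ≢ n → T γ b b' ≡ t → ⊥
      exclN w Bb' qα qβ qγ = excl w Bb₁ Bb' (trans (T-Eˡ _ (E-sym (line₁ α α≢β))) qα) (n-≢n (symT far₁) qβ)
        (trans (T-Eˡ _ (E-sym (line₁ γ λ g → β≢γ (sym g)))) qγ) λ _ ()

      excl-nne : DivA n n e → ⊥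
      excl-nne w = excl w Bb₂ Bb₁ (n-≢n (symT far₂) (E⇒≢n (line₁ α α≢β))) (≢n-n (≢n-sym (E⇒≢n (line₂ β λ g → α≢β (sym g)))) far₁)
        (E-trans (E-sym (line₂ γ λ g → α≢γ (sym g))) (line₁ γ λ g → β≢γ (sym g))) λ ()

      Stray : ℤ → ℤ → Set
      Stray u v = Σ ℤ λ b' → B b' × pp α ∣ᵢ (b - b') - (x - u) × pp β ∣ᵢ (b - b') - (x - v) × T γ b b' ≡ n

      diff : ∀ {ν z y b' a c} → (z - y) ≈ (b - b') → E ν z a → E ν y c → pp ν ∣ᵢ (b - b') - (a - c)
      diff {ν} {z} {y} {b'} {a} {c} (≈⁺ m) q r = subst (pp ν ∣ᵢ_) (lem (b - b') z y a c)
        (∣m∣n⇒∣m-n (∣m∣n⇒∣m-n (E⁻ q) (E⁻ r)) (∣ᵢ-trans (pp∣M ν) m))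
        where
        lem : ∀ k z y a c → (z - a) - (y - c) - ((z - y) - k) ≡ k - (a - c)
        lem = solve-∀

      mkStray : ∀ {u v} (s : Sol₁ (pt u v l₁) b) → E α (Sol₁.z s) x → E β (Sol₁.z s) x → T γ b (Sol₁.b' s) ≡ n → Stray u v
      mkStray {u} {v} s a r g = Sol₁.b' s , Sol₁.Bb' s , diff {α} {Sol₁.z s} {pt u v l₁} {Sol₁.b' s} {x} {u} (Sol₁.shift s) a (ptα u v l₁) ,
        diff {β} {Sol₁.z s} {pt u v l₁} {Sol₁.b' s} {x} {v} (Sol₁.shift s) r (ptβ u v l₁) , g

      strayAt : ∀ {u v} → T α u x ≡ h → T β v x ≡ h → Sol₁ (pt u v l₁) b → Stray u v
      strayAt {u} {v} hu hv s = split (E? β z y) (E? γ z y)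
        where
        y = pt u v l₁
        z = Sol₁.z s
        b' = Sol₁.b' s
        Az = Sol₁.Az s
        Bb' = Sol₁.Bb' s
        q = Sol₁.eqT s
        yα : T α y x ≡ h
        yα = conv (ptα u v l₁) E-refl hu
        yβ : T β y x ≡ h
        yβ = conv (ptβ u v l₁) E-refl hv
        yγ : E γ y l₁
        yγ = ptγ u v l₁
        ¬Ay : ¬ A y
        ¬Ay Ay = [ (λ r → h⇒¬E yβ (proj₂ (proj₂ r))) , (λ r → h⇒¬E yα (proj₁ (proj₂ r))) ]′
          (only Ay (all3 (h⇒≢n yα) (h⇒≢n yβ) (≢n-trans (E⇒≢n yγ) l₁~)))
        not-e : T α z y ≡ e → T β z y ≡ e → T γ z y ≡ e → ⊥
        not-e a c g = ¬Ay (A-resp (E⇒≈ (all3 a c g)) Az)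
        bα : ∀ {k} → T α z y ≡ k → T α b b' ≡ k
        bα g = trans (sym (q α)) g
        bβ : ∀ {k} → T β z y ≡ k → T β b b' ≡ k
        bβ g = trans (sym (q β)) g
        bγ : ∀ {k} → T γ z y ≡ k → T γ b b' ≡ k
        bγ g = trans (sym (q γ)) g
        eh : ∀ {ν} → E ν z x → T ν y x ≡ h → T ν z y ≡ h
        eh g k = conv g E-refl (symT k)
        zβx : ¬ E β z y → E β z x
        zβx ¬r = pick (E? β z x) λ ¬r' → bispan ¬Ay (armα hu l₁~ Sl₁)
          (all3 (E⇒≢n (E-trans (ptα u v l₁) (E-sym (ptα u x l₁)))) (h⇒≢n (conv E-refl (ptβ u x l₁) yβ)) (E⇒≢n (E-trans yγ (E-sym (ptγ u x l₁)))))
          Az Bb Bb' q (all3 (inj₁ (E-trans (ptα u v l₁) (E-sym (ptα u x l₁)))) (inj₂ (¬r , λ g → ¬r' (E-trans g (ptβ u x l₁))))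
            (inj₁ (E-trans yγ (E-sym (ptγ u x l₁)))))
        nne : T α z y ≡ n → T β z zβ ≡ n → E γ z y → DivA n n e
        nne g k f = divA Az Azβ (conv E-refl zβα (n-≢n g (h⇒≢n yα))) k (E-trans f (E-trans yγ (E-sym zβγ)))
        case1 : E β z y → E γ z y → ⊥
        case1 r c = caseV (T α z y) (λ g → not-e g r c) (λ g → excl hee Bb Bb' (bα g) (bβ r) (bγ c) λ ())
          (λ g → excl-nne (nne g (conv r E-refl (≢n-n (h⇒≢n yβ) (symT zβn))) c))
          where
          zβn : T β zβ x ≡ n
          zβn = zββ
        case2 : E β z x → E γ z y → ⊥
        case2 r c = caseV (T α z y) (λ g → excl ehe Bb Bb' (bα g) (bβ (eh r yβ)) (bγ c) λ _ ())
          (λ g → exclN hne Bb' (bα g) (h⇒≢n (bβ (eh r yβ))) (bγ c))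
          (λ g → excl-nne (nne g (conv r E-refl (symT zββ)) c))
        case3 : E β z y → ¬ E γ z y → ⊥
        case3 r ¬c = go (E? α z y) (E? α z x)
          where
          gen : ∀ {k} → T α z y ≡ k → T α z x ≡ k → ⊥
          gen g g' = exclN (divA Az Azβ (conv E-refl zβα g') (conv r E-refl (≢n-n (h⇒≢n yβ) (symT zββ))) (T-Eʳ z (E-trans zβγ (E-sym yγ))))
            Bb' (bα g) (E⇒≢n (bβ r)) (bγ refl)
          go : Dec (E α z y) → Dec (E α z x) → ⊥
          go (yes a) _ = caseV (T γ z y) ¬c (λ g → excl eeh Bb Bb' (bα a) (bβ r) (bγ g) λ _ _ ()) (λ g → exclN enn Bb' (bα a) (E⇒≢n (bβ r)) (bγ g))
          go _ (yes a) = caseV (T γ z y) ¬c (λ g → excl heh Bb Bb' (bα (eh a yα)) (bβ r) (bγ g) λ ()) (λ g → excl hen Bb Bb' (bα (eh a yα)) (bβ r) (bγ g) λ ())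
          go (no ¬a) (no ¬a') = caseV (T α z y) ¬a (λ g → gen g (≢⇒h (≢n-trans (h⇒≢n g) (h⇒≢n yα)) ¬a')) (λ g → gen g (n-≢n g (h⇒≢n yα)))
        case4 : E β z x → ¬ E γ z y → Stray u v
        case4 r ¬c = go (E? α z y) (E? α z x)
          where
          ¬βy : ¬ E β z y
          ¬βy g = h⇒¬E (eh r yβ) g
          side : ¬ E α z y → ¬ E α z x → ⊥
          side ¬a ¬a' = let v' , hv' , ¬zv = avoid β x z ; m , m~ , Sm , ¬zm = avoid-m z in
            bispan ¬Ay (armβ hv' m~ Sm)
              (all3 (h⇒≢n (conv E-refl (ptα x v' m) yα)) (≢n-trans (h⇒≢n yβ) (≢n-sym (h⇒≢n (conv (ptβ x v' m) E-refl hv'))))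
                (h⇒≢n (conv yγ (ptγ x v' m) (hlm l₁~ m~ Sl₁ Sm))))
              Az Bb Bb' q (all3 (inj₂ (¬a , λ g → ¬a' (E-trans g (ptα x v' m)))) (inj₂ (¬βy , λ g → ¬zv (E-sym (E-trans g (ptβ x v' m)))))
                (inj₂ (¬c , λ g → ¬zm (E-trans g (ptγ x v' m)))))
          go : Dec (E α z y) → Dec (E α z x) → Stray u v
          go (yes a) _ = ⊥-elim (caseV {⊥} (T γ z y) ¬c (λ g → excl ehh Bb Bb' (bα a) (bβ (eh r yβ)) (bγ g) λ _ ()) (λ g → excl ehn Bb Bb' (bα a) (bβ (eh r yβ)) (bγ g) λ _ ()))
          go _ (yes a) = caseV {Stray u v} (T γ z y) (λ g → ⊥-elim (¬c g)) (λ g → ⊥-elim (excl hhh Bb Bb' (bα (eh a yα)) (bβ (eh r yβ)) (bγ g) λ ()))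
            (λ g → mkStray s a r (bγ g))
          go (no ¬a) (no ¬a') = ⊥-elim (side ¬a ¬a')
        split : Dec (E β z y) → Dec (E γ z y) → Stray u v
        split (yes r) (yes k) = ⊥-elim (case1 r k)
        split (no ¬r) (yes k) = ⊥-elim (case2 (zβx ¬r) k)
        split (yes r) (no ¬k) = ⊥-elim (case3 r ¬k)
        split (no ¬r) (no ¬k) = case4 (zβx ¬r) ¬k

      strays : Stray u₁ v₁ → Stray u₁ v₂ → ⊥
      strays (b' , Bb' , aα , aβ , _) (b'' , Bb'' , cα , cβ , _) = caseV (T γ b' b'')
          (λ g → excl ehe Bb' Bb'' eα hβ g λ _ ()) (λ g → excl ehh Bb' Bb'' eα hβ g λ _ ()) (λ g → excl ehn Bb' Bb'' eα hβ g λ _ ())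
        where
        lα : ∀ b b' b'' x u → ((b - b'') - (x - u)) - ((b - b') - (x - u)) ≡ b' - b''
        lα = solve-∀
        lβ : ∀ b b' b'' x v v' → ((b - b'') - (x - v')) - ((b - b') - (x - v)) ≡ (b' - b'') - (v - v')
        lβ = solve-∀
        eα : E α b' b''
        eα = E⁺ (subst (pp α ∣ᵢ_) (lα b b' b'' x u₁) (∣m∣n⇒∣m-n cα aα))
        hβ : T β b' b'' ≡ h
        hβ = trans (T-diff (subst (pp β ∣ᵢ_) (lβ b b' b'' x v₁ v₂) (∣m∣n⇒∣m-n cβ aβ))) hv₁₂

      contradictory : ⊥
      contradictory = strays (strayAt hu₁ hv₁ (solution₁ _ b)) (strayAt hu₁ hv₂ (solution₁ _ b))

    opx : ∀ w → Op.x[ w ] ≈ x[ w ]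
    opx w = E⇒≈ (all3 (E-trans (Op.ptβ x x w) (E-sym (ptα x x w))) (E-trans (Op.ptα x x w) (E-sym (ptβ x x w))) (E-trans (Op.ptγ x x w) (E-sym (ptγ x x w))))

    typeα-all : ∀ {b} → B b → TypeAt β x[ l₁ ] b → ∀ w → T γ w x ≢ n → ¬ S w → TypeAt α Op.x[ w ] b
    typeα-all {b} Bb ty w w~ Sw = [ (λ r → r) , (λ r → ⊥-elim (type-unique t β≢γ ty
      (Op.transport w l₁ w~ Sw l₁~ Bb (ptβ x x l₁) (ptα x x l₁) (ptγ x x l₁) r))) ]′ (Op.AtLevel.kind w w~ Sw b Bb)

    Result : Set
    Result = (Shiftable γ x[ l₁ ] × Regular γ) ⊎
      (Regular α × Regular β × (∀ w → T γ w x ≢ n → ¬ S w → Shiftable α Op.x[ w ]))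

    result : Result
    result = first (search (AtLevel.kind l₁ l₁~ Sl₁))
      where
      second′ : ∀ {k} → TypeAt γ x[ l₁ ] k → (∀ b → B b → TypeAt γ x[ l₁ ] b) ⊎ (Σ ℤ λ b → B b × TypeAt β x[ l₁ ] b) → Result
      second′ tc (inj₁ all) = inj₁ (sweepγ l₁ l₁~ Sl₁ b₀ Bb₀ (all b₀ Bb₀) , λ b Bb → lineγ-full l₁ l₁~ Sl₁ b Bb (all b Bb))
      second′ tc (inj₂ (b , Bb , tb)) = ⊥-elim (Mixed.contradictory Bb tb (typeα-all Bb tb m₁ m₁~ Sm₁) (TypeAt.Az tc)
        (E-trans (TypeAt.line tc α α≢γ) (ptα x x l₁)) (E-trans (TypeAt.line tc β β≢γ) (ptβ x x l₁))
        (n-≢n (TypeAt.far tc) (≢n-trans (E⇒≢n (ptγ x x l₁)) l₁~)))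
      first : (∀ b → B b → TypeAt β x[ l₁ ] b) ⊎ (Σ ℤ λ b → B b × TypeAt γ x[ l₁ ] b) → Result
      first (inj₁ all) = inj₂ ((λ b Bb → Op.lineβ-full m₁ m₁~ Sm₁ b Bb (typeα-all Bb (all b Bb) m₁ m₁~ Sm₁)) ,
        (λ b Bb → lineβ-full l₁ l₁~ Sl₁ b Bb (all b Bb)) ,
        (λ w w~ Sw → Op.sweepβ w w~ Sw b₀ Bb₀ (typeα-all Bb₀ (all b₀ Bb₀) w w~ Sw)))
      first (inj₂ (k , Bk , tc)) = second′ tc (search λ b Bb → [ inj₂ , inj₁ ]′ (AtLevel.kind l₁ l₁~ Sl₁ b Bb))

  -- Diagonal boxes in the grid of x₀ (S ν marks the coordinates of I, J or K), for a B that is a transversal modulo p_i p_j p_k.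
  record Boxes {A B : ℤ → Set} (t : Tiling A B) (x₀ : ℤ) (S : Fin 3 → ℤ → Set) : Set where
    field
      S?     : ∀ ν w → Dec (S ν w)
      S-resp : ∀ {ν w w'} → E ν w w' → S ν w → S ν w'
      ⊤pt ⊥pt : Fin 3 → ℤ
      ⊤~     : ∀ ν → T ν (⊤pt ν) x₀ ≢ n
      ⊥~     : ∀ ν → T ν (⊥pt ν) x₀ ≢ n
      S⊤     : ∀ ν → S ν (⊤pt ν)
      S⊥     : ∀ ν → ¬ S ν (⊥pt ν)
      box⊤   : ∀ {y} → (∀ ν → T ν y x₀ ≢ n) → (∀ ν → S ν y) → A y
      box⊥   : ∀ {y} → (∀ ν → T ν y x₀ ≢ n) → (∀ ν → ¬ S ν y) → A y
      graph  : ∀ {b b'} → B b → B b' → (∀ ν → T ν b b' ≢ n) → b ≈ b'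
      onto   : ∀ c → Σ ℤ λ b → B b × (∀ ν → T ν b c ≢ n)

  flip : ∀ {A B t x₀ S} → Boxes {A} {B} t x₀ S → Boxes t x₀ (λ ν w → ¬ S ν w)
  flip {S = S} k = record { S? = λ ν w → ¬? (S? ν w) ; S-resp = λ q ¬s s → ¬s (S-resp (E-sym q) s)
    ; ⊤pt = ⊥pt ; ⊥pt = ⊤pt ; ⊤~ = ⊥~ ; ⊥~ = ⊤~ ; S⊤ = S⊥ ; S⊥ = λ ν g → g (S⊤ ν)
    ; box⊤ = box⊥ ; box⊥ = λ q s → box⊤ q (λ ν → pick (S? ν _) (s ν)) ; graph = graph ; onto = onto }
    where open Boxes k

  module Axis {A B : ℤ → Set} (t : Tiling A B) (α β γ : Fin 3) (d : Distinct3 p α β γ) (x₀ : ℤ) (S : Fin 3 → ℤ → Set) (k : Boxes t x₀ S) where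
    open Clashes t α β γ d
    open Boxes k

    differ : ∀ {ν w w'} → S ν w → ¬ S ν w' → ¬ E ν w w'
    differ s ¬s q = ¬s (S-resp q s)

    pt~ : ∀ {u v w} → T α u x₀ ≢ n → T β v x₀ ≢ n → T γ w x₀ ≢ n → ∀ ν → T ν (pt u v w) x₀ ≢ n
    pt~ {u} {v} {w} a b c = all3 (≢n-trans (E⇒≢n (ptα u v w)) a) (≢n-trans (E⇒≢n (ptβ u v w)) b) (≢n-trans (E⇒≢n (ptγ u v w)) c)

    inBox⊤ : ∀ {u v w} → T α u x₀ ≢ n → T β v x₀ ≢ n → T γ w x₀ ≢ n → S α u → S β v → S γ w → A (pt u v w)
    inBox⊤ {u} {v} {w} a b c sa sb sc = box⊤ (pt~ a b c)
      (all3 (S-resp (E-sym (ptα u v w)) sa) (S-resp (E-sym (ptβ u v w)) sb) (S-resp (E-sym (ptγ u v w)) sc))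

    inBox⊥ : ∀ {u v w} → T α u x₀ ≢ n → T β v x₀ ≢ n → T γ w x₀ ≢ n → ¬ S α u → ¬ S β v → ¬ S γ w → A (pt u v w)
    inBox⊥ {u} {v} {w} a b c sa sb sc = box⊥ (pt~ a b c)
      (all3 (λ s → sa (S-resp (ptα u v w) s)) (λ s → sb (S-resp (ptβ u v w) s)) (λ s → sc (S-resp (ptγ u v w) s)))

    -- A point of A on the α-axis grids.
    record OnAxis (z : ℤ) : Set where
      constructor onAxis
      field
        Az : A z
        zα : T α z x₀ ≡ n
        zβ : T β z x₀ ≢ n
        zγ : T γ z x₀ ≢ n

    hd : ∀ {ν w w'} → T ν w x₀ ≢ n → T ν w' x₀ ≢ n → ¬ E ν w w' → T ν w w' ≡ h
    hd a b q = ≢⇒h (≢n-trans a (≢n-sym b)) q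

    far : ∀ {z u v w} → OnAxis z → T α u x₀ ≢ n → T α z (pt u v w) ≡ n
    far {z} {u} {v} {w} o q = n-≢n (OnAxis.zα o) (≢n-sym (≢n-trans (E⇒≢n (ptα u v w)) q))

    nee⊤ : ∀ {z} → OnAxis z → S β z → S γ z → DivA n e e
    nee⊤ {z} o@(onAxis Az _ zβ zγ) sb sc = divA Az (inBox⊤ (⊤~ α) zβ zγ (S⊤ α) sb sc) (far o (⊤~ α)) (E-sym (ptβ (⊤pt α) z z)) (E-sym (ptγ (⊤pt α) z z))

    nhh⊤ : ∀ {z} → OnAxis z → S β z → S γ z → DivA n h h
    nhh⊤ {z} o@(onAxis Az _ zβ zγ) sb sc = divA Az (inBox⊥ (⊥~ α) (⊥~ β) (⊥~ γ) (S⊥ α) (S⊥ β) (S⊥ γ)) (far o (⊥~ α))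
      (conv E-refl (ptβ _ _ _) (hd zβ (⊥~ β) (differ sb (S⊥ β)))) (conv E-refl (ptγ _ _ _) (hd zγ (⊥~ γ) (differ sc (S⊥ γ))))

    nhe⊤ : ∀ {z} → OnAxis z → S β z → ¬ S γ z → DivA n h e
    nhe⊤ {z} o@(onAxis Az _ zβ zγ) sb sc = divA Az (inBox⊥ (⊥~ α) (⊥~ β) zγ (S⊥ α) (S⊥ β) sc) (far o (⊥~ α))
      (conv E-refl (ptβ _ _ _) (hd zβ (⊥~ β) (differ sb (S⊥ β)))) (E-sym (ptγ (⊥pt α) (⊥pt β) z))

    excl′ : ∀ {b b'} → DivA n h e → B b → B b' → T α b b' ≡ n → T β b b' ≡ h → T γ b b' ≡ e → ⊥
    excl′ w Bb Bb' q r g = excl w Bb Bb' q r g λ ()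

    exclₕ : ∀ {b b'} → DivA n h h → B b → B b' → T α b b' ≡ n → T β b b' ≡ h → T γ b b' ≡ h → ⊥
    exclₕ w Bb Bb' q r g = excl w Bb Bb' q r g λ ()

    module Pair {z b b₁ : ℤ} (oz : OnAxis z) (Bb : B b) (Bb₁ : B b₁) (far₁ : T α b b₁ ≡ n) where
      open OnAxis oz

      -- Along the α-line of b in B the β-coordinate is injective and the γ-coordinate constant; p_α ≠ p_β leaves
      -- a β-coordinate w that the line misses, which produces a point of the grid that cannot be covered.
      module HE (hβ : T β b b₁ ≡ h) (eγ : E γ b b₁) (sβ : S β z) (sγ : S γ z) where

        single : ∀ {j} → T β j x₀ ≢ n → S β j → E β j z
        single {j} j~ sj = pick (E? β j z) λ ¬q → excl
          (divA Az (inBox⊤ (⊤~ α) j~ zγ (S⊤ α) sj sγ) (far oz (⊤~ α)) (conv E-refl (ptβ _ _ _) (symT (hd j~ zβ ¬q))) (E-sym (ptγ (⊤pt α) j z)))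
          Bb Bb₁ far₁ hβ eγ λ ()

        star : ∀ {b₂} → B b₂ → T α b b₂ ≡ n → T β b b₂ ≢ n → T γ b b₂ ≢ n → T β b b₂ ≡ h × E γ b b₂
        star {b₂} Bb₂ qα qβ qγ = caseV (T β b b₂)
            (λ rβ → caseV (T γ b b₂) (λ rγ → ⊥-elim (excl (nee⊤ oz sβ sγ) Bb Bb₂ qα rβ rγ λ ())) (λ rγ → ⊥-elim (eh rβ rγ)) (λ rγ → ⊥-elim (qγ rγ)))
            (λ rβ → caseV (T γ b b₂) (λ rγ → rβ , rγ) (λ rγ → ⊥-elim (excl (nhh⊤ oz sβ sγ) Bb Bb₂ qα rβ rγ λ ())) (λ rγ → ⊥-elim (qγ rγ)))
            (λ rβ → ⊥-elim (qβ rβ))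
          where
          eh : E β b b₂ → T γ b b₂ ≡ h → ⊥
          eh rβ rγ = caseV (T α b₁ b₂) (λ g → near (E⇒≢n g)) (λ g → near (h⇒≢n g)) (λ g → excl (nhh⊤ oz sβ sγ) Bb₁ Bb₂ g kβ kγ λ ())
            where
            kβ : T β b₁ b₂ ≡ h
            kβ = conv E-refl (E-sym rβ) (symT hβ)
            kγ : T γ b₁ b₂ ≡ h
            kγ = trans (T-Eˡ b₂ (E-sym eγ)) rγ
            near : T α b₁ b₂ ≢ n → ⊥
            near g = h⇒¬E kβ (≈⇒E (graph Bb₁ Bb₂ (all3 g (h⇒≢n kβ) (h⇒≢n kγ))) β)

        class : ℕ → ℤ
        class i = pt (b + + i) b b

        member : ∀ i → Σ ℤ λ b' → B b' × (∀ ν → T ν b' (class i) ≢ n)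
        member i = onto (class i)
        c : Fin (p α) → ℤ
        c i = proj₁ (member (Fin.toℕ i))
        Bc : ∀ i → B (c i)
        Bc i = proj₁ (proj₂ (member (Fin.toℕ i)))
        c~ : ∀ i ν → T ν (c i) (class (Fin.toℕ i)) ≢ n
        c~ i = proj₂ (proj₂ (member (Fin.toℕ i)))
        cβ : ∀ i → T β b (c i) ≢ n
        cβ i = ≢n-sym (≢n-trans (c~ i β) (E⇒≢n (ptβ _ b b)))
        cγ : ∀ i → T γ b (c i) ≢ n
        cγ i = ≢n-sym (≢n-trans (c~ i γ) (E⇒≢n (ptγ _ b b)))
        cα : ∀ i → T α (c i) (b + + Fin.toℕ i) ≢ n
        cα i = ≢n-trans (c~ i α) (E⇒≢n (ptα _ b b))

        distinct : ∀ i j → i ≢ j → T α (c i) (c j) ≡ n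
        distinct i j i≢j = pick (N? α (c i) (c j)) λ near →
          small (Fin.toℕ i) (Fin.toℕ j) (FP.toℕ<n i) (FP.toℕ<n j) (λ q → i≢j (FP.toℕ-injective q))
            (≢n⁻ (≢n-trans (≢n-sym (cα i)) (≢n-trans near (cα j))))
          where
          lem : ∀ b i k → b + (i + k) - (b + i) ≡ k
          lem = solve-∀
          lt : ∀ i j → i < j → j < p α → ¬ p α ∣ᵢ (b + + j) - (b + + i)
          lt i j i<j j<p g = Folding.pos-∤ (ℕP.m<n⇒0<n∸m i<j) (ℕP.≤-<-trans (ℕP.m∸n≤m j i) j<p)
            (subst (p α ∣ᵢ_) (trans (cong (λ q → b + + q - (b + + i)) (sym (ℕP.m+[n∸m]≡n (ℕP.<⇒≤ i<j)))) (lem b (+ i) (+ (j ∸ i)))) g)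
          small : ∀ i j → i < p α → j < p α → i ≢ j → ¬ p α ∣ᵢ (b + + i) - (b + + j)
          small i j i<p j<p i≢j g = cmp (ℕP.<-cmp i j)
            where
            cmp : _ → ⊥
            cmp (tri< a _ _) = lt i j a j<p (∣-swap (p α) (b + + i) (b + + j) g)
            cmp (tri≈ _ q _) = i≢j q
            cmp (tri> _ _ a) = lt j i a i<p g

        cγE : ∀ i → E γ b (c i)
        cγE i = caseV (T α b (c i)) (λ g → near (E⇒≢n g)) (λ g → near (h⇒≢n g)) (λ g → proj₂ (star (Bc i) g (cβ i) (cγ i)))
          where
          near : T α b (c i) ≢ n → E γ b (c i)
          near g = ≈⇒E (graph Bb (Bc i) (all3 g (cβ i) (cγ i))) γ

        c≁ : ∀ i j → i ≢ j → ¬ E β (c i) (c j)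
        c≁ i j i≢j q = excl (nee⊤ oz sβ sγ) (Bc i) (Bc j) (distinct i j i≢j) q (E-trans (E-sym (cγE i)) (cγE j)) λ ()

        index : Fin (p α) → Fin (p β)
        index i = proj₁ (at-E {x = b} (≢n-sym (cβ i)))
        index-E : ∀ i → E β (c i) (at β b (Fin.toℕ (index i)))
        index-E i = proj₂ (at-E {x = b} (≢n-sym (cβ i)))

        pα≤pβ : p α ≤ p β
        pα≤pβ = FP.injective⇒≤ {f = index} λ {i} {j} q → pick (i Fin.≟ j) λ i≢j →
          c≁ i j i≢j (E-trans (index-E i) (subst (λ m → E β (at β b (Fin.toℕ m)) (c j)) (sym q) (E-sym (index-E j))))

        Met : Fin (p β) → Set
        Met j = Σ (Fin (p α)) λ i → E β (c i) (at β b (Fin.toℕ j))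

        met? : ∀ j → Dec (Met j)
        met? j = FP.any? λ i → E? β (c i) (at β b (Fin.toℕ j))

        not-onto : ¬ (∀ j → Met j)
        not-onto g = p≢ α≢β (ℕP.≤-antisym pα≤pβ (FP.injective⇒≤ {f = λ j → proj₁ (g j)} λ {j} {j'} q →
          at-inj {x = b} j j' (E-trans (E-sym (proj₂ (g j))) (subst (λ i → E β (c i) (at β b (Fin.toℕ j'))) (sym q) (proj₂ (g j'))))))

        missed : Σ (Fin (p β)) λ j → ¬ Met j
        missed = FP.¬∀⟶∃¬ (p β) Met met? not-onto

        w : ℤ
        w = at β b (Fin.toℕ (proj₁ missed))

        wβ : T β w b ≢ n
        wβ = at-near b (Fin.toℕ (proj₁ missed))

        member-of : ∀ {b₂} → B b₂ → T β b b₂ ≢ n → T γ b b₂ ≢ n → Σ (Fin (p α)) λ i → b₂ ≈ c i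
        member-of {b₂} Bb₂ qβ qγ = i , graph Bb₂ (Bc i) (all3 nα (≢n-trans (≢n-sym qβ) (cβ i)) (≢n-trans (≢n-sym qγ) (cγ i)))
          where
          r : Σ ℕ λ m → m < p α × p α ∣ᵢ + m - (b₂ - b)
          r = reduce (p α) (p>0 α) (b₂ - b)
          i : Fin (p α)
          i = Fin.fromℕ< (proj₁ (proj₂ r))
          lem : ∀ b b₂ m → - (m - (b₂ - b)) ≡ b₂ - (b + m)
          lem = solve-∀
          nα : T α b₂ (c i) ≢ n
          nα = ≢n-trans (≢n⁺ (subst (p α ∣ᵢ_) (trans (lem b b₂ (+ proj₁ r)) (cong (λ m → b₂ - (b + + m)) (sym (FP.toℕ-fromℕ< (proj₁ (proj₂ r))))))
            (∣m⇒∣-m (proj₂ (proj₂ r))))) (≢n-sym (cα i))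

        w≁b : ¬ E β w b
        w≁b q = proj₂ missed (i , E-trans (E-sym (≈⇒E (proj₂ m) β)) (E-sym q))
          where
          m : Σ (Fin (p α)) λ i → b ≈ c i
          m = member-of Bb (E⇒≢n E-refl) (E⇒≢n E-refl)
          i = proj₁ m

        xβ : ℤ
        xβ = z + (w - b)

        xβz : T β xβ z ≡ h
        xβz = trans (T-diff (subst (pp β ∣ᵢ_) (sym (lem z w b)) (0∣ᵢ (pp β)))) (≢⇒h wβ w≁b)
          where
          lem : ∀ z w b → (z + (w - b) - z) - (w - b) ≡ 0ℤ
          lem = solve-∀

        xβ~ : T β xβ x₀ ≢ n
        xβ~ = ≢n-trans (h⇒≢n xβz) zβ

        ¬Sx : ¬ S β xβ
        ¬Sx s = h⇒¬E xβz (single xβ~ s)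

        x : ℤ
        x = pt (⊥pt α) xβ z

        x~ : ∀ ν → T ν x x₀ ≢ n
        x~ = pt~ (⊥~ α) xβ~ zγ

        ¬Ax : ¬ A x
        ¬Ax Ax = excl (divA Az Ax (far oz (⊥~ α)) (conv E-refl (ptβ _ _ _) (symT xβz)) (E-sym (ptγ (⊥pt α) xβ z))) Bb Bb₁ far₁ hβ eγ λ ()

        dead : Sol₁ x b → ⊥
        dead s = split (N? α z₂ x) (N? β z₂ x)
          where
          z₂ = Sol₁.z s
          b₂ = Sol₁.b' s
          Az₂ = Sol₁.Az s
          Bb₂ = Sol₁.Bb' s
          q = Sol₁.eqT s
          γnear : T γ z₂ x ≢ n
          γnear g = bispan ¬Ax (inBox⊥ (⊥~ α) xβ~ (⊥~ γ) (S⊥ α) ¬Sx (S⊥ γ))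
            (all3 (E⇒≢n sα) (E⇒≢n sβ′) (h⇒≢n hγ)) Az₂ Bb Bb₂ q
            (all3 (inj₁ sα) (inj₁ sβ′) (inj₂ (n⇒¬E g , n⇒¬E (n-≢n g (h⇒≢n hγ)))))
            where
            sα : E α x (pt (⊥pt α) xβ (⊥pt γ))
            sα = E-trans (ptα _ _ _) (E-sym (ptα _ _ _))
            sβ′ : E β x (pt (⊥pt α) xβ (⊥pt γ))
            sβ′ = E-trans (ptβ _ _ _) (E-sym (ptβ _ _ _))
            hγ : T γ x (pt (⊥pt α) xβ (⊥pt γ)) ≡ h
            hγ = conv (ptγ _ _ _) (ptγ _ _ _) (hd zγ (⊥~ γ) (differ sγ (S⊥ γ)))
          notboth : T α z₂ x ≡ n → T β z₂ x ≡ n → ⊥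
          notboth g g' = bispan ¬Ax (inBox⊤ (⊤~ α) zβ zγ (S⊤ α) sβ sγ)
            (all3 hα (h⇒≢n hβ′) (E⇒≢n sγ′)) Az₂ Bb Bb₂ q
            (all3 (inj₂ (n⇒¬E g , n⇒¬E (n-≢n g hα))) (inj₂ (n⇒¬E g' , n⇒¬E (n-≢n g' (h⇒≢n hβ′)))) (inj₁ sγ′))
            where
            hα : T α x (pt (⊤pt α) z z) ≢ n
            hα = ≢n-trans (x~ α) (≢n-sym (pt~ (⊤~ α) zβ zγ α))
            hβ′ : T β x (pt (⊤pt α) z z) ≡ h
            hβ′ = conv (ptβ _ _ _) (ptβ _ _ _) xβz
            sγ′ : E γ x (pt (⊤pt α) z z)
            sγ′ = E-trans (ptγ _ _ _) (E-sym (ptγ _ _ _))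
          onα : T α z₂ x ≡ n → T β z₂ x ≢ n → ⊥
          onα g g' = go (S? β z₂)
            where
            st = star Bb₂ (trans (sym (q α)) g) (λ k → g' (trans (q β) k)) (λ k → γnear (trans (q γ) k))
            o₂ : OnAxis z₂
            o₂ = onAxis Az₂ (n-≢n g (x~ α)) (≢n-trans g' (x~ β)) (≢n-trans γnear (x~ γ))
            z₂γ : E γ z₂ z
            z₂γ = E-trans (trans (q γ) (proj₂ st)) (ptγ _ _ _)
            lem : ∀ z₂ z x b b₂ w → ((z₂ - z) - (x - (z + (w - b)))) - ((z₂ - x) - (b - b₂)) ≡ - (b₂ - w)
            lem = solve-∀
            go : Dec (S β z₂) → ⊥
            go (no ¬s) = excl (divA Az₂ (inBox⊤ (⊤~ α) zβ (OnAxis.zγ o₂) (S⊤ α) sβ (S-resp (E-sym z₂γ) sγ)) (far o₂ (⊤~ α))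
              (conv E-refl (ptβ _ _ _) (symT (hd zβ (OnAxis.zβ o₂) (differ sβ ¬s)))) (E-sym (ptγ _ _ _))) Bb Bb₁ far₁ hβ eγ λ ()
            go (yes s₂) = proj₂ missed (proj₁ m , E-trans (E-sym (≈⇒E (proj₂ m) β)) b₂w)
              where
              m : Σ (Fin (p α)) λ i → b₂ ≈ c i
              m = member-of Bb₂ (λ k → g' (trans (q β) k)) (λ k → γnear (trans (q γ) k))
              b₂w : E β b₂ w
              b₂w = E⁺ (subst (pp β ∣ᵢ_) (ℤP.neg-involutive _) (∣m⇒∣-m (subst (pp β ∣ᵢ_) (lem z₂ z x b b₂ w)
                (∣m∣n⇒∣m-n (∣m∣n⇒∣m-n (E⁻ (single (OnAxis.zβ o₂) s₂)) (E⁻ (ptβ (⊥pt α) xβ z))) (∣ᵢ-trans (pp∣M β) (≈⁻ (Sol₁.shift s)))))))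
          onβ : T α z₂ x ≢ n → T β z₂ x ≡ n → ⊥
          onβ g g' = n⇒¬E (n-≢n (symT far₁) (λ k → g (trans (q α) k))) (≈⇒E (clash Az Az₂ Bb₁ Bb₂ (all3
            (trans (n-≢n zα (≢n-trans (≢n-sym (x~ α)) (≢n-sym g))) (sym (n-≢n (symT far₁) (λ k → g (trans (q α) k)))))
            (trans (≢n-n (≢n-trans zβ (≢n-sym (x~ β))) (symT g')) (sym (≢n-n (≢n-sym (h⇒≢n hβ)) (trans (sym (q β)) g'))))
            (trans (T-Eˡ z₂ (E-sym (ptγ (⊥pt α) xβ z))) (trans (T-sym x z₂) (trans (q γ) (T-Eˡ b₂ eγ)))))) α)
          split : Dec (T α z₂ x ≡ n) → Dec (T β z₂ x ≡ n) → ⊥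
          split (yes g) (yes g') = notboth g g'
          split (yes g) (no g') = onα g g'
          split (no g) (yes g') = onβ g g'
          split (no g) (no g') = ¬Ax (A-resp (E⇒≈ λ ν → trans (q ν) (≈⇒E (graph Bb Bb₂ (all3 (λ k → g (trans (q α) k)) (λ k → g' (trans (q β) k)) (λ k → γnear (trans (q γ) k)))) ν)) Az₂)

        contradictory : ⊥
        contradictory = dead (solution₁ x b)

      module HH (hβ : T β b b₁ ≡ h) (hγ : T γ b b₁ ≡ h) (sβ : S β z) (¬sγ : ¬ S γ z) where

        singleβ : ∀ {j} → T β j x₀ ≢ n → S β j → E β j z
        singleβ {j} j~ sj = pick (E? β j z) λ ¬q → excl
          (divA Az (inBox⊤ (⊤~ α) j~ (⊤~ γ) (S⊤ α) sj (S⊤ γ)) (far oz (⊤~ α)) (conv E-refl (ptβ _ _ _) (symT (hd j~ zβ ¬q)))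
            (conv E-refl (ptγ _ _ _) (symT (hd (⊤~ γ) zγ (differ (S⊤ γ) ¬sγ)))))
          Bb Bb₁ far₁ hβ hγ λ ()

        singleγ : ∀ {j} → T γ j x₀ ≢ n → ¬ S γ j → E γ j z
        singleγ {j} j~ sj = pick (E? γ j z) λ ¬q → excl
          (divA Az (inBox⊥ (⊥~ α) (⊥~ β) j~ (S⊥ α) (S⊥ β) sj) (far oz (⊥~ α)) (conv E-refl (ptβ _ _ _) (hd zβ (⊥~ β) (differ sβ (S⊥ β))))
            (conv E-refl (ptγ _ _ _) (symT (hd j~ zγ ¬q))))
          Bb Bb₁ far₁ hβ hγ λ ()

        xγ : ℤ
        xγ = z + (b₁ - b)

        lem₀ : ∀ z b₁ b → (z + (b₁ - b) - z) - (b₁ - b) ≡ 0ℤ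
        lem₀ = solve-∀

        xγz : T γ xγ z ≡ h
        xγz = trans (T-diff (subst (pp γ ∣ᵢ_) (sym (lem₀ z b₁ b)) (0∣ᵢ (pp γ)))) (symT hγ)

        xγ~ : T γ xγ x₀ ≢ n
        xγ~ = ≢n-trans (h⇒≢n xγz) zγ

        Sxγ : S γ xγ
        Sxγ = pick (S? γ xγ) λ ¬s → h⇒¬E xγz (singleγ xγ~ ¬s)

        chosen : Σ ℤ λ v → T β v z ≡ h × ¬ E β v (z + (b₁ - b))
        chosen = avoid β z (z + (b₁ - b))
        v = proj₁ chosen
        vz : T β v z ≡ h
        vz = proj₁ (proj₂ chosen)
        v~ : T β v x₀ ≢ n
        v~ = ≢n-trans (h⇒≢n vz) zβ
        ¬Sv : ¬ S β v
        ¬Sv s = h⇒¬E vz (singleβ v~ s)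

        x : ℤ
        x = pt (⊥pt α) v xγ

        x~ : ∀ ν → T ν x x₀ ≢ n
        x~ = pt~ (⊥~ α) v~ xγ~

        ¬Ax : ¬ A x
        ¬Ax Ax = excl (divA Az Ax (far oz (⊥~ α)) (conv E-refl (ptβ _ _ _) (symT vz)) (conv E-refl (ptγ _ _ _) (symT xγz))) Bb Bb₁ far₁ hβ hγ λ ()

        dead : Sol₁ x b → ⊥
        dead s = split (N? α z₂ x) (N? β z₂ x)
          where
          z₂ = Sol₁.z s
          b₂ = Sol₁.b' s
          Az₂ = Sol₁.Az s
          Bb₂ = Sol₁.Bb' s
          q = Sol₁.eqT s
          γnear : E γ z₂ x ⊎ E γ z₂ z
          γnear = two (E? γ z₂ x) (E? γ z₂ z)
            where
            sα : E α x (pt (⊥pt α) v z)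
            sα = E-trans (ptα _ _ _) (E-sym (ptα _ _ _))
            sβ′ : E β x (pt (⊥pt α) v z)
            sβ′ = E-trans (ptβ _ _ _) (E-sym (ptβ _ _ _))
            two : Dec (E γ z₂ x) → Dec (E γ z₂ z) → E γ z₂ x ⊎ E γ z₂ z
            two (yes g) _ = inj₁ g
            two _ (yes g) = inj₂ g
            two (no g) (no g') = ⊥-elim (bispan ¬Ax (inBox⊥ (⊥~ α) v~ zγ (S⊥ α) ¬Sv ¬sγ)
              (all3 (E⇒≢n sα) (E⇒≢n sβ′) (h⇒≢n (conv (ptγ _ _ _) (ptγ _ _ _) xγz))) Az₂ Bb Bb₂ q
              (all3 (inj₁ sα) (inj₁ sβ′) (inj₂ (g , λ r → g' (E-trans r (ptγ _ _ _))))))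
          γn : T γ z₂ x ≢ n
          γn = [ E⇒≢n , (λ g → ≢n-trans (E⇒≢n g) (≢n-trans zγ (≢n-sym (x~ γ)))) ]′ γnear
          notboth : T α z₂ x ≡ n → T β z₂ x ≡ n → ⊥
          notboth g g' = bispan ¬Ax (inBox⊤ (⊤~ α) zβ xγ~ (S⊤ α) sβ Sxγ)
            (all3 hα (h⇒≢n hβ′) (E⇒≢n sγ′)) Az₂ Bb Bb₂ q
            (all3 (inj₂ (n⇒¬E g , n⇒¬E (n-≢n g hα))) (inj₂ (n⇒¬E g' , n⇒¬E (n-≢n g' (h⇒≢n hβ′)))) (inj₁ sγ′))
            where
            hα : T α x (pt (⊤pt α) z xγ) ≢ n
            hα = ≢n-trans (x~ α) (≢n-sym (pt~ (⊤~ α) zβ xγ~ α))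
            hβ′ : T β x (pt (⊤pt α) z xγ) ≡ h
            hβ′ = conv (ptβ _ _ _) (ptβ _ _ _) vz
            sγ′ : E γ x (pt (⊤pt α) z xγ)
            sγ′ = E-trans (ptγ _ _ _) (E-sym (ptγ _ _ _))
          lem : ∀ z₂ z x b b₂ a → ((z₂ - z) - (x - (z + (a - b)))) - ((z₂ - x) - (b - b₂)) ≡ - (b₂ - a)
          lem = solve-∀
          landing : ∀ {ν a} → E ν z₂ z → E ν x (z + (a - b)) → E ν b₂ a
          landing {ν} {a} r r' = E⁺ (subst (pp ν ∣ᵢ_) (ℤP.neg-involutive _) (∣m⇒∣-m (subst (pp ν ∣ᵢ_) (lem z₂ z x b b₂ a)
                (∣m∣n⇒∣m-n (∣m∣n⇒∣m-n (E⁻ r) (E⁻ r')) (∣ᵢ-trans (pp∣M ν) (≈⁻ (Sol₁.shift s)))))))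
          onα : T α z₂ x ≡ n → T β z₂ x ≢ n → ⊥
          onα g g' = last (proj₁ place) (proj₂ place)
            where
            o₂ : OnAxis z₂
            o₂ = onAxis Az₂ (n-≢n g (x~ α)) (≢n-trans g' (x~ β)) (≢n-trans γn (x~ γ))
            open OnAxis o₂ using () renaming (zβ to z₂β; zγ to z₂γ)
            place : E β z₂ z × E γ z₂ z
            place = go (S? β z₂) (S? γ z₂)
              where
              go : Dec (S β z₂) → Dec (S γ z₂) → E β z₂ z × E γ z₂ z
              go (yes s₁) (yes s₂) = ⊥-elim (excl (nhh⊤ o₂ s₁ s₂) Bb Bb₁ far₁ hβ hγ λ ())
              go (yes s₁) (no s₂) = singleβ z₂β s₁ , singleγ z₂γ s₂
              go (no s₁) (no s₂) = ⊥-elim (excl (divA Az₂ (inBox⊤ (⊤~ α) (⊤~ β) (⊤~ γ) (S⊤ α) (S⊤ β) (S⊤ γ)) (far o₂ (⊤~ α))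
                (conv E-refl (ptβ _ _ _) (symT (hd (⊤~ β) z₂β (differ (S⊤ β) s₁))))
                (conv E-refl (ptγ _ _ _) (symT (hd (⊤~ γ) z₂γ (differ (S⊤ γ) s₂))))) Bb Bb₁ far₁ hβ hγ λ ())
              go (no s₁) (yes s₂) = let k , kz , ¬k = avoid γ z z₂
                                        k~ = ≢n-trans (h⇒≢n kz) zγ
                                        sk = pick (S? γ k) λ ¬s → h⇒¬E kz (singleγ k~ ¬s) in
                ⊥-elim (excl (divA Az₂ (inBox⊤ (⊤~ α) zβ k~ (S⊤ α) sβ sk) (far o₂ (⊤~ α))
                  (conv E-refl (ptβ _ _ _) (symT (hd zβ z₂β (differ sβ s₁)))) (conv E-refl (ptγ _ _ _) (symT (hd k~ z₂γ ¬k)))) Bb Bb₁ far₁ hβ hγ λ ())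
            last : E β z₂ z → E γ z₂ z → ⊥
            last rβ rγ = caseV (T α b₂ b₁) (λ r → near (E⇒≢n r)) (λ r → near (h⇒≢n r))
                (λ r → excl (nhe⊤ oz sβ ¬sγ) Bb₂ Bb₁ r hβ₂ eγ₂ λ ())
              where
              eγ₂ : E γ b₂ b₁
              eγ₂ = landing rγ (ptγ _ _ _)
              ¬eβ : ¬ E β b₂ b₁
              ¬eβ r = proj₂ (proj₂ chosen) (E-trans (E-sym (ptβ (⊥pt α) v xγ)) (back r))
                where
                back : E β b₂ b₁ → E β x (z + (b₁ - b))
                back r = E⁺ (subst (pp β ∣ᵢ_) (lem″ z₂ z x b b₂ b₁) (∣m∣n⇒∣m+n (∣m∣n⇒∣m-n (E⁻ rβ) (∣ᵢ-trans (pp∣M β) (≈⁻ (Sol₁.shift s)))) (E⁻ r)))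
                  where
                  lem″ : ∀ z₂ z x b b₂ a → ((z₂ - z) - ((z₂ - x) - (b - b₂))) + (b₂ - a) ≡ x - (z + (a - b))
                  lem″ = solve-∀
              hβ₂ : T β b₂ b₁ ≡ h
              hβ₂ = ≢⇒h (≢n-trans (λ k → g' (trans (q β) (trans (T-sym b b₂) k))) (h⇒≢n hβ)) ¬eβ
              near : T α b₂ b₁ ≢ n → ⊥
              near r = ¬eβ (≈⇒E (graph Bb₂ Bb₁ (all3 r (h⇒≢n hβ₂) (E⇒≢n eγ₂))) β)
          onβ : T α z₂ x ≢ n → T β z₂ x ≡ n → ⊥
          onβ g g' = n⇒¬E bα (≈⇒E (clash Az Az₂ Bb₁ Bb₂ (all3
              (trans (n-≢n zα (≢n-trans (≢n-sym (x~ α)) (≢n-sym g))) (sym bα))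
              (trans (≢n-n (≢n-trans zβ (≢n-sym (x~ β))) (symT g')) (sym (≢n-n (≢n-sym (h⇒≢n hβ)) (trans (sym (q β)) g'))))
              ([ γx , γz ]′ γnear))) α)
            where
            bα : T α b₁ b₂ ≡ n
            bα = n-≢n (symT far₁) (λ k → g (trans (q α) k))
            γx : E γ z₂ x → T γ z z₂ ≡ T γ b₁ b₂
            γx r = trans (conv E-refl (E-trans r (ptγ (⊥pt α) v xγ)) (symT xγz)) (sym (trans (T-Eʳ b₁ (E-sym (trans (sym (q γ)) r))) (symT hγ)))
            γz : E γ z₂ z → T γ z z₂ ≡ T γ b₁ b₂
            γz r = trans (E-sym r) (sym (E-sym (landing r (ptγ _ _ _))))
          split : Dec (T α z₂ x ≡ n) → Dec (T β z₂ x ≡ n) → ⊥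
          split (yes g) (yes g') = notboth g g'
          split (yes g) (no g') = onα g g'
          split (no g) (yes g') = onβ g g'
          split (no g) (no g') = ¬Ax (A-resp (E⇒≈ λ ν → trans (q ν) (≈⇒E (graph Bb Bb₂ (all3 (λ k → g (trans (q α) k)) (λ k → g' (trans (q β) k)) (λ k → γn (trans (q γ) k)))) ν)) Az₂)

        contradictory : ⊥
        contradictory = dead (solution₁ x b)

  module Rigid {A B : ℤ → Set} (t : Tiling A B) (α β γ : Fin 3) (d : Distinct3 p α β γ) (x₀ : ℤ) (S : Fin 3 → ℤ → Set) (k : Boxes t x₀ S) where
    open Clashes t α β γ d
    open Boxes k
    open Axis t α β γ d x₀ S k using (OnAxis; onAxis)

    S′ : Fin 3 → ℤ → Set
    S′ ν w = ¬ S ν w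

    d′ : Distinct3 p α γ β
    d′ = proj₂ (proj₂ d) , (λ q → proj₁ (proj₂ d) (sym q)) , proj₁ d

    module X = Axis t α β γ d x₀ S k
    module X′ = Axis t α β γ d x₀ S′ (flip k)
    module Y = Axis t α γ β d′ x₀ S k
    module Y′ = Axis t α γ β d′ x₀ S′ (flip k)

    -- If A meets a grid on the α-axis, then two elements of B on an α-line of grids lie on an actual α-line.
    rigid : ∀ {z b b₁} → OnAxis z → B b → B b₁ → T α b b₁ ≡ n → T β b b₁ ≢ n → T γ b b₁ ≢ n → E β b b₁ × E γ b b₁
    rigid {z} {b} {b₁} (onAxis Az zα zβ zγ) Bb Bb₁ far₁ qβ qγ = caseV (T β b b₁)
        (λ rβ → caseV (T γ b b₁) (λ rγ → rβ , rγ) (λ rγ → ⊥-elim (eh rβ rγ)) (λ rγ → ⊥-elim (qγ rγ)))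
        (λ rβ → caseV (T γ b b₁) (λ rγ → ⊥-elim (he rβ rγ)) (λ rγ → ⊥-elim (hh rβ rγ)) (λ rγ → ⊥-elim (qγ rγ)))
        (λ rβ → ⊥-elim (qβ rβ))
      where
      oX : X.OnAxis z
      oX = X.onAxis Az zα zβ zγ
      oX′ : X′.OnAxis z
      oX′ = X′.onAxis Az zα zβ zγ
      oY : Y.OnAxis z
      oY = Y.onAxis Az zα zγ zβ
      oY′ : Y′.OnAxis z
      oY′ = Y′.onAxis Az zα zγ zβ
      dec : Dec (S β z) → Dec (S γ z) → {P : Set} → (S β z → S γ z → P) → (S β z → ¬ S γ z → P) → (¬ S β z → S γ z → P) → (¬ S β z → ¬ S γ z → P) → P
      dec (yes a) (yes c) f _ _ _ = f a c
      dec (yes a) (no c) _ f _ _ = f a c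
      dec (no a) (yes c) _ _ f _ = f a c
      dec (no a) (no c) _ _ _ f = f a c
      he : T β b b₁ ≡ h → E γ b b₁ → ⊥
      he rβ rγ = dec (S? β z) (S? γ z) (X.Pair.HE.contradictory oX Bb Bb₁ far₁ rβ rγ)
        (λ a c → X.excl′ (X.nhe⊤ oX a c) Bb Bb₁ far₁ rβ rγ)
        (λ a c → X′.excl′ (X′.nhe⊤ oX′ a (λ g → g c)) Bb Bb₁ far₁ rβ rγ)
        (X′.Pair.HE.contradictory oX′ Bb Bb₁ far₁ rβ rγ)
      eh : E β b b₁ → T γ b b₁ ≡ h → ⊥
      eh rβ rγ = dec (S? β z) (S? γ z) (λ a c → Y.Pair.HE.contradictory oY Bb Bb₁ far₁ rγ rβ c a)
        (λ a c → Y′.excl′ (Y′.nhe⊤ oY′ c (λ g → g a)) Bb Bb₁ far₁ rγ rβ)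
        (λ a c → Y.excl′ (Y.nhe⊤ oY c a) Bb Bb₁ far₁ rγ rβ)
        (λ a c → Y′.Pair.HE.contradictory oY′ Bb Bb₁ far₁ rγ rβ c a)
      hh : T β b b₁ ≡ h → T γ b b₁ ≡ h → ⊥
      hh rβ rγ = dec (S? β z) (S? γ z) (λ a c → X.exclₕ (X.nhh⊤ oX a c) Bb Bb₁ far₁ rβ rγ)
        (X.Pair.HH.contradictory oX Bb Bb₁ far₁ rβ rγ)
        (λ a c → Y.Pair.HH.contradictory oY Bb Bb₁ far₁ rγ rβ c a)
        (λ a c → X′.exclₕ (X′.nhh⊤ oX′ a c) Bb Bb₁ far₁ rβ rγ)

  others : ∀ ν → Σ (Fin 3) λ β → Σ (Fin 3) λ γ → Distinct3 p ν β γ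
  others 0F = 1F , 2F , (λ ()) , (λ ()) , λ ()
  others 1F = 2F , 0F , (λ ()) , (λ ()) , λ ()
  others 2F = 0F , 1F , (λ ()) , (λ ()) , λ ()

  module Missing {A B : ℤ → Set} (t : Tiling A B) (x₀ : ℤ) (S : Fin 3 → ℤ → Set) (k : Boxes t x₀ S) where
    open Base t

    Axial : Fin 3 → ℤ → ℤ → Set
    Axial ν z x = T ν z x ≡ n × (∀ μ → μ ≢ ν → T μ z x ≢ n)

    OnGrid : ℤ → Set
    OnGrid x = ∀ ν → T ν x x₀ ≢ n

    module _ {x : ℤ} (x~ : OnGrid x) (¬Ax : ¬ A x) where
      -- The boxes contain the points obtained from x by moving its odd coordinate, or the two others, to the opposite side.
      mixed : ∀ {S′} → Boxes t x₀ S′ → ∀ α β γ → Distinct3 p α β γ → S′ α x → S′ β x → ¬ S′ γ x →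
        ∀ {z b b'} → A z → B b → B b' → (∀ μ → T μ z x ≡ T μ b b') → Σ (Fin 3) λ ν → Axial ν z x
      mixed k′ α β γ d sα sβ ¬sγ {z} {b} {b'} Az Bb Bb' q = split (N? α z x) (N? β z x)
        where
        open Labels α β γ d
        open Boxes k′
        A₁ : A (pt x x (⊤pt γ))
        A₁ = box⊤ (all3 (≢n-trans (E⇒≢n (ptα _ _ _)) (x~ α)) (≢n-trans (E⇒≢n (ptβ _ _ _)) (x~ β)) (≢n-trans (E⇒≢n (ptγ _ _ _)) (⊤~ γ)))
          (all3 (S-resp (E-sym (ptα _ _ _)) sα) (S-resp (E-sym (ptβ _ _ _)) sβ) (S-resp (E-sym (ptγ _ _ _)) (S⊤ γ)))
        A₂ : A (pt (⊥pt α) (⊥pt β) x)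
        A₂ = box⊥ (all3 (≢n-trans (E⇒≢n (ptα _ _ _)) (⊥~ α)) (≢n-trans (E⇒≢n (ptβ _ _ _)) (⊥~ β)) (≢n-trans (E⇒≢n (ptγ _ _ _)) (x~ γ)))
          (all3 (λ s → S⊥ α (S-resp (ptα _ _ _) s)) (λ s → S⊥ β (S-resp (ptβ _ _ _) s)) (λ s → ¬sγ (S-resp (ptγ _ _ _) s)))
        near : ∀ {ν y u} → E ν y u → T ν u x₀ ≢ n → T ν x y ≢ n
        near {ν} g u~ = ≢n-trans (x~ ν) (≢n-sym (≢n-trans (E⇒≢n g) u~))
        moveN : ∀ {ν y u} → E ν y u → T ν u x₀ ≢ n → T ν z x ≡ n → T ν z y ≡ T ν b b'
        moveN {ν} g u~ r = trans (n-≢n r (near g u~)) (trans (sym r) (q ν))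
        moveE : ∀ {ν y} → E ν y x → T ν z y ≡ T ν b b'
        moveE {ν} g = trans (T-Eʳ z g) (q ν)
        ¬γ : T γ z x ≢ n
        ¬γ r = n⇒¬E (trans (sym (q γ)) r) (≈⇒E (clash Az A₁ Bb Bb'
          (all3 (moveE (ptα _ _ _)) (moveE (ptβ _ _ _)) (moveN (ptγ _ _ _) (⊤~ γ) r))) γ)
        ¬αβ : T α z x ≡ n → T β z x ≡ n → ⊥
        ¬αβ r r' = n⇒¬E (trans (sym (q α)) r) (≈⇒E (clash Az A₂ Bb Bb'
          (all3 (moveN (ptα _ _ _) (⊥~ α) r) (moveN (ptβ _ _ _) (⊥~ β) r') (moveE (ptγ _ _ _)))) α)
        ¬none : T α z x ≢ n → T β z x ≢ n → ⊥
        ¬none r r' = ¬Ax (A-resp (E⇒≈ λ μ → trans (q μ) (≈⇒E (graph Bb Bb'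
          (λ μ g → all3 {λ μ → T μ z x ≢ n} r r' ¬γ μ (trans (q μ) g))) μ)) Az)
        split : Dec (T α z x ≡ n) → Dec (T β z x ≡ n) → Σ (Fin 3) λ ν → Axial ν z x
        split (yes r) (yes r') = ⊥-elim (¬αβ r r')
        split (yes r) (no r') = α , r , lineα r' ¬γ
        split (no r) (yes r') = β , r' , lineβ r ¬γ
        split (no r) (no r') = ⊥-elim (¬none r r')

      axis : ∀ {z b b'} → A z → B b → B b' → (∀ μ → T μ z x ≡ T μ b b') → Σ (Fin 3) λ ν → Axial ν z x
      axis {z} {b} {b'} Az Bb Bb' q = go (S? 0F x) (S? 1F x) (S? 2F x)
        where
        open Boxes k
        Out = Σ (Fin 3) λ ν → Axial ν z x
        three : {P : Fin 3 → Set} → P 0F → P 1F → P 2F → ∀ ν → P ν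
        three a b c 0F = a
        three a b c 1F = b
        three a b c 2F = c
        two : ∀ {S′} → Boxes t x₀ S′ → ∀ α β γ → Distinct3 p α β γ → S′ α x → S′ β x → ¬ S′ γ x → Out
        two k′ α β γ d a b c = mixed k′ α β γ d a b c Az Bb Bb' q
        go : Dec (S 0F x) → Dec (S 1F x) → Dec (S 2F x) → Out
        go (yes a) (yes b) (yes c) = ⊥-elim (¬Ax (box⊤ x~ (three a b c)))
        go (no a) (no b) (no c) = ⊥-elim (¬Ax (box⊥ x~ (three a b c)))
        go (yes a) (yes b) (no c) = two k 0F 1F 2F ((λ ()) , (λ ()) , λ ()) a b c
        go (yes a) (no b) (yes c) = two k 0F 2F 1F ((λ ()) , (λ ()) , λ ()) a c b
        go (no a) (yes b) (yes c) = two k 1F 2F 0F ((λ ()) , (λ ()) , λ ()) b c a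
        go (no a) (no b) (yes c) = two (flip k) 0F 1F 2F ((λ ()) , (λ ()) , λ ()) a b (λ g → g c)
        go (no a) (yes b) (no c) = two (flip k) 0F 2F 1F ((λ ()) , (λ ()) , λ ()) a c (λ g → g b)
        go (yes a) (no b) (no c) = two (flip k) 1F 2F 0F ((λ ()) , (λ ()) , λ ()) b c (λ g → g a)

      rigid : ∀ {ν z b b'} → Axial ν z x → A z → B b → B b' → T ν b b' ≡ n → (∀ μ → μ ≢ ν → T μ b b' ≢ n) →
        ∀ μ → μ ≢ ν → E μ b b'
      rigid {ν} {z} {b} {b'} (zn , z~) Az Bb Bb' q q′ = let β , γ , d = others ν in go β γ d
        where
        go : ∀ β γ → Distinct3 p ν β γ → ∀ μ → μ ≢ ν → E μ b b'
        go β γ d = lineα {λ μ → E μ b b'} (proj₁ both) (proj₂ both)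
          where
          open Labels ν β γ d
          module R = Rigid t ν β γ d x₀ S k
          on : ∀ μ → μ ≢ ν → T μ z x₀ ≢ n
          on μ g = ≢n-trans (z~ μ g) (x~ μ)
          both : E β b b' × E γ b b'
          both = R.rigid (R.X.onAxis Az (n-≢n zn (x~ ν)) (on β λ g → α≢β (sym g)) (on γ λ g → α≢γ (sym g))) Bb Bb' q
            (q′ β λ g → α≢β (sym g)) (q′ γ λ g → α≢γ (sym g))

      regular : ∀ {ν z} → Axial ν z x → A z → Regular ν
      regular {ν} ax Az b Bb c = go (N? ν b c)
        where
        open Boxes k using (onto)
        go : Dec (T ν b c ≡ n) → Σ ℤ λ b' → B b' × T ν b' c ≢ n × Line ν b b'
        go (no q) = b , Bb , q , λ μ _ → E-refl
        go (yes q) = b' , Bb' , near , λ μ g → E-sym (rigid ax Az Bb Bb' (n-≢n q (≢n-sym near)) (λ μ g → ≢n-sym (≢n-trans (b'~ μ) (E⇒≢n (set-E′ c b g)))) μ g)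
          where
          b' = proj₁ (onto (set ν c b))
          Bb' = proj₁ (proj₂ (onto (set ν c b)))
          b'~ : ∀ μ → T μ b' (set ν c b) ≢ n
          b'~ = proj₂ (proj₂ (onto (set ν c b)))
          near : T ν b' c ≢ n
          near = ≢n-trans (b'~ ν) (E⇒≢n (set-E ν c b))

      missing : Σ (Fin 3) λ ν → Shiftable ν x × Regular ν
      missing = result (solution₁ x b₀)
        where
        open Boxes k using (graph)
        along : ∀ {ν z b'} → Axial ν z x → A z → B b' → (∀ μ → T μ z x ≡ T μ b₀ b') → Line ν x z
        along {ν} ax Az Bb' q μ g = trans (q μ) (rigid ax Az Bb₀ Bb' (trans (sym (q ν)) (proj₁ ax)) (λ κ h g → proj₂ ax κ h (trans (q κ) g)) μ g)
        result : Sol₁ x b₀ → Σ (Fin 3) λ ν → Shiftable ν x × Regular ν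
        result s = ν , sweep Bb₀ (mkType s (proj₁ ax) (along ax Az Bb' eqT)) loc sp , regular ax Az
          where
          open Sol₁ s
          ν = proj₁ (axis Az Bb₀ Bb' eqT)
          ax = proj₂ (axis Az Bb₀ Bb' eqT)
          loc : Localised ν x b₀
          loc {z'} {c} Az' Bc q = go (axis Az' Bb₀ Bc q)
            where
            go : (Σ (Fin 3) λ μ → Axial μ z' x) → E ν z' x ⊎ (T ν z' x ≡ n × Line ν x z')
            go (μ , ax') = decide (ν Fin.≟ μ)
              where
              decide : Dec (ν ≡ μ) → E ν z' x ⊎ (T ν z' x ≡ n × Line ν x z')
              decide (yes refl) = inj₂ (proj₁ ax' , along ax' Az' Bc q)
              decide (no g) = inj₁ (along ax' Az' Bc q ν g)
          sp : Sparse ν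
          sp {b} {b'} Bb Bb' near ln = graph Bb Bb' λ μ → decide μ (μ Fin.≟ ν)
            where
            decide : ∀ μ → Dec (μ ≡ ν) → T μ b b' ≢ n
            decide μ (yes refl) = near
            decide μ (no g) = E⇒≢n (ln μ g)

  toℤ : Fin M → ℤ
  toℤ y = + Fin.toℕ y

  opaque
    dist-ℤ : ∀ a b → dist p a b ≡ ∣ + a - + b ∣
    dist-ℤ a b = [ le , ge ]′ (ℕP.≤-total a b)
      where
      le : a ≤ b → dist p a b ≡ ∣ + a - + b ∣
      le q = trans (cong (ℕ._+ (b ∸ a)) (ℕP.m≤n⇒m∸n≡0 q))
        (sym (trans (cong ∣_∣ (trans (ℤP.m-n≡m⊖n a b) (ℤP.⊖-≤ q))) (ℤP.∣-i∣≡∣i∣ (+ (b ∸ a)))))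
      ge : b ≤ a → dist p a b ≡ ∣ + a - + b ∣
      ge q = trans (cong ((a ∸ b) ℕ.+_) (ℕP.m≤n⇒m∸n≡0 q)) (trans (ℕP.+-identityʳ (a ∸ b))
        (sym (cong ∣_∣ (trans (ℤP.m-n≡m⊖n a b) (ℤP.⊖-≥ q)))))

    dist⁺ : ∀ {m} a b → m ∣ᵢ + a - + b → m ℕD.∣ dist p a b
    dist⁺ {m} a b d = subst (m ℕD.∣_) (sym (dist-ℤ a b)) (∣⇒∣ᵤ d)

    dist⁻ : ∀ {m} a b → m ℕD.∣ dist p a b → m ∣ᵢ + a - + b
    dist⁻ {m} a b d = ∣ᵤ⇒∣ (subst (m ℕD.∣_) (dist-ℤ a b) d)

    residue-inj : ∀ {m a b} → a < m → b < m → m ∣ᵢ + a - + b → a ≡ b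
    residue-inj {m} {a} {b} la lb d = [ (λ q → le q la lb d) , (λ q → sym (le q lb la (∣-swap m (+ a) (+ b) d))) ]′ (ℕP.≤-total b a)
      where
      le : ∀ {a b} → b ≤ a → a < m → b < m → m ∣ᵢ + a - + b → a ≡ b
      le {a} {b} q la lb d = zero-or (a ∸ b) refl
        where
        zero-or : ∀ k → k ≡ a ∸ b → a ≡ b
        zero-or zero eq = ℕP.≤-antisym (ℕP.m∸n≡0⇒m≤n (sym eq)) q
        zero-or (suc k) eq = ⊥-elim (pos-∤ {m} {suc k} (s≤s z≤n) (ℕP.≤-<-trans (ℕP.≤-trans (ℕP.≤-reflexive eq) (ℕP.m∸n≤m a b)) la)
          (subst (m ∣ᵢ_) (trans (ℤP.m-n≡m⊖n a b) (trans (ℤP.⊖-≥ q) (cong +_ (sym eq)))) d))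

    Cong⁺ : ∀ {a b} → (+ a) ≈ (+ b) → Cong p a b
    Cong⁺ {a} {b} (≈⁺ d) = dist⁺ a b d

    Cong⁻ : ∀ {a b} → Cong p a b → (+ a) ≈ (+ b)
    Cong⁻ {a} {b} d = ≈⁺ (dist⁻ a b d)

    toℤ-inj : ∀ {x y} → toℤ x ≈ toℤ y → x ≡ y
    toℤ-inj {x} {y} (≈⁺ d) = FP.toℕ-injective (residue-inj (FP.toℕ<n x) (FP.toℕ<n y) d)

    red : ℤ → Fin M
    red z = Fin.fromℕ< (proj₁ (proj₂ (reduce M M>0 z)))

    toℤ-red : ∀ z → toℤ (red z) ≈ z
    toℤ-red z = ≈⁺ (subst (λ k → M ∣ᵢ + k - z) (sym (FP.toℕ-fromℕ< (proj₁ (proj₂ (reduce M M>0 z))))) (proj₂ (proj₂ (reduce M M>0 z))))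

    red-cong : ∀ {x y} → x ≈ y → red x ≡ red y
    red-cong {x} {y} q = toℤ-inj (≈-trans (toℤ-red x) (≈-trans q (≈-sym (toℤ-red y))))

    red-toℤ : ∀ y → red (toℤ y) ≡ y
    red-toℤ y = toℤ-inj (toℤ-red (toℤ y))

    T-red : ∀ ν z y → T ν (toℤ (red z)) y ≡ T ν z y
    T-red ν z y = T-Eˡ y (≈⇒E (toℤ-red z) ν)

    +-mono-≈ : ∀ {a a' b b'} → a ≈ a' → b ≈ b' → (a + b) ≈ (a' + b')
    +-mono-≈ {a} {a'} {b} {b'} (≈⁺ u) (≈⁺ v) = ≈⁺ (subst (M ∣ᵢ_) (lem a a' b b') (∣m∣n⇒∣m+n u v))
      where
      lem : ∀ a a' b b' → (a - a') + (b - b') ≡ a + b - (a' + b')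
      lem = solve-∀

  ⟦_⟧ : Subset M → ℤ → Set
  ⟦ A ⟧ z = red z ∈ A

  elem : Subset M → ℤ → Set
  elem B z = Σ (Fin M) λ y → y ∈ B × z ≡ toℤ y

  in⁺ : ∀ {A : Subset M} {y} → y ∈ A → ⟦ A ⟧ (toℤ y)
  in⁺ {A} {y} q = subst (_∈ A) (sym (red-toℤ y)) q

  in⁻ : ∀ {A : Subset M} {y} → ⟦ A ⟧ (toℤ y) → y ∈ A
  in⁻ {A} {y} q = subst (_∈ A) (red-toℤ y) q

  mkTiles : ∀ {A B} → (∀ t → Σ ℤ λ a → Σ ℤ λ b → ⟦ A ⟧ a × elem B b × (a + b) ≈ t) →
    (∀ {a a' b b'} → ⟦ A ⟧ a → ⟦ A ⟧ a' → elem B b → elem B b' → (a + b) ≈ (a' + b') → a ≈ a' × b ≈ b') → Tiles p A B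
  mkTiles {A} {B} s u = (λ x → ex x (s (toℤ x))) , λ a a' b b' ia ia' ib ib' q →
      let qa , qb = u (in⁺ ia) (in⁺ ia') (b , ib , refl) (b' , ib' , refl) (subst₂ _≈_ (ℤP.pos-+ (Fin.toℕ a) (Fin.toℕ b)) (ℤP.pos-+ (Fin.toℕ a') (Fin.toℕ b')) (Cong⁻ q))
      in toℤ-inj qa , toℤ-inj qb
    where
    ex : ∀ x → (Σ ℤ λ a → Σ ℤ λ b → ⟦ A ⟧ a × elem B b × (a + b) ≈ toℤ x) →
      Σ (Fin M) λ a → Σ (Fin M) λ b → a ∈ A × b ∈ B × Cong p (Fin.toℕ a ℕ.+ Fin.toℕ b) (Fin.toℕ x)
    ex x (a , b , ia , (j , ij , refl) , q) = red a , j , ia , ij ,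
      Cong⁺ (subst (_≈ toℤ x) (sym (ℤP.pos-+ (Fin.toℕ (red a)) (Fin.toℕ j))) (≈-trans (+-mono-≈ (toℤ-red a) ≈-refl) q))

  residue⁺ : ∀ {A : Subset M} {x} → x ∈ A → Fin.toℕ x ∈ˡ residues A
  residue⁺ i = ∈-map⁺ Fin.toℕ (elems⁺ i)

  residue⁻ : ∀ {A : Subset M} {k} → k ∈ˡ residues A → Σ (Fin M) λ x → x ∈ A × k ≡ Fin.toℕ x
  residue⁻ {A} i = let x , j , q = ∈-map⁻ Fin.toℕ i in x , elems⁻ A j , q

  unique-residues : ∀ (A : Subset M) → Unique (residues A)
  unique-residues A = map⁺ FP.toℕ-injective (unique-elems A)

  opaque
    hit⁺ : ∀ {c a b} → (+ a + + b) ≈ c → M ∣ᵢ c - + a - + b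
    hit⁺ {c} {a} {b} (≈⁺ d) = subst (M ∣ᵢ_) (lem (+ a) (+ b) c) (∣m⇒∣-m d)
      where
      lem : ∀ a b c → - (a + b - c) ≡ c - a - b
      lem = solve-∀

    hit⁻ : ∀ {c a b} → M ∣ᵢ c - + a - + b → (+ a + + b) ≈ c
    hit⁻ {c} {a} {b} d = ≈⁺ (subst (M ∣ᵢ_) (lem (+ a) (+ b) c) (∣m⇒∣-m d))
      where
      lem : ∀ a b c → - (c - a - b) ≡ a + b - c
      lem = solve-∀

  module FromTiles {A B : Subset M} (tiles : Tiles p A B) where
    Pair : ℤ → Fin M → Fin M → Set
    Pair c a b = a ∈ A × b ∈ B × (toℤ a + toℤ b) ≈ c

    pair : ∀ c → Σ (Fin M) λ a → Σ (Fin M) λ b → Pair c a b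
    pair c = let a , b , i , j , q = proj₁ tiles (red c) in a , b , i , j , subst (_≈ c) (ℤP.pos-+ (Fin.toℕ a) (Fin.toℕ b)) (≈-trans (Cong⁻ q) (toℤ-red c))

    pair-unique : ∀ {c a a' b b'} → Pair c a b → Pair c a' b' → a ≡ a' × b ≡ b'
    pair-unique {c} {a} {a'} {b} {b'} (i , j , q) (i' , j' , q') = proj₂ tiles a a' b b' i i' j j'
      (Cong⁺ (subst₂ _≈_ (sym (ℤP.pos-+ (Fin.toℕ a) (Fin.toℕ b))) (sym (ℤP.pos-+ (Fin.toℕ a') (Fin.toℕ b'))) (≈-trans q (≈-sym q'))))

    opaque
      tileL : TileL M (residues A) (residues B)
      tileL c = go (pair c)
        where
        go : (Σ (Fin M) λ a → Σ (Fin M) λ b → Pair c a b) → count₂ M c (residues A) (residues B) ≡ 1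
        go (a , b , i , j , q) = count₂-1 (unique-residues A) (unique-residues B) (residue⁺ i) (residue⁺ j) (hit⁺ q) other
          where
          other : ∀ {a' b'} → a' ∈ˡ residues A → b' ∈ˡ residues B → M ∣ᵢ c - + a' - + b' → a' ≡ Fin.toℕ a × b' ≡ Fin.toℕ b
          other {a'} {b'} k l r = go′ (residue⁻ k) (residue⁻ l)
            where
            go′ : (Σ (Fin M) λ x → x ∈ A × a' ≡ Fin.toℕ x) → (Σ (Fin M) λ y → y ∈ B × b' ≡ Fin.toℕ y) → a' ≡ Fin.toℕ a × b' ≡ Fin.toℕ b
            go′ (x , x∈ , refl) (y , y∈ , refl) = let qa , qb = pair-unique {c} (x∈ , y∈ , hit⁻ r) (i , j , q) in cong Fin.toℕ qa , cong Fin.toℕ qb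

    private
      module Scaled {r : ℤ} (ur : Unit r) where
        opaque
          s : ℕ
          s = proj₁ (reduce M M>0 r)
          s≈r : + s ≈ r
          s≈r = ≈⁺ (proj₂ (proj₂ (reduce M M>0 r)))
          p∤s : ∀ ν → ¬ p ν ℕD.∣ s
          p∤s ν d = ur ν (∣-resp-E (≈⇒E s≈r ν) (∣ᵢ-intro d))
          nz : NonZero s
          nz = ℕ.≢-nonZero λ q → p∤s 0F (subst (p 0F ℕD.∣_) (sym q) (p 0F ℕD.∣0))
          scaled : TileL M (map (s ℕ.*_) (residues A)) (residues B)
          scaled = tijdeman {M} {residues A} {residues B} s M>0 ⦃ nz ⦄ (λ pq d d' → clash (prime∣M pq d') d) tileL
            where
            clash : ∀ {q} → (Σ (Fin 3) λ ν → q ≡ p ν) → q ℕD.∣ s → ⊥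
            clash (ν , refl) d = p∤s ν d
          r*a : ∀ i {a} → toℤ i ≈ a → (+ (s ℕ.* Fin.toℕ i)) ≈ (r * a)
          r*a i {a} (≈⁺ d) = ≈⁺ (subst (M ∣ᵢ_) (trans (lem (+ s) (toℤ i) r a) (cong (_- r * a) (sym (ℤP.pos-* s (Fin.toℕ i)))))
            (∣m∣n⇒∣m+n (∣m⇒∣m*n (toℤ i) (≈⁻ s≈r)) (∣n⇒∣m*n r d)))
            where
            lem : ∀ s i r a → (s - r) * i + r * (i - a) ≡ s * i - r * a
            lem = solve-∀
          Solution : ℤ → Set
          Solution t = Σ ℤ λ a → Σ ℤ λ b → ⟦ A ⟧ a × elem B b × (r * a + b) ≈ t
          scaled-solve : ∀ t → Σ ℤ λ a → Σ ℤ λ b → ⟦ A ⟧ a × elem B b × (r * a + b) ≈ t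
          scaled-solve t = go (count₂-hit {M} {t} {map (s ℕ.*_) (residues A)} {residues B} (ℕP.≤-reflexive (sym (scaled t))))
            where
            found : ∀ {k l} → (Σ (Fin M) λ x → x ∈ A × k ≡ Fin.toℕ x) → (Σ (Fin M) λ y → y ∈ B × l ≡ Fin.toℕ y) →
              M ∣ᵢ t - + (s ℕ.* k) - + l → Solution t
            found (x , x∈ , refl) (y , y∈ , refl) q = toℤ x , toℤ y , in⁺ x∈ , (y , y∈ , refl) ,
              ≈-trans (+-mono-≈ (≈-sym (r*a x ≈-refl)) ≈-refl) (hit⁻ q)
            unscale : ∀ {k l} → (Σ ℕ λ k' → k' ∈ˡ residues A × k ≡ s ℕ.* k') → l ∈ˡ residues B → M ∣ᵢ t - + k - + l → Solution t
            unscale (k' , i , refl) j q = found (residue⁻ i) (residue⁻ j) q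
            go : (Σ ℕ λ k → Σ ℕ λ l → k ∈ˡ map (s ℕ.*_) (residues A) × l ∈ˡ residues B × M ∣ᵢ t - + k - + l) → Solution t
            go (k , l , i , j , q) = unscale (∈-map⁻ (s ℕ.*_) i) j q
          scaled-uniq : ∀ {a a' b b'} → ⟦ A ⟧ a → ⟦ A ⟧ a' → elem B b → elem B b' → (r * a + b) ≈ (r * a' + b') → a ≈ a' × b ≈ b'
          scaled-uniq {a} {a'} ia ia' (j , ij , refl) (j' , ij' , refl) q = conclude
              (count₂-single {M} {r * a + toℤ j} {map (s ℕ.*_) (residues A)} {residues B} (ℕP.≤-reflexive (scaled (r * a + toℤ j))) (mem a ia) (mem a' ia')
                (residue⁺ ij) (residue⁺ ij') (hit a j ≈-refl) (hit a' j' q))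
            where
            mem : ∀ a → ⟦ A ⟧ a → s ℕ.* Fin.toℕ (red a) ∈ˡ map (s ℕ.*_) (residues A)
            mem a i = ∈-map⁺ (s ℕ.*_) (residue⁺ i)
            hit : ∀ a'' j'' → (r * a + toℤ j) ≈ (r * a'' + toℤ j'') → M ∣ᵢ r * a + toℤ j - + (s ℕ.* Fin.toℕ (red a'')) - toℤ j''
            hit a'' j'' g = hit⁺ (≈-trans (+-mono-≈ (r*a (red a'') (toℤ-red a'')) ≈-refl) (≈-sym g))
            conclude : s ℕ.* Fin.toℕ (red a) ≡ s ℕ.* Fin.toℕ (red a') × Fin.toℕ j ≡ Fin.toℕ j' → a ≈ a' × toℤ j ≈ toℤ j'
            conclude (qa , qb) = ≈-trans (≈-sym (toℤ-red a)) (≈-trans (subst (λ y → toℤ (red a) ≈ + y) (ℕP.*-cancelˡ-≡ _ _ s ⦃ nz ⦄ qa) ≈-refl) (toℤ-red a')) ,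
              subst (λ y → toℤ j ≈ + y) qb ≈-refl

    tiling : Tiling ⟦ A ⟧ (elem B)
    tiling = record
      { A? = λ z → red z ∈? A
      ; A-resp = λ q i → subst (_∈ A) (red-cong q) i
      ; solve = λ ur → Scaled.scaled-solve ur
      ; uniq = λ ur → Scaled.scaled-uniq ur
      ; b₀ = toℤ (proj₁ (proj₂ (pair 0ℤ)))
      ; Bb₀ = proj₁ (proj₂ (pair 0ℤ)) , proj₁ (proj₂ (proj₂ (proj₂ (pair 0ℤ)))) , refl
      ; search = λ {Q} {R} f → find {Q} {R} (choose λ j → each f (j ∈? B)) }
      where
      P Q′ : (ℤ → Set) → Fin M → Set
      P Q j = j ∈ B → Q (toℤ j)
      Q′ R j = j ∈ B × R (toℤ j)
      each : ∀ {Q R : ℤ → Set} → (∀ b → elem B b → Q b ⊎ R b) → ∀ {j} → Dec (j ∈ B) → P Q j ⊎ Q′ R j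
      each f (no ¬i) = inj₁ λ i → ⊥-elim (¬i i)
      each f {j} (yes i) = [ (λ q → inj₁ λ _ → q) , (λ r → inj₂ (i , r)) ]′ (f (toℤ j) (j , i , refl))
      find : ∀ {Q R : ℤ → Set} → (∀ j → P Q j) ⊎ Σ (Fin M) (Q′ R) → (∀ b → elem B b → Q b) ⊎ (Σ ℤ λ b → elem B b × R b)
      find (inj₁ g) = inj₁ λ { _ (j , i , refl) → g j i }
      find (inj₂ (j , i , r)) = inj₂ (toℤ j , (j , i , refl) , r)

  Near : ℤ → ℤ → Set
  Near y x = ∀ ν → T ν y x ≢ n

  OnFiber : Fin 3 → ℤ → ℤ → Set
  OnFiber ν x y = T ν y x ≢ n × (∀ μ → μ ≢ ν → E μ y x)

  opaque
    near? : ∀ y x → Dec (Near y x)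
    near? y x = FP.all? λ ν → ¬? (N? ν y x)

    onFiber? : ∀ ν x y → Dec (OnFiber ν x y)
    onFiber? ν x y = ¬? (N? ν y x) ×-dec FP.all? λ μ → ¬? (μ Fin.≟ ν) →-dec E? μ y x

    T-red₂ : ∀ ν x y → T ν (toℤ (red x)) (toℤ (red y)) ≡ T ν x y
    T-red₂ ν x y = trans (T-red ν x (toℤ (red y))) (T-Eʳ x (≈⇒E (toℤ-red y) ν))

    grid⁻ : ∀ {x₀ y} → InGrid p x₀ y → Near (toℤ y) (toℤ x₀)
    grid⁻ {x₀} {y} d ν = ≢n⁺ (∣ᵢ-trans (p∣D ν) (dist⁻ (Fin.toℕ y) (Fin.toℕ x₀) d))
      where
      p∣D : ∀ ν → p ν ℕD.∣ Dof p
      p∣D 0F = ℕD.∣m⇒∣m*n (p 2F) (ℕD.m∣m*n (p 1F))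
      p∣D 1F = ℕD.∣m⇒∣m*n (p 2F) (ℕD.n∣m*n (p 0F))
      p∣D 2F = ℕD.n∣m*n (p 0F ℕ.* p 1F)

    grid⁺ : ∀ {x₀ y} → Near (toℤ y) (toℤ x₀) → InGrid p x₀ y
    grid⁺ {x₀} {y} near = coprime-∣ (Cop.sym (coprime-* (cop λ ()) (cop λ ())))
        (coprime-∣ (cop λ ()) (pd 0F) (pd 1F)) (pd 2F)
      where
      pd : ∀ ν → p ν ℕD.∣ dist p (Fin.toℕ y) (Fin.toℕ x₀)
      pd ν = dist⁺ (Fin.toℕ y) (Fin.toℕ x₀) (≢n⁻ (near ν))
      cop : ∀ {ν μ} → ν ≢ μ → Coprime (p ν) (p μ)
      cop {ν} {μ} q = coprime-p (pr ν) λ d → p≢ q (prime≡ (pr ν) (pr μ) d)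

    -- The gcd determines the valuation types, and conversely.

    T-gcd : ∀ ν x y → T ν (toℤ x) (toℤ y) ≡ val ν (+ gcdM p x y)
    T-gcd ν x y = trans (T-val ν (toℤ x) (toℤ y)) (val-cong (up (pp∣M ν)) down (up (ℕD.∣-trans (p∣pp ν) (pp∣M ν))) down)
      where
      d : ℕ
      d = dist p (Fin.toℕ x) (Fin.toℕ y)
      up : ∀ {m} → m ℕD.∣ M → m ∣ᵢ toℤ x - toℤ y → m ∣ᵢ + gcdM p x y
      up mM q = ∣ᵢ-intro (gcd-greatest (dist⁺ (Fin.toℕ x) (Fin.toℕ y) q) mM)
      down : ∀ {m} → m ∣ᵢ + gcdM p x y → m ∣ᵢ toℤ x - toℤ y
      down q = dist⁻ (Fin.toℕ x) (Fin.toℕ y) (ℕD.∣-trans (∣⇒∣ᵤ q) (gcd[m,n]∣m d M))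

    divisor-≡ : ∀ {m m'} → m ℕD.∣ M → m' ℕD.∣ M → (∀ ν → val ν (+ m) ≡ val ν (+ m')) → m ≡ m'
    divisor-≡ {m} {m'} d d' q = ℕD.∣-antisym (half d q) (half d' λ ν → sym (q ν))
      where
      half : ∀ {m m'} → m ℕD.∣ M → (∀ ν → val ν (+ m) ≡ val ν (+ m')) → m ℕD.∣ m'
      half {m} {m'} d q = let r , _ , g = transfer-all (+ m) (+ m') q in
        ∣⇒∣ᵤ (subst (m ∣ᵢ_) (lem r (+ m) (+ m')) (∣m∣n⇒∣m-n (∣n⇒∣m*n r (∣-refl {+ m})) (∣ᵢ-trans d g)))
        where
        lem : ∀ r m m' → r * m - (r * m - m') ≡ m'
        lem = solve-∀

    gcd-T : ∀ {x y m} → m ℕD.∣ M → (∀ ν → T ν (toℤ x) (toℤ y) ≡ val ν (+ m)) → gcdM p x y ≡ m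
    gcd-T {x} {y} d q = divisor-≡ (gcd[m,n]∣n (dist p (Fin.toℕ x) (Fin.toℕ y)) M) d λ ν → trans (sym (T-gcd ν x y)) (q ν)

    Mover-M : ∀ α → M ≡ Mover p α ℕ.* p α
    Mover-M α = trans (M≡pp*Mnu α) (lem (p α) (Mnu p α))
      where
      lem : ∀ a b → a ℕ.* a ℕ.* b ≡ a ℕ.* b ℕ.* a
      lem = ℕS.solve-∀

    Mover-h : ∀ α → val α (+ Mover p α) ≡ h
    Mover-h α = val-h⁺ (∣ᵢ-intro (ℕD.m∣m*n (Mnu p α))) λ d →
      p∤Mnu α (ℕD.*-cancelˡ-∣ (p α) ⦃ ℕ.>-nonZero (p>0 α) ⦄ (∣⇒∣ᵤ d))

    Mover-e : ∀ {α μ} → μ ≢ α → val μ (+ Mover p α) ≡ e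
    Mover-e {α} q = val-e⁺ (∣ᵢ-intro (ℕD.∣n⇒∣m*n (p α) (pp∣Mnu q)))

  module _ {α β γ : Fin 3} (d : Distinct3 p α β γ) where
    open Labels α β γ d

    opaque

      axis⁻ : ∀ {x y} → gcdM p x y ℕ.* p α ≡ M → T α (toℤ x) (toℤ y) ≡ h × E β (toℤ x) (toℤ y) × E γ (toℤ x) (toℤ y)
      axis⁻ {x} {y} q = tr α (Mover-h α) , tr β (Mover-e λ q → α≢β (sym q)) , tr γ (Mover-e λ q → α≢γ (sym q))
        where
        tr : ∀ ν {v} → val ν (+ Mover p α) ≡ v → T ν (toℤ x) (toℤ y) ≡ v
        tr ν r = trans (T-gcd ν x y) (trans (cong (λ m → val ν (+ m)) (ℕP.*-cancelʳ-≡ (gcdM p x y) (Mover p α) (p α) ⦃ ℕ.>-nonZero (p>0 α) ⦄ (trans q (Mover-M α)))) r)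

      axis⁺ : ∀ {x y} → T α (toℤ x) (toℤ y) ≡ h → E β (toℤ x) (toℤ y) → E γ (toℤ x) (toℤ y) → gcdM p x y ℕ.* p α ≡ M
      axis⁺ {x} {y} a b c = trans (cong (ℕ._* p α) (gcd-T (subst (Mover p α ℕD.∣_) (sym (Mover-M α)) (ℕD.m∣m*n (p α)))
        (all3 (trans a (sym (Mover-h α))) (trans b (sym (Mover-e λ q → α≢β (sym q)))) (trans c (sym (Mover-e λ q → α≢γ (sym q))))))) (sym (Mover-M α))

      private
        m₀ : ℕ
        m₀ = pp α ℕ.* (p β ℕ.* p γ)

        Mnu≡ : Mnu p α ≡ pp β ℕ.* pp γ
        Mnu≡ = go α β γ α≢β β≢γ α≢γ
          where
          go : ∀ α β γ → α ≢ β → β ≢ γ → α ≢ γ → Mnu p α ≡ pp β ℕ.* pp γ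
          go 0F 0F _ a _ _ = ⊥-elim (a refl)
          go 1F 1F _ a _ _ = ⊥-elim (a refl)
          go 2F 2F _ a _ _ = ⊥-elim (a refl)
          go _ 0F 0F _ b _ = ⊥-elim (b refl)
          go _ 1F 1F _ b _ = ⊥-elim (b refl)
          go _ 2F 2F _ b _ = ⊥-elim (b refl)
          go 0F _ 0F _ _ c = ⊥-elim (c refl)
          go 1F _ 1F _ _ c = ⊥-elim (c refl)
          go 2F _ 2F _ _ c = ⊥-elim (c refl)
          go 0F 1F 2F _ _ _ = refl
          go 0F 2F 1F _ _ _ = ℕP.*-comm (pp 1F) (pp 2F)
          go 1F 0F 2F _ _ _ = refl
          go 1F 2F 0F _ _ _ = ℕP.*-comm (pp 0F) (pp 2F)
          go 2F 0F 1F _ _ _ = refl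
          go 2F 1F 0F _ _ _ = ℕP.*-comm (pp 0F) (pp 1F)

        m₀-M : M ≡ m₀ ℕ.* (p β ℕ.* p γ)
        m₀-M = trans (M≡pp*Mnu α) (trans (cong (pp α ℕ.*_) Mnu≡) (lem (p α) (p β) (p γ)))
          where
          lem : ∀ a b c → a ℕ.* a ℕ.* (b ℕ.* b ℕ.* (c ℕ.* c)) ≡ a ℕ.* a ℕ.* (b ℕ.* c) ℕ.* (b ℕ.* c)
          lem = ℕS.solve-∀

        p∤p : ∀ {ν μ} → ν ≢ μ → ¬ p ν ℕD.∣ p μ
        p∤p {ν} {μ} q d = p≢ q (prime≡ (pr ν) (pr μ) d)

        half : ∀ ν κ → ν ≢ α → ν ≢ κ → m₀ ≡ p ν ℕ.* (pp α ℕ.* p κ) → val ν (+ m₀) ≡ h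
        half ν κ q r g = val-h⁺ (∣ᵢ-intro (subst (p ν ℕD.∣_) (sym g) (ℕD.m∣m*n _))) λ d →
          p∤* (pr ν) (p∤pp q) (p∤p r) (ℕD.*-cancelˡ-∣ (p ν) ⦃ ℕ.>-nonZero (p>0 ν) ⦄ (subst (pp ν ℕD.∣_) g (∣⇒∣ᵤ d)))

        m₀α : val α (+ m₀) ≡ e
        m₀α = val-e⁺ (∣ᵢ-intro (ℕD.m∣m*n _))
        m₀β : val β (+ m₀) ≡ h
        m₀β = half β γ (λ q → α≢β (sym q)) β≢γ (lem (p α) (p β) (p γ))
          where
          lem : ∀ a b c → a ℕ.* a ℕ.* (b ℕ.* c) ≡ b ℕ.* (a ℕ.* a ℕ.* c)
          lem = ℕS.solve-∀
        m₀γ : val γ (+ m₀) ≡ h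
        m₀γ = half γ β (λ q → α≢γ (sym q)) (λ q → β≢γ (sym q)) (lem (p α) (p β) (p γ))
          where
          lem : ∀ a b c → a ℕ.* a ℕ.* (b ℕ.* c) ≡ c ℕ.* (a ℕ.* a ℕ.* b)
          lem = ℕS.solve-∀

        nz : NonZero (p β ℕ.* p γ)
        nz = ℕ.>-nonZero (ℕP.*-mono-≤ (p>0 β) (p>0 γ))

      plane⁻ : ∀ {x y} → gcdM p x y ℕ.* (p β ℕ.* p γ) ≡ M → E α (toℤ x) (toℤ y) × T β (toℤ x) (toℤ y) ≡ h × T γ (toℤ x) (toℤ y) ≡ h
      plane⁻ {x} {y} q = tr α m₀α , tr β m₀β , tr γ m₀γ
        where
        tr : ∀ ν {v} → val ν (+ m₀) ≡ v → T ν (toℤ x) (toℤ y) ≡ v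
        tr ν r = trans (T-gcd ν x y) (trans (cong (λ m → val ν (+ m)) (ℕP.*-cancelʳ-≡ (gcdM p x y) m₀ (p β ℕ.* p γ) ⦃ nz ⦄ (trans q m₀-M))) r)

      plane⁺ : ∀ {x y} → E α (toℤ x) (toℤ y) → T β (toℤ x) (toℤ y) ≡ h → T γ (toℤ x) (toℤ y) ≡ h → gcdM p x y ℕ.* (p β ℕ.* p γ) ≡ M
      plane⁺ {x} {y} a b c = trans (cong (ℕ._* (p β ℕ.* p γ)) (gcd-T (subst (m₀ ℕD.∣_) (sym m₀-M) (ℕD.m∣m*n (p β ℕ.* p γ)))
        (all3 (trans a (sym m₀α)) (trans b (sym m₀β)) (trans c (sym m₀γ))))) (sym m₀-M)

  -- x + t M/p_ν, the t-th point of the M-fiber of x.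
  along : Fin 3 → ℕ → ℤ → ℤ
  along ν t x = x + + t * + Mover p ν

  opaque
    private
      cancel-x : ∀ x y → y ≡ x + y - x
      cancel-x = solve-∀

    along-near : ∀ ν t x → T ν (along ν t x) x ≢ n
    along-near ν t x = ≢n⁺ (subst (p ν ∣ᵢ_) (cancel-x x (+ t * + Mover p ν)) (∣n⇒∣m*n (+ t) (∣ᵢ-intro (ℕD.m∣m*n (Mnu p ν)))))

    along-E : ∀ {ν μ} → μ ≢ ν → ∀ t x → E μ (along ν t x) x
    along-E {ν} {μ} q t x = E⁺ (subst (pp μ ∣ᵢ_) (cancel-x x (+ t * + Mover p ν))
      (∣n⇒∣m*n (+ t) (∣ᵢ-intro (ℕD.∣n⇒∣m*n (p ν) (pp∣Mnu q)))))

    level : ∀ ν {y x} → T ν y x ≢ n → Σ (Fin (p ν)) λ t → E ν y (along ν (Fin.toℕ t) x)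
    level ν {y} {x} q = go (≢n⁻ q)
      where
      iv : Σ ℤ λ v → p ν ∣ᵢ + Mnu p ν * v - 1ℤ
      iv = inverse-p ν (+ Mnu p ν) λ d → p∤Mnu ν (∣⇒∣ᵤ d)
      go : p ν ∣ᵢ y - x → Σ (Fin (p ν)) λ t → E ν y (along ν (Fin.toℕ t) x)
      go (divides k k≡) = Fin.fromℕ< lt , subst (λ i → E ν y (along ν i x)) (sym (FP.toℕ-fromℕ< lt))
          (E⁺ (subst (pp ν ∣ᵢ_) eq (p∣ᵢ* ν {(- k) * (+ Mnu p ν * v - 1ℤ) + - (+ Mnu p ν) * (+ j - k * v)} {+ p ν} (∣m∣n⇒∣m+n (∣n⇒∣m*n (- k) (proj₂ iv)) (∣n⇒∣m*n (- (+ Mnu p ν)) (proj₂ (proj₂ r)))) ∣-refl)))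
        where
        v : ℤ
        v = proj₁ iv
        r : Σ ℕ λ j → j < p ν × p ν ∣ᵢ (+ j - k * v)
        r = reduce (p ν) (p>0 ν) (k * v)
        j : ℕ
        j = proj₁ r
        lt : j < p ν
        lt = proj₁ (proj₂ r)
        lem : ∀ k m v j p → (- k * (m * v - 1ℤ) + - m * (j - k * v)) * p ≡ k * p - j * (p * m)
        lem = solve-∀
        l₂ : ∀ y x z → y - x - z ≡ y - (x + z)
        l₂ = solve-∀
        eq : (- k * (+ Mnu p ν * v - 1ℤ) + - (+ Mnu p ν) * (+ j - k * v)) * + p ν ≡ y - along ν j x
        eq = trans (lem k (+ Mnu p ν) v (+ j) (+ p ν)) (trans (cong₂ (λ a b → a - + j * b) (sym k≡) (sym (ℤP.pos-* (p ν) (Mnu p ν)))) (l₂ y x (+ j * + Mover p ν)))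

    level-inj : ∀ ν x {s t : Fin (p ν)} → E ν (along ν (Fin.toℕ s) x) (along ν (Fin.toℕ t) x) → s ≡ t
    level-inj ν x {s} {t} q = FP.toℕ-injective (residue-inj (FP.toℕ<n s) (FP.toℕ<n t) (coprime (euclidℤ ν (half q))))
      where
      lem : ∀ x s t p m → x + s * (p * m) - (x + t * (p * m)) ≡ p * ((s - t) * m)
      lem = solve-∀
      half : E ν (along ν (Fin.toℕ s) x) (along ν (Fin.toℕ t) x) → p ν ∣ᵢ (+ Fin.toℕ s - + Fin.toℕ t) * + Mnu p ν
      half g = ∣ᵤ⇒∣ (ℕD.*-cancelˡ-∣ (p ν) ⦃ ℕ.>-nonZero (p>0 ν) ⦄ (subst (pp ν ℕD.∣_) (ℤP.abs-* (+ p ν) _)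
        (∣⇒∣ᵤ (subst (pp ν ∣ᵢ_) (trans (cong (λ z → x + + Fin.toℕ s * z - (x + + Fin.toℕ t * z)) (ℤP.pos-* (p ν) (Mnu p ν)))
          (lem x (+ Fin.toℕ s) (+ Fin.toℕ t) (+ p ν) (+ Mnu p ν))) (E⁻ g)))))
      coprime : p ν ∣ᵢ + Fin.toℕ s - + Fin.toℕ t ⊎ p ν ∣ᵢ + Mnu p ν → p ν ∣ᵢ + Fin.toℕ s - + Fin.toℕ t
      coprime (inj₁ d) = d
      coprime (inj₂ d) = ⊥-elim (p∤Mnu ν (∣⇒∣ᵤ d))

    pos-along : ∀ ν t x → + (x ℕ.+ t ℕ.* Mover p ν) ≡ along ν t (+ x)
    pos-along ν t x = trans (ℤP.pos-+ x _) (cong (_+_ (+ x)) (ℤP.pos-* t (Mover p ν)))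

    fiber⁻ : ∀ {x ν y} → InFiber p x ν y → OnFiber ν (toℤ x) (toℤ y)
    fiber⁻ {x} {ν} {y} (t , lt , q) = ≢n-trans (E⇒≢n (eq ν)) (along-near ν t (toℤ x)) , λ μ g → E-trans (eq μ) (along-E g t (toℤ x))
      where
      eq : ∀ μ → E μ (toℤ y) (along ν t (toℤ x))
      eq = ≈⇒E (subst (toℤ y ≈_) (pos-along ν t (Fin.toℕ x)) (Cong⁻ q))

    fiber⁺ : ∀ {x ν y} → OnFiber ν (toℤ x) (toℤ y) → InFiber p x ν y
    fiber⁺ {x} {ν} {y} (near , ln) = Fin.toℕ t , FP.toℕ<n t ,
        Cong⁺ {Fin.toℕ y} {Fin.toℕ x ℕ.+ Fin.toℕ t ℕ.* Mover p ν}
          (subst (toℤ y ≈_) (sym (pos-along ν (Fin.toℕ t) (Fin.toℕ x))) (E⇒≈ λ μ → all μ (μ Fin.≟ ν)))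
      where
      t : Fin (p ν)
      t = proj₁ (level ν {toℤ y} {toℤ x} near)
      all : ∀ μ → Dec (μ ≡ ν) → E μ (toℤ y) (along ν (Fin.toℕ t) (toℤ x))
      all μ (yes refl) = proj₂ (level ν {toℤ y} {toℤ x} near)
      all μ (no g) = E-trans (ln μ g) (E-sym (along-E g (Fin.toℕ t) (toℤ x)))

    fiber-plane : ∀ {x β γ y} → InFiber p x β y → InPlane p x β γ y
    fiber-plane {x} {β} {γ} {y} (t , lt , q) = t , 0 , lt , p>0 γ , subst (Cong p (Fin.toℕ y)) (sym (ℕP.+-identityʳ _)) q

    plane-swap : ∀ {x β γ y} → InPlane p x β γ y → InPlane p x γ β y
    plane-swap {x} {β} {γ} {y} (t , u , lt , lu , q) = u , t , lu , lt , subst (Cong p (Fin.toℕ y)) (lem (Fin.toℕ x) (t ℕ.* Mover p β) (u ℕ.* Mover p γ)) q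
      where
      lem : ∀ a b c → a ℕ.+ b ℕ.+ c ≡ a ℕ.+ c ℕ.+ b
      lem = ℕS.solve-∀

    inPlane⁻ : ∀ {ν β γ} → Distinct3 p ν β γ → ∀ {x y} → InPlane p x β γ y →
      E ν (toℤ y) (toℤ x) × T β (toℤ y) (toℤ x) ≢ n × T γ (toℤ y) (toℤ x) ≢ n
    inPlane⁻ {ν} {β} {γ} d {x} {y} (t , u , lt , lu , q) = E-trans (eq ν) (E-trans (along-E α≢γ u _) (along-E α≢β t _)) ,
        ≢n-trans (E⇒≢n (E-trans (eq β) (along-E β≢γ u _))) (along-near β t _) ,
        ≢n-trans (E⇒≢n (eq γ)) (≢n-trans (along-near γ u _) (E⇒≢n (along-E (λ g → β≢γ (sym g)) t (toℤ x))))
      where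
      open Labels ν β γ d
      eq : ∀ μ → E μ (toℤ y) (along γ u (along β t (toℤ x)))
      eq = ≈⇒E (subst (toℤ y ≈_) (trans (pos-along γ u _) (cong (along γ u) (pos-along β t (Fin.toℕ x)))) (Cong⁻ q))

    -- Meeting each plane of the corner in a single fiber.
    corner : ∀ {A : Subset M} {x₀ ν β γ} → Distinct3 p ν β γ → ∀ a c → Near a (toℤ x₀) → Near c (toℤ x₀) →
      T ν a c ≡ h → E β a c → E γ a c →
      (∀ {y} → OnFiber β a y → ⟦ A ⟧ y) → (∀ {y} → OnFiber γ c y → ⟦ A ⟧ y) →
      (∀ {y} → ⟦ A ⟧ y → Near y (toℤ x₀) → E ν y a → E γ y a) → (∀ {y} → ⟦ A ⟧ y → Near y (toℤ x₀) → E ν y c → E β y c) →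
      Corner p A x₀ ν
    corner {A} {x₀} {ν} {β} {γ} d a c na nc qν qβ qγ fa fc oa oc =
        β , γ , d , red a , red c , (fa (self a) , grid⁺ {x₀} {red a} (near-red na)) , (fc (self c) , grid⁺ {x₀} {red c} (near-red nc)) ,
        axis⁺ d {red a} {red c} (trans (T-red₂ ν a c) qν) (trans (T-red₂ β a c) qβ) (trans (T-red₂ γ a c) qγ) ,
        (λ y → mk⇔ (λ { (i , pl) → fiber⁺ {red a} {β} {y} (fwdβ {y} i (plane a {y} pl)) })
          (λ f → in⁻ {A} {y} (fa (unred β a {y} (fiber⁻ {red a} {β} {y} f))) , fiber-plane {red a} {β} {γ} {y} f)) ,
        (λ y → mk⇔ (λ { (i , pl) → fiber⁺ {red c} {γ} {y} (fwdγ {y} i (plane c {y} pl)) })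
          (λ f → in⁻ {A} {y} (fc (unred γ c {y} (fiber⁻ {red c} {γ} {y} f))) , plane-swap {red c} {γ} {β} {y} (fiber-plane {red c} {γ} {β} {y} f)))
      where
      open Labels ν β γ d
      self : ∀ {ν} z → OnFiber ν z z
      self z = E⇒≢n E-refl , λ _ _ → E-refl
      near-red : ∀ {z} → Near z (toℤ x₀) → Near (toℤ (red z)) (toℤ x₀)
      near-red {z} q ν g = q ν (trans (sym (T-red ν z (toℤ x₀))) g)
      tr : ∀ μ z {y : Fin M} {v} → T μ (toℤ y) (toℤ (red z)) ≡ v → T μ (toℤ y) z ≡ v
      tr μ z {y} q = trans (T-Eʳ (toℤ y) (E-sym (≈⇒E (toℤ-red z) μ))) q
      tr⁻ : ∀ μ z {y : Fin M} {v} → T μ (toℤ y) z ≡ v → T μ (toℤ y) (toℤ (red z)) ≡ v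
      tr⁻ μ z {y} q = trans (T-Eʳ (toℤ y) (≈⇒E (toℤ-red z) μ)) q
      unred : ∀ μ z {y} → OnFiber μ (toℤ (red z)) (toℤ y) → OnFiber μ z (toℤ y)
      unred μ z {y} (q , l) = (λ g → q (tr⁻ μ z {y} g)) , λ κ g → tr κ z {y} (l κ g)
      rered : ∀ μ z {y} → OnFiber μ z (toℤ y) → OnFiber μ (toℤ (red z)) (toℤ y)
      rered μ z {y} (q , l) = (λ g → q (tr μ z {y} g)) , λ κ g → tr⁻ κ z {y} (l κ g)
      plane : ∀ z {y} → InPlane p (red z) β γ y → E ν (toℤ y) z × T β (toℤ y) z ≢ n × T γ (toℤ y) z ≢ n
      plane z {y} pl = let u , v , w = inPlane⁻ d {red z} {y} pl in tr ν z {y} u , (λ g → v (tr⁻ β z {y} g)) , (λ g → w (tr⁻ γ z {y} g))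
      fwdβ : ∀ {y} → y ∈ A → E ν (toℤ y) a × T β (toℤ y) a ≢ n × T γ (toℤ y) a ≢ n → OnFiber β (toℤ (red a)) (toℤ y)
      fwdβ {y} i (u , v , w) = rered β a {y} (v , lineβ {λ μ → E μ (toℤ y) a} u (oa (in⁺ i) (all3 (≢n-trans (E⇒≢n u) (na ν)) (≢n-trans v (na β)) (≢n-trans w (na γ))) u))
      fwdγ : ∀ {y} → y ∈ A → E ν (toℤ y) c × T β (toℤ y) c ≢ n × T γ (toℤ y) c ≢ n → OnFiber γ (toℤ (red c)) (toℤ y)
      fwdγ {y} i (u , v , w) = rered γ c {y} (w , lineγ {λ μ → E μ (toℤ y) c} u (oc (in⁺ i) (all3 (≢n-trans (E⇒≢n u) (nc ν)) (≢n-trans v (nc β)) (≢n-trans w (nc γ))) u))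

    partly-filled : ∀ {A : Subset M} {x₀ ν} → ¬ Fibered p (AΛ p A x₀) ν →
      Σ ℤ λ x → Σ ℤ λ y → Near x (toℤ x₀) × ¬ ⟦ A ⟧ x × ⟦ A ⟧ y × OnFiber ν x y
    partly-filled {A} {x₀} {ν} ¬f = decide (FP.any? λ x → near? (toℤ x) (toℤ x₀) ×-dec ¬? (x ∈? A) ×-dec FP.any? λ y → (y ∈? A) ×-dec onFiber? ν (toℤ x) (toℤ y))
      where
      Gap : Set
      Gap = Σ (Fin M) λ x → Near (toℤ x) (toℤ x₀) × ¬ x ∈ A × Σ (Fin M) λ y → y ∈ A × OnFiber ν (toℤ x) (toℤ y)
      flipped : ∀ {x y} → OnFiber ν x y → OnFiber ν y x
      flipped (q , l) = ≢n-sym q , λ μ g → E-sym (l μ g)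
      full : ¬ Gap → ∀ {s y} → AΛ p A x₀ s → InFiber p s ν y → AΛ p A x₀ y
      full ¬g {s} {y} (i , g) f = member (y ∈? A) , grid⁺ {x₀} {y} near
        where
        near : Near (toℤ y) (toℤ x₀)
        near μ = ≢n-trans (close (μ Fin.≟ ν)) (grid⁻ {x₀} {s} g μ)
          where
          close : Dec (μ ≡ ν) → T μ (toℤ y) (toℤ s) ≢ n
          close (yes refl) = proj₁ (fiber⁻ {s} {ν} {y} f)
          close (no q) = E⇒≢n (proj₂ (fiber⁻ {s} {ν} {y} f) μ q)
        member : Dec (y ∈ A) → y ∈ A
        member (yes j) = j
        member (no ¬j) = ⊥-elim (¬g (y , near , ¬j , s , i , flipped {toℤ s} {toℤ y} (fiber⁻ {s} {ν} {y} f)))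
      decide : Dec Gap → Σ ℤ λ x → Σ ℤ λ y → Near x (toℤ x₀) × ¬ ⟦ A ⟧ x × ⟦ A ⟧ y × OnFiber ν x y
      decide (yes (x , nx , ¬i , y , j , f)) = toℤ x , toℤ y , nx , (λ i → ¬i (in⁻ {A} {x} i)) , in⁺ j , f
      decide (no ¬g) = ⊥-elim (¬f (AΛ p A x₀ , (λ _ s → s) , λ y → mk⇔ (λ s → y , s , fiber⁺ {y} {ν} {y} (E⇒≢n E-refl , λ _ _ → E-refl))
        λ { (s , i , f) → full ¬g {s} {y} i f }))

  module Distribution where
    open import Defs using (mask; _Φ∣_; Φ; Poly)
    open Polynomials
    open CyclotomicPolynomials using (E₋; E₋-prime)
    open Folding using (_∣ᵢ_; _∣ᵢ?_; 0∣ᵢ; fold; fold-cong; fold-E₋; fold-E₋⊛; sum<; sum<-fold; sum<-periodic; periodic⇒∣total; total; total-⊛)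
    open Tijdeman using (fold-polyOf₂; length-TileL)
    open Counting
    open import Data.List using (filter; length)
    open import Data.List.Membership.Propositional.Properties using (∈-filter⁺; ∈-filter⁻)
    open import Data.List.Relation.Unary.Unique.Propositional.Properties using (filter⁺)

    equidistributed : ∀ q es → 1 ≤ q → (∀ c → count q (1ℤ + c) es ≡ count q c es) → length es ≡ q ℕ.* count q 0ℤ es
    equidistributed q es 1≤q k = ℤP.+-injective (begin
        + length es                                  ≡⟨ total-polyOf es ⟨
        total (polyOf es)                            ≡⟨ sum<-fold q (polyOf es) 1≤q ⟨
        sum< q f                                     ≡⟨ cong (λ m → sum< m f) (ℕP.*-identityʳ q) ⟨
        sum< (q ℕ.* 1) f                             ≡⟨ sum<-periodic q 1 f (λ c → trans (fold-polyOf q (1ℤ + c) es) (trans (cong +_ (k c)) (sym (fold-polyOf q c es)))) ⟩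
        + q * sum< 1 f                               ≡⟨ cong (+ q *_) (trans (ℤP.+-identityʳ (f 0ℤ)) (fold-polyOf q 0ℤ es)) ⟩
        + q * + count q 0ℤ es                        ≡⟨ ℤP.pos-* q (count q 0ℤ es) ⟨
        + (q ℕ.* count q 0ℤ es)                      ∎)
      where
      open ≡-Reasoning
      f : ℤ → ℤ
      f c = fold q c (polyOf es)

    count-filter : ∀ m c es → count m c es ≡ length (filter (λ k → m ∣ᵢ? (c - + k)) es)
    count-filter m c [] = refl
    count-filter m c (k ∷ es) with m ∣ᵢ? (c - + k)
    ... | yes _ = cong suc (count-filter m c es)
    ... | no _  = count-filter m c es

    module _ {A B : Subset M} (tiles : Tiles p A B) (ν : Fin 3) where
      open FromTiles tiles using (tiling; tileL)
      open Base tiling using (Regular; Sparse; solve; uniq)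

      private
        as bs : List ℕ
        as = residues A
        bs = residues B

        class : List ℕ → ℤ → List ℕ
        class es c = filter (λ k → p ν ∣ᵢ? (c - + k)) es

        module _ (reg : Regular ν) (sparse : Sparse ν) where
          class-≤ : ∀ c c' → length (class bs c) ≤ length (class bs c')
          class-≤ c c' = length-≤ {R = λ b b' → Line ν (+ b) (+ b')} (filter⁺ (λ k → p ν ∣ᵢ? (c - + k)) (unique-residues B)) (λ i → image (∈-filter⁻ (λ k → p ν ∣ᵢ? (c - + k)) {xs = bs} i))
              (λ {x} {x'} {y} i i' → single {x} {x'} {y} (∈-filter⁻ (λ k → p ν ∣ᵢ? (c - + k)) {xs = bs} i) (∈-filter⁻ (λ k → p ν ∣ᵢ? (c - + k)) {xs = bs} i'))
            where
            open Base tiling using (Line)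
            inB : ∀ {b} → b ∈ˡ bs → elem B (+ b)
            inB i = let y , y∈ , q = residue⁻ i in y , y∈ , cong +_ q
            found : ∀ {b b'} → elem B b' → T ν b' c' ≢ n → Line ν (+ b) b' → Σ ℕ λ k → k ∈ˡ class bs c' × Line ν (+ b) (+ k)
            found (y , y∈ , refl) near ln = Fin.toℕ y , ∈-filter⁺ (λ k → p ν ∣ᵢ? (c' - + k)) (residue⁺ y∈) (≢n⁻ (≢n-sym near)) , ln
            image : ∀ {b} → b ∈ˡ bs × p ν ∣ᵢ c - + b → Σ ℕ λ k → k ∈ˡ class bs c' × Line ν (+ b) (+ k)
            image {b} (i , _) = let b' , Bb' , near , ln = reg (+ b) (inB i) c' in found Bb' near ln
            single : ∀ {x x' y} → x ∈ˡ bs × p ν ∣ᵢ c - + x → x' ∈ˡ bs × p ν ∣ᵢ c - + x' → Line ν (+ x) (+ y) → Line ν (+ x') (+ y) → x ≡ x'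
            single {x} {x'} (i , d) (i' , d') l l' = equal (residue⁻ i) (residue⁻ i')
                (sparse (inB i) (inB i') (≢n-trans {ν} {+ x} {c} {+ x'} (≢n-sym (≢n⁺ d)) (≢n⁺ d')) λ μ g → E-trans (E-sym (l μ g)) (l' μ g))
              where
              equal : (Σ (Fin M) λ y → y ∈ B × x ≡ Fin.toℕ y) → (Σ (Fin M) λ y → y ∈ B × x' ≡ Fin.toℕ y) → (+ x) ≈ (+ x') → x ≡ x'
              equal (y , _ , refl) (y' , _ , refl) q = cong Fin.toℕ (toℤ-inj q)

        B-equidistributed : Regular ν → Sparse ν → ∀ c → count (p ν) (1ℤ + c) bs ≡ count (p ν) c bs
        B-equidistributed reg sparse c = trans (count-filter (p ν) (1ℤ + c) bs)
          (trans (ℕP.≤-antisym (class-≤ reg sparse (1ℤ + c) c) (class-≤ reg sparse c (1ℤ + c))) (sym (count-filter (p ν) c bs)))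

        A-equidistributed : p ν Φ∣ mask p A → ∀ c → count (p ν) (1ℤ + c) as ≡ count (p ν) c as
        A-equidistributed (Q , eq) c = ℤP.+-injective (trans (sym (fold-mask A (p ν) (1ℤ + c))) (trans (sym (ℤP.i-j≡0⇒i≡j _ _ zero′)) (fold-mask A (p ν) c)))
          where
          P : Poly
          P = maskOf A
          E₋P : E₋ 1 ⊛ P ≋ E₋ (p ν) ⊛ Q
          E₋P = ≋-trans (*-congʳ (E₋ 1) (eqₚ eq)) (≋-trans (lem (E₋ 1) (Φ (p ν)) Q) (*-congˡ Q (≋-sym (E₋-prime (pr ν)))))
            where
            open import Tactic.RingSolver as PS using ()
            lem : ∀ a b c → a ⊛ (b ⊛ c) ≋ (b ⊛ a) ⊛ c
            lem = PS.solve-∀ polyACR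
          l : ∀ c → 1ℤ + c - 1ℤ ≡ c
          l = solve-∀
          zero′ : fold (p ν) c P - fold (p ν) (1ℤ + c) P ≡ 0ℤ
          zero′ = trans (cong (λ z → fold (p ν) z P - fold (p ν) (1ℤ + c) P) (sym (l c)))
            (trans (sym (fold-E₋⊛ (p ν) (1ℤ + c) 1 P)) (trans (fold-cong (p ν) (1ℤ + c) E₋P) (fold-E₋ (p ν) (1ℤ + c) Q)))

        A₀ B₀ : List ℕ
        A₀ = class as 0ℤ
        B₀ = class bs 0ℤ

        Sum : ℤ → Set
        Sum c = Σ (Fin M) λ a → Σ (Fin M) λ b → a ∈ A × b ∈ B × (toℤ a + toℤ b) ≈ c × p ν ∣ᵢ toℤ a × p ν ∣ᵢ toℤ b

        opaque
          -- A unit congruent to 1 − w/a' at p_ν would turn a' + b' = c + w into a second representation of c if p_ν ∤ a'.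
          move : ∀ {c w} → p ν ∣ᵢ w → (∀ μ → μ ≢ ν → pp μ ∣ᵢ w) → Sum c → Sum (c + w)
          move {c} {w} pw ppw (a , b , ia , ib , q , pa , pb) = moved (FromTiles.pair tiles (c + w))
            where
            l₁ : ∀ c w a' b' → (a' + b' - (c + w)) + c + w - a' ≡ b'
            l₁ = solve-∀
            l₂ : ∀ a b c → (a + b) - (a + b - c) ≡ c
            l₂ = solve-∀
            pc : p ν ∣ᵢ c
            pc = subst (p ν ∣ᵢ_) (l₂ (toℤ a) (toℤ b) c) (∣m∣n⇒∣m-n (∣m∣n⇒∣m+n pa pb) (∣ᵢ-trans (ℕD.∣-trans (p∣pp ν) (pp∣M ν)) (≈⁻ q)))
            moved : (Σ (Fin M) λ a' → Σ (Fin M) λ b' → FromTiles.Pair tiles (c + w) a' b') → Sum (c + w)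
            moved (a' , b' , ia' , ib' , q') = a' , b' , ia' , ib' , q' , pa' , pb'
              where
              module _ (¬d : ¬ p ν ∣ᵢ toℤ a') where
                v : ℤ
                v = proj₁ (inverse ν (toℤ a') ¬d)
                vd : pp ν ∣ᵢ toℤ a' * v - 1ℤ
                vd = proj₂ (inverse ν (toℤ a') ¬d)
                ρ r : ℤ
                ρ = 1ℤ - w * v
                r = set ν ρ 1ℤ
                l₃ : ∀ w v → 1ℤ - w * v + w * v ≡ 1ℤ
                l₃ = solve-∀
                ur : Unit r
                ur = set-unit ν ρ λ d → unit-1 ν (subst (p ν ∣ᵢ_) (l₃ w v) (∣m∣n⇒∣m+n d (∣m⇒∣m*n v pw)))
                l₄ : ∀ r w v a a' b b' c → ((r - (1ℤ - w * v)) * (a - a') + (a + b - c) - (a' + b' - (c + w))) + (w * (a' * v - 1ℤ) + - v * (w * a)) ≡ r * a + b - (r * a' + b')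
                l₄ = solve-∀
                l₅ : ∀ r w a a' b b' c → (r - 1ℤ) * (a - a') + (a + b - c) - (a' + b' - (c + w)) - w ≡ r * a + b - (r * a' + b')
                l₅ = solve-∀
                same : ∀ μ → Dec (μ ≡ ν) → E μ (r * toℤ a + toℤ b) (r * toℤ a' + toℤ b')
                same μ (yes refl) = E⁺ (subst (pp ν ∣ᵢ_) (l₄ r w v (toℤ a) (toℤ a') (toℤ b) (toℤ b') c)
                  (∣m∣n⇒∣m+n (∣m∣n⇒∣m-n (∣m∣n⇒∣m+n (∣m⇒∣m*n (toℤ a - toℤ a') (E⁻ (set-E ν ρ 1ℤ))) (∣ᵢ-trans (pp∣M ν) (≈⁻ q))) (∣ᵢ-trans (pp∣M ν) (≈⁻ q')))
                    (∣m∣n⇒∣m+n (∣n⇒∣m*n w vd) (∣n⇒∣m*n (- v) (p∣ᵢ* ν pw pa)))))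
                same μ (no g) = E⁺ (subst (pp μ ∣ᵢ_) (l₅ r w (toℤ a) (toℤ a') (toℤ b) (toℤ b') c)
                  (∣m∣n⇒∣m-n (∣m∣n⇒∣m-n (∣m∣n⇒∣m+n (∣m⇒∣m*n (toℤ a - toℤ a') (E⁻ (set-E′ ρ 1ℤ g))) (∣ᵢ-trans (pp∣M μ) (≈⁻ q))) (∣ᵢ-trans (pp∣M μ) (≈⁻ q'))) (ppw μ g)))
                forced : toℤ a ≈ toℤ a'
                forced = proj₁ (uniq ur (in⁺ ia) (in⁺ ia') (b , ib , refl) (b' , ib' , refl) (E⇒≈ λ μ → same μ (μ Fin.≟ ν)))
              decide : Dec (p ν ∣ᵢ toℤ a') → p ν ∣ᵢ toℤ a'
              decide (yes d) = d
              decide (no ¬d) = ∣-resp-E (≈⇒E (forced ¬d) ν) pa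
              pa' : p ν ∣ᵢ toℤ a'
              pa' = decide (p ν ∣ᵢ? toℤ a')
              pb' : p ν ∣ᵢ toℤ b'
              pb' = subst (p ν ∣ᵢ_) (l₁ c w (toℤ a') (toℤ b')) (∣m∣n⇒∣m-n (∣m∣n⇒∣m+n (∣m∣n⇒∣m+n (∣ᵢ-trans (ℕD.∣-trans (p∣pp ν) (pp∣M ν)) (≈⁻ q')) pc) pw) pa')

        P? : ∀ k → Dec (p ν ∣ᵢ 0ℤ - + k)
        P? k = p ν ∣ᵢ? (0ℤ - + k)

        opaque
          neg⁺ : ∀ {x} → p ν ∣ᵢ x → p ν ∣ᵢ 0ℤ - x
          neg⁺ d = ∣m∣n⇒∣m-n (0∣ᵢ (p ν)) d
          neg⁻ : ∀ {x} → p ν ∣ᵢ 0ℤ - x → p ν ∣ᵢ x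
          neg⁻ {x} d = subst (p ν ∣ᵢ_) (lem x) (∣m⇒∣-m d)
            where
            lem : ∀ x → - (0ℤ - x) ≡ x
            lem = solve-∀

          sum⇒hit : ∀ {c} → Sum c → count₂ M c A₀ B₀ ≡ 1
          sum⇒hit {c} (a , b , ia , ib , q , pa , pb) = count₂-1 (filter⁺ P? (unique-residues A)) (filter⁺ P? (unique-residues B))
              (∈-filter⁺ P? (residue⁺ ia) (neg⁺ pa)) (∈-filter⁺ P? (residue⁺ ib) (neg⁺ pb)) (hit⁺ q)
              λ i j r → count₂-single {M} {c} {as} {bs} (ℕP.≤-reflexive (tileL c)) (proj₁ (∈-filter⁻ P? {xs = as} i)) (residue⁺ ia) (proj₁ (∈-filter⁻ P? {xs = bs} j)) (residue⁺ ib) r (hit⁺ q)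

          hit⇒sum : ∀ {c} → 1 ≤ count₂ M c A₀ B₀ → Sum c
          hit⇒sum {c} le = go (count₂-hit {M} {c} {A₀} {B₀} le)
            where
            found : ∀ {k l} → (Σ (Fin M) λ x → x ∈ A × k ≡ Fin.toℕ x) → (Σ (Fin M) λ x → x ∈ B × l ≡ Fin.toℕ x) →
              M ∣ᵢ c - + k - + l → p ν ∣ᵢ + k → p ν ∣ᵢ + l → Sum c
            found (x , x∈ , refl) (y , y∈ , refl) q pa pb = x , y , x∈ , y∈ , hit⁻ q , pa , pb
            go : (Σ ℕ λ k → Σ ℕ λ l → k ∈ˡ A₀ × l ∈ˡ B₀ × M ∣ᵢ c - + k - + l) → Sum c
            go (k , l , i , j , q) = let i' , pa = ∈-filter⁻ P? {xs = as} i ; j' , pb = ∈-filter⁻ P? {xs = bs} j in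
              found (residue⁻ i') (residue⁻ j') q (neg⁻ pa) (neg⁻ pb)

          periodic : ∀ c → count₂ M (+ Mover p ν + c) A₀ B₀ ≡ count₂ M c A₀ B₀
          periodic c = go (1 ℕ.≤? count₂ M c A₀ B₀) (1 ℕ.≤? count₂ M (+ Mover p ν + c) A₀ B₀)
            where
            w : ℤ
            w = + Mover p ν
            pw : p ν ∣ᵢ w
            pw = ∣ᵢ-intro (ℕD.m∣m*n (Mnu p ν))
            ppw : ∀ μ → μ ≢ ν → pp μ ∣ᵢ w
            ppw μ g = ∣ᵢ-intro (ℕD.∣n⇒∣m*n (p ν) (pp∣Mnu g))
            lem : ∀ w c → w + c + - w ≡ c
            lem = solve-∀
            up : Sum c → Sum (w + c)
            up s = subst Sum (ℤP.+-comm c w) (move pw ppw s)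
            down : Sum (w + c) → Sum c
            down s = subst Sum (lem w c) (move (∣m⇒∣-m pw) (λ μ g → ∣m⇒∣-m (ppw μ g)) s)
            go : Dec (1 ≤ count₂ M c A₀ B₀) → Dec (1 ≤ count₂ M (w + c) A₀ B₀) → count₂ M (w + c) A₀ B₀ ≡ count₂ M c A₀ B₀
            go (yes k) _ = trans (sum⇒hit (up (hit⇒sum k))) (sym (sum⇒hit (hit⇒sum k)))
            go _ (yes k) = trans (sum⇒hit (hit⇒sum k)) (sym (sum⇒hit (down (hit⇒sum k))))
            go (no ¬k) (no ¬l) = trans (ℕP.n<1⇒n≡0 (ℕP.≰⇒> ¬l)) (sym (ℕP.n<1⇒n≡0 (ℕP.≰⇒> ¬k)))

          M≡p*Mover : M ≡ p ν ℕ.* Mover p ν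
          M≡p*Mover = trans (M≡pp*Mnu ν) (ℕP.*-assoc (p ν) (p ν) (Mnu p ν))

          p∣A₀B₀ : p ν ℕD.∣ length A₀ ℕ.* length B₀
          p∣A₀B₀ = ∣⇒∣ᵤ (subst (p ν ∣ᵢ_) (trans (total-⊛ (polyOf A₀) (polyOf B₀)) (trans (cong₂ _*_ (total-polyOf A₀) (total-polyOf B₀)) (sym (ℤP.pos-* (length A₀) (length B₀)))))
            (periodic⇒∣total (p ν) (Mover p ν) (polyOf A₀ ⊛ polyOf B₀) (subst (1 ≤_) M≡p*Mover M>0) λ c →
              subst (λ m → fold m (+ Mover p ν + c) (polyOf A₀ ⊛ polyOf B₀) ≡ fold m c (polyOf A₀ ⊛ polyOf B₀)) M≡p*Mover
                (trans (fold-polyOf₂ M (+ Mover p ν + c) A₀ B₀) (trans (cong +_ (periodic c)) (sym (fold-polyOf₂ M c A₀ B₀))))))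

      opaque
        -- Otherwise A and B are both equidistributed modulo p_ν, so p_ν does not divide |A₀||B₀| = M/p_ν²;
        -- but A₀ ⊕ B₀ is invariant under translation by M/p_ν.
        Φ-p∤ : Regular ν → Sparse ν → ¬ p ν Φ∣ mask p A
        Φ-p∤ reg sparse φ = p∤Mnu ν (subst (p ν ℕD.∣_) size p∣A₀B₀)
          where
          a b : ℕ
          a = length A₀
          b = length B₀
          |A| : length as ≡ p ν ℕ.* a
          |A| = trans (equidistributed (p ν) as (p>0 ν) (A-equidistributed φ)) (cong (p ν ℕ.*_) (count-filter (p ν) 0ℤ as))
          |B| : length bs ≡ p ν ℕ.* b
          |B| = trans (equidistributed (p ν) bs (p>0 ν) (B-equidistributed reg sparse)) (cong (p ν ℕ.*_) (count-filter (p ν) 0ℤ bs))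
          lem : ∀ q a b → q ℕ.* q ℕ.* (a ℕ.* b) ≡ q ℕ.* a ℕ.* (q ℕ.* b)
          lem = ℕS.solve-∀
          size : a ℕ.* b ≡ Mnu p ν
          size = ℕP.*-cancelˡ-≡ (a ℕ.* b) (Mnu p ν) (pp ν) ⦃ ℕ.>-nonZero (pp>0 ν) ⦄ (begin
            pp ν ℕ.* (a ℕ.* b)          ≡⟨ lem (p ν) a b ⟩
            p ν ℕ.* a ℕ.* (p ν ℕ.* b)   ≡⟨ cong₂ ℕ._*_ |A| |B| ⟨
            length as ℕ.* length bs     ≡⟨ length-TileL {M} {as} {bs} M>0 tileL ⟩
            M                           ≡⟨ M≡pp*Mnu ν ⟩
            pp ν ℕ.* Mnu p ν            ∎)
            where open ≡-Reasoning

  open Distribution using (Φ-p∤)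

  module Translation where
    open import Defs using (mask; _Φ∣_; Φ; Poly)
    open Polynomials hiding (at)
    open Division using (_∣ₚ_; _,ₚ_; monic-cancel)
    open CyclotomicPolynomials using (E₋; E₋-monic; Φ∣E₋-∣; Φ⊛E₋-∣; ∣ₚ-trans; ∣ₚ-resp; ∣ₚ-+; ∣ₚ-*ʳ; ∣ₚ-neg)
    open Folding using (_∣ᵢ_; fold; fold-+; fold-neg; fold-E₋⊛; fold-zero⇒∣)
    open Tijdeman using (prime∣^)
    open Counting
    open import Data.Nat.ListAction using (product)
    import Tactic.RingSolver as PolySolver
    open import Data.Bool using (true)
    open import Data.Vec using (tabulate)
    open import Data.Vec.Properties using (lookup∘tabulate; []=⇒lookup; lookup⇒[]=)
    open import Data.List.Relation.Unary.All as All using (All; []; _∷_)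
    open import Relation.Nullary using (_⊎-dec_)

    -- The subset of ℤ_M with a given decidable predicate.
    module _ {P : ℤ → Set} (P? : ∀ z → Dec (P z)) (resp : ∀ {x y} → x ≈ y → P x → P y) where
      subset : Subset M
      subset = tabulate λ y → does (P? (toℤ y))

      opaque
        subset⁺ : ∀ {z} → P z → ⟦ subset ⟧ z
        subset⁺ {z} q = lookup⇒[]= (red z) subset (trans (lookup∘tabulate _ (red z)) (decide (P? (toℤ (red z)))))
          where
          decide : (d : Dec (P (toℤ (red z)))) → does d ≡ true
          decide (yes _) = refl
          decide (no ¬q) = ⊥-elim (¬q (resp (≈-sym (toℤ-red z)) q))

        subset⁻ : ∀ {z} → ⟦ subset ⟧ z → P z
        subset⁻ {z} i = resp (toℤ-red z) (decide (P? (toℤ (red z))) (trans (sym (lookup∘tabulate _ (red z))) ([]=⇒lookup i)))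
          where
          decide : (d : Dec (P (toℤ (red z)))) → does d ≡ true → P (toℤ (red z))
          decide (yes q) _ = q
          decide (no _) ()

    opaque
      fold-in : ∀ (V : Subset M) {c} → ⟦ V ⟧ c → fold M c (maskOf V) ≡ 1ℤ
      fold-in V {c} i = trans (fold-mask V M c) (cong +_ (count-1 (unique-residues V) (residue⁺ i) (≈⁻ (≈-sym (toℤ-red c))) other))
        where
        other : ∀ {k} → k ∈ˡ residues V → M ∣ᵢ c - + k → k ≡ Fin.toℕ (red c)
        other {k} j q = go (residue⁻ {V} j)
          where
          go : (Σ (Fin M) λ x → x ∈ V × k ≡ Fin.toℕ x) → k ≡ Fin.toℕ (red c)
          go (x , _ , refl) = cong Fin.toℕ (trans (sym (red-toℤ x)) (red-cong (≈-sym (≈⁺ q))))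

      fold-out : ∀ (V : Subset M) {c} → ¬ ⟦ V ⟧ c → fold M c (maskOf V) ≡ 0ℤ
      fold-out V {c} ¬i = trans (fold-mask V M c) (cong +_ (count-0 {M} {c} {residues V} λ {k} j q → go (residue⁻ {V} j) q))
        where
        go : ∀ {k} → (Σ (Fin M) λ x → x ∈ V × k ≡ Fin.toℕ x) → M ∣ᵢ c - + k → ⊥
        go (x , i , refl) q = ¬i (subst (_∈ V) (trans (sym (red-toℤ x)) (red-cong (≈-sym (≈⁺ q)))) i)

    Splits : Fin 3 → ℕ → Set
    Splits ν s = (¬ p ν ℕD.∣ s) ⊎ pp ν ℕD.∣ s

    opaque
      splits-* : ∀ ν {s t} → Splits ν s → Splits ν t → Splits ν (s ℕ.* t)
      splits-* ν (inj₁ a) (inj₁ b) = inj₁ (p∤* (pr ν) a b)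
      splits-* ν {s} {t} (inj₂ a) _ = inj₂ (ℕD.∣m⇒∣m*n t a)
      splits-* ν {s} {t} _ (inj₂ b) = inj₂ (ℕD.∣n⇒∣m*n s b)

      coprime-^ : ∀ {m k} j → Coprime m k → Coprime (m ℕ.^ j) k
      coprime-^ zero c (d₁ , _) = ℕD.∣1⇒≡1 d₁
      coprime-^ {m} (suc j) c = Cop.sym (coprime-* (Cop.sym c) (Cop.sym (coprime-^ j c)))

    Powers : List (ℕ × ℕ) → ℕ
    Powers qs = product (map (λ qe → proj₁ qe ℕ.^ proj₂ qe) qs)

    opaque
      ∤Powers : ∀ {q} → Prime q → ∀ qs → All (λ qe → Prime (proj₁ qe) × (proj₁ qe ℕ.^ proj₂ qe) ℕD.∣ M) qs → All (q ≢_) (map proj₁ qs) → ¬ q ℕD.∣ Powers qs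
      ∤Powers pq [] _ _ d with ℕD.∣1⇒≡1 d
      ∤Powers (prime ⦃ () ⦄ _) [] _ _ d | refl
      ∤Powers {q} pq ((r , k) ∷ qs) ((prr , _) ∷ hs) (q≢r ∷ g) d with euclidsLemma (r ℕ.^ k) (Powers qs) pq d
      ... | inj₁ u = q≢r (prime≡ pq prr (prime∣^ pq r k u))
      ... | inj₂ u = ∤Powers pq qs hs g u

      Powers∣M : ∀ qs → Unique (map proj₁ qs) → All (λ qe → Prime (proj₁ qe) × (proj₁ qe ℕ.^ proj₂ qe) ℕD.∣ M) qs → Powers qs ℕD.∣ M
      Powers∣M [] _ _ = ℕD.1∣ M
      Powers∣M ((q , k) ∷ qs) (q∉ ∷ u) ((pq , d) ∷ hs) = coprime-∣ (coprime-^ k (coprime-p pq (∤Powers pq qs hs q∉))) d (Powers∣M qs u hs)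

    T2-transfer : ∀ {A A' : Subset M} ν → (∀ {s} → 1 ≤ s → s ℕD.∣ M → Splits ν s → (s Φ∣ mask p A → s Φ∣ mask p A') × (s Φ∣ mask p A' → s Φ∣ mask p A)) →
      ¬ p ν Φ∣ mask p A' → T2 p A → T2 p A'
    T2-transfer {A} {A'} ν tr ¬Φ t2 qs ne u hs = proj₁ (tr (ℕP.n≢0⇒n>0 λ z → ℕP.<⇒≢ M>0 (sym (ℕD.0∣⇒≡0 (subst (ℕD._∣ M) z whole)))) whole (splits qs hs))
        (t2 qs ne u (All.map back hs))
      where
      Ok : ℕ × ℕ → Set
      Ok qe = Prime (proj₁ qe) × 1 ≤ proj₂ qe × (proj₁ qe ℕ.^ proj₂ qe) ℕD.∣ M × (proj₁ qe ℕ.^ proj₂ qe) Φ∣ mask p A'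
      whole : Powers qs ℕD.∣ M
      whole = Powers∣M qs u (All.map (λ { (a , _ , b , _) → a , b }) hs)
      split : ∀ {qe} → Ok qe → Splits ν (proj₁ qe ℕ.^ proj₂ qe)
      split {q , suc k} (pq , _ , d , φ) = go (prime∣M pq (ℕD.∣-trans (ℕD.m∣m*n (q ℕ.^ k)) d)) k φ
        where
        go : (Σ (Fin 3) λ μ → q ≡ p μ) → ∀ k → (q ℕ.^ suc k) Φ∣ mask p A' → Splits ν (q ℕ.^ suc k)
        go (μ , refl) k φ = decide (μ Fin.≟ ν) k φ
          where
          decide : Dec (μ ≡ ν) → ∀ k → (p μ ℕ.^ suc k) Φ∣ mask p A' → Splits ν (p μ ℕ.^ suc k)
          decide (no g) k φ = inj₁ λ d → p≢ (λ z → g (sym z)) (prime≡ (pr ν) (pr μ) (prime∣^ (pr ν) (p μ) (suc k) d))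
          decide (yes refl) zero φ = ⊥-elim (¬Φ (subst (_Φ∣ mask p A') (ℕP.*-identityʳ (p ν)) φ))
          decide (yes refl) (suc k) φ = inj₂ (subst (pp ν ℕD.∣_) (ℕP.*-assoc (p ν) (p ν) (p ν ℕ.^ k)) (ℕD.m∣m*n (p ν ℕ.^ k)))
      splits : ∀ qs → All Ok qs → Splits ν (Powers qs)
      splits [] _ = inj₁ λ d → lem (ℕD.∣1⇒≡1 d)
        where
        lem : p ν ≢ 1
        lem q with subst (3 ≤_) q (p≥3 ν)
        ... | s≤s ()
      splits (qe ∷ qs) (ok ∷ hs) = splits-* ν (split ok) (splits qs hs)
      back : ∀ {qe} → Ok qe → Prime (proj₁ qe) × 1 ≤ proj₂ qe × (proj₁ qe ℕ.^ proj₂ qe) ℕD.∣ M × (proj₁ qe ℕ.^ proj₂ qe) Φ∣ mask p A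
      back {qe} ok@(pq , 1≤k , d , φ) = pq , 1≤k , d , proj₂ (tr (ℕP.m^n>0 (proj₁ qe) ⦃ Data.Nat.Primality.prime⇒nonZero pq ⦄ (proj₂ qe)) d (split ok)) φ
        where import Data.Nat.Primality

    -- Translating by t, a multiple of M/p_ν², a part R of A that is a union of M-fibers in the p_ν direction.
    module Translate {A B : Subset M} (tiles : Tiles p A B) (ν : Fin 3) (reg : Base.Regular (FromTiles.tiling tiles) ν)
        {R : ℤ → Set} (R? : ∀ z → Dec (R z)) (R⊂A : ∀ {z} → R z → ⟦ A ⟧ z) (closed : ∀ {x y} → OnFiber ν x y → R x → R y)
        (t : ℕ) (pp∣t : ∀ μ → μ ≢ ν → pp μ ℕD.∣ t) where
      open FromTiles tiles using (tiling)
      open Base tiling using (A?; A-resp; solve; uniq; clash; Sparse; Line)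

      Moved : ℤ → Set
      Moved z = (⟦ A ⟧ z × ¬ R z) ⊎ R (z - + t)

      opaque
        R-resp : ∀ {x y} → x ≈ y → R x → R y
        R-resp q = closed (≢n-sym (E⇒≢n (≈⇒E q ν)) , λ μ _ → E-sym (≈⇒E q μ))

        -t-cong : ∀ {x y} → x ≈ y → (x - + t) ≈ (y - + t)
        -t-cong {x} {y} q = +-mono-≈ {x} {y} { - + t } { - + t } q ≈-refl

      Moved? : ∀ z → Dec (Moved z)
      Moved? z = (A? z ×-dec ¬? (R? z)) ⊎-dec R? (z - + t)

      Moved-resp : ∀ {x y} → x ≈ y → Moved x → Moved y
      Moved-resp q (inj₁ (a , ¬r)) = inj₁ (A-resp q a , λ r → ¬r (R-resp (≈-sym q) r))
      Moved-resp q (inj₂ r) = inj₂ (R-resp (-t-cong q) r)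

      A' : Subset M
      A' = subset Moved? Moved-resp

      in′⁺ : ∀ {z} → Moved z → ⟦ A' ⟧ z
      in′⁺ = subset⁺ Moved? Moved-resp

      in′⁻ : ∀ {z} → ⟦ A' ⟧ z → Moved z
      in′⁻ = subset⁻ Moved? Moved-resp

      opaque
        t-E : ∀ {μ} → μ ≢ ν → ∀ z → E μ (z - + t) z
        t-E {μ} g z = E⁺ (subst (pp μ ∣ᵢ_) (lem z (+ t)) (∣m⇒∣-m (∣ᵢ-intro (pp∣t μ g))))
          where
          lem : ∀ z t → - t ≡ z - t - z
          lem = solve-∀

        tiles′ : Tiles p A' B
        tiles′ = mkTiles existence uniqueness
          where
          unit : ∀ a b {c} → (1ℤ * a + b) ≈ c → (a + b) ≈ c
          unit a b {c} q = subst (λ z → (z + b) ≈ c) (ℤP.*-identityˡ a) q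
          unit⁻ : ∀ a b a' b' → (a + b) ≈ (a' + b') → (1ℤ * a + b) ≈ (1ℤ * a' + b')
          unit⁻ a b a' b' q = subst₂ (λ x y → (x + b) ≈ (y + b')) (sym (ℤP.*-identityˡ a)) (sym (ℤP.*-identityˡ a')) q
          -- The line of b in B contains b' congruent to b ∓ t, and the difference can be absorbed by R.
          existence : ∀ x → Σ ℤ λ a → Σ ℤ λ b → ⟦ A' ⟧ a × elem B b × (a + b) ≈ x
          existence x = start (solve unit-1 x)
            where
            start : (Σ ℤ λ a → Σ ℤ λ b → ⟦ A ⟧ a × elem B b × (1ℤ * a + b) ≈ x) → Σ ℤ λ a → Σ ℤ λ b → ⟦ A' ⟧ a × elem B b × (a + b) ≈ x
            start (a , b , Aa , Bb , q) = decide (R? a)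
              where
              decide : Dec (R a) → Σ ℤ λ a → Σ ℤ λ b → ⟦ A' ⟧ a × elem B b × (a + b) ≈ x
              decide (no ¬r) = a , b , in′⁺ (inj₁ (Aa , ¬r)) , Bb , unit a b q
              decide (yes r) = let b' , Bb' , near , ln = reg b Bb (b - + t) in
                a + (b - b') , b' , in′⁺ (inj₂ (closed (moved b' near ln) r)) , Bb' , subst (_≈ x) (l₁ a b b') (unit a b q)
                where
                l₁ : ∀ a b b' → a + b ≡ a + (b - b') + b'
                l₁ = solve-∀
                l₂ : ∀ a b b' t → - (b' - (b - t)) ≡ a + (b - b') - t - a
                l₂ = solve-∀
                l₃ : ∀ a b b' t → - (b' - b) - t ≡ a + (b - b') - t - a
                l₃ = solve-∀
                moved : ∀ b' → T ν b' (b - + t) ≢ n → Line ν b b' → OnFiber ν a (a + (b - b') - + t)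
                moved b' near ln = ≢n⁺ (subst (p ν ∣ᵢ_) (l₂ a b b' (+ t)) (∣m⇒∣-m (≢n⁻ near))) ,
                  λ μ g → E⁺ (subst (pp μ ∣ᵢ_) (l₃ a b b' (+ t)) (∣m∣n⇒∣m-n (∣m⇒∣-m (E⁻ (ln μ g))) (∣ᵢ-intro (pp∣t μ g))))
          lemt : ∀ a b t → a - t + b ≡ a + b + - t
          lemt = solve-∀
          mixed : ∀ a a' b b' → ⟦ A ⟧ a → ¬ R a → R (a' - + t) → elem B b → elem B b' → (a + b) ≈ (a' + b') → ⊥
          mixed a a' b b' Aa ¬r r Bb Bb' q = let c , Bc , near , ln = reg b' Bb' (b' + + t) in
            let r″ = closed (moved c near ln) r in
            ¬r (R-resp (≈-sym (proj₁ (uniq unit-1 Aa (R⊂A r″) Bb Bc (unit⁻ a b (a' + (b' - c)) c (subst ((a + b) ≈_) (l₁ a' b' c) q))))) r″)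
            where
            l₁ : ∀ a b c → a + b ≡ a + (b - c) + c
            l₁ = solve-∀
            l₂ : ∀ a b c t → - (c - (b + t)) ≡ a + (b - c) - (a - t)
            l₂ = solve-∀
            l₃ : ∀ a b c t → - (c - b) + t ≡ a + (b - c) - (a - t)
            l₃ = solve-∀
            moved : ∀ c → T ν c (b' + + t) ≢ n → Line ν b' c → OnFiber ν (a' - + t) (a' + (b' - c))
            moved c near ln = ≢n⁺ (subst (p ν ∣ᵢ_) (l₂ a' b' c (+ t)) (∣m⇒∣-m (≢n⁻ near))) ,
              λ μ g → E⁺ (subst (pp μ ∣ᵢ_) (l₃ a' b' c (+ t)) (∣m∣n⇒∣m+n (∣m⇒∣-m (E⁻ (ln μ g))) (∣ᵢ-intro (pp∣t μ g))))
          uniqueness : ∀ {a a' b b'} → ⟦ A' ⟧ a → ⟦ A' ⟧ a' → elem B b → elem B b' → (a + b) ≈ (a' + b') → a ≈ a' × b ≈ b'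
          uniqueness {a} {a'} {b} {b'} i i' Bb Bb' q = cases (in′⁻ i) (in′⁻ i')
            where
            cases : Moved a → Moved a' → a ≈ a' × b ≈ b'
            cases (inj₁ (Aa , _)) (inj₁ (Aa' , _)) = uniq unit-1 Aa Aa' Bb Bb' (unit⁻ a b a' b' q)
            cases (inj₁ (Aa , ¬r)) (inj₂ r) = ⊥-elim (mixed a a' b b' Aa ¬r r Bb Bb' q)
            cases (inj₂ r) (inj₁ (Aa , ¬r)) = ⊥-elim (mixed a' a b' b Aa ¬r r Bb' Bb (≈-sym q))
            cases (inj₂ r) (inj₂ r') = untranslate (uniq unit-1 (R⊂A r) (R⊂A r') Bb Bb' (unit⁻ (a - + t) b (a' - + t) b' (subst₂ _≈_ (sym (lemt a b (+ t))) (sym (lemt a' b' (+ t))) (+-mono-≈ {a + b} {a' + b'} { - + t } { - + t } q ≈-refl))))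
              where
              lem : ∀ a t → a - t + t ≡ a
              lem = solve-∀
              untranslate : (a - + t) ≈ (a' - + t) × b ≈ b' → a ≈ a' × b ≈ b'
              untranslate (u , v) = subst₂ _≈_ (lem a (+ t)) (lem a' (+ t)) (+-mono-≈ {a - + t} {a' - + t} {+ t} {+ t} u ≈-refl) , v

        sparse : ∀ {z} → R z → Sparse ν
        sparse {z} r {b} {b'} Bb Bb' near ln = E⇒≈ λ μ → agree μ (μ Fin.≟ ν)
          where
          1<p : 1 < p ν
          1<p = ℕP.≤-trans (s≤s (s≤s z≤n)) (p≥3 ν)
          z′ : ℤ
          z′ = set ν (at ν z 1) z
          Az′ : ⟦ A ⟧ z′
          Az′ = R⊂A (closed (≢n-trans (E⇒≢n (set-E ν (at ν z 1) z)) (at-near z 1) , λ μ g → set-E′ (at ν z 1) z g) r)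
          agree : ∀ μ → Dec (μ ≡ ν) → E μ b b'
          agree μ (no g) = ln μ g
          agree μ (yes refl) = decide (E? ν b b')
            where
            vec : ¬ E ν b b' → ∀ κ → Dec (κ ≡ ν) → T κ z′ z ≡ T κ b b'
            vec ¬q κ (no g) = trans (set-E′ (at ν z 1) z g) (sym (ln κ g))
            vec ¬q κ (yes refl) = trans (T-Eˡ z (set-E ν (at ν z 1) z)) (trans (at-h z 1 ℕP.≤-refl 1<p) (sym (≢⇒h near ¬q)))
            decide : Dec (E ν b b') → E ν b b'
            decide (yes q) = q
            decide (no ¬q) = ≈⇒E (clash Az′ (R⊂A r) Bb Bb' λ κ → vec ¬q κ (κ Fin.≟ ν)) ν

        disjoint : ∀ {z} → ⟦ A ⟧ z → ¬ R z → ¬ R (z - + t)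
        disjoint {z} Az ¬r r = decide (N? ν (z - + t) z)
          where
          decide : Dec (T ν (z - + t) z ≡ n) → ⊥
          decide (no g) = ¬r (closed (≢n-sym g , λ μ q → E-sym (t-E q z)) r)
          decide (yes g) = let b' , Bb' , near , ln = reg b₀ Bb₀ (b₀ + (z - + t - z)) in
            n⇒¬E g (trans (vec b' near ln ν (ν Fin.≟ ν)) (≈⇒E (clash (R⊂A r) Az Bb' Bb₀ λ μ → vec b' near ln μ (μ Fin.≟ ν)) ν))
            where
            open Base tiling using (b₀; Bb₀)
            l₁ : ∀ b d → (b + d) - b ≡ d
            l₁ = solve-∀
            vec : ∀ b' → T ν b' (b₀ + (z - + t - z)) ≢ n → Line ν b₀ b' → ∀ μ → Dec (μ ≡ ν) → T μ (z - + t) z ≡ T μ b' b₀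
            vec b' near ln μ (no q) = trans (t-E q z) (sym (ln μ q))
            vec b' near ln μ (yes refl) = trans g (sym (≢n-n near (n⁺ λ d → n⁻ g (subst (p ν ∣ᵢ_) (l₁ b₀ (z - + t - z)) d))))

      private
        RR : Subset M
        RR = subset R? R-resp

      opaque
        fold-moved : ∀ c → fold M c (maskOf A') ≡ fold M c (maskOf A) + (fold M (c - + t) (maskOf RR) - fold M c (maskOf RR))
        fold-moved c = decide (R? c) (A? c) (R? (c - + t))
          where
          r⁺ : ∀ {z} → R z → fold M z (maskOf RR) ≡ 1ℤ
          r⁺ r = fold-in RR (subset⁺ R? R-resp r)
          r⁻ : ∀ {z} → ¬ R z → fold M z (maskOf RR) ≡ 0ℤ
          r⁻ ¬r = fold-out RR λ i → ¬r (subset⁻ R? R-resp i)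
          moved⁻ : (¬ ⟦ A ⟧ c ⊎ R c) → ¬ R (c - + t) → ¬ ⟦ A' ⟧ c
          moved⁻ g ¬r i = [ (λ { (a , ¬r′) → [ (λ ¬a → ¬a a) , ¬r′ ]′ g }) , ¬r ]′ (in′⁻ i)
          eval : ∀ {w x y z : ℤ} {w' x' y' z'} → w ≡ w' → x ≡ x' → y ≡ y' → z ≡ z' → w' ≡ x' + (y' - z') → w ≡ x + (y - z)
          eval refl refl refl refl q = q
          decide : Dec (R c) → Dec (⟦ A ⟧ c) → Dec (R (c - + t)) → fold M c (maskOf A') ≡ fold M c (maskOf A) + (fold M (c - + t) (maskOf RR) - fold M c (maskOf RR))
          decide (yes r) _ (yes r') = eval (fold-in A' (in′⁺ (inj₂ r'))) (fold-in A (R⊂A r)) (r⁺ r') (r⁺ r) refl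
          decide (yes r) _ (no ¬r') = eval (fold-out A' (moved⁻ (inj₂ r) ¬r')) (fold-in A (R⊂A r)) (r⁻ ¬r') (r⁺ r) refl
          decide (no ¬r) (yes a) (yes r') = ⊥-elim (disjoint a ¬r r')
          decide (no ¬r) (yes a) (no ¬r') = eval (fold-in A' (in′⁺ (inj₁ (a , ¬r)))) (fold-in A a) (r⁻ ¬r') (r⁻ ¬r) refl
          decide (no ¬r) (no ¬a) (yes r') = eval (fold-in A' (in′⁺ (inj₂ r'))) (fold-out A ¬a) (r⁺ r') (r⁻ ¬r) refl
          decide (no ¬r) (no ¬a) (no ¬r') = eval (fold-out A' (moved⁻ (inj₁ ¬a) ¬r')) (fold-out A ¬a) (r⁻ ¬r') (r⁻ ¬r) refl

        -- mask A' − mask A ≡ (X^t − 1) mask R modulo X^M − 1.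
        difference : E₋ M ∣ₚ (maskOf A' ⊟ maskOf A) ⊟ (E₋ t ⊛ maskOf RR)
        difference = fold-zero⇒∣ M M>0 λ c → begin
            fold M c ((maskOf A' ⊟ maskOf A) ⊟ (E₋ t ⊛ maskOf RR))
              ≡⟨ fold-+ M c (maskOf A' ⊟ maskOf A) (negₚ (E₋ t ⊛ maskOf RR)) ⟩
            fold M c (maskOf A' ⊟ maskOf A) + fold M c (negₚ (E₋ t ⊛ maskOf RR))
              ≡⟨ cong₂ _+_ (fold-+ M c (maskOf A') (negₚ (maskOf A))) (fold-neg M c (E₋ t ⊛ maskOf RR)) ⟩
            fold M c (maskOf A') + fold M c (negₚ (maskOf A)) - fold M c (E₋ t ⊛ maskOf RR)
              ≡⟨ cong₂ (λ x y → fold M c (maskOf A') + x - y) (fold-neg M c (maskOf A)) (fold-E₋⊛ M c t (maskOf RR)) ⟩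
            fold M c (maskOf A') - fold M c (maskOf A) - (fold M (c - + t) (maskOf RR) - fold M c (maskOf RR))
              ≡⟨ cong (λ x → x - fold M c (maskOf A) - (fold M (c - + t) (maskOf RR) - fold M c (maskOf RR))) (fold-moved c) ⟩
            fold M c (maskOf A) + (fold M (c - + t) (maskOf RR) - fold M c (maskOf RR)) - fold M c (maskOf A) - (fold M (c - + t) (maskOf RR) - fold M c (maskOf RR))
              ≡⟨ lem (fold M c (maskOf A)) (fold M (c - + t) (maskOf RR) - fold M c (maskOf RR)) ⟩
            0ℤ ∎
          where
          open ≡-Reasoning
          lem : ∀ a b → a + b - a - b ≡ 0ℤ
          lem = solve-∀

        t-multiple : Mnu p ν ℕD.∣ t
        t-multiple = go ν pp∣t
          where
          cop : ∀ {μ κ} → μ ≢ κ → Coprime (pp μ) (pp κ)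
          cop g = coprime-pp (p∤pp g)
          go : ∀ ν → (∀ μ → μ ≢ ν → pp μ ℕD.∣ t) → Mnu p ν ℕD.∣ t
          go 0F d = coprime-∣ (cop λ ()) (d 1F λ ()) (d 2F λ ())
          go 1F d = coprime-∣ (cop λ ()) (d 0F λ ()) (d 2F λ ())
          go 2F d = coprime-∣ (cop λ ()) (d 0F λ ()) (d 1F λ ())

        Φ∣difference : ∀ {s} → 1 ≤ s → s ℕD.∣ M → Splits ν s → Φ s ∣ₚ E₋ t ⊛ maskOf RR
        Φ∣difference {s} 1≤s s∣M (inj₁ p∤s) = ∣ₚ-*ʳ (maskOf RR) (Φ∣E₋-∣ 1≤s (ℕD.∣-trans (coprime-divisor (Cop.sym (coprime-pp p∤s)) (subst (s ℕD.∣_) (M≡pp*Mnu ν) s∣M)) t-multiple))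
        Φ∣difference {s} 1≤s s∣M (inj₂ pp∣s) = E₋t⊛ (cancelled (Φ⊛E₋-∣ 1≤s 1≤m s∣M m∣M s∤m))
          where
          m : ℕ
          m = Mover p ν
          M≡ : M ≡ p ν ℕ.* m
          M≡ = trans (M≡pp*Mnu ν) (ℕP.*-assoc (p ν) (p ν) (Mnu p ν))
          m∣M : m ℕD.∣ M
          m∣M = subst (m ℕD.∣_) (sym M≡) (ℕD.n∣m*n (p ν))
          1≤m : 1 ≤ m
          1≤m = ℕP.n≢0⇒n>0 λ z → ℕP.<⇒≢ M>0 (sym (ℕD.0∣⇒≡0 (subst (ℕD._∣ M) z m∣M)))
          s∤m : ¬ s ℕD.∣ m
          s∤m d = p∤Mnu ν (ℕD.*-cancelˡ-∣ (p ν) ⦃ ℕ.>-nonZero (p>0 ν) ⦄ (ℕD.∣-trans pp∣s d))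
          m-near : ∀ c → OnFiber ν c (c - + m)
          m-near c = ≢n⁺ (subst (p ν ∣ᵢ_) (lem c (+ m)) (∣m⇒∣-m (∣ᵢ-intro (ℕD.m∣m*n (Mnu p ν))))) ,
              λ μ g → E⁺ (subst (pp μ ∣ᵢ_) (lem c (+ m)) (∣m⇒∣-m (∣ᵢ-intro (ℕD.∣n⇒∣m*n (p ν) (pp∣Mnu g)))))
            where
            lem : ∀ c m → - m ≡ c - m - c
            lem = solve-∀
          invariant : ∀ c → fold M (c - + m) (maskOf RR) ≡ fold M c (maskOf RR)
          invariant c = decide (R? c)
            where
            decide : Dec (R c) → fold M (c - + m) (maskOf RR) ≡ fold M c (maskOf RR)
            decide (yes r) = trans (fold-in RR (subset⁺ R? R-resp (closed (m-near c) r))) (sym (fold-in RR (subset⁺ R? R-resp r)))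
            decide (no ¬r) = trans (fold-out RR λ i → ¬r (closed (≢n-sym (proj₁ (m-near c)) , λ μ g → E-sym (proj₂ (m-near c) μ g)) (subset⁻ R? R-resp i)))
              (sym (fold-out RR λ i → ¬r (subset⁻ R? R-resp i)))
          killed : E₋ M ∣ₚ E₋ m ⊛ maskOf RR
          killed = fold-zero⇒∣ M M>0 λ c → trans (fold-E₋⊛ M c m (maskOf RR)) (trans (cong (_- fold M c (maskOf RR)) (invariant c)) (ℤP.+-inverseʳ (fold M c (maskOf RR))))
          cancelled : (Φ s ⊛ E₋ m) ∣ₚ E₋ M → Φ s ∣ₚ maskOf RR
          cancelled d = go (∣ₚ-trans d killed)
            where
            lem : ∀ a b c → (a ⊛ b) ⊛ c ≋ b ⊛ (a ⊛ c)
            lem = PolySolver.solve-∀ polyACR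
            go : (Φ s ⊛ E₋ m) ∣ₚ E₋ m ⊛ maskOf RR → Φ s ∣ₚ maskOf RR
            go (U ,ₚ q) = U ,ₚ monic-cancel (E₋-monic m 1≤m) (≋-trans q (lem (Φ s) (E₋ m) U))
          E₋t⊛ : Φ s ∣ₚ maskOf RR → Φ s ∣ₚ E₋ t ⊛ maskOf RR
          E₋t⊛ d = ∣ₚ-resp (∣ₚ-*ʳ (E₋ t) d) (*-comm (maskOf RR) (E₋ t))

        Φ-transfer : ∀ {s} → 1 ≤ s → s ℕD.∣ M → Splits ν s → (s Φ∣ mask p A → s Φ∣ mask p A') × (s Φ∣ mask p A' → s Φ∣ mask p A)
        Φ-transfer {s} 1≤s s∣M sp = forth , back
          where
          W : Poly
          W = (maskOf A' ⊟ maskOf A) ⊟ (E₋ t ⊛ maskOf RR)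
          Φ∣W : Φ s ∣ₚ W
          Φ∣W = ∣ₚ-trans (Φ∣E₋-∣ 1≤s s∣M) difference
          Φ∣X : Φ s ∣ₚ E₋ t ⊛ maskOf RR
          Φ∣X = Φ∣difference 1≤s s∣M sp
          l₁ : ∀ a a' x → ((a' ⊞ negₚ a) ⊞ negₚ x) ⊞ x ⊞ a ≋ a'
          l₁ = PolySolver.solve-∀ polyACR
          l₂ : ∀ a a' x → negₚ (((a' ⊞ negₚ a) ⊞ negₚ x) ⊞ x) ⊞ a' ≋ a
          l₂ = PolySolver.solve-∀ polyACR
          fromₚ : ∀ {P} → s Φ∣ P → Φ s ∣ₚ P
          fromₚ (Q , q) = Q ,ₚ eqₚ q
          toₚ : ∀ {P} → Φ s ∣ₚ P → s Φ∣ P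
          toₚ (Q ,ₚ q) = Q , _≋_.at q
          forth : s Φ∣ mask p A → s Φ∣ mask p A'
          forth d = toₚ (∣ₚ-resp (∣ₚ-+ (∣ₚ-+ Φ∣W Φ∣X) (fromₚ d)) (l₁ (maskOf A) (maskOf A') (E₋ t ⊛ maskOf RR)))
          back : s Φ∣ mask p A' → s Φ∣ mask p A
          back d = toₚ (∣ₚ-resp (∣ₚ-+ (∣ₚ-neg (∣ₚ-+ Φ∣W Φ∣X)) (fromₚ d)) (l₂ (maskOf A) (maskOf A') (E₋ t ⊛ maskOf RR)))

        T2⇔ : ∀ {z} → R z → (T2 p A → T2 p A') × (T2 p A' → T2 p A)
        T2⇔ r = T2-transfer {A} {A'} ν Φ-transfer (Φ-p∤ tiles′ ν reg (sparse r)) ,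
          T2-transfer {A'} {A} ν (λ a b c → proj₂ (Φ-transfer a b c) , proj₁ (Φ-transfer a b c)) (Φ-p∤ tiles ν reg (sparse r))

  open Translation using (module Translate)

  opaque
    onFiber-refl : ∀ {ν x} → OnFiber ν x x
    onFiber-refl = E⇒≢n E-refl , λ _ _ → E-refl

    onFiber-sym : ∀ {ν x y} → OnFiber ν x y → OnFiber ν y x
    onFiber-sym (q , l) = ≢n-sym q , λ μ g → E-sym (l μ g)

    onFiber-trans : ∀ {ν x y z} → OnFiber ν x y → OnFiber ν y z → OnFiber ν x z
    onFiber-trans (q , l) (q' , l') = ≢n-trans q' q , λ μ g → E-trans (l' μ g) (l μ g)

    onFiber-near : ∀ {ν x y x₀} → OnFiber ν x y → Near x x₀ → Near y x₀
    onFiber-near {ν} {x} {y} {x₀} (q , l) near μ = close (μ Fin.≟ ν)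
      where
      close : Dec (μ ≡ ν) → T μ y x₀ ≢ n
      close (yes refl) = ≢n-trans q (near μ)
      close (no g) = ≢n-trans (E⇒≢n (l μ g)) (near μ)

    translate-n : ∀ {ν z y b} → T ν z y ≡ n → T ν (b + (z - y)) b ≡ n
    translate-n {ν} {z} {y} {b} q = n⁺ λ d → n⁻ q (subst (p ν ∣ᵢ_) (lem b (z - y)) d)
      where
      lem : ∀ b d → (b + d) - b ≡ d
      lem = solve-∀

  record Equivalent (B A A' : Subset M) : Set where
    field
      tiles : Tiles p A' B
      fwd   : T2 p A → T2 p A'
      bwd   : T2 p A' → T2 p A

  equivalent-refl : ∀ {A B} → Tiles p A B → Equivalent B A A
  equivalent-refl t = record { tiles = t ; fwd = λ x → x ; bwd = λ x → x }

  equivalent-trans : ∀ {A B A' A''} → Equivalent B A A' → Equivalent B A' A'' → Equivalent B A A''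
  equivalent-trans r s = record { tiles = Equivalent.tiles s ; fwd = λ x → Equivalent.fwd s (Equivalent.fwd r x) ; bwd = λ x → Equivalent.bwd r (Equivalent.bwd s x) }

  module _ {A B : Subset M} (tiles : Tiles p A B) where
    open FromTiles tiles using (tiling)
    open Base tiling using (Regular; Shiftable; A?)

    record Filled (ν : Fin 3) (x : ℤ) (A' : Subset M) : Set where
      field
        equiv : Equivalent B A A'
        z     : ℤ
        far   : T ν z x ≡ n
        line  : ∀ μ → μ ≢ ν → E μ z x
        kept  : ∀ {y} → ⟦ A ⟧ y → ¬ OnFiber ν z y → ⟦ A' ⟧ y
        new   : ∀ {y} → OnFiber ν x y → ⟦ A' ⟧ y
        only  : ∀ {y} → ⟦ A' ⟧ y → ⟦ A ⟧ y ⊎ OnFiber ν x y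

      off : ∀ {y} → Near y x → ¬ OnFiber ν z y
      off near (q , _) = ≢n-trans (≢n-sym q) (near ν) far

    fill : ∀ {ν x} → Regular ν → Shiftable ν x → Σ (Subset M) (Filled ν x)
    fill {ν} {x} reg s = Tr.A' , record
      { equiv = record { tiles = Tr.tiles′ ; fwd = proj₁ (Tr.T2⇔ onFiber-refl) ; bwd = proj₂ (Tr.T2⇔ onFiber-refl) }
      ; z = z ; far = far ; line = line
      ; kept = λ a g → Tr.in′⁺ (inj₁ (a , g))
      ; new = λ g → Tr.in′⁺ (inj₂ (back g))
      ; only = λ i → [ (λ { (a , _) → inj₁ a }) , (λ r → inj₂ (forth r)) ]′ (Tr.in′⁻ i) }
      where
      open Base.Shiftable s
      t : ℕ
      t = proj₁ (reduce M M>0 (x - z))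
      opaque
        t≈ : M ∣ᵢ + t - (x - z)
        t≈ = proj₂ (proj₂ (reduce M M>0 (x - z)))
        pp∣t : ∀ μ → μ ≢ ν → pp μ ℕD.∣ t
        pp∣t μ g = ∣⇒∣ᵤ (subst (pp μ ∣ᵢ_) (lem (+ t) x z) (∣m∣n⇒∣m-n (∣ᵢ-trans (pp∣M μ) t≈) (E⁻ (line μ g))))
          where
          lem : ∀ t x z → t - (x - z) - (z - x) ≡ t
          lem = solve-∀
        R⊂A : ∀ {y} → OnFiber ν z y → ⟦ A ⟧ y
        R⊂A {y} (q , l) = fiber y q l
      module Tr = Translate tiles ν reg {OnFiber ν z} (onFiber? ν z) R⊂A (λ f g → onFiber-trans g f) t pp∣t
      opaque
        move-T : ∀ μ y → T μ (y - + t) z ≡ T μ y x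
        move-T μ y = T-diff (subst (pp μ ∣ᵢ_) (lem y x z (+ t)) (∣m⇒∣-m (∣ᵢ-trans (pp∣M μ) t≈)))
          where
          lem : ∀ y x z t → - (t - (x - z)) ≡ y - t - z - (y - x)
          lem = solve-∀
        forth : ∀ {y} → OnFiber ν z (y - + t) → OnFiber ν x y
        forth {y} (q , l) = (λ g → q (trans (move-T ν y) g)) , λ μ g → trans (sym (move-T μ y)) (l μ g)
        back : ∀ {y} → OnFiber ν x y → OnFiber ν z (y - + t)
        back {y} (q , l) = (λ g → q (trans (sym (move-T ν y)) g)) , λ μ g → trans (move-T μ y) (l μ g)

    record Carved (x₀ : ℤ) (R : ℤ → Set) (A' : Subset M) : Set where
      field
        equiv : Equivalent B A A'
        kept  : ∀ {y} → ⟦ A ⟧ y → ¬ R y → ⟦ A' ⟧ y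
        only  : ∀ {y} → Near y x₀ → ⟦ A' ⟧ y → ⟦ A ⟧ y × ¬ R y

    carve : ∀ {ν x₀} → Regular ν → {R : ℤ → Set} → (∀ z → Dec (R z)) → (∀ {z} → R z → Near z x₀) → (∀ {z} → R z → ⟦ A ⟧ z) →
      (∀ {x y} → OnFiber ν x y → R x → R y) → ∀ {z} → R z → Σ (Subset M) (Carved x₀ R)
    carve {ν} {x₀} reg {R} R? near R⊂A closed r = Tr.A' , record
      { equiv = record { tiles = Tr.tiles′ ; fwd = proj₁ (Tr.T2⇔ r) ; bwd = proj₂ (Tr.T2⇔ r) }
      ; kept = λ a g → Tr.in′⁺ (inj₁ (a , g))
      ; only = λ {y} near i → [ (λ q → q) , (λ r′ → ⊥-elim (outside {y} near r′)) ]′ (Tr.in′⁻ i) }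
      where
      module Tr = Translate tiles ν reg {R} R? R⊂A closed (Mnu p ν) (λ μ g → pp∣Mnu g)
      opaque
        outside : ∀ {y} → Near y x₀ → ¬ R (y - + Mnu p ν)
        outside {y} ny r′ = p∤Mnu ν (∣⇒∣ᵤ (subst (p ν ∣ᵢ_) (lem y x₀ (+ Mnu p ν)) (∣m∣n⇒∣m-n (≢n⁻ (ny ν)) (≢n⁻ (near r′ ν)))))
          where
          lem : ∀ y x m → y - x - (y - m - x) ≡ m
          lem = solve-∀

  module _ {Inv : Subset M → Set} {P : Fin M → Set} (P? : ∀ x → Dec (P x))
      (next : ∀ {A} → Inv A → ∀ {x} → P x → ¬ x ∈ A → Σ (Subset M) λ A' → Inv A' × x ∈ A' × (∀ {y} → P y → y ∈ A → y ∈ A')) where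
    private
      Extends : Subset M → List (Fin M) → Set
      Extends A xs = Σ (Subset M) λ A' → Inv A' × (∀ {x} → x ∈ˡ xs → P x → x ∈ A') × (∀ {y} → P y → y ∈ A → y ∈ A')

      run : ∀ xs {A} → Inv A → Extends A xs
      run [] {A} inv = A , inv , (λ ()) , λ _ i → i
      run (x ∷ xs) {A} inv = decide (P? x) (x ∈? A)
        where
        skip : (P x → x ∈ A) → Extends A (x ∷ xs)
        skip g = let A' , inv' , all , mono = run xs inv in
          A' , inv' , (λ { (here refl) px → mono px (g px) ; (there i) px → all i px }) , mono
        decide : Dec (P x) → Dec (x ∈ A) → Extends A (x ∷ xs)
        decide (no ¬px) _ = skip λ px → ⊥-elim (¬px px)
        decide (yes px) (yes i) = skip λ _ → i
        decide (yes px) (no ¬i) = let A₁ , inv₁ , i₁ , mono₁ = next inv px ¬i ; A₂ , inv₂ , all , mono₂ = run xs inv₁ in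
          A₂ , inv₂ , (λ { (here refl) px → mono₂ px i₁ ; (there i) px → all i px }) , λ py i → mono₂ py (mono₁ py i)

    exhaust : ∀ {A} → Inv A → Σ (Subset M) λ A' → Inv A' × (∀ {x} → P x → x ∈ A')
    exhaust inv = let A' , inv' , all , _ = run (allFin M) inv in A' , inv' , λ {x} → all (∈-allFin x)

  module _ {A B : Subset M} (tiles : Tiles p A B) (x0 : Fin M) where
    open FromTiles tiles using (tiling)
    open Base tiling using (Regular; Shiftable; A-resp)

    x₀ : ℤ
    x₀ = toℤ x0

    Result : Set
    Result = Σ (Subset M) λ A' → Equivalent B A A' × Σ (Fin 3) λ ν → Corner p A' x0 ν

    offset : ∀ ν x → Σ ℤ λ u → T ν u x ≡ h
    offset ν x = let u , q , _ = avoid ν x x in u , q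

    module _ {α β γ : Fin 3} (d : Distinct3 p α β γ) {x : ℤ} (nx : Near x x₀) where
      open Labels α β γ d

      near-pt : ∀ {u v w} → T α u x ≢ n → T β v x ≢ n → T γ w x ≢ n → Near (pt u v w) x₀
      near-pt {u} {v} {w} a b c = all3 (≢n-trans (E⇒≢n (ptα u v w)) (≢n-trans a (nx α))) (≢n-trans (E⇒≢n (ptβ u v w)) (≢n-trans b (nx β)))
        (≢n-trans (E⇒≢n (ptγ u v w)) (≢n-trans c (nx γ)))

      near-x : ∀ {y} → Near y x₀ → Near y x
      near-x ny ν = ≢n-trans (ny ν) (≢n-sym (nx ν))

      centered : (∀ {y} → T α y x ≡ h → E β y x → E γ y x → ⟦ A ⟧ y) → (∀ {y} → E α y x → T β y x ≡ h → T γ y x ≡ h → ⟦ A ⟧ y) →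
        (∀ {y} → ⟦ A ⟧ y → Near y x → (T α y x ≡ h × E β y x × E γ y x) ⊎ (E α y x × T β y x ≡ h × T γ y x ≡ h)) →
        Shiftable β x → Regular β → Result
      centered inα inβγ only s reg = A′ , F.equiv , β ,
          corner {A′} (α≢β′ , α≢γ , β≢γ) x c nx (near-pt (E⇒≢n E-refl) (h⇒≢n hv) (E⇒≢n E-refl))
            (conv E-refl (ptβ x v x) (trans (T-sym x v) hv)) (E-sym (ptα x v x)) (E-sym (ptγ x v x)) fa fc oa oc
        where
        α≢β′ : β ≢ α
        α≢β′ q = α≢β (sym q)
        A′ = proj₁ (fill tiles reg s)
        module F = Filled (proj₂ (fill tiles reg s))
        v = proj₁ (offset β x)
        hv : T β v x ≡ h
        hv = proj₂ (offset β x)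
        c = pt x v x
        keep : ∀ {y} → Near y x → ⟦ A ⟧ y → ⟦ A′ ⟧ y
        keep near i = F.kept i (F.off near)
        fa : ∀ {y} → OnFiber α x y → ⟦ A′ ⟧ y
        fa {y} (q , l) = caseV (T α y x) (λ g → F.new (E⇒≢n (l β α≢β′) , lineβ g (l γ λ g → α≢γ (sym g))))
          (λ g → keep (all3 q (E⇒≢n (l β α≢β′)) (E⇒≢n (l γ λ g → α≢γ (sym g)))) (inα g (l β α≢β′) (l γ λ g → α≢γ (sym g)))) (λ g → ⊥-elim (q g))
        fc : ∀ {y} → OnFiber γ c y → ⟦ A′ ⟧ y
        fc {y} (q , l) = caseV (T γ y x) (λ g → F.new (h⇒≢n yβ , lineβ yα g)) (λ g → keep (all3 (E⇒≢n yα) (h⇒≢n yβ) (h⇒≢n g)) (inβγ yα yβ g))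
            (λ g → ⊥-elim (q (trans (T-Eʳ y (ptγ x v x)) g)))
          where
          yα : E α y x
          yα = E-trans (l α α≢γ) (ptα x v x)
          yβ : T β y x ≡ h
          yβ = conv (E-trans (l β β≢γ) (ptβ x v x)) E-refl hv
        oa : ∀ {y} → ⟦ A′ ⟧ y → Near y x₀ → E β y x → E γ y x
        oa {y} i ny g = [ (λ a → [ (λ r → proj₂ (proj₂ r)) , (λ r → ⊥-elim (h⇒¬E (proj₁ (proj₂ r)) g)) ]′ (only a (near-x ny))) ,
          (λ f → proj₂ f γ λ q → β≢γ (sym q)) ]′ (F.only i)
        oc : ∀ {y} → ⟦ A′ ⟧ y → Near y x₀ → E β y c → E α y c
        oc {y} i ny g = E-trans ([ (λ a → [ (λ r → ⊥-elim (h⇒¬E yβ (proj₁ (proj₂ r)))) , proj₁ ]′ (only a (near-x ny))) , (λ f → proj₂ f α α≢β) ]′ (F.only i)) (E-sym (ptα x v x))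
          where
          yβ : T β y x ≡ h
          yβ = conv (E-trans g (ptβ x v x)) E-refl hv

    swap : ∀ {α β γ} → Distinct3 p α β γ → Distinct3 p α γ β
    swap d = proj₂ (proj₂ d) , (λ q → proj₁ (proj₂ d) (sym q)) , proj₁ d

    fullPlane : ∀ α β γ → Distinct3 p α β γ → ∀ x → Near x x₀ →
      (∀ {y} → T α y x ≡ h → E β y x → E γ y x → ⟦ A ⟧ y) → (∀ {y} → E α y x → T β y x ≡ h → T γ y x ≡ h → ⟦ A ⟧ y) →
      (∀ {y} → ⟦ A ⟧ y → Near y x → (T α y x ≡ h × E β y x × E γ y x) ⊎ (E α y x × T β y x ≡ h × T γ y x ≡ h)) → Result
    fullPlane α β γ d x nx inα inβγ only = [ (λ r → centered d nx inα inβγ only (proj₁ r) (proj₂ r)) ,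
      (λ r → centered (swap d) nx (λ a b c → inα a c b) (λ a b c → inβγ a c b)
        (λ i ny → [ (λ { (a , b , c) → inj₁ (a , c , b) }) , (λ { (a , b , c) → inj₂ (a , c , b) }) ]′ (only i ny)) (proj₁ r) (proj₂ r)) ]′
      (Center.result tiling α β γ d x inα inβγ only)

    module Cross (α β γ : Fin 3) (d : Distinct3 p α β γ) (x : ℤ) (nx : Near x x₀) (S : ℤ → Set) (k : Crossed tiling α β γ x S) where
      open Labels α β γ d
      open Crossed k

      β≢α : β ≢ α
      β≢α q = α≢β (sym q)
      γ≢α : γ ≢ α
      γ≢α q = α≢γ (sym q)
      γ≢β : γ ≢ β
      γ≢β q = β≢γ (sym q)

      x[_] : ℤ → ℤ
      x[ w ] = pt x x w

      near-level : ∀ {w} → T γ w x ≢ n → Near x[ w ] x₀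
      near-level q = near-pt d nx (E⇒≢n E-refl) (E⇒≢n E-refl) q

      verticals : Shiftable γ x[ l₁ ] → Regular γ → Result
      verticals s reg = A′ , F.equiv , γ ,
          corner {A′} (γ≢α , α≢β , γ≢β) x[ l₁ ] x[ m₁ ] (near-level l₁~) (near-level m₁~)
            (conv (ptγ x x l₁) (ptγ x x m₁) (≢⇒h (≢n-trans l₁~ (≢n-sym m₁~)) λ q → Sm₁ (S-resp q Sl₁)))
            (E-trans (ptα x x l₁) (E-sym (ptα x x m₁))) (E-trans (ptβ x x l₁) (E-sym (ptβ x x m₁))) fa fc oa oc
        where
        A′ = proj₁ (fill tiles reg s)
        module F = Filled (proj₂ (fill tiles reg s))
        keep : ∀ {y} → T α y x ≢ n → T β y x ≢ n → T γ y x ≢ n → ⟦ A ⟧ y → ⟦ A′ ⟧ y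
        keep a b c i = F.kept i (F.off (all3 (≢n-trans a (≢n-sym (E⇒≢n (ptα x x l₁)))) (≢n-trans b (≢n-sym (E⇒≢n (ptβ x x l₁))))
          (≢n-trans c (≢n-sym (≢n-trans (E⇒≢n (ptγ x x l₁)) l₁~)))))
        center : ∀ {y} → E α y x → E β y x → T γ y x ≢ n → ⟦ A′ ⟧ y
        center a b c = F.new (≢n-trans c (≢n-sym (≢n-trans (E⇒≢n (ptγ x x l₁)) l₁~)) ,
          lineγ (E-trans a (E-sym (ptα x x l₁))) (E-trans b (E-sym (ptβ x x l₁))))
        fa : ∀ {y} → OnFiber α x[ l₁ ] y → ⟦ A′ ⟧ y
        fa {y} (q , l) = caseV (T α y x) (λ g → center g yβ yγ) (λ g → keep (h⇒≢n g) (E⇒≢n yβ) yγ (inα g yβ yγ (S-resp (E-sym eγ) Sl₁)))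
            (λ g → ⊥-elim (q (trans (T-Eʳ y (ptα x x l₁)) g)))
          where
          yβ : E β y x
          yβ = E-trans (l β β≢α) (ptβ x x l₁)
          eγ : E γ y l₁
          eγ = E-trans (l γ γ≢α) (ptγ x x l₁)
          yγ : T γ y x ≢ n
          yγ = ≢n-trans (E⇒≢n eγ) l₁~
        fc : ∀ {y} → OnFiber β x[ m₁ ] y → ⟦ A′ ⟧ y
        fc {y} (q , l) = caseV (T β y x) (λ g → center yα g yγ) (λ g → keep (E⇒≢n yα) (h⇒≢n g) yγ (inβ yα g yγ λ s → Sm₁ (S-resp eγ s)))
            (λ g → ⊥-elim (q (trans (T-Eʳ y (ptβ x x m₁)) g)))
          where
          yα : E α y x
          yα = E-trans (l α α≢β) (ptα x x m₁)
          eγ : E γ y m₁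
          eγ = E-trans (l γ γ≢β) (ptγ x x m₁)
          yγ : T γ y x ≢ n
          yγ = ≢n-trans (E⇒≢n eγ) m₁~
        oa : ∀ {y} → ⟦ A′ ⟧ y → Near y x₀ → E γ y x[ l₁ ] → E β y x[ l₁ ]
        oa {y} i ny g = [ (λ a → [ (λ r → E-trans (proj₂ (proj₂ r)) (E-sym (ptβ x x l₁))) ,
            (λ r → ⊥-elim (proj₁ r (S-resp (E-sym (E-trans g (ptγ x x l₁))) Sl₁))) ]′ (only a (near-x d nx ny))) , (λ f → proj₂ f β β≢γ) ]′ (F.only i)
        oc : ∀ {y} → ⟦ A′ ⟧ y → Near y x₀ → E γ y x[ m₁ ] → E α y x[ m₁ ]
        oc {y} i ny g = [ (λ a → [ (λ r → ⊥-elim (Sm₁ (S-resp (E-trans g (ptγ x x m₁)) (proj₁ r)))) ,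
            (λ r → E-trans (proj₁ (proj₂ r)) (E-sym (ptα x x m₁))) ]′ (only a (near-x d nx ny))) ,
          (λ f → E-trans (proj₂ f α α≢γ) (E-trans (ptα x x l₁) (E-sym (ptα x x m₁)))) ]′ (F.only i)

      -- The α-lines through the points x[ w ] with w ∉ S.
      Lines : ℤ → Set
      Lines y = Near y x₀ × E β y x × ¬ S y

      lines? : ∀ y → Dec (Lines y)
      lines? y = near? y x₀ ×-dec E? β y x ×-dec ¬? (S? y)

      lines-closed : ∀ {y y'} → OnFiber α y y' → Lines y → Lines y'
      lines-closed f@(_ , l) (ny , q , ¬s) = onFiber-near f ny , E-trans (l β β≢α) q , λ s → ¬s (S-resp (l γ γ≢α) s)

      record Progress (A₁ : Subset M) : Set where
        field
          equiv : Equivalent B A A₁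
          kept  : ∀ {y} → Near y x₀ → ⟦ A ⟧ y → ⟦ A₁ ⟧ y
          only₁ : ∀ {y} → Near y x₀ → ⟦ A₁ ⟧ y → ⟦ A ⟧ y ⊎ Lines y
          ready : ∀ {y} → Lines y → ¬ ⟦ A₁ ⟧ y → Base.Shiftable (FromTiles.tiling (Equivalent.tiles equiv)) α y

      progress : ∀ {A₁} → Regular α → Progress A₁ → ∀ {y} → Lines y → ¬ ⟦ A₁ ⟧ y →
        Σ (Subset M) λ A₂ → Progress A₂ × ⟦ A₂ ⟧ y × (∀ {y'} → Lines y' → ⟦ A₁ ⟧ y' → ⟦ A₂ ⟧ y')
      progress {A₁} reg pg {y} ly ¬i = A₂ , record
          { equiv = equivalent-trans P.equiv F.equiv
          ; kept = λ ny i → keep ny (P.kept ny i)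
          ; only₁ = λ ny i → [ (λ j → P.only₁ ny j) , (λ f → inj₂ (lines-closed f ly)) ]′ (F.only i)
          ; ready = λ {y'} ly' ¬i' → still y' ly' ¬i' (P.ready ly' λ j → ¬i' (keep (proj₁ ly') j)) } ,
          F.new onFiber-refl , λ ly' j → keep (proj₁ ly') j
        where
        module P = Progress pg
        t₁ = Equivalent.tiles P.equiv
        A₂ = proj₁ (fill t₁ reg (P.ready ly ¬i))
        module F = Filled (proj₂ (fill t₁ reg (P.ready ly ¬i)))
        keep : ∀ {y'} → Near y' x₀ → ⟦ A₁ ⟧ y' → ⟦ A₂ ⟧ y'
        keep ny' j = F.kept j (F.off λ ν → ≢n-trans (ny' ν) (≢n-sym (proj₁ ly ν)))
        still : ∀ y' → Lines y' → ¬ ⟦ A₂ ⟧ y' → Base.Shiftable (FromTiles.tiling t₁) α y' → Base.Shiftable (FromTiles.tiling (Equivalent.tiles F.equiv)) α y'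
        still y' ly' ¬i' s = record { z = Sh.z ; far = Sh.far ; line = Sh.line ; fiber = λ u q l → F.kept (Sh.fiber u q l) (apart u q l) }
          where
          module Sh = Base.Shiftable s
          apart : ∀ u → T α u Sh.z ≢ n → (∀ μ → μ ≢ α → E μ u Sh.z) → ¬ OnFiber α F.z u
          apart u q l (q' , l') = ¬i' (F.new (≢n-trans (proj₁ ly' α) (≢n-sym (proj₁ ly α)) ,
            λ μ g → E-trans (E-sym (E-trans (l μ g) (Sh.line μ g))) (E-trans (l' μ g) (F.line μ g))))

      horizontals : Regular α → Regular β → (∀ w → T γ w x ≢ n → ¬ S w → Shiftable α x[ w ]) → Result
      horizontals regα regβ sh = A₃ , equivalent-trans P.equiv C.equiv , α ,
          corner {A₃} d a c (near-level m₁~) (near-pt d nx (h⇒≢n hu) (E⇒≢n E-refl) m₁~)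
            (conv (ptα x x m₁) (ptα u x m₁) (trans (T-sym x u) hu)) (E-trans (ptβ x x m₁) (E-sym (ptβ u x m₁))) (E-trans (ptγ x x m₁) (E-sym (ptγ u x m₁)))
            fa fc oa oc
        where
        start : Progress A
        start = record { equiv = equivalent-refl tiles ; kept = λ _ i → i ; only₁ = λ _ i → inj₁ i ; ready = λ {y} ly _ → at-line y ly (sh y (≢n-trans (proj₁ ly γ) (≢n-sym (nx γ))) (proj₂ (proj₂ ly))) }
          where
          at-line : ∀ y → Lines y → Shiftable α x[ y ] → Shiftable α y
          at-line y (ny , q , _) s = record { z = Sh.z ; far = n-≢n Sh.far (≢n-trans (E⇒≢n (ptα x x y)) (≢n-trans (≢n-sym (≢n-sym (nx α))) (≢n-sym (ny α))))
              ; line = lineα (E-trans (Sh.line β β≢α) (E-trans (ptβ x x y) (E-sym q))) (E-trans (Sh.line γ γ≢α) (ptγ x x y)) ; fiber = Sh.fiber }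
            where module Sh = Base.Shiftable s
        done : Σ (Subset M) λ A₂ → Progress A₂ × (∀ {y} → Lines (toℤ y) → y ∈ A₂)
        done = exhaust {Progress} {λ y → Lines (toℤ y)} (λ y → lines? (toℤ y)) (λ {A₁} pg {y} ly ¬i → let A₂ , pg₂ , i , mono = progress regα pg ly (λ j → ¬i (in⁻ {A₁} {y} j)) in
          A₂ , pg₂ , in⁻ {A₂} {y} i , λ {y'} ly' j → in⁻ {A₂} {y'} (mono ly' (in⁺ j))) start
        A₂ = proj₁ done
        module P = Progress (proj₁ (proj₂ done))
        lines-in : ∀ {y} → Lines y → ⟦ A₂ ⟧ y
        lines-in {y} (ny , q , ¬s) = proj₂ (proj₂ done) {red y} ((λ ν → ≢n-trans (E⇒≢n (to ν)) (ny ν)) , E-trans (to β) q , λ s → ¬s (S-resp (to γ) s))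
          where
          to : ∀ μ → E μ (toℤ (red y)) y
          to = ≈⇒E (toℤ-red y)
        R : ℤ → Set
        R y = Near y x₀ × E α y x × ¬ S y × ¬ E γ y m₁
        R? : ∀ y → Dec (R y)
        R? y = near? y x₀ ×-dec E? α y x ×-dec ¬? (S? y) ×-dec ¬? (E? γ y m₁)
        column : ∀ {y} → Near y x₀ → E α y x → ¬ S y → ⟦ A₂ ⟧ y
        column {y} ny q ¬s = caseV (T β y x) (λ g → lines-in (ny , g , ¬s)) (λ g → P.kept ny (inβ q g (near-x d nx ny γ) ¬s)) (λ g → ⊥-elim (near-x d nx ny β g))
        carved : Σ (Subset M) (Carved (Equivalent.tiles P.equiv) x₀ R)
        carved = carve (Equivalent.tiles P.equiv) regβ R? proj₁ (λ { (ny , q , ¬s , _) → column ny q ¬s })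
          (λ { f@(_ , l) (ny , q , ¬s , g) → onFiber-near f ny , E-trans (l α α≢β) q , (λ s → ¬s (S-resp (l γ γ≢β) s)) , λ g' → g (E-trans (E-sym (l γ γ≢β)) g') })
          {x[ m₂ ]} (near-level m₂~ , ptα x x m₂ , (λ s → Sm₂ (S-resp (ptγ x x m₂) s)) , λ g → m₁≢m₂ (E-sym (E-trans (E-sym (ptγ x x m₂)) g)))
        A₃ = proj₁ carved
        module C = Carved (proj₂ carved)
        a c u : ℤ
        u = proj₁ (offset α x)
        a = x[ m₁ ]
        c = pt u x m₁
        hu : T α u x ≡ h
        hu = proj₂ (offset α x)
        fa : ∀ {y} → OnFiber β a y → ⟦ A₃ ⟧ y
        fa {y} f@(_ , l) = C.kept (column (onFiber-near f (near-level m₁~)) (E-trans (l α α≢β) (ptα x x m₁)) λ s → Sm₁ (S-resp yγ s)) λ r → proj₂ (proj₂ (proj₂ r)) yγ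
          where
          yγ : E γ y m₁
          yγ = E-trans (l γ γ≢β) (ptγ x x m₁)
        fc : ∀ {y} → OnFiber γ c y → ⟦ A₃ ⟧ y
        fc {y} f@(_ , l) = C.kept (member (S? y)) λ r → h⇒¬E yα (proj₁ (proj₂ r))
          where
          ny : Near y x₀
          ny = onFiber-near f (near-pt d nx (h⇒≢n hu) (E⇒≢n E-refl) m₁~)
          yα : T α y x ≡ h
          yα = conv (E-trans (l α α≢γ) (ptα u x m₁)) E-refl hu
          yβ : E β y x
          yβ = E-trans (l β β≢γ) (ptβ u x m₁)
          member : Dec (S y) → ⟦ A₂ ⟧ y
          member (yes s) = P.kept ny (inα yα yβ (near-x d nx ny γ) s)
          member (no ¬s) = lines-in (ny , yβ , ¬s)
        oa : ∀ {y} → ⟦ A₃ ⟧ y → Near y x₀ → E α y a → E γ y a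
        oa {y} i ny g = E-trans (pick (E? γ y m₁) λ ¬g → proj₂ (C.only ny i) (ny , yα , ¬s , ¬g)) (E-sym (ptγ x x m₁))
          where
          yα : E α y x
          yα = E-trans g (ptα x x m₁)
          ¬s : ¬ S y
          ¬s s = [ (λ j → [ (λ r → h⇒¬E (proj₁ (proj₂ r)) yα) , (λ r → proj₁ r s) ]′ (only j (near-x d nx ny))) , (λ r → proj₂ (proj₂ r) s) ]′ (P.only₁ ny (proj₁ (C.only ny i)))
        oc : ∀ {y} → ⟦ A₃ ⟧ y → Near y x₀ → E α y c → E β y c
        oc {y} i ny g = E-trans ([ (λ j → [ (λ r → proj₂ (proj₂ r)) , (λ r → ⊥-elim (h⇒¬E yα (proj₁ (proj₂ r)))) ]′ (only j (near-x d nx ny))) , (λ r → proj₁ (proj₂ r)) ]′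
            (P.only₁ ny (proj₁ (C.only ny i)))) (E-sym (ptβ u x m₁))
          where
          yα : T α y x ≡ h
          yα = conv (E-trans g (ptα u x m₁)) E-refl hu

      almostCorner : Result
      almostCorner = [ (λ r → verticals (proj₁ r) (proj₂ r)) , (λ { (a , b , s) → horizontals a b λ w q ¬s → transport w (s w q ¬s) }) ]′ (Both.result tiling α β γ d x S k)
        where
        module K = Both tiling α β γ d x S k
        transport : ∀ w → Shiftable α K.Op.x[ w ] → Shiftable α x[ w ]
        transport w s = record { z = Sh.z ; far = trans (T-Eʳ Sh.z (E-sym (≈⇒E (K.opx w) α))) Sh.far ; line = λ μ g → E-trans (Sh.line μ g) (≈⇒E (K.opx w) μ) ; fiber = Sh.fiber }
          where module Sh = Base.Shiftable s

    module Diagonal (S : Fin 3 → ℤ → Set) (k : Boxes tiling x₀ S) (¬fib : ∀ ν → ¬ Fibered p (AΛ p A x0) ν) where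
      record Progress (A₁ : Subset M) : Set where
        field
          equiv : Equivalent B A A₁
          kept  : ∀ {y} → Near y x₀ → ⟦ A ⟧ y → ⟦ A₁ ⟧ y

      boxes : ∀ {A₁} (pg : Progress A₁) → Boxes (FromTiles.tiling (Equivalent.tiles (Progress.equiv pg))) x₀ S
      boxes pg = record { S? = K.S? ; S-resp = K.S-resp ; ⊤pt = K.⊤pt ; ⊥pt = K.⊥pt ; ⊤~ = K.⊤~ ; ⊥~ = K.⊥~ ; S⊤ = K.S⊤ ; S⊥ = K.S⊥
          ; box⊤ = λ ny s → Progress.kept pg ny (K.box⊤ ny s) ; box⊥ = λ ny s → Progress.kept pg ny (K.box⊥ ny s) ; graph = K.graph ; onto = K.onto }
        where module K = Boxes k

      progress : ∀ {A₁} → Progress A₁ → ∀ {y} → Near y x₀ → ¬ ⟦ A₁ ⟧ y →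
        Σ (Subset M) λ A₂ → Progress A₂ × ⟦ A₂ ⟧ y × (∀ {y'} → Near y' x₀ → ⟦ A₁ ⟧ y' → ⟦ A₂ ⟧ y')
      progress {A₁} pg {y} ny ¬i = A₂ , record { equiv = equivalent-trans P.equiv F.equiv ; kept = λ ny' i → keep ny' (P.kept ny' i) } , F.new onFiber-refl , keep
        where
        module P = Progress pg
        t₁ = Equivalent.tiles P.equiv
        found = Missing.missing (FromTiles.tiling t₁) x₀ S (boxes pg) ny ¬i
        A₂ = proj₁ (fill t₁ (proj₂ (proj₂ found)) (proj₁ (proj₂ found)))
        module F = Filled (proj₂ (fill t₁ (proj₂ (proj₂ found)) (proj₁ (proj₂ found))))
        keep : ∀ {y'} → Near y' x₀ → ⟦ A₁ ⟧ y' → ⟦ A₂ ⟧ y'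
        keep ny' j = F.kept j (F.off λ ν → ≢n-trans (ny' ν) (≢n-sym (ny ν)))

      -- A missing point whose ν-fiber meets A is missing in another direction.
      direction : ∀ ν → Σ (Fin 3) λ μ → ν ≢ μ × Regular μ
      direction ν = let x , y , nx , ¬i , j , f = partly-filled {A} {x0} {ν} (¬fib ν) in conclude nx ¬i j f (Missing.missing tiling x₀ S k nx ¬i)
        where
        conclude : ∀ {x y} → Near x x₀ → ¬ ⟦ A ⟧ x → ⟦ A ⟧ y → OnFiber ν x y → (Σ (Fin 3) λ μ → Shiftable μ x × Regular μ) → Σ (Fin 3) λ μ → ν ≢ μ × Regular μ
        conclude {x} {y} nx ¬i j f (μ , s , reg) = μ , (λ { refl → clashing s reg f }) , reg
          where
          clashing : Shiftable ν x → Regular ν → OnFiber ν x y → ⊥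
          clashing s reg (q , l) = let b' , Bb' , near , ln = reg b₀ Bb₀ (b₀ ℤ.+ (Sh.z ℤ.- y)) in
              n⇒¬E zy (trans (vec near ln ν (ν Fin.≟ ν)) (≈⇒E (clash (Sh.fiber Sh.z (E⇒≢n E-refl) λ _ _ → E-refl) j Bb' Bb₀ λ κ → vec near ln κ (κ Fin.≟ ν)) ν))
            where
            open Base tiling using (b₀; Bb₀; clash; Line)
            module Sh = Base.Shiftable s
            zy : T ν Sh.z y ≡ n
            zy = n-≢n Sh.far (≢n-sym q)
            vec : ∀ {b'} → T ν b' (b₀ ℤ.+ (Sh.z ℤ.- y)) ≢ n → Line ν b₀ b' → ∀ κ → Dec (κ ≡ ν) → T κ Sh.z y ≡ T κ b' b₀
            vec near ln κ (no g) = trans (E-trans (Sh.line κ g) (E-sym (l κ g))) (sym (ln κ g))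
            vec near ln κ (yes refl) = trans zy (sym (≢n-n near (translate-n zy)))

      third : ∀ α β → α ≢ β → Σ (Fin 3) λ γ → Distinct3 p α β γ
      third α β q = let β' , γ' , d = others α in go β' γ' d (β Fin.≟ β')
        where
        go : ∀ β' γ' → Distinct3 p α β' γ' → Dec (β ≡ β') → Σ (Fin 3) λ γ → Distinct3 p α β γ
        go β' γ' d (yes refl) = γ' , d
        go β' γ' d (no g) = β' , q , g , proj₁ d

      carving : ∀ α β γ → Distinct3 p α β γ → Regular α → Regular β → Result
      carving α β γ d regα regβ = A₃ , equivalent-trans P.equiv (equivalent-trans C₁.equiv C₂.equiv) , γ ,
          corner {A₃} (γ≢α , α≢β , γ≢β) x₀ c x₀~ (near-pt d x₀~ (E⇒≢n E-refl) (E⇒≢n E-refl) (h⇒≢n hw))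
            (conv E-refl (ptγ x₀ x₀ w) (trans (T-sym x₀ w) hw)) (E-sym (ptα x₀ x₀ w)) (E-sym (ptβ x₀ x₀ w)) fa fc oa oc
        where
        open Labels α β γ d
        γ≢α : γ ≢ α
        γ≢α q = α≢γ (sym q)
        γ≢β : γ ≢ β
        γ≢β q = β≢γ (sym q)
        β≢α : β ≢ α
        β≢α q = α≢β (sym q)
        x₀~ : Near x₀ x₀
        x₀~ ν = E⇒≢n E-refl
        done : Σ (Subset M) λ A₁ → Progress A₁ × (∀ {y} → Near (toℤ y) x₀ → y ∈ A₁)
        done = exhaust {Progress} {λ y → Near (toℤ y) x₀} (λ y → near? (toℤ y) x₀) (λ {A₁} pg {y} ny ¬i → let A₂ , pg₂ , i , mono = progress pg ny (λ j → ¬i (in⁻ {A₁} {y} j)) in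
          A₂ , pg₂ , in⁻ {A₂} {y} i , λ {y'} ny' j → in⁻ {A₂} {y'} (mono ny' (in⁺ j))) (record { equiv = equivalent-refl tiles ; kept = λ _ i → i })
        A₁ = proj₁ done
        module P = Progress (proj₁ (proj₂ done))
        full : ∀ {y} → Near y x₀ → ⟦ A₁ ⟧ y
        full {y} ny = proj₂ (proj₂ done) {red y} λ ν → ≢n-trans (E⇒≢n (≈⇒E (toℤ-red y) ν)) (ny ν)
        w v u c : ℤ
        w = proj₁ (offset γ x₀)
        v = proj₁ (offset β x₀)
        u = proj₁ (offset α x₀)
        c = pt x₀ x₀ w
        hw : T γ w x₀ ≡ h
        hw = proj₂ (offset γ x₀)
        hv : T β v x₀ ≡ h
        hv = proj₂ (offset β x₀)
        hu : T α u x₀ ≡ h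
        hu = proj₂ (offset α x₀)
        R₁ R₂ : ℤ → Set
        R₁ y = Near y x₀ × E γ y x₀ × ¬ E β y x₀
        R₂ y = Near y x₀ × E γ y w × ¬ E α y x₀
        apart : ∀ {y} → E γ y w → ¬ E γ y x₀
        apart q q' = h⇒¬E hw (E-trans (E-sym q) q')
        carved₁ : Σ (Subset M) (Carved (Equivalent.tiles P.equiv) x₀ R₁)
        carved₁ = carve (Equivalent.tiles P.equiv) regα (λ y → near? y x₀ ×-dec E? γ y x₀ ×-dec ¬? (E? β y x₀)) proj₁ (λ r → full (proj₁ r))
          (λ { f@(_ , l) (ny , q , g) → onFiber-near f ny , E-trans (l γ γ≢α) q , λ g' → g (E-trans (E-sym (l β β≢α)) g') })
          {pt x₀ v x₀} (near-pt d x₀~ (E⇒≢n E-refl) (h⇒≢n hv) (E⇒≢n E-refl) , ptγ x₀ v x₀ , λ g → h⇒¬E hv (E-trans (E-sym (ptβ x₀ v x₀)) g))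
        A₂ = proj₁ carved₁
        module C₁ = Carved (proj₂ carved₁)
        carved₂ : Σ (Subset M) (Carved (Equivalent.tiles C₁.equiv) x₀ R₂)
        carved₂ = carve (Equivalent.tiles C₁.equiv) regβ (λ y → near? y x₀ ×-dec E? γ y w ×-dec ¬? (E? α y x₀)) proj₁ (λ { (ny , q , g) → C₁.kept (full ny) λ r → apart q (proj₁ (proj₂ r)) })
          (λ { f@(_ , l) (ny , q , g) → onFiber-near f ny , E-trans (l γ γ≢β) q , λ g' → g (E-trans (E-sym (l α α≢β)) g') })
          {pt u x₀ w} (near-pt d x₀~ (h⇒≢n hu) (E⇒≢n E-refl) (h⇒≢n hw) , ptγ u x₀ w , λ g → h⇒¬E hu (E-trans (E-sym (ptα u x₀ w)) g))
        A₃ = proj₁ carved₂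
        module C₂ = Carved (proj₂ carved₂)
        fa : ∀ {y} → OnFiber α x₀ y → ⟦ A₃ ⟧ y
        fa f@(_ , l) = C₂.kept (C₁.kept (full (onFiber-near f x₀~)) λ r → proj₂ (proj₂ r) (l β β≢α)) λ r → apart (proj₁ (proj₂ r)) (l γ γ≢α)
        fc : ∀ {y} → OnFiber β c y → ⟦ A₃ ⟧ y
        fc {y} f@(_ , l) = C₂.kept (C₁.kept (full (onFiber-near f (near-pt d x₀~ (E⇒≢n E-refl) (E⇒≢n E-refl) (h⇒≢n hw)))) λ r → apart (E-trans (l γ γ≢β) (ptγ x₀ x₀ w)) (proj₁ (proj₂ r)))
          λ r → proj₂ (proj₂ r) (E-trans (l α α≢β) (ptα x₀ x₀ w))
        oa : ∀ {y} → ⟦ A₃ ⟧ y → Near y x₀ → E γ y x₀ → E β y x₀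
        oa {y} i ny q = pick (E? β y x₀) λ g → proj₂ (C₁.only ny (proj₁ (C₂.only ny i))) (ny , q , g)
        oc : ∀ {y} → ⟦ A₃ ⟧ y → Near y x₀ → E γ y c → E α y c
        oc {y} i ny q = E-trans (pick (E? α y x₀) λ g → proj₂ (C₂.only ny i) (ny , E-trans q (ptγ x₀ x₀ w) , g)) (E-sym (ptα x₀ x₀ w))

      diagonalBoxes : Result
      diagonalBoxes = let α , _ , regα = direction 0F ; β , α≢β , regβ = direction α ; γ , d = third α β α≢β in carving α β γ d regα regβ

  module _ {A B : Subset M} (tiles : Tiles p A B) (x0 : Fin M) where
    open FromTiles tiles using (tiling)
    open Base tiling using (clash)

    private
      x₀′ : ℤ
      x₀′ = toℤ x0

      redT : ∀ {μ y z v} → T μ y z ≡ v → T μ (toℤ (red y)) z ≡ v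
      redT {μ} {y} {z} q = trans (T-red μ y z) q

      redT⁻ : ∀ {μ y z v} → T μ (toℤ (red y)) z ≡ v → T μ y z ≡ v
      redT⁻ {μ} {y} {z} q = trans (sym (T-red μ y z)) q

      inGrid : ∀ {y} → Near y x₀′ → InGrid p x0 (red y)
      inGrid {y} near = grid⁺ {x0} {red y} λ ν g → near ν (redT⁻ g)

    fromFullPlane : FullPlane p A x0 → Result tiles x0
    fromFullPlane (α , β , γ , d , x , gx , _ , iff) = fullPlane tiles x0 α β γ d (toℤ x) nx inα inβγ only
      where
      open Labels α β γ d
      nx : Near (toℤ x) x₀′
      nx = grid⁻ {x0} {x} gx
      near : ∀ {y} → T α y (toℤ x) ≢ n → T β y (toℤ x) ≢ n → T γ y (toℤ x) ≢ n → Near y x₀′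
      near a b c = all3 (≢n-trans a (nx α)) (≢n-trans b (nx β)) (≢n-trans c (nx γ))
      inα : ∀ {y} → T α y (toℤ x) ≡ h → E β y (toℤ x) → E γ y (toℤ x) → ⟦ A ⟧ y
      inα {y} a b c = proj₁ (Equivalence.from (iff (red y)) (inGrid (near (h⇒≢n a) (E⇒≢n b) (E⇒≢n c)) ,
        inj₁ (axis⁺ d {red y} {x} (redT a) (redT b) (redT c))))
      inβγ : ∀ {y} → E α y (toℤ x) → T β y (toℤ x) ≡ h → T γ y (toℤ x) ≡ h → ⟦ A ⟧ y
      inβγ {y} a b c = proj₁ (Equivalence.from (iff (red y)) (inGrid (near (E⇒≢n a) (h⇒≢n b) (h⇒≢n c)) ,
        inj₂ (plane⁺ d {red y} {x} (redT a) (redT b) (redT c))))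
      only : ∀ {y} → ⟦ A ⟧ y → Near y (toℤ x) → (T α y (toℤ x) ≡ h × E β y (toℤ x) × E γ y (toℤ x)) ⊎ (E α y (toℤ x) × T β y (toℤ x) ≡ h × T γ y (toℤ x) ≡ h)
      only {y} i ny = [ (λ g → let a , b , c = axis⁻ d {red y} {x} g in inj₁ (redT⁻ a , redT⁻ b , redT⁻ c)) ,
          (λ g → let a , b , c = plane⁻ d {red y} {x} g in inj₂ (redT⁻ a , redT⁻ b , redT⁻ c)) ]′
        (proj₂ (Equivalence.to (iff (red y)) (i , inGrid λ ν → ≢n-trans (ny ν) (nx ν))))

    fromAlmostCorner : AlmostCorner p A x0 → Result tiles x0
    fromAlmostCorner (α , β , γ , d , xs , gxs , apart , Lα , Lβ , disj , 1<Lα , 1<Lβ , cover-l , iff) =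
        Cross.almostCorner tiles x0 α β γ d x nx S record
          { S? = λ w → FP.any? λ l → (l ∈? Lα) ×-dec E? γ w (X l)
          ; S-resp = λ { q (l , i , g) → l , i , E-trans (E-sym q) g }
          ; inα = inα ; inβ = inβ ; only = only
          ; l₁ = X a₁ ; l₂ = X a₂ ; m₁ = X b₁ ; m₂ = X b₂
          ; l₁~ = level~ a₁ a₁ ; l₂~ = level~ a₂ a₁ ; m₁~ = level~ b₁ a₁ ; m₂~ = level~ b₂ a₁
          ; Sl₁ = a₁ , a₁∈ , E-refl ; Sl₂ = a₂ , a₂∈ , E-refl
          ; Sm₁ = λ { (l , i , g) → disj l (i , subst (_∈ Lβ) (same g) b₁∈) }
          ; Sm₂ = λ { (l , i , g) → disj l (i , subst (_∈ Lβ) (same g) b₂∈) }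
          ; l₁≢l₂ = λ g → a₁≢a₂ (same g) ; m₁≢m₂ = λ g → b₁≢b₂ (same g) }
      where
      open Labels α β γ d
      d-γ : Distinct3 p γ α β
      d-γ = (λ q → α≢γ (sym q)) , α≢β , λ q → β≢γ (sym q)
      d-β : Distinct3 p β α γ
      d-β = (λ q → α≢β (sym q)) , α≢γ , β≢γ
      X : Fin (p γ) → ℤ
      X l = toℤ (xs l)
      twoα : Σ (Fin (p γ)) λ a → Σ (Fin (p γ)) λ b → a ∈ Lα × b ∈ Lα × a ≢ b
      twoα = two-elements Lα 1<Lα
      twoβ : Σ (Fin (p γ)) λ a → Σ (Fin (p γ)) λ b → a ∈ Lβ × b ∈ Lβ × a ≢ b
      twoβ = two-elements Lβ 1<Lβ
      a₁ a₂ b₁ b₂ : Fin (p γ)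
      a₁ = proj₁ twoα
      a₂ = proj₁ (proj₂ twoα)
      b₁ = proj₁ twoβ
      b₂ = proj₁ (proj₂ twoβ)
      a₁∈ : a₁ ∈ Lα
      a₁∈ = proj₁ (proj₂ (proj₂ twoα))
      a₂∈ : a₂ ∈ Lα
      a₂∈ = proj₁ (proj₂ (proj₂ (proj₂ twoα)))
      a₁≢a₂ : a₁ ≢ a₂
      a₁≢a₂ = proj₂ (proj₂ (proj₂ (proj₂ twoα)))
      b₁∈ : b₁ ∈ Lβ
      b₁∈ = proj₁ (proj₂ (proj₂ twoβ))
      b₂∈ : b₂ ∈ Lβ
      b₂∈ = proj₁ (proj₂ (proj₂ (proj₂ twoβ)))
      b₁≢b₂ : b₁ ≢ b₂
      b₁≢b₂ = proj₂ (proj₂ (proj₂ (proj₂ twoβ)))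
      x : ℤ
      x = X a₁
      nx : Near x x₀′
      nx = grid⁻ {x0} {xs a₁} (gxs a₁)
      S : ℤ → Set
      S w = Σ (Fin (p γ)) λ l → l ∈ Lα × E γ w (X l)
      parallel : ∀ l l' → E α (X l) (X l') × E β (X l) (X l') × (l ≢ l' → T γ (X l) (X l') ≡ h)
      parallel l l' = go (l Fin.≟ l')
        where
        go : Dec (l ≡ l') → E α (X l) (X l') × E β (X l) (X l') × (l ≢ l' → T γ (X l) (X l') ≡ h)
        go (yes refl) = E-refl , E-refl , λ g → ⊥-elim (g refl)
        go (no g) = let a , b , c = axis⁻ d-γ {xs l} {xs l'} (apart l l' g) in b , c , λ _ → a
      same : ∀ {l l'} → E γ (X l) (X l') → l ≡ l'
      same {l} {l'} q = pick (l Fin.≟ l') λ g → h⇒¬E (proj₂ (proj₂ (parallel l l')) g) q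
      level~ : ∀ l l' → T γ (X l) (X l') ≢ n
      level~ l l' = go (l Fin.≟ l')
        where
        go : Dec (l ≡ l') → T γ (X l) (X l') ≢ n
        go (yes refl) = E⇒≢n E-refl
        go (no g) = h⇒≢n (proj₂ (proj₂ (parallel l l')) g)
      index : Fin (p γ) → Fin (p γ)
      index l = proj₁ (at-E {γ} {X l} {x} (level~ l a₁))
      index-E : ∀ l → E γ (X l) (at γ x (Fin.toℕ (index l)))
      index-E l = proj₂ (at-E {γ} {X l} {x} (level~ l a₁))
      index-inj : ∀ {l l'} → index l ≡ index l' → l ≡ l'
      index-inj {l} {l'} q = same (E-trans (index-E l) (subst (λ k → E γ (at γ x (Fin.toℕ k)) (X l')) (sym q) (E-sym (index-E l'))))
      on-level : ∀ {w} → T γ w x ≢ n → Σ (Fin (p γ)) λ l → E γ w (X l)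
      on-level {w} q = let k , g = at-E {γ} {w} {x} q ; l , r = surjective index index-inj k in
        l , E-trans g (subst (λ k → E γ (at γ x (Fin.toℕ k)) (X l)) r (E-sym (index-E l)))
      near : ∀ {y} → T α y x ≢ n → T β y x ≢ n → T γ y x ≢ n → Near y x₀′
      near a b c = all3 (≢n-trans a (nx α)) (≢n-trans b (nx β)) (≢n-trans c (nx γ))
      toα : ∀ {y l v} → T α y x ≡ v → T α y (X l) ≡ v
      toα {y} {l} q = trans (T-Eʳ y (proj₁ (parallel l a₁))) q
      toβ : ∀ {y l v} → T β y x ≡ v → T β y (X l) ≡ v
      toβ {y} {l} q = trans (T-Eʳ y (proj₁ (proj₂ (parallel l a₁)))) q
      inα : ∀ {y} → T α y x ≡ h → E β y x → T γ y x ≢ n → S y → ⟦ A ⟧ y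
      inα {y} a b c (l , i , g) = proj₁ (Equivalence.from (iff (red y)) (inGrid (near (h⇒≢n a) (E⇒≢n b) c) ,
        inj₁ (l , i , axis⁺ d {red y} {xs l} (redT (toα {y} {l} a)) (redT (toβ {y} {l} b)) (redT g))))
      inβ : ∀ {y} → E α y x → T β y x ≡ h → T γ y x ≢ n → ¬ S y → ⟦ A ⟧ y
      inβ {y} a b c ¬s = let l , g = on-level c in proj₁ (Equivalence.from (iff (red y)) (inGrid (near (E⇒≢n a) (h⇒≢n b) c) ,
        inj₂ (l , [ (λ i → ⊥-elim (¬s (l , i , g))) , (λ i → i) ]′ (cover-l l) , axis⁺ d-β {red y} {xs l} (redT (toβ {y} {l} b)) (redT (toα {y} {l} a)) (redT g))))
      only : ∀ {y} → ⟦ A ⟧ y → Near y x → (S y × T α y x ≡ h × E β y x) ⊎ (¬ S y × E α y x × T β y x ≡ h)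
      only {y} i ny = [ (λ { (l , j , g) → let a , b , c = axis⁻ d {red y} {xs l} g in inj₁ ((l , j , redT⁻ c) , fromα l (redT⁻ a) , fromβ l (redT⁻ b)) }) ,
          (λ { (l , j , g) → let b , a , c = axis⁻ d-β {red y} {xs l} g in
            inj₂ ((λ { (l' , j' , g') → disj l' (j' , subst (_∈ Lβ) (same (E-trans (E-sym (redT⁻ c)) g')) j) }) , fromα l (redT⁻ a) , fromβ l (redT⁻ b)) }) ]′
        (proj₂ (Equivalence.to (iff (red y)) (i , inGrid λ ν → ≢n-trans (ny ν) (nx ν))))
        where
        fromα : ∀ l {v} → T α y (X l) ≡ v → T α y x ≡ v
        fromα l q = trans (T-Eʳ y (proj₁ (parallel a₁ l))) q
        fromβ : ∀ l {v} → T β y (X l) ≡ v → T β y x ≡ v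
        fromβ l q = trans (T-Eʳ y (proj₁ (proj₂ (parallel a₁ l)))) q

    fromDiagonalBoxes : ∣ B ∣ˢ ≡ Dof p → (∀ m → Dof p ℕD.∣ m → m ℕD.∣ M → InDiv p (AΛ p A x0) m) → DiagonalBoxes p A x0 →
      (∀ ν → ¬ Fibered p (AΛ p A x0) ν) → Result tiles x0
    fromDiagonalBoxes |B| div (I , J , K , pI , pJ , pK , box) = Diagonal.diagonalBoxes tiles x0 S record
        { S? = λ ν w → FP.any? λ l → (l ∈? part ν) ×-dec E? ν w (along ν (Fin.toℕ l) x₀′)
        ; S-resp = λ { q (l , i , g) → l , i , E-trans (E-sym q) g }
        ; ⊤pt = λ ν → along ν (Fin.toℕ (proj₁ (proj₁ (proper ν)))) x₀′
        ; ⊥pt = λ ν → along ν (Fin.toℕ (proj₁ (proj₂ (proper ν)))) x₀′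
        ; ⊤~ = λ ν → along-near ν (Fin.toℕ (proj₁ (proj₁ (proper ν)))) x₀′ ; ⊥~ = λ ν → along-near ν (Fin.toℕ (proj₁ (proj₂ (proper ν)))) x₀′
        ; S⊤ = λ ν → proj₁ (proj₁ (proper ν)) , proj₂ (proj₁ (proper ν)) , E-refl
        ; S⊥ = λ ν → λ { (l , i , g) → proj₂ (proj₂ (proper ν)) (subst (_∈ part ν) (sym (level-inj ν x₀′ g)) i) }
        ; box⊤ = λ {y} ny s → inside y (λ ν → proj₁ (s ν)) (λ ν → proj₂ (proj₂ (s ν))) (inj₁ (proj₁ (proj₂ (s 0F)) , proj₁ (proj₂ (s 1F)) , proj₁ (proj₂ (s 2F))))
        ; box⊥ = λ {y} ny s → inside y (λ ν → proj₁ (level ν (ny ν))) (λ ν → proj₂ (level ν (ny ν)))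
            (inj₂ (outside 0F ny s , outside 1F ny s , outside 2F ny s))
        ; graph = graph ; onto = onto }
      where
      part : ∀ ν → Subset (p ν)
      part 0F = I
      part 1F = J
      part 2F = K
      proper : ∀ ν → (Σ (Fin (p ν)) λ l → l ∈ part ν) × (Σ (Fin (p ν)) λ l → l ∉ part ν)
      proper 0F = pI
      proper 1F = pJ
      proper 2F = pK
      S : Fin 3 → ℤ → Set
      S ν w = Σ (Fin (p ν)) λ l → l ∈ part ν × E ν w (along ν (Fin.toℕ l) x₀′)
      outside : ∀ ν {y} (ny : Near y x₀′) → (∀ ν → ¬ S ν y) → proj₁ (level ν (ny ν)) ∉ part ν
      outside ν ny s i = s ν (proj₁ (level ν (ny ν)) , i , proj₂ (level ν (ny ν)))
      inside : ∀ y (l : ∀ ν → Fin (p ν)) → (∀ ν → E ν y (along ν (Fin.toℕ (l ν)) x₀′)) →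
        ((l 0F ∈ I × l 1F ∈ J × l 2F ∈ K) ⊎ (l 0F ∉ I × l 1F ∉ J × l 2F ∉ K)) → ⟦ A ⟧ y
      inside y l q s = proj₁ (box (l 0F) (l 1F) (l 2F) s (red y) (Cong⁺ {Fin.toℕ (red y)} (≈-trans (toℤ-red y) (E⇒≈ λ ν → E-trans (q ν) (coords ν)))))
        where
        k₀ k₁ k₂ s₀ s₁ : ℕ
        k₀ = Fin.toℕ (l 0F)
        k₁ = Fin.toℕ (l 1F)
        k₂ = Fin.toℕ (l 2F)
        s₀ = Fin.toℕ x0 ℕ.+ k₀ ℕ.* Mover p 0F
        s₁ = s₀ ℕ.+ k₁ ℕ.* Mover p 1F
        unfold : + (s₁ ℕ.+ k₂ ℕ.* Mover p 2F) ≡ along 2F k₂ (along 1F k₁ (along 0F k₀ x₀′))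
        unfold = trans (pos-along 2F k₂ s₁) (cong (along 2F k₂) (trans (pos-along 1F k₁ s₀) (cong (along 1F k₁) (pos-along 0F k₀ (Fin.toℕ x0)))))
        along-cong : ∀ ν t {x x'} → E ν x x' → E ν (along ν t x) (along ν t x')
        along-cong ν t {x} {x'} g = E⁺ (subst (pp ν ∣ᵢ_) (lem x x' (+ t * + Mover p ν)) (E⁻ g))
          where
          lem : ∀ x x' m → x - x' ≡ x + m - (x' + m)
          lem = solve-∀
        coords : ∀ ν → E ν (along ν (Fin.toℕ (l ν)) x₀′) (+ (s₁ ℕ.+ k₂ ℕ.* Mover p 2F))
        coords ν = subst (E ν (along ν (Fin.toℕ (l ν)) x₀′)) (sym unfold) (go ν)
          where
          go : ∀ ν → E ν (along ν (Fin.toℕ (l ν)) x₀′) (along 2F k₂ (along 1F k₁ (along 0F k₀ x₀′)))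
          go 0F = E-sym (E-trans (along-E {2F} {0F} (λ ()) k₂ _) (along-E {1F} {0F} (λ ()) k₁ _))
          go 1F = E-sym (E-trans (along-E {2F} {1F} (λ ()) k₂ _) (along-cong 1F k₁ (along-E {0F} {1F} (λ ()) k₀ x₀′)))
          go 2F = E-sym (along-cong 2F k₂ (E-trans (along-E {1F} {2F} (λ ()) k₁ _) (along-E {0F} {2F} (λ ()) k₀ x₀′)))
      D∣M : Dof p ℕD.∣ M
      D∣M = ℕD.*-pres-∣ (ℕD.*-pres-∣ (p∣pp 0F) (p∣pp 1F)) (p∣pp 2F)
      graph : ∀ {b b'} → elem B b → elem B b' → (∀ ν → T ν b b' ≢ n) → b ≈ b'
      graph (j , ij , refl) (j' , ij' , refl) near = let s , s' , (is , _) , (is' , _) , eq = div (gcdM p j j') (gcd-greatest (grid⁺ {j'} {j} near) D∣M) (gcd[m,n]∣n (dist p (Fin.toℕ j) (Fin.toℕ j')) M) in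
        clash (in⁺ is) (in⁺ is') (j , ij , refl) (j' , ij' , refl) λ ν → trans (T-gcd ν s s') (trans (cong (λ m → val ν (+ m)) eq) (sym (T-gcd ν j j')))
      D>0 : 1 ≤ Dof p
      D>0 = ℕP.*-mono-≤ (ℕP.*-mono-≤ (p>0 0F) (p>0 1F)) (p>0 2F)
      member : Fin (Dof p) → Fin M
      member i = lookup (elems B) (Fin.cast (sym (trans (length-elems B) |B|)) i)
      member∈ : ∀ i → member i ∈ B
      member∈ i = elems⁻ B (∈-lookup (Fin.cast (sym (trans (length-elems B) |B|)) i))
      residue : ℤ → Fin (Dof p)
      residue z = Fin.fromℕ< (proj₁ (proj₂ (reduce (Dof p) D>0 z)))
      residue-∣ : ∀ z → Dof p ∣ᵢ + Fin.toℕ (residue z) - z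
      residue-∣ z = subst (λ k → Dof p ∣ᵢ + k - z) (sym (FP.toℕ-fromℕ< (proj₁ (proj₂ (reduce (Dof p) D>0 z))))) (proj₂ (proj₂ (reduce (Dof p) D>0 z)))
      same-residue : ∀ j j' → residue (toℤ j) ≡ residue (toℤ j') → Near (toℤ j) (toℤ j')
      same-residue j j' q = grid⁻ {j'} {j} (dist⁺ (Fin.toℕ j) (Fin.toℕ j') (subst (Dof p ∣ᵢ_) (lem (+ Fin.toℕ (residue (toℤ j'))) (toℤ j) (toℤ j'))
          (∣m∣n⇒∣m-n (residue-∣ (toℤ j')) (subst (λ k → Dof p ∣ᵢ + Fin.toℕ k - toℤ j) q (residue-∣ (toℤ j))))))
        where
        lem : ∀ r j j' → (r - j') - (r - j) ≡ j - j'
        lem = solve-∀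
      class-inj : ∀ {i i'} → residue (toℤ (member i)) ≡ residue (toℤ (member i')) → i ≡ i'
      class-inj {i} {i'} q = uncast (unique-lookup (unique-elems B) _ _ (toℤ-inj (graph (member i , member∈ i , refl) (member i' , member∈ i' , refl) (same-residue (member i) (member i') q))))
        where
        uncast : Fin.cast (sym (trans (length-elems B) |B|)) i ≡ Fin.cast (sym (trans (length-elems B) |B|)) i' → i ≡ i'
        uncast g = FP.toℕ-injective (trans (sym (FP.toℕ-cast _ i)) (trans (cong Fin.toℕ g) (FP.toℕ-cast _ i')))
      onto : ∀ c → Σ ℤ λ b → elem B b × (∀ ν → T ν b c ≢ n)
      onto c = let i , q = surjective (λ i → residue (toℤ (member i))) class-inj (residue (toℤ (red c))) in
        toℤ (member i) , (member i , member∈ i , refl) , λ ν → ≢n-trans (same-residue (member i) (red c) q ν) (E⇒≢n (≈⇒E (toℤ-red c) ν))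

open import Defs
open import Data.Bool using (Bool)
open import Data.Nat.Divisibility using (_∣_)
open import Data.Fin using (zero; suc)
open import Data.Fin.Subset using (Subset; ∣_∣)
open import Function.Bundles using (_⇔_; mk⇔)

-- Of the two alternatives it is always the second that is proved.
theorem7p1 :
  (p : Fin 3 → ℕ) →
  (∀ ν → Prime (p ν)) → (∀ ν → 3 ≤ p ν) →
  ¬ (p zero ≡ p (suc zero)) → ¬ (p (suc zero) ≡ p (suc (suc zero))) → ¬ (p zero ≡ p (suc (suc zero))) →
  (A B : Subset (Mof p)) →
  Tiles p A B →
  ∣ A ∣ ≡ Dof p → ∣ B ∣ ≡ Dof p →
  Mof p Φ∣ mask p A →
  (x0 : Fin (Mof p)) →
  Σ (Fin (Mof p)) (AΛ p A x0) →
  (∀ ν → ¬ Fibered p (AΛ p A x0) ν) →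
  (((∀ m → Dof p ∣ m → m ∣ Mof p → InDiv p (AΛ p A x0) m) × DiagonalBoxes p A x0)
    ⊎ FullPlane p A x0
    ⊎ AlmostCorner p A x0) →
  (Tiles p (gridSet p x0) B × (T2 p A ⇔ T2 p (gridSet p x0))
     × ShiftChain p B A (gridSet p x0)
     × (∀ (flag : Fin 3 → Fin 2 → Bool) → FlagsSpec p A flag →
          TranslateOf p (gridSet p x0) (AflatExps p flag))
     × T2 p A × T2 p B)
  ⊎ (Σ (Subset (Mof p)) λ A' → Tiles p A' B × (T2 p A ⇔ T2 p A')
       × Σ (Fin 3) λ ν → Corner p A' x0 ν)
theorem7p1 p pr p≥3 p₀≢p₁ p₁≢p₂ p₀≢p₂ A B tiles |A| |B| Φ_M x0 nonempty ¬fibered structure = inj₂ (corner structure)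
  where
  distinct : ∀ {ν μ : Fin 3} → ν ≢ μ → p ν ≢ p μ
  distinct {zero} {zero} q _ = q refl
  distinct {zero} {suc zero} _ = p₀≢p₁
  distinct {zero} {suc (suc zero)} _ = p₀≢p₂
  distinct {suc zero} {zero} _ r = p₀≢p₁ (sym r)
  distinct {suc zero} {suc zero} q _ = q refl
  distinct {suc zero} {suc (suc zero)} _ = p₁≢p₂
  distinct {suc (suc zero)} {zero} _ r = p₀≢p₂ (sym r)
  distinct {suc (suc zero)} {suc zero} _ r = p₁≢p₂ (sym r)
  distinct {suc (suc zero)} {suc (suc zero)} q _ = q refl

  module S = Setting p pr p≥3 distinct

  Conclusion : Set
  Conclusion = Σ (Subset (Mof p)) λ A' → Tiles p A' B × (T2 p A ⇔ T2 p A') × Σ (Fin 3) λ ν → Corner p A' x0 ν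

  conclude : S.Result tiles x0 → Conclusion
  conclude (A' , q , ν , c) = A' , S.Equivalent.tiles q , mk⇔ (S.Equivalent.fwd q) (S.Equivalent.bwd q) , ν , c

  corner : ((∀ m → Dof p ∣ m → m ∣ Mof p → InDiv p (AΛ p A x0) m) × DiagonalBoxes p A x0) ⊎ FullPlane p A x0 ⊎ AlmostCorner p A x0 → Conclusion
  corner (inj₁ (div , boxes)) = conclude (S.fromDiagonalBoxes tiles x0 |B| div boxes ¬fibered)
  corner (inj₂ (inj₁ plane)) = conclude (S.fromFullPlane tiles x0 plane)
  corner (inj₂ (inj₂ almost)) = conclude (S.fromAlmostCorner tiles x0 almost)
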